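{- There is a finite first-order language $L$ such that for every $\Pi^1_1$ set $B\subseteq\omega$ there is a Turing reduction of $B$ to the set $3Mod_L$ of all indexes of decidable Ehrenfeucht $L$-theories with exactly three countable models.
   Context: An Ehrenfeucht theory is a complete first-order theory with finitely many (but more than one) countable models up to isomorphism; "exactly three countable models" is meant up to isomorphism. $(\varphi_e)_{e\in\omega}$ is a standard enumeration of the unary partial computable functions, $\mathrm{sgn}(x)=1$ for $x\ne 0$ and $\mathrm{sgn}(0)=0$. A Gödel numbering of the sentences of the finite language $L$ is fixed. A number $e$ is an index of a decidable complete $L$-theory $T$ if $\mathrm{sgn}(\varphi_e(x))$ is total and is the characteristic function of the set of Gödel numbers of the sentences of $T$. Thus $3Mod_L\subseteq\omega$ is the set of all $e$ that are indexes of decidable complete $L$-theories having exactly three countable models up to isomorphism. -}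

module Defs where

open import Level using (Level; 0ℓ; _⊔_) renaming (suc to lsuc)
open import Data.Bool using (Bool; T)
open import Data.Fin using (Fin; toℕ)
open import Data.Fin.Patterns using (0F; 1F; 2F; 3F)
open import Data.Nat using (ℕ; zero; suc; _+_; _*_; _/_; _<_)
open import Data.Product using (Σ-syntax; ∃-syntax; _×_)
open import Data.Sum using (_⊎_)
open import Data.Vec using (Vec; []; _∷_; lookup; map)
open import Function.Bundles using (_⇔_; _↣_; _⤖_; module Bijection)
open import Relation.Binary.PropositionalEquality using (_≡_)
open import Relation.Nullary using (¬_)
open import Relation.Unary using (Pred; ∅)

private
  variable
    ℓ ℓ′ : Level
    m n : ℕ

------------------------------------------------------------------------
-- Computability

-- Cantor's pairing function.
⟪_,_⟫ : ℕ → ℕ → ℕ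
⟪ a , b ⟫ = (a + b) * suc (a + b) / 2 + b

sgn : ℕ → ℕ
sgn zero    = 0
sgn (suc _) = 1

-- χ A x y is the graph of the characteristic function of A.
data χ (A : Pred ℕ ℓ) (x : ℕ) : ℕ → Set ℓ where
  inside  :   A x → χ A x 1
  outside : ¬ A x → χ A x 0

-- The μ-recursive functions relative to an oracle.
data Program : ℕ → Set where
  zer    : Program n
  succ   : Program 1
  proj   : Fin n → Program n
  comp   : Program m → Vec (Program n) m → Program n
  rec    : Program n → Program (2 + n) → Program (1 + n)
  μ      : Program (1 + n) → Program n
  oracle : Program 1

mutual
  data Eval (A : Pred ℕ ℓ) : Program n → Vec ℕ n → ℕ → Set ℓ where
    zer    : {xs : Vec ℕ n} → Eval A zer xs 0
    succ   : ∀ {x} → Eval A succ (x ∷ []) (suc x)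
    proj   : ∀ {i} {xs : Vec ℕ n} → Eval A (proj i) xs (lookup xs i)
    comp   : ∀ {f : Program m} {gs} {xs : Vec ℕ n} {ys z} →
             Evals A gs xs ys → Eval A f ys z → Eval A (comp f gs) xs z
    rec-z  : ∀ {f g} {xs : Vec ℕ n} {y} →
             Eval A f xs y → Eval A (rec f g) (0 ∷ xs) y
    rec-s  : ∀ {f g} {xs : Vec ℕ n} {k y z} →
             Eval A (rec f g) (k ∷ xs) y → Eval A g (k ∷ y ∷ xs) z →
             Eval A (rec f g) (suc k ∷ xs) z
    μ      : ∀ {f} {xs : Vec ℕ n} {y} →
             (∀ i → i < y → ∃[ k ] Eval A f (i ∷ xs) (suc k)) →
             Eval A f (y ∷ xs) 0 →
             Eval A (μ f) xs y
    oracle : ∀ {x y} → χ A x y → Eval A oracle (x ∷ []) y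

  data Evals (A : Pred ℕ ℓ) : Vec (Program n) m → Vec ℕ n → Vec ℕ m → Set ℓ where
    []  : {xs : Vec ℕ n} → Evals A [] xs []
    _∷_ : ∀ {g} {gs : Vec (Program n) m} {xs y ys} →
          Eval A g xs y → Evals A gs xs ys → Evals A (g ∷ gs) xs (y ∷ ys)

mutual
  code : Program n → ℕ
  code zer              = ⟪ 0 , 0 ⟫
  code succ             = ⟪ 1 , 0 ⟫
  code (proj i)         = ⟪ 2 , toℕ i ⟫
  code (comp {m = m} f gs) = ⟪ 3 , ⟪ m , ⟪ code f , codes gs ⟫ ⟫ ⟫
  code (rec f g)        = ⟪ 4 , ⟪ code f , code g ⟫ ⟫
  code (μ f)            = ⟪ 5 , code f ⟫
  code oracle           = ⟪ 6 , 0 ⟫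

  -- Injective only for a fixed length, which is why comp records m.
  codes : Vec (Program n) m → ℕ
  codes []       = 0
  codes (g ∷ gs) = ⟪ code g , codes gs ⟫

-- Φ A e x y says that the e-th partial function computable in A is
-- defined at x with value y; it is nowhere defined if e codes no program.
Φ : Pred ℕ ℓ → ℕ → ℕ → ℕ → Set ℓ
Φ A e x y = ∃[ p ] code {1} p ≡ e × Eval A p (x ∷ []) y

φ : ℕ → ℕ → ℕ → Set
φ = Φ ∅

infix 4 _≤T_

_≤T_ : Pred ℕ ℓ → Pred ℕ ℓ′ → Set (ℓ ⊔ ℓ′)
B ≤T A = ∃[ e ] ∀ x → ∃[ y ] Φ A e x y × χ B x y

------------------------------------------------------------------------
-- First-order logic

-- Finite languages; constants are function symbols of arity 0.
record Language : Set where
  field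
    #functions : ℕ
    #relations : ℕ
    arityᶠ     : Fin #functions → ℕ
    arityʳ     : Fin #relations → ℕ

open Language

module _ (L : Language) where

  data Term (n : ℕ) : Set where
    var : Fin n → Term n
    app : (f : Fin (#functions L)) → Vec (Term n) (arityᶠ L f) → Term n

  infix  6 _≈̇_
  infixr 5 _∧̇_
  infixr 4 _∨̇_
  infixr 3 _⇒̇_

  -- De Bruijn: the quantifiers bind variable 0F.
  data Formula (n : ℕ) : Set where
    _≈̇_         : Term n → Term n → Formula n
    rel         : (r : Fin (#relations L)) → Vec (Term n) (arityʳ L r) → Formula n
    ¬̇_          : Formula n → Formula n
    _∧̇_ _∨̇_ _⇒̇_ : Formula n → Formula n → Formula n
    ∀̇_ ∃̇_       : Formula (suc n) → Formula n

  Sentence : Set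
  Sentence = Formula 0

  record Structure : Set₁ where
    field
      Carrier   : Set
      inhabited : Carrier
      ⟦_⟧ᶠ      : (f : Fin (#functions L)) → Vec Carrier (arityᶠ L f) → Carrier
      ⟦_⟧ʳ      : (r : Fin (#relations L)) → Vec Carrier (arityʳ L r) → Set

module _ {L : Language} where

  mutual
    termCode : Term L n → ℕ
    termCode (var i)    = ⟪ 0 , toℕ i ⟫
    termCode (app f ts) = ⟪ 1 , ⟪ toℕ f , termCodes ts ⟫ ⟫

    termCodes : Vec (Term L n) m → ℕ
    termCodes []       = 0
    termCodes (t ∷ ts) = ⟪ termCode t , termCodes ts ⟫

  ⌜_⌝ : Formula L n → ℕ
  ⌜ s ≈̇ t ⌝    = ⟪ 0 , ⟪ termCode s , termCode t ⟫ ⟫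
  ⌜ rel r ts ⌝ = ⟪ 1 , ⟪ toℕ r , termCodes ts ⟫ ⟫
  ⌜ ¬̇ α ⌝      = ⟪ 2 , ⌜ α ⌝ ⟫
  ⌜ α ∧̇ β ⌝    = ⟪ 3 , ⟪ ⌜ α ⌝ , ⌜ β ⌝ ⟫ ⟫
  ⌜ α ∨̇ β ⌝    = ⟪ 4 , ⟪ ⌜ α ⌝ , ⌜ β ⌝ ⟫ ⟫
  ⌜ α ⇒̇ β ⌝    = ⟪ 5 , ⟪ ⌜ α ⌝ , ⌜ β ⌝ ⟫ ⟫
  ⌜ ∀̇ α ⌝      = ⟪ 6 , ⌜ α ⌝ ⟫
  ⌜ ∃̇ α ⌝      = ⟪ 7 , ⌜ α ⌝ ⟫

  module _ (M : Structure L) where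
    open Structure M

    mutual
      eval : Vec Carrier n → Term L n → Carrier
      eval ρ (var i)    = lookup ρ i
      eval ρ (app f ts) = ⟦ f ⟧ᶠ (evals ρ ts)

      evals : Vec Carrier n → Vec (Term L n) m → Vec Carrier m
      evals ρ []       = []
      evals ρ (t ∷ ts) = eval ρ t ∷ evals ρ ts

  infix 4 _⊨_[_] _⊨_ _⊨ᵀ_ _⊩_ _≅_

  _⊨_[_] : (M : Structure L) → Formula L n → Vec (Structure.Carrier M) n → Set
  M ⊨ s ≈̇ t    [ ρ ] = eval M ρ s ≡ eval M ρ t
  M ⊨ rel r ts [ ρ ] = Structure.⟦_⟧ʳ M r (evals M ρ ts)
  M ⊨ ¬̇ α      [ ρ ] = ¬ (M ⊨ α [ ρ ])
  M ⊨ α ∧̇ β    [ ρ ] = M ⊨ α [ ρ ] × M ⊨ β [ ρ ]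
  M ⊨ α ∨̇ β    [ ρ ] = M ⊨ α [ ρ ] ⊎ M ⊨ β [ ρ ]
  M ⊨ α ⇒̇ β    [ ρ ] = M ⊨ α [ ρ ] → M ⊨ β [ ρ ]
  M ⊨ ∀̇ α      [ ρ ] = ∀ a → M ⊨ α [ a ∷ ρ ]
  M ⊨ ∃̇ α      [ ρ ] = ∃[ a ] M ⊨ α [ a ∷ ρ ]

  _⊨_ : Structure L → Sentence L → Set
  M ⊨ σ = M ⊨ σ [ [] ]

  _⊨ᵀ_ : Structure L → Pred (Sentence L) 0ℓ → Set
  M ⊨ᵀ Th = ∀ σ → Th σ → M ⊨ σ

  _⊩_ : Pred (Sentence L) 0ℓ → Sentence L → Set₁
  Th ⊩ σ = ∀ M → M ⊨ᵀ Th → M ⊨ σ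

  record IsCompleteTheory (Th : Pred (Sentence L) 0ℓ) : Set₁ where
    field
      closed     : ∀ σ → Th ⊩ σ → Th σ
      consistent : ∀ σ → ¬ (Th σ × Th (¬̇ σ))
      complete   : ∀ σ → Th σ ⊎ Th (¬̇ σ)

  record _≅_ (M N : Structure L) : Set where
    private
      module M = Structure M
      module N = Structure N
    field
      bijection : M.Carrier ⤖ N.Carrier
    open Bijection bijection using (to)
    field
      preservesᶠ : ∀ f xs → to (M.⟦ f ⟧ᶠ xs) ≡ N.⟦ f ⟧ᶠ (map to xs)
      preservesʳ : ∀ r xs → M.⟦ r ⟧ʳ xs ⇔ N.⟦ r ⟧ʳ (map to xs)

  record CountableModel (Th : Pred (Sentence L) 0ℓ) : Set₁ where
    field
      structure : Structure L
      countable : Structure.Carrier structure ↣ ℕ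
      models    : structure ⊨ᵀ Th

  open CountableModel using (structure)

  HasExactlyCountableModels : ℕ → Pred (Sentence L) 0ℓ → Set₁
  HasExactlyCountableModels k Th =
    Σ[ M ∈ (Fin k → CountableModel Th) ]
           (∀ (i j : Fin k) → structure (M i) ≅ structure (M j) → i ≡ j)
         × (∀ (N : CountableModel Th) → ∃[ i ] structure N ≅ structure (M i))

  GödelNumbers : Pred (Sentence L) 0ℓ → Pred ℕ 0ℓ
  GödelNumbers Th x = ∃[ σ ] Th σ × ⌜ σ ⌝ ≡ x

  IsIndexOf : ℕ → Pred (Sentence L) 0ℓ → Set
  IsIndexOf e Th = ∀ x → ∃[ y ] φ e x y × χ (GödelNumbers Th) x (sgn y)

3Mod : Language → Pred ℕ (lsuc 0ℓ)
3Mod L e = ∃[ Th ] IsCompleteTheory {L} Th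
                 × IsIndexOf e Th
                 × HasExactlyCountableModels 3 Th

------------------------------------------------------------------------
-- Π¹₁ sets

-- Symbols: 0, successor, +, ×, and a unary predicate for a set variable.
arithmetic : Language
arithmetic = record
  { #functions = 4
  ; #relations = 1
  ; arityᶠ     = lookup (0 ∷ 1 ∷ 2 ∷ 2 ∷ [])
  ; arityʳ     = lookup (1 ∷ [])
  }

standardModel : (ℕ → Bool) → Structure arithmetic
standardModel X = record
  { Carrier   = ℕ
  ; inhabited = 0
  ; ⟦_⟧ᶠ      = λ where
      0F []           → 0
      1F (a ∷ [])     → suc a
      2F (a ∷ b ∷ []) → a + b
      3F (a ∷ b ∷ []) → a * b
  ; ⟦_⟧ʳ      = λ where
      0F (a ∷ []) → T (X a)
  }

-- B is defined by ∀X α(X, x) with α arithmetical.  Subsets of ℕ are taken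
-- as Boolean characteristic functions, which classically are all of them.
Π¹₁ : Pred ℕ 0ℓ → Set
Π¹₁ B = ∃[ α ] ∀ x → B x ⇔ (∀ X → standardModel X ⊨ α [ x ∷ [] ])

{-# OPTIONS --safe #-}

-- A model of the theory of x is a dense linear preorder without endpoints together
-- with an equivalence relation, whose classes are the rows; only the sizes of the
-- cells, in which a row meets a class of the preorder (a point), carry information.
-- In a distinguished row the size gives each point a level, finite or infinite, which
-- never decreases.  Every other row lists points: its cell of size c + 1 shows that the
-- levels of the points listed before spell the node c of a tree.  So a list goes on
-- only within the tree, and not beyond a point of infinite level.
--
-- If the tree is well-founded, then all lists are finite, and by back and forth a
-- countable model is determined by its points of infinite level: there are none, or
-- there are some but no least one, or there is a least one.  An infinite path yields a
-- fourth model, with a row that follows it.  The theory sees neither: formulas of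
-- bounded depth can be played with small levels and nodes only.  It is decidable
-- uniformly in x, because in the model without points of infinite level each quantifier
-- has a witness whose code is bounded in terms of the number of moves made before.
--
-- The tree for a Π¹₁ set consists of the finite attempts at a set X and a table of truth
-- values and witnesses that make the defining arithmetical formula fail at X and x.
module Submission where

open import Axiom.ExcludedMiddle using (ExcludedMiddle)
open import Data.Bool using (Bool; true; false; T; not; _∧_; _∨_; if_then_else_)
open import Data.Bool.Properties using (T-irrelevant; T-∧; T-∨)
open import Data.Empty using (⊥; ⊥-elim)
import Data.Fin as Fin
open import Data.Fin using (Fin; zero; suc; toℕ; fromℕ<; _↑ˡ_; _↑ʳ_)
open import Data.Fin.Patterns using (0F; 1F; 2F; 3F; 4F; 5F; 6F)
open import Data.Fin.Properties using (pigeonhole; toℕ-injective; toℕ<n; toℕ-fromℕ<)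
import Data.List as List
open import Data.List using (List; []; _∷_; length)
open import Data.List.Membership.Propositional using (_∈_)
open import Data.List.Membership.Propositional.Properties
  using (∈-map⁺; ∈-map⁻; ∈-++⁺ˡ; ∈-++⁺ʳ; ∈-++⁻; ∈-concat⁺′; ∈-concat⁻′)
import Data.List.Properties as List
open import Data.List.Relation.Unary.Any using (here; there)
open import Data.Nat hiding (equal; compare; less; greater)
open import Data.Nat.DivMod using (m*n/n≡m)
open import Data.Nat.Properties
open import Data.Nat.Solver using (module +-*-Solver)
open import Data.Product using (_×_; _,_; proj₁; proj₂; swap; Σ-syntax; ∃-syntax)
open import Data.Sum using (_⊎_; inj₁; inj₂; fromInj₂)
open import Data.Unit using (⊤; tt)
import Data.Vec as Vec
open import Data.Vec using (Vec; []; _∷_; _++_; allFin; fromList; lookup; tabulate; toList)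
import Data.Vec.Properties as Vec
open import Data.Vec.Properties using (tabulate∘lookup)
open import Function.Base using (_∘_; id)
open import Function.Bundles
  using (_↣_; _⇔_; mk↣; mk⇔; mk⤖; module Bijection; module Equivalence; module Injection)
open import Induction.WellFounded using (Acc; acc)
open import Level using (Level; Lift; lift; 0ℓ) renaming (suc to lsuc)
open import Relation.Binary.Definitions using (tri<; tri≈; tri>)
open import Relation.Binary.PropositionalEquality hiding ([_])
open import Relation.Nullary using (¬_; Dec; yes; no)
open import Relation.Nullary.Decidable using (isYes; toWitness; fromWitness)
open import Relation.Unary using (Pred; ∅)
open import Defs
open Equivalence using (to; from)

-- Ehrenfeucht's example with three countable models is a dense order with an increasing sequence of
-- constants; its models differ in what lies beyond all constants. A finite language has no room for
-- the constants, so they become intervals of constant level, read off from the size of a cell.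
--
-- The obstacle is that the theory must be decidable uniformly in `x`, so that no sentence may
-- reveal whether the tree has a path. Nodes are therefore spelt by levels: a large level looks like
-- an infinite one, and it cannot be noticed whether a list goes on beyond nodes of large code.
--
-- One game, with a parameter `V` for the numbers that are visible as levels and sizes, serves three
-- ends. If all numbers are visible, it gives isomorphisms; if only those below `C` are, it gives
-- elementary equivalence, whatever the tree; and a model played against itself, with grades that
-- tell how late a response appears, gives bounded witnesses. The invariant is that a row is matched
-- together with all visible points of its list. This is where well-foundedness enters: the list
-- must end.

module Arithmetic where

  private
    variable
      m n : ℕ

  -- Cantor's pairing function, its inverses, and recursion on sequences.

  natrec : ℕ → (ℕ → ℕ → ℕ) → ℕ → ℕ
  natrec z s zero    = z
  natrec z s (suc k) = s k (natrec z s k)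

  tri : ℕ → ℕ
  tri zero    = 0
  tri (suc s) = tri s + suc s

  tri*2 : ∀ s → tri s * 2 ≡ s * suc s
  tri*2 zero    = refl
  tri*2 (suc s) = begin
    (tri s + suc s) * 2         ≡⟨ *-distribʳ-+ 2 (tri s) (suc s) ⟩
    tri s * 2 + suc s * 2       ≡⟨ cong (_+ suc s * 2) (tri*2 s) ⟩
    s * suc s + suc s * 2       ≡⟨ cong (_+ suc s * 2) (*-comm s (suc s)) ⟩
    suc s * s + suc s * 2       ≡⟨ *-distribˡ-+ (suc s) s 2 ⟨
    suc s * (s + 2)             ≡⟨ cong (suc s *_) (+-comm s 2) ⟩
    suc s * suc (suc s)         ∎
    where open ≡-Reasoning

  pair-tri : ∀ a b → ⟪ a , b ⟫ ≡ tri (a + b) + b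
  pair-tri a b = cong (_+ b)
    (trans (cong (_/ 2) (sym (tri*2 (a + b)))) (m*n/n≡m (tri (a + b)) 2))

  -- The number of the diagonal on which `n` lies. It is found by counting upwards and moving on
  -- whenever the next triangular number is reached, which keeps the inverses of pairing primitive
  -- recursive.
  diag : ℕ → ℕ
  diag = natrec 0 (λ k d → if suc k <ᵇ tri (suc d) then d else suc d)

  π₂ : ℕ → ℕ
  π₂ n = n ∸ tri (diag n)

  π₁ : ℕ → ℕ
  π₁ n = diag n ∸ π₂ n

  diag-bounds : ∀ n → tri (diag n) ≤ n × n < tri (suc (diag n))
  diag-bounds zero    = z≤n , s≤s z≤n
  diag-bounds (suc k) with diag-bounds k | suc k <ᵇ tri (suc (diag k)) in eq
  ... | lo , hi | true  = m≤n⇒m≤1+n lo , <ᵇ⇒< _ _ (subst T (sym eq) tt)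
  ... | lo , hi | false = ≮⇒≥ (λ lt → subst T eq (<⇒<ᵇ lt)) ,
                          <-≤-trans (s≤s hi) (≤-trans (≤-reflexive (+-comm 1 _))
                                                      (+-monoʳ-≤ _ (s≤s z≤n)))

  tri-mono : ∀ {s t} → s ≤ t → tri s ≤ tri t
  tri-mono z≤n     = z≤n
  tri-mono (s≤s p) = +-mono-≤ (tri-mono p) (s≤s p)

  s≤tri : ∀ s → s ≤ tri s
  s≤tri zero    = z≤n
  s≤tri (suc s) = m≤n+m (suc s) (tri s)

  diag-unique : ∀ {n d d′} → tri d ≤ n → n < tri (suc d) →
                tri d′ ≤ n → n < tri (suc d′) → d ≡ d′
  diag-unique {n} {d} {d′} a b c e with <-cmp d d′
  ... | tri≈ _ eq _ = eq
  ... | tri< lt _ _ = ⊥-elim (<⇒≱ b (≤-trans (tri-mono lt) c))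
  ... | tri> _ _ gt = ⊥-elim (<⇒≱ e (≤-trans (tri-mono gt) a))

  diag-pair : ∀ a b → diag ⟪ a , b ⟫ ≡ a + b
  diag-pair a b rewrite pair-tri a b =
    diag-unique {tri (a + b) + b} (proj₁ D) (proj₂ D) (m≤m+n _ b)
      (+-monoʳ-< (tri (a + b)) (s≤s (m≤n+m b a)))
    where D = diag-bounds (tri (a + b) + b)

  π₂-pair : ∀ a b → π₂ ⟪ a , b ⟫ ≡ b
  π₂-pair a b rewrite diag-pair a b | pair-tri a b = m+n∸m≡n (tri (a + b)) b

  π₁-pair : ∀ a b → π₁ ⟪ a , b ⟫ ≡ a
  π₁-pair a b = trans (cong₂ _∸_ (diag-pair a b) (π₂-pair a b)) (m+n∸n≡m a b)

  pair-π : ∀ n → ⟪ π₁ n , π₂ n ⟫ ≡ n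
  pair-π n = begin
    ⟪ π₁ n , π₂ n ⟫                ≡⟨ pair-tri (π₁ n) (π₂ n) ⟩
    tri (π₁ n + π₂ n) + π₂ n       ≡⟨ cong (λ d → tri d + π₂ n) (m∸n+n≡m π₂≤) ⟩
    tri (diag n) + (n ∸ tri (diag n)) ≡⟨ m+[n∸m]≡n (proj₁ (diag-bounds n)) ⟩
    n                              ∎
    where
      open ≡-Reasoning
      π₂≤ : π₂ n ≤ diag n
      π₂≤ = ≤-trans (∸-monoˡ-≤ (tri (diag n)) (s≤s⁻¹ (subst (n <_) (+-suc _ _) (proj₂ (diag-bounds n)))))
                    (≤-reflexive (m+n∸m≡n (tri (diag n)) (diag n)))

  pair-injective : ∀ {a b c d} → ⟪ a , b ⟫ ≡ ⟪ c , d ⟫ → a ≡ c × b ≡ d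
  pair-injective {a} {b} {c} {d} eq =
    trans (sym (π₁-pair a b)) (trans (cong π₁ eq) (π₁-pair c d)) ,
    trans (sym (π₂-pair a b)) (trans (cong π₂ eq) (π₂-pair c d))

  fst≤pair : ∀ a b → a ≤ ⟪ a , b ⟫
  fst≤pair a b rewrite pair-tri a b = ≤-trans (≤-trans (m≤m+n a b) (s≤tri (a + b))) (m≤m+n _ b)

  snd≤pair : ∀ a b → b ≤ ⟪ a , b ⟫
  snd≤pair a b rewrite pair-tri a b = m≤n+m b _

  pair-mono : ∀ {a b c d} → a ≤ c → b ≤ d → ⟪ a , b ⟫ ≤ ⟪ c , d ⟫
  pair-mono {a} {b} {c} {d} p q rewrite pair-tri a b | pair-tri c d =
    +-mono-≤ (tri-mono (+-mono-≤ p q)) q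

  -- Tag 0 has to be excluded because of `⟪ 0 , 0 ⟫`. For positive tags this makes the codes of
  -- proper subformulas smaller, so that a quantifier pays for the variable that it binds.
  snd<pair : ∀ a b → b < ⟪ suc a , b ⟫
  snd<pair a b rewrite pair-tri (suc a) b =
    m≤n⇒m≤o+n (tri (a + b)) (s≤s (m≤n+m b a)) ▸ b
    where
      _▸_ : ∀ {k} → k ≤ tri (a + b) + suc (a + b) → ∀ c → k ≤ tri (a + b) + suc (a + b) + c
      p ▸ c = ≤-trans p (m≤m+n _ c)

  π₁≤ : ∀ n → π₁ n ≤ n
  π₁≤ n = subst (π₁ n ≤_) (pair-π n) (fst≤pair _ _)

  π₂≤ : ∀ n → π₂ n ≤ n
  π₂≤ n = subst (π₂ n ≤_) (pair-π n) (snd≤pair (π₁ n) _)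

  -- Finite sequences as numbers: 0 is empty and s ▹ a appends a.

  infixl 5 _▹_
  _▹_ : ℕ → ℕ → ℕ
  s ▹ a = suc ⟪ s , a ⟫

  par lst : ℕ → ℕ
  par c = π₁ (pred c)
  lst c = π₂ (pred c)

  par-▹ : ∀ s a → par (s ▹ a) ≡ s
  par-▹ = π₁-pair

  lst-▹ : ∀ s a → lst (s ▹ a) ≡ a
  lst-▹ = π₂-pair

  ▹-injective : ∀ {s a t b} → s ▹ a ≡ t ▹ b → s ≡ t × a ≡ b
  ▹-injective eq = pair-injective (suc-injective eq)

  ▹-mono : ∀ {s t a b} → s ≤ t → a ≤ b → s ▹ a ≤ t ▹ b
  ▹-mono p q = s≤s (pair-mono p q)

  s<▹ : ∀ s a → s < s ▹ a
  s<▹ s a = s≤s (fst≤pair s a)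

  a<▹ : ∀ s a → a < s ▹ a
  a<▹ s a = s≤s (snd≤pair s a)

  -- at h j counts from the end of the sequence.
  at : ℕ → ℕ → ℕ
  at h j = lst (natrec h (λ _ → par) j)

  at-zero : ∀ s a → at (s ▹ a) 0 ≡ a
  at-zero = lst-▹

  at-suc : ∀ s a j → at (s ▹ a) (suc j) ≡ at s j
  at-suc s a j = cong lst (lemma j)
    where
      lemma : ∀ j → natrec (s ▹ a) (λ _ → par) (suc j) ≡ natrec s (λ _ → par) j
      lemma zero    = par-▹ s a
      lemma (suc j) = cong par (lemma j)

  -- Course-of-values recursion: G receives n and the sequence of earlier values.

  table : (ℕ → ℕ → ℕ) → ℕ → ℕ
  table G = natrec 0 (λ k h → h ▹ G k h)

  cov : (ℕ → ℕ → ℕ) → ℕ → ℕ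
  cov G n = G n (table G n)

  at-table′ : ∀ G i j → at (table G (j + suc i)) j ≡ cov G i
  at-table′ G i zero    = at-zero (table G i) _
  at-table′ G i (suc j) = trans (at-suc (table G (j + suc i)) _ j) (at-table′ G i j)

  at-table : ∀ G {i n} → i < n → at (table G n) (n ∸ suc i) ≡ cov G i
  at-table G {i} {n} lt = subst (λ k → at (table G k) (n ∸ suc i) ≡ cov G i)
                                (m∸n+n≡m lt) (at-table′ G i (n ∸ suc i))

  -- The inner `natrec` only distinguishes 0 from a successor `suc m`. The history then has length
  -- `suc m` and is read from its end, whence the position `m ∸ π₁ m` of the value at `π₁ m`.
  sfoldStep : ℕ → (ℕ → ℕ → ℕ → ℕ) → ℕ → ℕ → ℕ
  sfoldStep z g n h = natrec z (λ m _ → g (at h (m ∸ π₁ m)) (π₁ m) (π₂ m)) n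

  sfold : ℕ → (ℕ → ℕ → ℕ → ℕ) → ℕ → ℕ
  sfold z g = cov (sfoldStep z g)

  sfold-▹ : ∀ z g s a → sfold z g (s ▹ a) ≡ g (sfold z g s) s a
  sfold-▹ z g s a
    rewrite at-table (sfoldStep z g) {π₁ ⟪ s , a ⟫} {s ▹ a} (s≤s (π₁≤ ⟪ s , a ⟫))
          | π₁-pair s a | π₂-pair s a = refl

  -- Primitive recursive expressions, their compilation and closure properties.

  data Exp : ℕ → Set where
    var  : Fin n → Exp n
    zero : Exp n
    suc  : Exp n → Exp n
    nrec : Exp n → Exp (2 + n) → Exp n → Exp n
    call : Exp m → Vec (Exp n) m → Exp n

  mutual
    ⟦_⟧ : Exp n → Vec ℕ n → ℕ
    ⟦ var i ⟧      ρ = lookup ρ i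
    ⟦ zero ⟧       ρ = 0
    ⟦ suc e ⟧      ρ = suc (⟦ e ⟧ ρ)
    ⟦ nrec z s c ⟧ ρ = natrec (⟦ z ⟧ ρ) (λ k y → ⟦ s ⟧ (k ∷ y ∷ ρ)) (⟦ c ⟧ ρ)
    ⟦ call e es ⟧  ρ = ⟦ e ⟧ (⟦ es ⟧* ρ)

    ⟦_⟧* : Vec (Exp n) m → Vec ℕ n → Vec ℕ m
    ⟦ [] ⟧*     ρ = []
    ⟦ e ∷ es ⟧* ρ = ⟦ e ⟧ ρ ∷ ⟦ es ⟧* ρ

  mutual
    compile : Exp n → Program n
    compile (var i)      = proj i
    compile zero         = zer
    compile (suc e)      = comp succ (compile e ∷ [])
    compile (nrec z s c) = comp (rec (compile z) (compile s)) (compile c ∷ tabulate proj)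
    compile (call e es)  = comp (compile e) (compile* es)

    compile* : Vec (Exp n) m → Vec (Program n) m
    compile* []       = []
    compile* (e ∷ es) = compile e ∷ compile* es

  module _ {ℓ : Level} {A : Pred ℕ ℓ} where

    evals-tabulate : (f : Fin m → Fin n) (xs : Vec ℕ n) →
                     Evals A (tabulate (λ i → proj (f i))) xs (tabulate (λ i → lookup xs (f i)))
    evals-tabulate {zero}  f xs = []
    evals-tabulate {suc m} f xs = proj ∷ evals-tabulate (λ i → f (suc i)) xs

    evals-id : (xs : Vec ℕ n) → Evals A (tabulate proj) xs xs
    evals-id xs = subst (Evals A _ xs) (tabulate∘lookup xs) (evals-tabulate (λ i → i) xs)

    mutual
      compile-sound : (e : Exp n) (ρ : Vec ℕ n) → Eval A (compile e) ρ (⟦ e ⟧ ρ)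
      compile-sound (var i)      ρ = proj
      compile-sound zero         ρ = zer
      compile-sound (suc e)      ρ = comp (compile-sound e ρ ∷ []) succ
      compile-sound (nrec z s c) ρ =
        comp (compile-sound c ρ ∷ evals-id ρ) (go (⟦ c ⟧ ρ))
        where
          go : ∀ k → Eval A (rec (compile z) (compile s)) (k ∷ ρ)
                            (natrec (⟦ z ⟧ ρ) (λ k y → ⟦ s ⟧ (k ∷ y ∷ ρ)) k)
          go zero    = rec-z (compile-sound z ρ)
          go (suc k) = rec-s (go k) (compile-sound s _)
      compile-sound (call e es)  ρ = comp (compile*-sound es ρ) (compile-sound e _)

      compile*-sound : (es : Vec (Exp n) m) (ρ : Vec ℕ n) →
                       Evals A (compile* es) ρ (⟦ es ⟧* ρ)
      compile*-sound []       ρ = []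
      compile*-sound (e ∷ es) ρ = compile-sound e ρ ∷ compile*-sound es ρ

  record Computable {n} (f : Vec ℕ n → ℕ) : Set where
    constructor computable
    field
      term    : Exp n
      correct : ∀ ρ → ⟦ term ⟧ ρ ≡ f ρ

  open Computable

  private
    variable
      f g h : Vec ℕ n → ℕ

  record Fun₁ (f : ℕ → ℕ) : Set where
    constructor fun₁
    field body : Computable {1} (λ ρ → f (lookup ρ 0F))

  record Fun₂ (f : ℕ → ℕ → ℕ) : Set where
    constructor fun₂
    field body : Computable {2} (λ ρ → f (lookup ρ 0F) (lookup ρ 1F))

  record Fun₃ (f : ℕ → ℕ → ℕ → ℕ) : Set where
    constructor fun₃
    field body : Computable {3} (λ ρ → f (lookup ρ 0F) (lookup ρ 1F) (lookup ρ 2F))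

  record Fun₄ (f : ℕ → ℕ → ℕ → ℕ → ℕ) : Set where
    constructor fun₄
    field body : Computable {4} (λ ρ → f (lookup ρ 0F) (lookup ρ 1F) (lookup ρ 2F) (lookup ρ 3F))

  ext : (∀ ρ → f ρ ≡ g ρ) → Computable f → Computable g
  ext eq c = computable (term c) (λ ρ → trans (correct c ρ) (eq ρ))

  arg : (i : Fin n) → Computable (λ ρ → lookup ρ i)
  arg i = computable (var i) (λ _ → refl)

  sucC : Computable f → Computable (λ ρ → suc (f ρ))
  sucC c = computable (suc (term c)) (λ ρ → cong suc (correct c ρ))

  lit : ∀ k → Computable {n} (λ _ → k)
  lit zero    = computable zero (λ _ → refl)
  lit (suc k) = sucC (lit k)

  ap₁ : ∀ {F} → Fun₁ F → Computable f → Computable (λ ρ → F (f ρ))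
  ap₁ (fun₁ F) c = computable (call (term F) (term c ∷ []))
    (λ ρ → trans (cong (λ x → ⟦ term F ⟧ (x ∷ [])) (correct c ρ)) (correct F _))

  ap₂ : ∀ {F} → Fun₂ F → Computable f → Computable g → Computable (λ ρ → F (f ρ) (g ρ))
  ap₂ (fun₂ F) c d = computable (call (term F) (term c ∷ term d ∷ []))
    (λ ρ → trans (cong₂ (λ x y → ⟦ term F ⟧ (x ∷ y ∷ [])) (correct c ρ) (correct d ρ))
                 (correct F _))

  ap₃ : ∀ {F} → Fun₃ F → Computable f → Computable g → Computable h →
        Computable (λ ρ → F (f ρ) (g ρ) (h ρ))
  ap₃ {f = f} {F = F} (fun₃ F′) c d e = computable (call (term F′) (term c ∷ term d ∷ term e ∷ []))
    (λ ρ → trans (cong₂ (λ x y → ⟦ term F′ ⟧ (⟦ term c ⟧ ρ ∷ x ∷ y ∷ [])) (correct d ρ) (correct e ρ))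
           (trans (cong (λ x → ⟦ term F′ ⟧ (x ∷ _ ∷ _ ∷ [])) (correct c ρ)) (correct F′ _)))

  ap₄ : ∀ {k : Vec ℕ n → ℕ} {F} → Fun₄ F → Computable f → Computable g → Computable h → Computable k →
        Computable (λ ρ → F (f ρ) (g ρ) (h ρ) (k ρ))
  ap₄ (fun₄ F′) c d e k = computable (call (term F′) (term c ∷ term d ∷ term e ∷ term k ∷ []))
    (λ ρ → trans (cong₂ (λ x y → ⟦ term F′ ⟧ (⟦ term c ⟧ ρ ∷ ⟦ term d ⟧ ρ ∷ x ∷ y ∷ [])) (correct e ρ) (correct k ρ))
           (trans (cong₂ (λ x y → ⟦ term F′ ⟧ (x ∷ y ∷ _ ∷ _ ∷ [])) (correct c ρ) (correct d ρ)) (correct F′ _)))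

  natrec-cong : ∀ {z z′ s s′} → z ≡ z′ → (∀ k y → s k y ≡ s′ k y) → ∀ c → natrec z s c ≡ natrec z′ s′ c
  natrec-cong p q zero    = p
  natrec-cong {s = s} p q (suc c) = trans (cong (s c) (natrec-cong p q c)) (q c _)

  nrecC : ∀ {z : Vec ℕ n → ℕ} {s : Vec ℕ (2 + n) → ℕ} {c : Vec ℕ n → ℕ} →
          Computable z → Computable s → Computable c →
          Computable (λ ρ → natrec (z ρ) (λ k y → s (k ∷ y ∷ ρ)) (c ρ))
  nrecC {z = z} {s} Z S C = computable (nrec (term Z) (term S) (term C))
    (λ ρ → trans (natrec-cong {s′ = λ k y → s (k ∷ y ∷ ρ)} (correct Z ρ) (λ k y → correct S _) (⟦ term C ⟧ ρ))
                 (cong (natrec (z ρ) (λ k y → s (k ∷ y ∷ ρ))) (correct C ρ)))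

  ⟦tabulate⟧ : (r : Fin m → Fin n) (ρ : Vec ℕ n) →
               ⟦ tabulate (λ i → var (r i)) ⟧* ρ ≡ tabulate (λ i → lookup ρ (r i))
  ⟦tabulate⟧ {zero}  r ρ = refl
  ⟦tabulate⟧ {suc m} r ρ = cong (lookup ρ (r 0F) ∷_) (⟦tabulate⟧ (λ i → r (suc i)) ρ)

  -- Discards the second variable, the accumulator of a recursion.
  dropAcc : {f : Vec ℕ (1 + n) → ℕ} → Computable f →
            Computable {2 + n} (λ { (k ∷ y ∷ ρ) → f (k ∷ ρ) })
  dropAcc {f = f} c = computable (call (term c) (var 0F ∷ tabulate (λ i → var (suc (suc i)))))
    (λ { (k ∷ y ∷ ρ) → trans (cong (λ ρ′ → ⟦ term c ⟧ (k ∷ ρ′))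
                                   (trans (⟦tabulate⟧ (λ i → suc (suc i)) (k ∷ y ∷ ρ)) (tabulate∘lookup ρ)))
                             (correct c _) })

  addC : Fun₂ _+_
  addC = fun₂ (ext (λ { (a ∷ b ∷ []) → eq a b }) (nrecC (arg 1F) (sucC (arg 1F)) (arg 0F)))
    where
      eq : ∀ a b → natrec b (λ _ y → suc y) a ≡ a + b
      eq zero    b = refl
      eq (suc a) b = cong suc (eq a b)

  mulC : Fun₂ _*_
  mulC = fun₂ (ext (λ { (a ∷ b ∷ []) → eq a b }) (nrecC (lit 0) (ap₂ addC (arg 3F) (arg 1F)) (arg 0F)))
    where
      eq : ∀ a b → natrec 0 (λ _ y → b + y) a ≡ a * b
      eq zero    b = refl
      eq (suc a) b = cong (b +_) (eq a b)

  predC : Fun₁ pred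
  predC = fun₁ (ext (λ { (zero ∷ []) → refl ; (suc a ∷ []) → refl }) (nrecC (lit 0) (arg 0F) (arg 0F)))

  subC : Fun₂ _∸_
  subC = fun₂ (ext (λ { (a ∷ b ∷ []) → eq a b }) (nrecC (arg 0F) (ap₁ predC (arg 1F)) (arg 1F)))
    where
      eq : ∀ a b → natrec a (λ _ → pred) b ≡ a ∸ b
      eq a zero    = refl
      eq a (suc b) = trans (cong pred (eq a b)) (pred[m∸n]≡m∸[1+n] a b)

  triC : Fun₁ tri
  triC = fun₁ (ext (λ { (a ∷ []) → eq a }) (nrecC (lit 0) (ap₂ addC (arg 1F) (sucC (arg 0F))) (arg 0F)))
    where
      eq : ∀ a → natrec 0 (λ k y → y + suc k) a ≡ tri a
      eq zero    = refl
      eq (suc a) = cong (_+ suc a) (eq a)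

  pairC : Fun₂ ⟪_,_⟫
  pairC = fun₂ (ext (λ { (a ∷ b ∷ []) → sym (pair-tri a b) })
              (ap₂ addC (ap₁ triC (ap₂ addC (arg 0F) (arg 1F))) (arg 1F)))

  b2n : Bool → ℕ
  b2n true  = 1
  b2n false = 0

  Decidableᵇ : (Vec ℕ n → Bool) → Set
  Decidableᵇ p = Computable (λ ρ → b2n (p ρ))

  private
    variable
      p q : Vec ℕ n → Bool

  ifC : Decidableᵇ p → Computable f → Computable g → Computable (λ ρ → if p ρ then f ρ else g ρ)
  ifC {p = p} {f} {g} P F G = computable (call (nrec (var 2F) (var 3F) (var 0F)) (term P ∷ term F ∷ term G ∷ []))
    (λ ρ → trans (trans (cong (natrec _ _) (correct P ρ)) (eq (p ρ) _ _))
                 (cong₂ (λ x y → if p ρ then x else y) (correct F ρ) (correct G ρ)))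
    where
      eq : ∀ b x y → natrec y (λ _ _ → x) (b2n b) ≡ (if b then x else y)
      eq true  x y = refl
      eq false x y = refl

  andC : Decidableᵇ p → Decidableᵇ q → Decidableᵇ (λ ρ → p ρ ∧ q ρ)
  andC {p = p} P Q = ext (λ ρ → eq (p ρ)) (ifC P Q (lit 0))
    where
      eq : ∀ b {c} → (if b then b2n c else 0) ≡ b2n (b ∧ c)
      eq true  = refl
      eq false = refl

  orC : Decidableᵇ p → Decidableᵇ q → Decidableᵇ (λ ρ → p ρ ∨ q ρ)
  orC {p = p} P Q = ext (λ ρ → eq (p ρ)) (ifC P (lit 1) Q)
    where
      eq : ∀ b {c} → (if b then 1 else b2n c) ≡ b2n (b ∨ c)
      eq true  = refl
      eq false = refl

  notC : Decidableᵇ p → Decidableᵇ (λ ρ → not (p ρ))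
  notC {p = p} P = ext (λ ρ → eq (p ρ)) (ifC P (lit 0) (lit 1))
    where
      eq : ∀ b → (if b then 0 else 1) ≡ b2n (not b)
      eq true  = refl
      eq false = refl

  ltC : Computable f → Computable g → Decidableᵇ (λ ρ → f ρ <ᵇ g ρ)
  ltC {f = f} {g} F G = ext (λ ρ → eq (f ρ) (g ρ)) (ap₂ subC (lit 1) (ap₂ subC (sucC F) G))
    where
      eq : ∀ a b → 1 ∸ (suc a ∸ b) ≡ b2n (a <ᵇ b)
      eq zero    zero    = refl
      eq zero    (suc zero) = refl
      eq zero    (suc (suc b)) = refl
      eq (suc a) zero    = refl
      eq (suc a) (suc b) = eq a b

  eqC : Computable f → Computable g → Decidableᵇ (λ ρ → f ρ ≡ᵇ g ρ)
  eqC {f = f} {g} F G = ext (λ ρ → eq (f ρ) (g ρ))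
    (ap₂ subC (lit 1) (ap₂ addC (ap₂ subC F G) (ap₂ subC G F)))
    where
      eq : ∀ a b → 1 ∸ ((a ∸ b) + (b ∸ a)) ≡ b2n (a ≡ᵇ b)
      eq zero    zero    = refl
      eq zero    (suc b) = 0∸n≡0 b
      eq (suc a) zero    = 0∸n≡0 (a + 0)
      eq (suc a) (suc b) = eq a b

  allᵇ : (ℕ → Bool) → ℕ → Bool
  allᵇ p zero    = true
  allᵇ p (suc n) = p n ∧ allᵇ p n

  allᵇ⇒ : ∀ p n → T (allᵇ p n) → ∀ i → i < n → T (p i)
  allᵇ⇒ p (suc n) t i lt with p n in eq
  ... | true with m≤n⇒m<n∨m≡n (s≤s⁻¹ lt)
  ...   | inj₁ i<n  = allᵇ⇒ p n t i i<n
  ...   | inj₂ refl = subst T (sym eq) tt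

  ⇒allᵇ : ∀ p n → (∀ i → i < n → T (p i)) → T (allᵇ p n)
  ⇒allᵇ p zero    f = tt
  ⇒allᵇ p (suc n) f with p n | f n ≤-refl
  ... | true | _ = ⇒allᵇ p n (λ i lt → f i (m≤n⇒m≤1+n lt))

  allC : {p : Vec ℕ (1 + n) → Bool} {c : Vec ℕ n → ℕ} →
         Decidableᵇ p → Computable c → Decidableᵇ (λ ρ → allᵇ (λ i → p (i ∷ ρ)) (c ρ))
  allC {p = p} {c} P C = ext (λ ρ → eq ρ (c ρ))
    (nrecC {s = λ { (k ∷ y ∷ ρ) → b2n (p (k ∷ ρ)) * y }} (lit 1)
           (ext (λ { (k ∷ y ∷ ρ) → refl }) (ap₂ mulC (dropAcc P) (arg 1F))) C)
    where
      eq : ∀ ρ n → natrec 1 (λ k y → b2n (p (k ∷ ρ)) * y) n ≡ b2n (allᵇ (λ i → p (i ∷ ρ)) n)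
      eq ρ zero    = refl
      eq ρ (suc n) with p (n ∷ ρ)
      ... | true  = trans (+-identityʳ _) (eq ρ n)
      ... | false = refl

  diagC : Fun₁ diag
  diagC = fun₁ (nrecC (lit 0) (ifC (ltC (sucC (arg 0F)) (ap₁ triC (sucC (arg 1F)))) (arg 1F) (sucC (arg 1F))) (arg 0F))

  π₂C : Fun₁ π₂
  π₂C = fun₁ (ap₂ subC (arg 0F) (ap₁ triC (ap₁ diagC (arg 0F))))

  π₁C : Fun₁ π₁
  π₁C = fun₁ (ap₂ subC (ap₁ diagC (arg 0F)) (ap₁ π₂C (arg 0F)))

  ▹C : Fun₂ _▹_
  ▹C = fun₂ (sucC (ap₂ pairC (arg 0F) (arg 1F)))

  parC : Fun₁ par
  parC = fun₁ (ap₁ π₁C (ap₁ predC (arg 0F)))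

  lstC : Fun₁ lst
  lstC = fun₁ (ap₁ π₂C (ap₁ predC (arg 0F)))

  atC : Fun₂ at
  atC = fun₂ (ap₁ lstC (nrecC (arg 0F) (ap₁ parC (arg 1F)) (arg 1F)))

  module _ {G : Vec ℕ (2 + n) → ℕ} (GC : Computable G) where

    tableC : {c : Vec ℕ n → ℕ} → Computable c → Computable (λ ρ → table (λ k h → G (k ∷ h ∷ ρ)) (c ρ))
    tableC C = nrecC {s = λ { (k ∷ h ∷ ρ) → h ▹ G (k ∷ h ∷ ρ) }} (lit 0)
      (ext (λ { (k ∷ h ∷ ρ) → refl }) (ap₂ ▹C (arg 1F) GC)) C

    covC : {c : Vec ℕ n → ℕ} → Computable c → Computable (λ ρ → cov (λ k h → G (k ∷ h ∷ ρ)) (c ρ))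
    covC {c} C = computable (call (term GC) (term C ∷ term (tableC C) ∷ tabulate var))
      (λ ρ → trans (correct GC _)
        (trans (cong (λ ρ′ → G (⟦ term C ⟧ ρ ∷ ⟦ term (tableC C) ⟧ ρ ∷ ρ′))
                     (trans (⟦tabulate⟧ (λ i → i) ρ) (tabulate∘lookup ρ)))
               (cong₂ (λ x y → G (x ∷ y ∷ ρ)) (correct C ρ) (correct (tableC C) ρ))))

-- Points, rows, cell sizes and the axioms of the theory.

module Structures where

  open Arithmetic

  private
    variable
      m n c r : ℕ

  -- ≲ is a total preorder, ~ an equivalence relation and Star one of its classes.
  -- A point is a class of the preorder, and a row is a class of ~.
  -- The sizes of the cells (row ∩ point) carry all the information.
  L₃ : Language
  L₃ = record
    { #functions = 0
    ; #relations = 3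
    ; arityᶠ     = λ ()
    ; arityʳ     = lookup (2 ∷ 2 ∷ 1 ∷ [])
    }

  -- The node spelt by the levels `ns`, the most recent one first. The root is 0, so that the first
  -- point of a list has a cell of one element.
  labels : List ℕ → ℕ
  labels []       = 0
  labels (n ∷ ns) = labels ns ▹ n

  length≤labels : ∀ ns → length ns ≤ labels ns
  length≤labels []       = z≤n
  length≤labels (n ∷ ns) = s≤s (≤-trans (length≤labels ns) (fst≤pair _ n))

  hd : {A : Set} → Vec A (suc n) → A
  hd (x ∷ _) = x

  module _ {A : Set} where

    NotIn : A → List A → Set
    NotIn w []       = ⊤
    NotIn w (e ∷ es) = w ≢ e × NotIn w es

    -- Outside es, exactly k elements satisfy P.
    Exact : (A → Set) → ℕ → List A → Set
    Exact P zero    es = ∀ w → P w → ¬ NotIn w es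
    Exact P (suc k) es = ∃[ w ] P w × NotIn w es × Exact P k (w ∷ es)

    NotIn-map : ∀ {w es} → (∀ {e} → e ∈ es → w ≢ e) → NotIn w es
    NotIn-map {es = []}     f = tt
    NotIn-map {es = e ∷ es} f = f (here refl) , NotIn-map (f ∘ there)

    NotIn-∈ : ∀ {w es e} → NotIn w es → e ∈ es → w ≢ e
    NotIn-∈ (p , _) (here refl) = p
    NotIn-∈ (_ , q) (there i)   = NotIn-∈ q i

    Exact-resp : ∀ {P Q : A → Set} {es fs} → (∀ w → P w ⇔ Q w) →
                 (∀ w → NotIn w es ⇔ NotIn w fs) → ∀ k → Exact P k es → Exact Q k fs
    Exact-resp pq ef zero    E           = λ w q ∉ → E w (from (pq w) q) (from (ef w) ∉)
    Exact-resp pq ef (suc k) (w , p , ∉ , E) =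
      w , to (pq w) p , to (ef w) ∉ ,
      Exact-resp pq (λ u → mk⇔ (λ (a , b) → a , to (ef u) b) (λ (a , b) → a , from (ef u) b)) k E

  record Classical : Set₁ where
    field em : (P : Set) → Dec P

    dne : {P : Set} → ¬ ¬ P → P
    dne {P} ¬¬p with em P
    ... | yes p = p
    ... | no ¬p = ⊥-elim (¬¬p ¬p)

    module _ {A : Set} where

      -- The elements may be counted in any order: if the count begins with some `u` other than `w`,
      -- then `w` is removed further down and the two are exchanged.
      exact-remove : ∀ {P : A → Set} {es} k {w} → P w → NotIn w es → Exact P (suc k) es → Exact P k (w ∷ es)
      exact-remove k {w} p ∉ (u , pu , u∉ , E) with em (w ≡ u)
      ... | yes refl = E
      exact-remove zero    {w} p ∉ (u , pu , u∉ , E) | no w≢u = ⊥-elim (E w p (w≢u , ∉))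
      exact-remove (suc k) {w} p ∉ (u , pu , u∉ , E) | no w≢u =
        u , pu , ((λ u≡w → w≢u (sym u≡w)) , u∉) ,
        Exact-resp (λ _ → mk⇔ id id)
          (λ _ → mk⇔ (λ (a , b , c) → b , a , c) (λ (a , b , c) → b , a , c)) k
          (exact-remove k p (w≢u , ∉) E)

      exact-unique : ∀ {P : A → Set} {es} k l → Exact P k es → Exact P l es → k ≡ l
      exact-unique zero    zero    E F = refl
      exact-unique zero    (suc l) E (w , p , ∉ , _) = ⊥-elim (E w p ∉)
      exact-unique (suc k) zero    (w , p , ∉ , _) F = ⊥-elim (F w p ∉)
      exact-unique (suc k) (suc l) (w , p , ∉ , E) F =
        cong suc (exact-unique k l E (exact-remove l p ∉ F))

  -- Position i in a chain has index c.
  Entry : (ns : List ℕ) → ℕ → Fin (suc (length ns)) → Set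
  Entry ns       c zero    = c ≡ labels ns
  Entry (n ∷ ns) c (suc i) = Entry ns c i

  entry : ∀ ns i → ∃[ c ] c ≤ labels ns × Entry ns c i
  entry ns       zero    = labels ns , ≤-refl , refl
  entry (n ∷ ns) (suc i) with entry ns i
  ... | c , le , e = c , ≤-trans le (<⇒≤ (s<▹ (labels ns) n)) , e

  firstEntry : ∀ ns → ∃[ i ] Entry ns 0 i
  firstEntry []       = zero , refl
  firstEntry (n ∷ ns) with firstEntry ns
  ... | i , e = suc i , e

  module Str (M : Structure L₃) where
    open Structure M

    infix 4 _≲_ _~_ _∼_ _≺_

    _≲_ _~_ _∼_ _≺_ : Carrier → Carrier → Set
    a ≲ b = ⟦ 0F ⟧ʳ (a ∷ b ∷ [])
    a ~ b = ⟦ 1F ⟧ʳ (a ∷ b ∷ [])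
    a ∼ b = a ≲ b × b ≲ a
    a ≺ b = ¬ b ≲ a

    Star : Carrier → Set
    Star a = ⟦ 2F ⟧ʳ (a ∷ [])

    Cell : Carrier → Carrier → Carrier → Set
    Cell y x w = w ~ y × w ∼ x

    -- The cell of row y and point x has c + 1 elements.
    Sz : Carrier → Carrier → ℕ → Set
    Sz y x c = Exact (Cell y x) (suc c) []

    Lv : Carrier → ℕ → Set
    Lv x n = ∃[ p ] Star p × Sz p x n

    NotSim : Carrier → ∀ {n} → Vec Carrier n → Set
    NotSim x []       = ⊤
    NotSim x (y ∷ ys) = ¬ x ∼ y × NotSim x ys

    NotRow : Carrier → List Carrier → Set
    NotRow y []       = ⊤
    NotRow y (z ∷ zs) = ¬ y ~ z × NotRow y zs

    -- Distinct points, most recent first, with ns the levels of all but the head.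
    Chain : (ns : List ℕ) → Vec Carrier (suc (length ns)) → Set
    Chain []       xs       = ⊤
    Chain (n ∷ ns) (x ∷ xs) = Chain ns xs × Lv (hd xs) n × NotSim x xs

    Has : Carrier → (ns : List ℕ) → Vec Carrier (suc (length ns)) → Set
    Has y []       (x ∷ _)  = Sz y x 0
    Has y (n ∷ ns) (x ∷ xs) = Sz y x (labels (n ∷ ns)) × Has y ns xs

  -- Every prefix is asked for, because `S` is an arbitrary function, whose zeros may fail to be
  -- closed under prefixes.
  Good : (ℕ → ℕ) → List ℕ → Set
  Good S []       = S 0 ≡ 0
  Good S (n ∷ ns) = S (labels (n ∷ ns)) ≡ 0 × Good S ns

  -- Gr r bounds the elements and Sm r the numbers that exist at stage r: every
  -- witness is found one stage later.
  record Axioms (S : ℕ → ℕ) (M : Structure L₃)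
                (Gr : ℕ → Structure.Carrier M → Set) (Sm : ℕ → ℕ → Set) : Set where
    open Structure M
    open Str M
    field
      gr-suc      : ∀ {r a} → Gr r a → Gr (suc r) a
      total       : ∀ a b → a ≲ b ⊎ b ≲ a
      ≲-trans     : ∀ {a b c} → a ≲ b → b ≲ c → a ≲ c
      ~-refl      : ∀ {a} → a ~ a
      ~-sym       : ∀ {a b} → a ~ b → b ~ a
      ~-trans     : ∀ {a b c} → a ~ b → b ~ c → a ~ c
      star-resp   : ∀ {a b} → Star a → a ~ b → Star b
      star-unique : ∀ {a b} → Star a → Star b → a ~ b
      star        : ∃[ p ] Star p × (∀ r → Gr r p)
      cell        : ∀ y x → ∃[ w ] Cell y x w
      -- The content lies in the grade: if a cell has any element outside `us`, then it has one that
      -- appears just one stage after its row, its point and `us`.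
      fresh       : ∀ {y x w us} → Cell y x w → NotIn w us →
                    ∃[ u ] Cell y x u × NotIn u us ×
                      (∀ {r} → Gr r y → Gr r x → (∀ {v} → v ∈ us → Gr r v) → Gr (suc r) u)
      dense       : ∀ {a b} → a ≺ b → ∃[ c ] a ≺ c × c ≺ b × (∀ {r} → Gr r a → Gr r b → Gr (suc r) c)
      above       : ∀ a → ∃[ b ] a ≺ b × (∀ {r} → Gr r a → Gr (suc r) b)
      -- In this form monotonicity also says that a point below one of finite level has a finite
      -- level, and the bound on `m` makes each instance a finite disjunction, hence first-order.
      lv-mono     : ∀ {a b n} → a ≲ b → Lv b n → ∃[ m ] m ≤ n × Lv a m
      lv-exists   : ∀ n → ∃[ a ] Lv a n × (∀ {r} → Sm r n → Gr (suc r) a)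
      -- Together with `lv-above`: a level is an open interval, so a new point of that level fits on
      -- either side of those already matched.
      lv-below    : ∀ {a n} → Lv a n → ∃[ b ] b ≺ a × Lv b n × (∀ {r} → Gr r a → Gr (suc r) b)
      lv-above    : ∀ {a n} → Lv a n → ∃[ b ] a ≺ b × Lv b n × (∀ {r} → Gr r a → Gr (suc r) b)
      sz-unique   : ∀ {y x x′ c} → ¬ Star y → Sz y x c → Sz y x′ c → x ∼ x′
      sz-parent   : ∀ {y x c n} → ¬ Star y → Sz y x (c ▹ n) → ∃[ x′ ] Sz y x′ c × Lv x′ n
      sz-good     : ∀ {y x c} → ¬ Star y → Sz y x c → S c ≡ 0
      -- A row knows its list: when a row has been chosen, the points on its list can be matched
      -- without a later stage.
      sz-graded   : ∀ {y x c} → ¬ Star y → Sz y x c → ∃[ x′ ] x′ ∼ x × (∀ {r} → Gr r y → Gr r x′)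
      -- The head of `xs` may have infinite level, since large finite levels approximate such a
      -- head. That the list stops is demanded for a single `n`, which keeps the axiom first-order;
      -- it suffices to take the level of the head. Because of `ys`, each list belongs to infinitely
      -- many rows.
      row         : ∀ ns xs n ys → Good S ns → Chain ns xs →
                    ∃[ y ] ¬ Star y × NotRow y ys × Has y ns xs ×
                      (Lv (hd xs) n → ∀ x → ¬ Sz y x (labels ns ▹ n)) ×
                      (∀ {r} → Sm r (labels ns) → (∀ i → Gr r (lookup xs i)) →
                       (∀ {z} → z ∈ ys → Gr r z) → Gr (suc r) y)
      emptyRow    : ∀ ys → ∃[ y ] ¬ Star y × NotRow y ys × (∀ x → ¬ Sz y x 0) ×
                      (∀ {r} → (∀ {z} → z ∈ ys → Gr r z) → Gr (suc r) y)

  module Theory (cl : Classical) {S : ℕ → ℕ} {M : Structure L₃} {Gr Sm} (ax : Axioms S M Gr Sm) where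
    open Classical cl
    open Structure M
    open Str M
    open Axioms ax

    ≲-refl : ∀ {a} → a ≲ a
    ≲-refl {a} with total a a
    ... | inj₁ p = p
    ... | inj₂ p = p

    ≺⇒≲ : ∀ {a b} → a ≺ b → a ≲ b
    ≺⇒≲ {a} {b} p with total a b
    ... | inj₁ q = q
    ... | inj₂ q = ⊥-elim (p q)

    ≲≺-trans : ∀ {a b c} → a ≲ b → b ≺ c → a ≺ c
    ≲≺-trans p q r = q (≲-trans r p)

    ≺≲-trans : ∀ {a b c} → a ≺ b → b ≲ c → a ≺ c
    ≺≲-trans p q r = p (≲-trans q r)

    ∼-refl : ∀ {a} → a ∼ a
    ∼-refl = ≲-refl , ≲-refl

    ∼-sym : ∀ {a b} → a ∼ b → b ∼ a
    ∼-sym = swap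

    ∼-trans : ∀ {a b c} → a ∼ b → b ∼ c → a ∼ c
    ∼-trans (p , q) (r , s) = ≲-trans p r , ≲-trans s q

    sz-resp : ∀ {y y′ x x′ c} → y ~ y′ → x ∼ x′ → Sz y x c → Sz y′ x′ c
    sz-resp {c = c} p q = Exact-resp
      (λ w → mk⇔ (λ (a , b) → ~-trans a p , ∼-trans b q)
                 (λ (a , b) → ~-trans a (~-sym p) , ∼-trans b (∼-sym q)))
      (λ _ → mk⇔ id id) (suc c)

    sz-functional : ∀ {y x c c′} → Sz y x c → Sz y x c′ → c ≡ c′
    sz-functional {c = c} {c′} E F = suc-injective (exact-unique (suc c) (suc c′) E F)

    lv-resp : ∀ {x x′ n} → x ∼ x′ → Lv x n → Lv x′ n
    lv-resp q (p , s , z) = p , s , sz-resp ~-refl q z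

    lv-star : ∀ {p x n} → Star p → Lv x n → Sz p x n
    lv-star s (p , s′ , z) = sz-resp (star-unique s′ s) ∼-refl z

    lv-functional : ∀ {x n n′} → Lv x n → Lv x n′ → n ≡ n′
    lv-functional (p , s , z) l = sz-functional z (lv-star s l)

    has-entry : ∀ {y c} ns xs i → Has y ns xs → Entry ns c i → Sz y (lookup xs i) c
    has-entry []       (x ∷ _)  zero    h refl = h
    has-entry (n ∷ ns) (x ∷ xs) zero    h refl = proj₁ h
    has-entry (n ∷ ns) (x ∷ xs) (suc i) h e    = has-entry ns xs i (proj₂ h) e

    -- Going on from a listed point means extending its index by its level; only at the head is
    -- there nothing to go on to.
    nextEntry : ∀ ns (xs : Vec Carrier (suc (length ns))) {c} i → Chain ns xs → Entry ns c i →
                (i ≡ zero) ⊎ (∃[ n ] Lv (lookup xs i) n × ∃[ j ] Entry ns (c ▹ n) j)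
    nextEntry ns xs zero ch e = inj₁ refl
    nextEntry (n ∷ ns) (x ∷ x′ ∷ xs) (suc i) (ch , l , _) e with nextEntry ns (x′ ∷ xs) i ch e
    ... | inj₂ (n′ , l′ , j , e′) = inj₂ (n′ , l′ , suc j , e′)
    ... | inj₁ refl = inj₂ (n , l , zero , cong (_▹ n) e)

    notSim-lookup : ∀ {x n} {ys : Vec Carrier n} → NotSim x ys → ∀ i → ¬ x ∼ lookup ys i
    notSim-lookup {ys = y ∷ ys} (p , q) zero    = p
    notSim-lookup {ys = y ∷ ys} (p , q) (suc i) = notSim-lookup q i

    lookup-notSim : ∀ {x n} {ys : Vec Carrier n} → (∀ i → ¬ x ∼ lookup ys i) → NotSim x ys
    lookup-notSim {ys = []}     f = tt
    lookup-notSim {ys = y ∷ ys} f = f zero , lookup-notSim (f ∘ suc)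

    notRow-∈ : ∀ {y zs z} → NotRow y zs → z ∈ zs → ¬ y ~ z
    notRow-∈ (p , _) (here refl) = p
    notRow-∈ (_ , q) (there i)   = notRow-∈ q i

    module _ (V : ℕ → Set) (V-down : ∀ {m n} → m ≤ n → V n → V m) where

      Stops : Carrier → (ns : List ℕ) → Vec Carrier (suc (length ns)) → Set
      Stops y ns xs = ∀ n → V (labels ns ▹ n) → Lv (hd xs) n → ∀ x → ¬ Sz y x (labels ns ▹ n)

      -- By induction on the index: `sz-parent` leads to the point listed before, which is on the
      -- known list, and so is its successor unless it is the head. There `Stops` forbids a visible
      -- continuation.
      complete : ∀ {y} ns xs → ¬ Star y → Chain ns xs → Has y ns xs → Stops y ns xs →
                 ∀ {x c} → V c → Sz y x c → ∃[ i ] Entry ns c i × lookup xs i ∼ x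
      complete {y} ns xs ¬s ch h stop {c = c} = go c ≤-refl
        where
          go : ∀ {x c} b → c ≤ b → V c → Sz y x c → ∃[ i ] Entry ns c i × lookup xs i ∼ x
          go {c = zero} b le vc sz with firstEntry ns
          ... | i , e = i , e , sz-unique ¬s (has-entry ns xs i h e) sz
          go {x} {suc c} (suc b) (s≤s le) vc sz =
            subst (λ k → ∃[ i ] Entry ns (suc k) i × lookup xs i ∼ x) (pair-π c)
                  (step (subst V (cong suc (sym (pair-π c))) vc)
                        (subst (Sz y x) (cong suc (sym (pair-π c))) sz))
            where
              step : V (π₁ c ▹ π₂ c) → Sz y x (π₁ c ▹ π₂ c) →
                     ∃[ i ] Entry ns (π₁ c ▹ π₂ c) i × lookup xs i ∼ x
              step vc sz with sz-parent ¬s sz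
              ... | x′ , sz′ , l with go b (≤-trans (π₁≤ c) le) (V-down (<⇒≤ (s<▹ (π₁ c) (π₂ c))) vc) sz′
              ...   | i , e , sim with nextEntry ns xs i ch e
              ...     | inj₂ (n , l′ , j , e′)
                        rewrite lv-functional (lv-resp sim l′) l =
                        j , e′ , sz-unique ¬s (has-entry ns xs j h e′) sz
              ...     | inj₁ refl = ⊥-elim (atHead xs e sim stop)
                where
                  atHead : ∀ xs → Entry ns (π₁ c) zero → lookup xs zero ∼ x′ → Stops y ns xs → ⊥
                  atHead (x₀ ∷ _) e sim stop =
                    stop (π₂ c) (subst (λ k → V (k ▹ π₂ c)) e vc) (lv-resp (∼-sym sim) l) x
                         (subst (λ k → Sz y x (k ▹ π₂ c)) e sz)

      -- The chain of parents of any finite cell ends at index 0, so a list without a first point is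
      -- empty.
      no-contents : ∀ {y} → ¬ Star y → (∀ x → V 0 → ¬ Sz y x 0) → ∀ {x c} → V c → ¬ Sz y x c
      no-contents {y} ¬s none {c = c} = go c ≤-refl
        where
          go : ∀ {x c} b → c ≤ b → V c → ¬ Sz y x c
          go {c = zero} b le vc sz = none _ vc sz
          go {x} {suc c} (suc b) (s≤s le) vc sz
            with sz-parent ¬s (subst (Sz y x) (cong suc (sym (pair-π c))) sz)
          ... | x′ , sz′ , l = go b (≤-trans (π₁≤ c) le) (V-down (m≤n⇒m≤1+n (π₁≤ c)) vc) sz′

      infix 4 _⊏_
      -- Children are below their parents, so accessibility of 0 excludes an infinite branch of
      -- visible nodes from the root.
      _⊏_ : ℕ → ℕ → Set
      c′ ⊏ c = ∃[ n ] c′ ≡ c ▹ n × V c′ × S c′ ≡ 0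

      Contents : Carrier → Set
      Contents y = ∃[ ns ] ∃[ xs ] V (labels ns) × Good S ns × Chain ns xs × Has y ns xs × Stops y ns xs

      -- The list is followed as long as a visible cell continues it. Each step moves to a child in
      -- the tree, and accessibility ends the search.
      extendContents : ∀ {y} → ¬ Star y → ∀ ns (xs : Vec Carrier (suc (length ns))) →
                       Acc _⊏_ (labels ns) → V (labels ns) → Good S ns → Chain ns xs → Has y ns xs → Contents y
      extendContents {y} ¬s ns (x ∷ xs) (acc rs) v g ch h
        with em (∃[ n ] ∃[ x′ ] V (labels ns ▹ n) × Lv x n × Sz y x′ (labels ns ▹ n))
      ... | no ¬p = ns , x ∷ xs , v , g , ch , h , λ n v′ l x′ sz → ¬p (n , x′ , v′ , l , sz)
      ... | yes (n , x′ , v′ , l , sz) =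
        extendContents ¬s (n ∷ ns) (x′ ∷ x ∷ xs) (rs (n , refl , v′ , sz-good ¬s sz)) v′
           (sz-good ¬s sz , g) (ch , l , lookup-notSim distinct) (sz , h)
        where
          -- A repeated point would have a cell of two different sizes, as the new index exceeds all
          -- earlier ones.
          distinct : ∀ i → ¬ x′ ∼ lookup (x ∷ xs) i
          distinct i sim with entry ns i
          ... | c , le , e = <⇒≢ (s≤s (≤-trans le (fst≤pair (labels ns) n)))
            (sz-functional (has-entry ns (x ∷ xs) i h e) (sz-resp ~-refl sim sz))

      contents : ∀ {y} → ¬ Star y → Acc _⊏_ 0 → (∀ x → V 0 → ¬ Sz y x 0) ⊎ Contents y
      contents {y} ¬s wf with em (∃[ x ] V 0 × Sz y x 0)
      ... | no ¬p = inj₁ (λ x v sz → ¬p (x , v , sz))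
      ... | yes (x , v , sz) = inj₂ (extendContents ¬s [] (x ∷ []) wf v (sz-good ¬s sz) tt sz)

    Big : (ℕ → Set) → Carrier → Set
    Big V x = ∀ n → V n → ¬ Lv x n

-- Extending a matching by one point.

module Steps where

  open Arithmetic
  open Structures

  ⇔-refl : {A : Set} → A ⇔ A
  ⇔-refl = mk⇔ id id

  ⇔-sym : {A B : Set} → A ⇔ B → B ⇔ A
  ⇔-sym e = mk⇔ (from e) (to e)

  ⇔-trans : {A B C : Set} → A ⇔ B → B ⇔ C → A ⇔ C
  ⇔-trans e f = mk⇔ (to f ∘ to e) (from e ∘ from f)

  ¬-⇔ : {A B : Set} → A ⇔ B → (¬ A) ⇔ (¬ B)
  ¬-⇔ e = mk⇔ (λ f b → f (from e b)) (λ f a → f (to e a))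

  module Step (cl : Classical) {S : ℕ → ℕ} {M N : Structure L₃} {GrM SmM Gr Sm}
              (axM : Axioms S M GrM SmM) (axN : Axioms S N Gr Sm)
              (V : ℕ → Set) (V-down : ∀ {m n} → m ≤ n → V n → V m) where
    open Classical cl
    private
      module M where
        open Structure M public
        open Str M public
        open Axioms axM public
        open Theory cl axM public
      module N where
        open Structure N public
        open Str N public
        open Axioms axN public
        open Theory cl axN public

    Pairs : Set
    Pairs = List (M.Carrier × N.Carrier)

    greatest : (P : M.Carrier × N.Carrier → Set) (xs : Pairs) →
               (∀ {p} → p ∈ xs → ¬ P p) ⊎
               (∃[ p ] p ∈ xs × P p × (∀ {q} → q ∈ xs → P q → proj₁ q M.≲ proj₁ p))
    greatest P [] = inj₁ λ ()
    greatest P (x ∷ xs) with em (P x) | greatest P xs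
    ... | no ¬p | inj₁ none = inj₁ λ { (here refl) → ¬p ; (there i) → none i }
    ... | yes p | inj₁ none = inj₂ (x , here refl , p , λ { (here refl) _ → M.≲-refl ; (there i) q → ⊥-elim (none i q) })
    ... | no ¬p | inj₂ (m , i , pm , mx) = inj₂ (m , there i , pm , λ { (here refl) q → ⊥-elim (¬p q) ; (there j) q → mx j q })
    ... | yes p | inj₂ (m , i , pm , mx) with M.total (proj₁ m) (proj₁ x)
    ...   | inj₁ m≲x = inj₂ (x , here refl , p , λ { (here refl) _ → M.≲-refl ; (there j) q → M.≲-trans (mx j q) m≲x })
    ...   | inj₂ x≲m = inj₂ (m , there i , pm , λ { (here refl) _ → x≲m ; (there j) q → mx j q })

    least : (P : M.Carrier × N.Carrier → Set) (xs : Pairs) →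
            (∀ {p} → p ∈ xs → ¬ P p) ⊎
            (∃[ p ] p ∈ xs × P p × (∀ {q} → q ∈ xs → P q → proj₁ p M.≲ proj₁ q))
    least P [] = inj₁ λ ()
    least P (x ∷ xs) with em (P x) | least P xs
    ... | no ¬p | inj₁ none = inj₁ λ { (here refl) → ¬p ; (there i) → none i }
    ... | yes p | inj₁ none = inj₂ (x , here refl , p , λ { (here refl) _ → M.≲-refl ; (there i) q → ⊥-elim (none i q) })
    ... | no ¬p | inj₂ (m , i , pm , mx) = inj₂ (m , there i , pm , λ { (here refl) q → ⊥-elim (¬p q) ; (there j) q → mx j q })
    ... | yes p | inj₂ (m , i , pm , mx) with M.total (proj₁ m) (proj₁ x)
    ...   | inj₁ m≲x = inj₂ (m , there i , pm , λ { (here refl) _ → m≲x ; (there j) q → mx j q })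
    ...   | inj₂ x≲m = inj₂ (x , here refl , p , λ { (here refl) _ → M.≲-refl ; (there j) q → M.≲-trans x≲m (mx j q) })

    record Points (xs : Pairs) : Set where
      field
        order : ∀ {p q} → p ∈ xs → q ∈ xs → (proj₁ p M.≲ proj₁ q) ⇔ (proj₂ p N.≲ proj₂ q)
        level : ∀ {p} → p ∈ xs → ∀ n → V n → M.Lv (proj₁ p) n ⇔ N.Lv (proj₂ p) n

      order≺ : ∀ {p q} → p ∈ xs → q ∈ xs → (proj₁ p M.≺ proj₁ q) ⇔ (proj₂ p N.≺ proj₂ q)
      order≺ i j = ¬-⇔ (order j i)

      order∼ : ∀ {p q} → p ∈ xs → q ∈ xs → (proj₁ p M.∼ proj₁ q) ⇔ (proj₂ p N.∼ proj₂ q)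
      order∼ i j = mk⇔ (λ (a , b) → to (order i j) a , to (order j i) b)
                       (λ (a , b) → from (order i j) a , from (order j i) b)

      big : ∀ {p} → p ∈ xs → M.Big V (proj₁ p) ⇔ N.Big V (proj₂ p)
      big i = mk⇔ (λ b n v l → b n v (from (level i n v) l)) (λ b n v l → b n v (to (level i n v) l))

    -- The points above all levels in V: either they have no least element, or it
    -- has already been matched.
    Tail : Pairs → ℕ → Set
    Tail xs r = ∀ {a} → M.Big V a →
      (∃[ p ] p ∈ xs × M.Big V (proj₁ p) × proj₁ p M.≲ a) ⊎
      ((∃[ b ] N.Big V b × Gr (suc r) b) ×
       (∀ {b} → N.Big V b → ∃[ b′ ] N.Big V b′ × b′ N.≺ b × (Gr r b → Gr (suc r) b′)))

    -- One cut argument for two kinds of regions: the points of a fixed visible level, and the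
    -- points above all visible levels. Matched points outside the region are on the right side
    -- anyway, by `sep↓` and `sep↑`; inside, the new point is put between its nearest neighbours.
    module Place {xs : Pairs} (pts : Points xs) {r : ℕ} (graded : ∀ {p} → p ∈ xs → Gr r (proj₂ p))
      (GM : M.Carrier → Set) (GN : N.Carrier → Set)
      (same    : ∀ {p} → p ∈ xs → GM (proj₁ p) ⇔ GN (proj₂ p))
      (convex  : ∀ {a b c} → GN a → GN c → a N.≺ b → b N.≺ c → GN b)
      (upward  : ∀ {b} → GN b → ∃[ b′ ] GN b′ × b N.≺ b′ × (Gr r b → Gr (suc r) b′))
      {a : M.Carrier}
      (low     : (∃[ p ] p ∈ xs × GM (proj₁ p) × proj₁ p M.≲ a) ⊎
                 ((∃[ b ] GN b × Gr (suc r) b) ×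
                  (∀ {b} → GN b → ∃[ b′ ] GN b′ × b′ N.≺ b × (Gr r b → Gr (suc r) b′))))
      (sep↓    : ∀ {p} → p ∈ xs → proj₁ p M.≺ a → ¬ GM (proj₁ p) → ∀ {b} → GN b → proj₂ p N.≺ b)
      (sep↑    : ∀ {p} → p ∈ xs → a M.≺ proj₁ p → ¬ GM (proj₁ p) → ∀ {b} → GN b → b N.≺ proj₂ p)
      (new     : ∀ {p} → p ∈ xs → ¬ a M.∼ proj₁ p) where
      open Points pts

      Goal : Set
      Goal = ∃[ b ] GN b × Gr (suc r) b ×
             (∀ {p} → p ∈ xs → proj₁ p M.≺ a → proj₂ p N.≺ b) ×
             (∀ {p} → p ∈ xs → a M.≺ proj₁ p → b N.≺ proj₂ p)

      below above : M.Carrier × N.Carrier → Set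
      below p = proj₁ p M.≺ a × GM (proj₁ p)
      above p = a M.≺ proj₁ p × GM (proj₁ p)

      case↓ : ∀ {b} → GN b → (∀ {p} → p ∈ xs → below p → proj₂ p N.≺ b) →
              ∀ {p} → p ∈ xs → proj₁ p M.≺ a → proj₂ p N.≺ b
      case↓ g f {p} i lt with em (GM (proj₁ p))
      ... | yes q = f i (lt , q)
      ... | no ¬q = sep↓ i lt ¬q g

      case↑ : ∀ {b} → GN b → (∀ {p} → p ∈ xs → above p → b N.≺ proj₂ p) →
              ∀ {p} → p ∈ xs → a M.≺ proj₁ p → b N.≺ proj₂ p
      case↑ g f {p} i lt with em (GM (proj₁ p))
      ... | yes q = f i (lt , q)
      ... | no ¬q = sep↑ i lt ¬q g

      -- The first alternative of `low` is a matched point of the region below `a`, which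
      -- contradicts the assumption.
      lowest : (∀ {p} → p ∈ xs → ¬ below p) →
               (∃[ b ] GN b × Gr (suc r) b) ×
               (∀ {b} → GN b → ∃[ b′ ] GN b′ × b′ N.≺ b × (Gr r b → Gr (suc r) b′))
      lowest none = fromInj₂ (λ (p , i , g , le) → ⊥-elim (none i ((λ ge → new i (ge , le)) , g))) low

      orders : ((b , _) : Goal) → ∀ {p} → p ∈ xs →
               (a M.≲ proj₁ p ⇔ b N.≲ proj₂ p) × (proj₁ p M.≲ a ⇔ proj₂ p N.≲ b)
      orders (b , _ , _ , lo , hi) {p} i with em (proj₁ p M.≲ a)
      ... | yes p≲a = mk⇔ (λ le → ⊥-elim (new i (le , p≲a))) (λ le → ⊥-elim (p≺b le)) ,
                      mk⇔ (λ _ → N.≺⇒≲ p≺b) (λ _ → p≲a)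
        where p≺b = lo i (λ le → new i (le , p≲a))
      ... | no a≺p = mk⇔ (λ _ → N.≺⇒≲ (hi i a≺p)) (λ _ → M.≺⇒≲ a≺p) ,
                     mk⇔ (λ le → ⊥-elim (a≺p le)) (λ le → ⊥-elim (hi i a≺p le))

      place : Goal
      place with greatest below xs | least above xs
      ... | inj₂ (l , i , (l≺a , gl) , mx) | inj₂ (h , j , (a≺h , gh) , mn)
          with N.dense (to (order≺ i j) (M.≺≲-trans l≺a (M.≺⇒≲ a≺h)))
      ...   | b , l≺b , b≺h , gr = b , g , gr (graded i) (graded j) ,
              case↓ g (λ k q → N.≲≺-trans (to (order k i) (mx k q)) l≺b) ,
              case↑ g (λ k q → N.≺≲-trans b≺h (to (order j k) (mn k q)))
              where g = convex (to (same i) gl) (to (same j) gh) l≺b b≺h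
      place | inj₂ (l , i , (l≺a , gl) , mx) | inj₁ none with upward (to (same i) gl)
      ... | b , g , l≺b , gr = b , g , gr (graded i) ,
              case↓ g (λ k q → N.≲≺-trans (to (order k i) (mx k q)) l≺b) ,
              case↑ g (λ k q → ⊥-elim (none k q))
      place | inj₁ none | inj₂ (h , j , (a≺h , gh) , mn) with proj₂ (lowest none) (to (same j) gh)
      ... | b , g , b≺h , gr = b , g , gr (graded j) ,
              case↓ g (λ k q → ⊥-elim (none k q)) ,
              case↑ g (λ k q → N.≺≲-trans b≺h (to (order j k) (mn k q)))
      place | inj₁ none | inj₁ none′ with proj₁ (lowest none)
      ... | b , g , gr = b , g , gr , case↓ g (λ k q → ⊥-elim (none k q)) , case↑ g (λ k q → ⊥-elim (none′ k q))

    extendPoints : ∀ {xs} → Points xs → ∀ {a b} → (∀ n → V n → M.Lv a n ⇔ N.Lv b n) →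
                   (∀ {p} → p ∈ xs → (a M.≲ proj₁ p ⇔ b N.≲ proj₂ p) × (proj₁ p M.≲ a ⇔ proj₂ p N.≲ b)) →
                   Points ((a , b) ∷ xs)
    extendPoints pts lv or = record
      { order = λ { (here refl) (here refl) → mk⇔ (λ _ → N.≲-refl) (λ _ → M.≲-refl)
                  ; (here refl) (there j)   → proj₁ (or j)
                  ; (there i)   (here refl) → proj₂ (or i)
                  ; (there i)   (there j)   → order i j }
      ; level = λ { (here refl) → lv ; (there i) → level i } }
      where open Points pts

    module _ {xs : Pairs} {r : ℕ} (pts : Points xs) (graded : ∀ {p} → p ∈ xs → Gr r (proj₂ p))
             {a : M.Carrier} (new : ∀ {p} → p ∈ xs → ¬ a M.∼ proj₁ p) where
      open Points pts

      -- The points of one level form a convex set without endpoints. As levels never decrease,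
      -- matched points of other levels lie on the same side of it in both structures.
      addLevelled : (∀ n → V n → Sm r n) → ∀ {n} → V n → M.Lv a n →
                    ∃[ b ] Gr (suc r) b × Points ((a , b) ∷ xs)
      addLevelled rich {n} vn la = proj₁ P.place , proj₁ (proj₂ (proj₂ P.place)) ,
          extendPoints pts levels (P.orders P.place)
        where
          convex : ∀ {a b c} → N.Lv a n → N.Lv c n → a N.≺ b → b N.≺ c → N.Lv b n
          convex la lc a≺b b≺c with N.lv-mono (N.≺⇒≲ b≺c) lc
          ... | m , m≤n , lb with N.lv-mono (N.≺⇒≲ a≺b) lb
          ...   | k , k≤m , la′ rewrite N.lv-functional la′ la | ≤-antisym m≤n k≤m = lb
          sep↓ : ∀ {p} → p ∈ xs → proj₁ p M.≺ a → ¬ M.Lv (proj₁ p) n → ∀ {b} → N.Lv b n → proj₂ p N.≺ b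
          sep↓ i lt ¬l lb b≲p with M.lv-mono (M.≺⇒≲ lt) la
          ... | m , m≤n , lp with N.lv-mono b≲p (to (level i m (V-down m≤n vn)) lp)
          ...   | k , k≤m , lb′ rewrite N.lv-functional lb′ lb | ≤-antisym m≤n k≤m = ¬l lp
          sep↑ : ∀ {p} → p ∈ xs → a M.≺ proj₁ p → ¬ M.Lv (proj₁ p) n → ∀ {b} → N.Lv b n → b N.≺ proj₂ p
          sep↑ i lt ¬l lb p≲b with N.lv-mono p≲b lb
          ... | m , m≤n , lp with M.lv-mono (M.≺⇒≲ lt) (from (level i m (V-down m≤n vn)) lp)
          ...   | k , k≤m , la′ =
                  ¬l (from (level i n vn) (subst (N.Lv _) (≤-antisym m≤n (subst (_≤ m) (M.lv-functional la′ la) k≤m)) lp))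
          upward : ∀ {b} → N.Lv b n → ∃[ b′ ] N.Lv b′ n × b N.≺ b′ × (Gr r b → Gr (suc r) b′)
          upward l = let b , lt , l′ , gr = N.lv-above l in b , l′ , lt , gr
          downward : ∀ {b} → N.Lv b n → ∃[ b′ ] N.Lv b′ n × b′ N.≺ b × (Gr r b → Gr (suc r) b′)
          downward l = let b , lt , l′ , gr = N.lv-below l in b , l′ , lt , gr
          witness : ∃[ b ] N.Lv b n × Gr (suc r) b
          witness = let b , l , gr = N.lv-exists n in b , l , gr (rich n vn)
          module P = Place pts {r} graded (λ x → M.Lv x n) (λ x → N.Lv x n) (λ i → level i n vn) convex
            (λ l → upward l) {a} (inj₂ (witness , λ l → downward l))
            sep↓ sep↑ new
          levels : ∀ k → V k → M.Lv a k ⇔ N.Lv (proj₁ P.place) k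
          levels k _ = mk⇔ (λ l → subst (N.Lv _) (M.lv-functional la l) (proj₁ (proj₂ P.place)))
                           (λ l → subst (M.Lv a) (N.lv-functional (proj₁ (proj₂ P.place)) l) la)

      -- The region above the visible levels is closed upwards, so there is always room at its top;
      -- room at its bottom is what `Tail` provides.
      addBig : Tail xs r → M.Big V a → ∃[ b ] Gr (suc r) b × Points ((a , b) ∷ xs)
      addBig tail biga = proj₁ P.place , proj₁ (proj₂ (proj₂ P.place)) ,
          extendPoints pts levels (P.orders P.place)
        where
          upBig : ∀ {b c} → b N.≲ c → N.Big V b → N.Big V c
          upBig le bb n v l with N.lv-mono le l
          ... | m , m≤n , l′ = bb m (V-down m≤n v) l′
          sep↓ : ∀ {p} → p ∈ xs → proj₁ p M.≺ a → ¬ M.Big V (proj₁ p) → ∀ {b} → N.Big V b → proj₂ p N.≺ b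
          sep↓ i lt ¬b bb b≲p = ¬b (from (big i) (upBig b≲p bb))
          sep↑ : ∀ {p} → p ∈ xs → a M.≺ proj₁ p → ¬ M.Big V (proj₁ p) → ∀ {b} → N.Big V b → b N.≺ proj₂ p
          sep↑ i lt ¬b = ⊥-elim (¬b λ n v l →
            let m , m≤n , l′ = M.lv-mono (M.≺⇒≲ lt) l in biga m (V-down m≤n v) l′)
          upward : ∀ {b} → N.Big V b → ∃[ b′ ] N.Big V b′ × b N.≺ b′ × (Gr r b → Gr (suc r) b′)
          upward {b} bb = let c , lt , gr = N.above b in c , upBig (N.≺⇒≲ lt) bb , lt , gr
          module P = Place pts {r} graded (M.Big V) (N.Big V) big
            (λ ba _ a≺b _ → upBig (N.≺⇒≲ a≺b) ba) (λ {b} bb → upward {b} bb)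
            {a} (tail biga) sep↓ sep↑ new
          levels : ∀ k → V k → M.Lv a k ⇔ N.Lv (proj₁ P.place) k
          levels k v = mk⇔ (λ l → ⊥-elim (biga k v l)) (λ l → ⊥-elim (proj₁ (proj₂ P.place) k v l))

    addPoint : ∀ {xs r} → Points xs → (∀ {p} → p ∈ xs → Gr r (proj₂ p)) → (∀ n → V n → Sm r n) → Tail xs r →
               ∀ a → ∃[ b ] Gr (suc r) b × Points ((a , b) ∷ xs)
    addPoint {xs} {r} pts graded rich tail a with em (∃[ p ] p ∈ xs × a M.∼ proj₁ p)
    ... | yes ((a′ , b) , i , sim) = b , N.gr-suc (graded i) , extendPoints pts
            (λ n v → ⇔-trans (mk⇔ (M.lv-resp sim) (M.lv-resp (M.∼-sym sim))) (level i n v))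
            (λ j → ⇔-trans (mk⇔ (M.≲-trans (proj₂ sim)) (M.≲-trans (proj₁ sim))) (order i j) ,
                   ⇔-trans (mk⇔ (λ p → M.≲-trans p (proj₁ sim)) (λ p → M.≲-trans p (proj₂ sim))) (order j i))
      where open Points pts
    ... | no ¬old with em (∃[ n ] V n × M.Lv a n)
    ...   | yes (n , vn , la) = addLevelled pts graded (λ i sim → ¬old (_ , i , sim)) rich vn la
    ...   | no ¬lv = addBig pts graded (λ i sim → ¬old (_ , i , sim)) tail (λ n v l → ¬lv (n , v , l))

-- The back-and-forth game on points, rows and elements.

module Responses where

  open Arithmetic
  open Structures
  open Steps

  module Game (cl : Classical) {S : ℕ → ℕ} {M N : Structure L₃} {GrM SmM Gr Sm}
              (axM : Axioms S M GrM SmM) (axN : Axioms S N Gr Sm)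
              (V : ℕ → Set) (V-down : ∀ {m n} → m ≤ n → V n → V m) where
    open Classical cl
    open Step cl axM axN V V-down
    private
      module M where
        open Structure M public
        open Str M public
        open Axioms axM public
        open Theory cl axM public
      module N where
        open Structure N public
        open Str N public
        open Axioms axN public
        open Theory cl axN public

    -- `xs` matches points, `ys` rows and `ws` the elements actually played; points and rows are
    -- given by representatives. By `sizes→` and `sizes←`, the visible points on the list of a
    -- matched row are matched as well, so no point that is added later can change the visible
    -- contents of that row.
    record State (r : ℕ) (xs ys ws : Pairs) : Set where
      field
        points  : Points xs
        rows    : ∀ {p q} → p ∈ ys → q ∈ ys → (proj₁ p M.~ proj₁ q) ⇔ (proj₂ p N.~ proj₂ q)
        stars   : ∀ {p} → p ∈ ys → M.Star (proj₁ p) ⇔ N.Star (proj₂ p)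
        sizes→  : ∀ {p} → p ∈ ys → ¬ M.Star (proj₁ p) → ∀ {c x} → V c → M.Sz (proj₁ p) x c →
                  ∃[ q ] q ∈ xs × proj₁ q M.∼ x × N.Sz (proj₂ p) (proj₂ q) c
        sizes←  : ∀ {p} → p ∈ ys → ¬ N.Star (proj₂ p) → ∀ {c x} → V c → N.Sz (proj₂ p) x c →
                  ∃[ q ] q ∈ xs × proj₂ q N.∼ x × M.Sz (proj₁ p) (proj₁ q) c
        pointOf : ∀ {p} → p ∈ ws → ∃[ q ] q ∈ xs × proj₁ q M.∼ proj₁ p × proj₂ q N.∼ proj₂ p
        rowOf   : ∀ {p} → p ∈ ws → ∃[ q ] q ∈ ys × proj₁ q M.~ proj₁ p × proj₂ q N.~ proj₂ p
        exactly   : ∀ {p q} → p ∈ ws → q ∈ ws → (proj₁ p ≡ proj₁ q) ⇔ (proj₂ p ≡ proj₂ q)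
        grx     : ∀ {p} → p ∈ xs → Gr r (proj₂ p)
        gry     : ∀ {p} → p ∈ ys → Gr r (proj₂ p)
        grw     : ∀ {p} → p ∈ ws → Gr r (proj₂ p)
      open Points points public

      -- In the star row sizes are levels, which matched points share; in any other row a visible
      -- size puts the point on the list, which is matched.
      sameSize : ∀ {p q c} → p ∈ ys → q ∈ xs → V c →
                 M.Sz (proj₁ p) (proj₁ q) c ⇔ N.Sz (proj₂ p) (proj₂ q) c
      sameSize {p} {q} {c} i j v with em (M.Star (proj₁ p))
      ... | yes s = mk⇔ (λ z → N.lv-star (to (stars i) s) (to (level j c v) (proj₁ p , s , z)))
                        (λ z → M.lv-star s (from (level j c v) (proj₂ p , to (stars i) s , z)))
      ... | no ¬s = mk⇔
        (λ z → let q′ , k , sim , z′ = sizes→ i ¬s v z in N.sz-resp N.~-refl (to (order∼ k j) sim) z′)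
        (λ z → let q′ , k , sim , z′ = sizes← i (¬s ∘ from (stars i)) v z in M.sz-resp M.~-refl (from (order∼ k j) sim) z′)

      ≲-agree : ∀ {p q} → p ∈ ws → q ∈ ws → (proj₁ p M.≲ proj₁ q) ⇔ (proj₂ p N.≲ proj₂ q)
      ≲-agree i j =
        let _ , i′ , (a , a′) , (b , b′) = pointOf i
            _ , j′ , (c , c′) , (d , d′) = pointOf j
        in mk⇔ (λ e → N.≲-trans b′ (N.≲-trans (to (order i′ j′) (M.≲-trans a (M.≲-trans e c′))) d))
               (λ e → M.≲-trans a′ (M.≲-trans (from (order i′ j′) (N.≲-trans b (N.≲-trans e d′))) c))

      ~-agree : ∀ {p q} → p ∈ ws → q ∈ ws → (proj₁ p M.~ proj₁ q) ⇔ (proj₂ p N.~ proj₂ q)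
      ~-agree i j =
        let _ , i′ , a , b = rowOf i
            _ , j′ , c , d = rowOf j
        in mk⇔ (λ e → N.~-trans (N.~-sym b) (N.~-trans (to (rows i′ j′) (M.~-trans a (M.~-trans e (M.~-sym c)))) d))
               (λ e → M.~-trans (M.~-sym a) (M.~-trans (from (rows i′ j′) (N.~-trans b (N.~-trans e (N.~-sym d)))) c))

      star-agree : ∀ {p} → p ∈ ws → M.Star (proj₁ p) ⇔ N.Star (proj₂ p)
      star-agree i =
        let _ , i′ , a , b = rowOf i
        in mk⇔ (λ e → N.star-resp (to (stars i′) (M.star-resp e (M.~-sym a))) b)
               (λ e → M.star-resp (from (stars i′) (N.star-resp e (N.~-sym b))) a)

    -- If w is the only element without partner, then the two cells differ in size.
    count : ∀ {P : M.Carrier → Set} {Q : N.Carrier → Set} {w} (ws : Pairs) {es fs} →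
            (∀ {p} → p ∈ ws → (P (proj₁ p) × NotIn (proj₁ p) es) ⇔ (Q (proj₂ p) × NotIn (proj₂ p) fs)) →
            (∀ {p q} → p ∈ ws → q ∈ ws → (proj₁ p ≡ proj₁ q) ⇔ (proj₂ p ≡ proj₂ q)) →
            (∀ z → Q z → NotIn z fs → ∃[ p ] p ∈ ws × proj₂ p ≡ z) →
            P w → NotIn w es → (∀ {p} → p ∈ ws → w ≢ proj₁ p) →
            ∃[ k ] k ≤ length ws × Exact Q k fs × ¬ Exact P k es
    count [] corr eqv cover pw w∉ new =
      0 , z≤n , (λ z q z∉ → case∅ (cover z q z∉)) , λ E → E _ pw w∉
      where
        case∅ : ∀ {P : _ → Set} → ∃[ p ] p ∈ [] × P p → ⊥
        case∅ (_ , () , _)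
    count {P} {Q} {w} ((a , b) ∷ ws) {es} {fs} corr eqv cover pw w∉ new with em (Q b × NotIn b fs)
    ... | yes (qb , b∉) =
      let k , le , E , ¬F = count ws {a ∷ es} {b ∷ fs}
            (λ i → mk⇔ (λ (p , ne , n∉) → let q , n∉′ = to (corr (there i)) (p , n∉) in
                          q , (λ eq → ne (from (eqv (there i) (here refl)) eq)) , n∉′)
                       (λ (q , ne , n∉) → let p , n∉′ = from (corr (there i)) (q , n∉) in
                          p , (λ eq → ne (to (eqv (there i) (here refl)) eq)) , n∉′))
            (λ i j → eqv (there i) (there j))
            (λ z q (z≢b , z∉) → elsewhere z≢b (cover z q z∉))
            pw (new (here refl) , w∉) (new ∘ there)
          pa , a∉ = from (corr (here refl)) (qb , b∉)
      in suc k , s≤s le , (b , qb , b∉ , E) , λ F → ¬F (exact-remove k pa a∉ F)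
      where
        elsewhere : ∀ {z} → z ≢ b → ∃[ p ] p ∈ (a , b) ∷ ws × proj₂ p ≡ z → ∃[ p ] p ∈ ws × proj₂ p ≡ z
        elsewhere z≢b (_ , here refl , eq) = ⊥-elim (z≢b (sym eq))
        elsewhere z≢b (p , there i , eq) = p , i , eq
    ... | no ¬b =
      let k , le , E , ¬F = count ws {es} {fs} (λ i → corr (there i)) (λ i j → eqv (there i) (there j))
            (λ z q z∉ → elsewhere (λ { refl → ¬b (q , z∉) }) (cover z q z∉)) pw w∉ (new ∘ there)
      in k , m≤n⇒m≤1+n le , E , ¬F
      where
        elsewhere : ∀ {z} → z ≢ b → ∃[ p ] p ∈ (a , b) ∷ ws × proj₂ p ≡ z → ∃[ p ] p ∈ ws × proj₂ p ≡ z
        elsewhere z≢b (_ , here refl , eq) = ⊥-elim (z≢b (sym eq))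
        elsewhere z≢b (p , there i , eq) = p , i , eq

    infix 4 _⊆_
    _⊆_ : Pairs → Pairs → Set
    xs ⊆ xs′ = ∀ {p} → p ∈ xs → p ∈ xs′

    regrade : ∀ {r r′ xs ys ws} → (∀ {a} → Gr r a → Gr r′ a) → State r xs ys ws → State r′ xs ys ws
    regrade g st = record
      { points = points ; rows = rows ; stars = stars ; sizes→ = sizes→ ; sizes← = sizes←
      ; pointOf = pointOf ; rowOf = rowOf ; exactly = exactly
      ; grx = g ∘ grx ; gry = g ∘ gry ; grw = g ∘ grw }
      where open State st

    statePoint : ∀ {r xs ys ws a b} → State r xs ys ws → Points ((a , b) ∷ xs) → Gr (suc r) b →
                 State (suc r) ((a , b) ∷ xs) ys ws
    statePoint st pts g = record
      { points = pts ; rows = rows ; stars = stars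
      ; sizes→ = λ i s v z → let q , j , rest = sizes→ i s v z in q , there j , rest
      ; sizes← = λ i s v z → let q , j , rest = sizes← i s v z in q , there j , rest
      ; pointOf = λ i → let q , j , rest = pointOf i in q , there j , rest
      ; rowOf = rowOf ; exactly = exactly
      ; grx = λ { (here refl) → g ; (there i) → N.gr-suc (grx i) }
      ; gry = N.gr-suc ∘ gry ; grw = N.gr-suc ∘ grw }
      where open State st

    stateRow : ∀ {r xs ys ws y y′} → State r xs ys ws → (∀ {p} → p ∈ ys → ¬ y M.~ proj₁ p) →
               (∀ {p} → p ∈ ys → ¬ y′ N.~ proj₂ p) → (M.Star y ⇔ N.Star y′) →
               (¬ M.Star y → ∀ {c x} → V c → M.Sz y x c → ∃[ q ] q ∈ xs × proj₁ q M.∼ x × N.Sz y′ (proj₂ q) c) →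
               (¬ N.Star y′ → ∀ {c x} → V c → N.Sz y′ x c → ∃[ q ] q ∈ xs × proj₂ q N.∼ x × M.Sz y (proj₁ q) c) →
               Gr (suc r) y′ → State (suc r) xs ((y , y′) ∷ ys) ws
    stateRow st new new′ s f g gr = record
      { points = points
      ; rows = λ { (here refl) (here refl) → mk⇔ (λ _ → N.~-refl) (λ _ → M.~-refl)
                 ; (here refl) (there j) → mk⇔ (⊥-elim ∘ new j) (⊥-elim ∘ new′ j)
                 ; (there i) (here refl) → mk⇔ (⊥-elim ∘ new i ∘ M.~-sym) (⊥-elim ∘ new′ i ∘ N.~-sym)
                 ; (there i) (there j) → rows i j }
      ; stars = λ { (here refl) → s ; (there i) → stars i }
      ; sizes→ = λ { (here refl) → f ; (there i) → sizes→ i }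
      ; sizes← = λ { (here refl) → g ; (there i) → sizes← i }
      ; pointOf = pointOf
      ; rowOf = λ i → let q , j , rest = rowOf i in q , there j , rest
      ; exactly = exactly
      ; grx = N.gr-suc ∘ grx
      ; gry = λ { (here refl) → gr ; (there i) → N.gr-suc (gry i) }
      ; grw = N.gr-suc ∘ grw }
      where open State st

    gr+ : ∀ k {r a} → Gr r a → Gr (k + r) a
    gr+ zero    g = g
    gr+ (suc k) g = N.gr-suc (gr+ k g)

    -- Matching a row takes as many stages as its list has points. So that the stage after a move
    -- does not depend on the row, `pad` rounds this number up to a common `K`.
    module Moves (Ready : ℕ → Set) (ready-suc : ∀ {r} → Ready r → Ready (suc r))
                 (rich : ∀ {r} → Ready r → ∀ n → V n → Sm r n)
                 (wf : Acc (M._⊏_ V V-down) 0)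
                 (K : ℕ) (pad : ∀ ns → V (labels ns) → ∀ {r a} → Gr (length ns + r) a → Gr (K + r) a)
                 where

      Tails : Pairs → Set
      Tails xs = ∀ {xs′ r} → xs ⊆ xs′ → Ready r → Tail xs′ r

      ready+ : ∀ k {r} → Ready r → Ready (k + r)
      ready+ zero    p = p
      ready+ (suc k) p = ready-suc (ready+ k p)

      addPoints : ∀ {r xs ys ws n} → State r xs ys ws → Ready r → Tails xs → (as : Vec M.Carrier n) →
                  ∃[ xs′ ] Σ[ bs ∈ Vec N.Carrier n ] xs ⊆ xs′ × State (n + r) xs′ ys ws ×
                    (∀ i → (lookup as i , lookup bs i) ∈ xs′)
      addPoints {xs = xs} st rd tl [] = xs , [] , id , st , λ ()
      addPoints {r} {xs} st rd tl (_∷_ {n} a as) with addPoints st rd tl as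
      ... | xs′ , bs , sub , st′ , mem with addPoint (State.points st′) (State.grx st′) (rich (ready+ n rd)) (tl sub (ready+ n rd)) a
      ...   | b , g , pts = (a , b) ∷ xs′ , b ∷ bs , there ∘ sub , statePoint st′ pts g ,
                λ { zero → here refl ; (suc i) → there (mem i) }

      chain-map : ∀ {xs} → Points xs → ∀ ns as bs → V (labels ns) → (∀ i → (lookup as i , lookup bs i) ∈ xs) →
                  M.Chain ns as → N.Chain ns bs
      chain-map pts [] as bs v mem ch = tt
      chain-map pts (n ∷ ns) (a ∷ a′ ∷ as) (b ∷ b′ ∷ bs) v mem (ch , l , ns≁) =
        chain-map pts ns (a′ ∷ as) (b′ ∷ bs) (V-down (<⇒≤ (s<▹ (labels ns) n)) v) (mem ∘ suc) ch ,
        to (Points.level pts (mem (suc zero)) n (V-down (<⇒≤ (a<▹ (labels ns) n)) v)) l ,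
        N.lookup-notSim (λ i sim → M.notSim-lookup ns≁ i (from (Points.order∼ pts (mem zero) (mem (suc i))) sim))

      theLevel : ∀ a → ∃[ n ] (∀ m → M.Lv a m → m ≡ n)
      theLevel a with em (∃[ n ] M.Lv a n)
      ... | yes (n , l) = n , λ m l′ → M.lv-functional l′ l
      -- The default is safe: it is only compared with levels of `a`, and there are none.
      ... | no ¬l       = 0 , λ m l′ → ⊥-elim (¬l (m , l′))

      head∈ : ∀ {xs n} (as : Vec M.Carrier (suc n)) (bs : Vec N.Carrier (suc n)) →
              (∀ i → (lookup as i , lookup bs i) ∈ xs) → (hd as , hd bs) ∈ xs
      head∈ (a ∷ _) (b ∷ _) mem = mem zero

      RowResult : ℕ → Pairs → Pairs → Pairs → M.Carrier → Set
      RowResult r xs ys ws y = ∃[ xs′ ] ∃[ ys′ ] xs ⊆ xs′ × State (suc (suc K) + r) xs′ ys′ ws ×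
                               (∃[ q ] q ∈ ys′ × proj₁ q M.~ y)

      module _ {r xs ys ws y} (st : State r xs ys ws) (new : ∀ {p} → p ∈ ys → ¬ y M.~ proj₁ p) where
        open State st

        addStar : M.Star y → RowResult r xs ys ws y
        addStar s = xs , (y , p) ∷ ys , id ,
            regrade (λ {a} g → subst (λ k → Gr k a) (cong suc (+-suc K r)) (gr+ (suc K) g))
              (stateRow st new (λ i e → new i (M.star-unique s (from (stars i) (N.star-resp s′ e))))
                (mk⇔ (λ _ → s′) (λ _ → s)) (λ ¬s → ⊥-elim (¬s s)) (λ ¬s → ⊥-elim (¬s s′)) (gr (suc r))) ,
            (y , p) , here refl , M.~-refl
          where
            p = proj₁ N.star
            s′ = proj₁ (proj₂ N.star)
            gr = proj₂ (proj₂ N.star)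

        addEmpty : ¬ M.Star y → (∀ x → V 0 → ¬ M.Sz y x 0) → RowResult r xs ys ws y
        addEmpty ¬s none with N.emptyRow (List.map proj₂ ys)
        ... | y′ , ¬s′ , fresh , none′ , gr = xs , (y , y′) ∷ ys , id ,
            regrade (λ {a} g → subst (λ k → Gr k a) (cong suc (+-suc K r)) (gr+ (suc K) g))
              (stateRow st new (λ i → N.notRow-∈ fresh (∈-map⁺ proj₂ i)) (mk⇔ (⊥-elim ∘ ¬s) (⊥-elim ∘ ¬s′))
                (λ _ v z → ⊥-elim (M.no-contents V V-down ¬s none v z))
                (λ _ v z → ⊥-elim (N.no-contents V V-down ¬s′ (λ x _ → none′ x) v z))
                (gr λ i → let q , j , eq = ∈-map⁻ proj₂ i in subst (Gr r) (sym eq) (gry j))) ,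
            (y , y′) , here refl , M.~-refl

        -- The points on the list of `y` are matched one by one; then the axiom `row` supplies a new
        -- row of `N` with the list of their partners. By `complete`, both lists contain all visible
        -- points of their rows.
        addFull : Ready r → Tails xs → ¬ M.Star y → M.Contents V V-down y → RowResult r xs ys ws y
        addFull rd tl ¬s (ns , as , v , good , ch , has , stops)
          with addPoints st rd tl as | theLevel (hd as)
        ... | xs′ , bs , sub , st′ , mem | n , only
          with chain-map (State.points st′) ns as bs v mem ch
        ...   | ch′ with N.row ns bs n (List.map proj₂ ys) good ch′
        ...     | y′ , ¬s′ , fresh , has′ , stop′ , gr = xs′ , (y , y′) ∷ ys , sub ,
            regrade (λ {c} g → subst (λ k → Gr k c) (+-suc² K) (pad ns v
                       (subst (λ k → Gr k c) (sym (+-suc² (length ns))) g)))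
              (stateRow st′ new (λ i → N.notRow-∈ fresh (∈-map⁺ proj₂ i)) (mk⇔ (⊥-elim ∘ ¬s) (⊥-elim ∘ ¬s′))
                (λ _ v z → let i , e , sim = M.complete V V-down ns as ¬s ch has stops v z in
                            _ , mem i , sim , N.has-entry ns bs i has′ e)
                (λ _ v z → let i , e , sim = N.complete V V-down ns bs ¬s′ ch′ has′ stops′ v z in
                            _ , mem i , sim , M.has-entry ns as i has e)
                (gr (rich (ready+ (suc (length ns)) rd) (labels ns) v) (λ i → State.grx st′ (mem i))
                    (λ i → let q , j , eq = ∈-map⁻ proj₂ i in subst (Gr _) (sym eq) (State.gry st′ j)))) ,
            (y , y′) , here refl , M.~-refl
          where
            +-suc² : ∀ k → k + suc (suc r) ≡ suc (suc (k + r))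
            +-suc² k = trans (+-suc k (suc r)) (cong suc (+-suc k r))
            -- The axiom stops the row only at `n`. A visible level of the head of `bs` is also one
            -- of the head of `as`, and therefore equals `n`.
            stops′ : N.Stops V V-down y′ ns bs
            stops′ m vm l x z with only m (from (State.level st′ (head∈ as bs mem) m (V-down (<⇒≤ (a<▹ (labels ns) m)) vm)) l)
            ... | refl = stop′ l x z

      addRow : ∀ {r xs ys ws} → State r xs ys ws → Ready r → Tails xs → ∀ y → RowResult r xs ys ws y
      addRow {r} {xs} {ys} st rd tl y with em (∃[ q ] q ∈ ys × proj₁ q M.~ y)
      ... | yes q = xs , ys , id , regrade (gr+ (suc (suc K))) st , q
      ... | no old with em (M.Star y)
      ...   | yes s = addStar st (λ i e → old (_ , i , M.~-sym e)) s
      ...   | no ¬s with M.contents V V-down ¬s wf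
      ...     | inj₁ none = addEmpty st (λ i e → old (_ , i , M.~-sym e)) ¬s none
      ...     | inj₂ full = addFull st (λ i e → old (_ , i , M.~-sym e)) rd tl ¬s full

      stateLeaf : ∀ {r xs ys ws w w′} → State r xs ys ws →
                  (∃[ q ] q ∈ xs × proj₁ q M.∼ w × proj₂ q N.∼ w′) → (∃[ q ] q ∈ ys × proj₁ q M.~ w × proj₂ q N.~ w′) →
                  (∀ {p} → p ∈ ws → (w ≡ proj₁ p) ⇔ (w′ ≡ proj₂ p)) → Gr (suc r) w′ →
                  State (suc r) xs ys ((w , w′) ∷ ws)
      stateLeaf st pt rw eqs gr = record
        { points = points ; rows = rows ; stars = stars ; sizes→ = sizes→ ; sizes← = sizes←
        ; pointOf = λ { (here refl) → pt ; (there i) → pointOf i }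
        ; rowOf = λ { (here refl) → rw ; (there i) → rowOf i }
        ; exactly = λ { (here refl) (here refl) → mk⇔ (λ _ → refl) (λ _ → refl)
                    ; (here refl) (there j) → eqs j
                    ; (there i) (here refl) → mk⇔ (sym ∘ to (eqs i) ∘ sym) (sym ∘ from (eqs i) ∘ sym)
                    ; (there i) (there j) → exactly i j }
        ; grx = N.gr-suc ∘ grx ; gry = N.gr-suc ∘ gry
        ; grw = λ { (here refl) → gr ; (there i) → N.gr-suc (grw i) } }
        where open State st

      -- An element of the corresponding cell that has not been played serves as response. If there
      -- is none, then the cell of `N` is exhausted by played elements; its size is small enough to
      -- be visible, and `count` contradicts `sameSize`.
      addLeaf : ∀ {r xs ys ws w q q′} → State r xs ys ws → (∀ c → c < length ws → V c) →
                q ∈ xs → proj₁ q M.∼ w → q′ ∈ ys → proj₁ q′ M.~ w →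
                ∃[ w′ ] State (suc r) xs ys ((w , w′) ∷ ws)
      addLeaf {r} {xs} {ys} {ws} {w} {x , x′} {y , y′} st few i x∼w j y~w with em (∃[ p ] p ∈ ws × w ≡ proj₁ p)
      ... | yes ((_ , w′) , k , refl) = w′ , stateLeaf st (State.pointOf st k) (State.rowOf st k)
                                                (λ l → State.exactly st k l) (N.gr-suc (State.grw st k))
      ... | no new with em (∃[ u ] N.Cell y′ x′ u × NotIn u (List.map proj₂ ws))
      ...   | yes (_ , c , u∉) =
        let w′ , (~y′ , ∼x′) , w′∉ , gr = N.fresh c u∉ in
        w′ , stateLeaf st (_ , i , x∼w , N.∼-sym ∼x′) (_ , j , y~w , N.~-sym ~y′)
               (λ k → mk⇔ (λ eq → ⊥-elim (new (_ , k , eq))) (λ eq → ⊥-elim (NotIn-∈ w′∉ (∈-map⁺ proj₂ k) eq)))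
               (gr (State.gry st j) (State.grx st i)
                   (λ l → let q , k , eq = ∈-map⁻ proj₂ l in subst (Gr r) (sym eq) (State.grw st k)))
      ...   | no full = ⊥-elim (absurd (count {P = M.Cell y x} {Q = N.Cell y′ x′} {w} ws {[]} {[]}
                (λ k → mk⇔ (λ (c , t) → to (cells k) c , t) (λ (c , t) → from (cells k) c , t))
                (State.exactly st) cover (M.~-sym y~w , M.∼-sym x∼w) tt (λ k eq → new (_ , k , eq))))
        where
          open State st
          cells : ∀ {p} → p ∈ ws → M.Cell y x (proj₁ p) ⇔ N.Cell y′ x′ (proj₂ p)
          cells k = let q , a , b , c = rowOf k ; q′ , a′ , b′ , c′ = pointOf k in mk⇔
            (λ (e , s) → N.~-trans (N.~-sym c) (to (rows a j) (M.~-trans b e)) ,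
                         N.∼-trans (N.∼-sym c′) (to (order∼ a′ i) (M.∼-trans b′ s)))
            (λ (e , s) → M.~-trans (M.~-sym b) (from (rows a j) (N.~-trans c e)) ,
                         M.∼-trans (M.∼-sym b′) (from (order∼ a′ i) (N.∼-trans c′ s)))
          cover : ∀ z → N.Cell y′ x′ z → ⊤ → ∃[ p ] p ∈ ws × proj₂ p ≡ z
          cover z c _ with em (∃[ p ] p ∈ ws × proj₂ p ≡ z)
          ... | yes q = q
          ... | no ¬q = ⊥-elim (full (z , c , NotIn-map λ l eq →
                  let q , k , eq′ = ∈-map⁻ proj₂ l in ¬q (q , k , sym (trans eq eq′))))
          absurd : ¬ (∃[ k ] k ≤ length ws × Exact (N.Cell y′ x′) k [] × ¬ Exact (M.Cell y x) k [])
          -- No cell is empty.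
          absurd (zero , _ , E , _) = let u , c = N.cell y′ x′ in E u c tt
          -- A cell of `suc k` elements has index `k`, which is less than the number of elements
          -- played.
          absurd (suc k , le , E , ¬F) = ¬F (from (sameSize j i (few k le)) E)

      -- The point of `w` takes one stage, its row `K + 2` stages and `w` itself one more.
      addElement : ∀ {r xs ys ws} → State r xs ys ws → Ready r → Tails xs → (∀ c → c < length ws → V c) → ∀ w →
                   ∃[ xs′ ] ∃[ ys′ ] ∃[ w′ ] xs ⊆ xs′ × State (suc (suc (suc K) + suc r)) xs′ ys′ ((w , w′) ∷ ws)
      addElement st rd tl few w with addPoint (State.points st) (State.grx st) (rich rd) (tl id rd) w
      ... | x′ , g , pts with addRow (statePoint st pts g) (ready-suc rd) (λ sub → tl (sub ∘ there)) w
      ...   | xs′ , ys′ , sub , st′ , q , j , e with addLeaf st′ few (sub (here refl)) M.∼-refl j e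
      ...     | w′ , st″ = xs′ , ys′ , w′ , sub ∘ there , st″

-- Bounded games and elementary equivalence.

module Games where

  open Arithmetic
  open Structures
  open Steps
  open Responses

  private
    variable
      n : ℕ

  Axioms′ : (ℕ → ℕ) → Structure L₃ → Set
  Axioms′ S M = Axioms S M (λ _ _ → ⊤) (λ _ _ → ⊤)

  forget : ∀ {S M Gr Sm} → Axioms S M Gr Sm → Axioms′ S M
  forget ax = record
    { gr-suc = λ _ → tt ; total = total ; ≲-trans = ≲-trans ; ~-refl = ~-refl ; ~-sym = ~-sym
    ; ~-trans = ~-trans ; star-resp = star-resp ; star-unique = star-unique
    ; star = let p , s , _ = star in p , s , λ _ → tt
    ; cell = cell
    ; fresh = λ c us → let u , c′ , u∉ , _ = fresh c us in u , c′ , u∉ , λ _ _ _ → tt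
    ; dense = λ lt → let c , l , r , _ = dense lt in c , l , r , λ _ _ → tt
    ; above = λ a → let b , lt , _ = above a in b , lt , λ _ → tt
    ; lv-mono = lv-mono
    ; lv-exists = λ n → let a , l , _ = lv-exists n in a , l , λ _ → tt
    ; lv-below = λ l → let b , lt , l′ , _ = lv-below l in b , lt , l′ , λ _ → tt
    ; lv-above = λ l → let b , lt , l′ , _ = lv-above l in b , lt , l′ , λ _ → tt
    ; sz-unique = sz-unique ; sz-parent = sz-parent ; sz-good = sz-good
    ; sz-graded = λ ¬s z → let x , sim , _ = sz-graded ¬s z in x , sim , λ _ → tt
    ; row = λ ns xs n ys g ch → let y , a , b , c , d , _ = row ns xs n ys g ch in y , a , b , c , d , λ _ _ _ → tt
    ; emptyRow = λ ys → let y , a , b , c , _ = emptyRow ys in y , a , b , c , λ _ → tt }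
    where open Axioms ax

  flipped : ∀ {A B : Set} → List (A × B) → List (B × A)
  flipped = List.map swap

  ∈-flipped : ∀ {A B : Set} {xs : List (A × B)} {p} → p ∈ flipped xs → swap p ∈ xs
  ∈-flipped i with ∈-map⁻ swap i
  ... | q , j , refl = j

  flipped-∈ : ∀ {A B : Set} {xs : List (A × B)} {p} → p ∈ xs → swap p ∈ flipped xs
  flipped-∈ = ∈-map⁺ swap

  module _ (cl : Classical) {S : ℕ → ℕ} {M N : Structure L₃} {V : ℕ → Set} (V-down : ∀ {m n} → m ≤ n → V n → V m) where

    module _ {GrM SmM Gr Sm GrM′ SmM′ Gr′ Sm′} (axM : Axioms S M GrM SmM) (axN : Axioms S N Gr Sm)
             (axN′ : Axioms S N GrM′ SmM′) (axM′ : Axioms S M Gr′ Sm′) where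
      private
        module G = Game cl axM axN V V-down
        module G′ = Game cl axN′ axM′ V V-down

      flip : ∀ {r r′ xs ys ws} → (∀ a → Gr′ r′ a) → G.State r xs ys ws → G′.State r′ (flipped xs) (flipped ys) (flipped ws)
      flip gr st = record
        { points = record
          { order = λ i j → ⇔-sym (order (∈-flipped i) (∈-flipped j))
          ; level = λ i n v → ⇔-sym (level (∈-flipped i) n v) }
        ; rows = λ i j → ⇔-sym (rows (∈-flipped i) (∈-flipped j))
        ; stars = λ i → ⇔-sym (stars (∈-flipped i))
        ; sizes→ = λ i s v z → let q , j , a , b = sizes← (∈-flipped i) s v z in swap q , flipped-∈ j , a , b
        ; sizes← = λ i s v z → let q , j , a , b = sizes→ (∈-flipped i) s v z in swap q , flipped-∈ j , a , b
        ; pointOf = λ i → let q , j , a , b = pointOf (∈-flipped i) in swap q , flipped-∈ j , b , a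
        ; rowOf = λ i → let q , j , a , b = rowOf (∈-flipped i) in swap q , flipped-∈ j , b , a
        ; exactly = λ i j → ⇔-sym (exactly (∈-flipped i) (∈-flipped j))
        ; grx = λ _ → gr _ ; gry = λ _ → gr _ ; grw = λ _ → gr _ }
        where open G.State st

    module _ {GrM SmM Gr Sm} (axM : Axioms S M GrM SmM) (axN : Axioms S N Gr Sm) where
      private
        module G = Game cl axM axN V V-down
        module G′ = Game cl (forget axM) (forget axN) V V-down

      ungrade : ∀ {r r′ xs ys ws} → G.State r xs ys ws → G′.State r′ xs ys ws
      ungrade st = record
        { points = record { order = order ; level = level }
        ; rows = rows ; stars = stars ; sizes→ = sizes→ ; sizes← = sizes← ; pointOf = pointOf ; rowOf = rowOf
        ; exactly = exactly ; grx = λ _ → tt ; gry = λ _ → tt ; grw = λ _ → tt }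
        where open G.State st

  pairUp : {A B : Set} → Vec A n → Vec B n → List (A × B)
  pairUp []       []       = []
  pairUp (a ∷ as) (b ∷ bs) = (a , b) ∷ pairUp as bs

  length-pairUp : {A B : Set} (as : Vec A n) (bs : Vec B n) → length (pairUp as bs) ≡ n
  length-pairUp []       []       = refl
  length-pairUp (a ∷ as) (b ∷ bs) = cong suc (length-pairUp as bs)

  ∈-pairUp : {A B : Set} (as : Vec A n) (bs : Vec B n) → ∀ i → (lookup as i , lookup bs i) ∈ pairUp as bs
  ∈-pairUp (a ∷ as) (b ∷ bs) zero    = here refl
  ∈-pairUp (a ∷ as) (b ∷ bs) (suc i) = there (∈-pairUp as bs i)

  flipped-pairUp : {A B : Set} (as : Vec A n) (bs : Vec B n) → flipped (pairUp as bs) ≡ pairUp bs as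
  flipped-pairUp []       []       = refl
  flipped-pairUp (a ∷ as) (b ∷ bs) = cong (_ ∷_) (flipped-pairUp as bs)

  index : Term L₃ n → Fin n
  index (var i)    = i
  index (app () _)

  eval-index : ∀ (M : Structure L₃) (ρ : Vec (Structure.Carrier M) n) t → eval M ρ t ≡ lookup ρ (index t)
  eval-index M ρ (var i)    = refl
  eval-index M ρ (app () _)

  depth : Formula L₃ n → ℕ
  depth (_ ≈̇ _)   = 0
  depth (rel _ _) = 0
  depth (¬̇ α)     = depth α
  depth (α ∧̇ β)   = depth α ⊔ depth β
  depth (α ∨̇ β)   = depth α ⊔ depth β
  depth (α ⇒̇ β)   = depth α ⊔ depth β
  depth (∀̇ α)     = suc (depth α)
  depth (∃̇ α)     = suc (depth α)

  -- With only the numbers below `C` visible, the tree is cut down to finitely many nodes, and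
  -- points of infinite level look like those of level `C` or more.
  module Bounded (cl : Classical) {S : ℕ → ℕ} {M N : Structure L₃} {GrM SmM Gr Sm}
                 (axM : Axioms S M GrM SmM) (axN : Axioms S N Gr Sm)
                 (sm-suc : ∀ {r n} → Sm r n → Sm (suc r) n) (C : ℕ) where
    open Classical cl
    private
      module M where
        open Str M public
        open Theory cl axM public
      module N where
        open Str N public
        open Axioms axN public
        open Theory cl axN public

    V : ℕ → Set
    V = _< C

    V-down : ∀ {m n} → m ≤ n → V n → V m
    V-down = ≤-<-trans

    open Step cl axM axN V V-down
    open Game cl axM axN V V-down

    -- `C` itself is included because points of level `C` represent those above the visible levels.
    Ready : ℕ → Set
    Ready r = ∀ n → n ≤ C → Sm r n

    -- Children have larger codes, and visible codes stay below `C`.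
    wf : ∀ c → Acc (M._⊏_ V V-down) c
    wf c = go (C ∸ c) c ≤-refl
      where
        go : ∀ k c → C ∸ c ≤ k → Acc (M._⊏_ V V-down) c
        go k c le = acc λ { (n , refl , lt , _) → next k n le lt }
          where
            next : ∀ k n → C ∸ c ≤ k → c ▹ n < C → Acc (M._⊏_ V V-down) (c ▹ n)
            next zero    n le lt = ⊥-elim (<⇒≱ (m<n⇒0<n∸m (<-trans (s<▹ c n) lt)) le)
            next (suc k) n le lt = go k (c ▹ n) (s≤s⁻¹ (≤-trans (∸-monoʳ-< (s<▹ c n) (<⇒≤ lt)) le))

    -- Seen from below `C`, the invisible part begins with the points of level `C`. These have no
    -- least one, and all other invisible points lie above them; so the shape of the part of
    -- infinite level is hidden.
    tails : ∀ {xs r} → Ready r → Tail xs r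
    tails {r = r} rd _ = inj₂ ((let a , l , gr = N.lv-exists C in a , bigC l , gr (rd C ≤-refl)) , below)
      where
        bigC : ∀ {a} → N.Lv a C → N.Big V a
        bigC l n n<C l′ = <⇒≢ n<C (N.lv-functional l′ l)
        below : ∀ {b} → N.Big V b → ∃[ b′ ] N.Big V b′ × b′ N.≺ b × (Gr r b → Gr (suc r) b′)
        below {b} bb with em (N.Lv b C)
        ... | yes l = let b′ , lt , l′ , gr = N.lv-below l in b′ , bigC l′ , lt , gr
        ... | no ¬l = let z , l , gr = N.lv-exists C in z , bigC l , z≺b l , λ _ → gr (rd C ≤-refl)
          where
            z≺b : ∀ {z} → N.Lv z C → z N.≺ b
            z≺b l b≲z with N.lv-mono b≲z l
            ... | m , m≤C , l′ with m≤n⇒m<n∨m≡n m≤C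
            ...   | inj₁ m<C  = bb m m<C l′
            ...   | inj₂ refl = ¬l l′

    shift : ∀ ns → V (labels ns) → ∀ r → (C ∸ length ns) + (length ns + r) ≡ C + r
    shift ns v r = trans (sym (+-assoc (C ∸ length ns) (length ns) r))
      (cong (_+ r) (m∸n+n≡m (≤-trans (length≤labels ns) (<⇒≤ v))))

    open Moves Ready (λ rd n le → sm-suc (rd n le)) (λ rd n n<C → rd n (<⇒≤ n<C)) (wf 0)
               C (λ ns v {r} {a} g → subst (λ k → Gr k a) (shift ns v r) (gr+ (C ∸ length ns) g)) public

    move : ∀ {r xs ys ws} → State r xs ys ws → Ready r → length ws ≤ C → ∀ w →
           ∃[ xs′ ] ∃[ ys′ ] ∃[ w′ ] State (suc (suc (suc C) + suc r)) xs′ ys′ ((w , w′) ∷ ws)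
    move st rd le w = let xs′ , ys′ , w′ , _ , st′ = addElement st rd (λ _ → tails) (λ c lt → <-≤-trans lt le) w
                      in xs′ , ys′ , w′ , st′

  module Equivalent (cl : Classical) {S : ℕ → ℕ} {M N : Structure L₃}
                    (axM : Axioms′ S M) (axN : Axioms′ S N) (C : ℕ) where
    private
      module F = Bounded cl axM axN (λ _ → tt) C
      module B = Bounded cl axN axM (λ _ → tt) C
      module G = Game cl axM axN F.V F.V-down

    Matched : Vec (Structure.Carrier M) n → Vec (Structure.Carrier N) n → Set
    Matched ρ ρ′ = ∃[ xs ] ∃[ ys ] G.State 0 xs ys (pairUp ρ ρ′)

    forth : ∀ {ρ : Vec _ n} {ρ′} → n ≤ C → Matched ρ ρ′ → ∀ a → ∃[ b ] Matched (a ∷ ρ) (b ∷ ρ′)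
    forth {ρ = ρ} {ρ′} le (xs , ys , st) a =
      let xs′ , ys′ , b , st′ = F.move st (λ _ _ → tt) (subst (_≤ C) (sym (length-pairUp ρ ρ′)) le) a
      in b , xs′ , ys′ , G.regrade id st′

    back : ∀ {ρ : Vec _ n} {ρ′} → n ≤ C → Matched ρ ρ′ → ∀ b → ∃[ a ] Matched (a ∷ ρ) (b ∷ ρ′)
    back {ρ = ρ} {ρ′} le (xs , ys , st) b =
      let xs′ , ys′ , a , st′ = B.move (subst (λ ws → Game.State cl axN axM F.V F.V-down 0 _ _ ws) (flipped-pairUp ρ ρ′)
                                         (flip cl F.V-down axM axN axN axM (λ _ → tt) st))
                                       (λ _ _ → tt) (subst (_≤ C) (sym (length-pairUp ρ′ ρ)) le) b
      in a , flipped xs′ , flipped ys′ ,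
         subst (G.State 0 (flipped xs′) (flipped ys′)) (flipped-pairUp (b ∷ ρ′) (a ∷ ρ))
           (flip cl F.V-down axN axM axM axN (λ _ → tt) st′)

    -- Each quantifier is one move. `C` has to bound the total number of elements played, since that
    -- many elements can exhaust a cell and so reveal its size.
    agree : ∀ (φ : Formula L₃ n) ρ ρ′ → n + depth φ ≤ C → Matched ρ ρ′ → (M ⊨ φ [ ρ ]) ⇔ (N ⊨ φ [ ρ′ ])
    agree (s ≈̇ t) ρ ρ′ le (_ , _ , st)
      rewrite eval-index M ρ s | eval-index M ρ t | eval-index N ρ′ s | eval-index N ρ′ t =
      G.State.exactly st (∈-pairUp ρ ρ′ (index s)) (∈-pairUp ρ ρ′ (index t))
    agree (rel 0F (s ∷ t ∷ [])) ρ ρ′ le (_ , _ , st)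
      rewrite eval-index M ρ s | eval-index M ρ t | eval-index N ρ′ s | eval-index N ρ′ t =
      G.State.≲-agree st (∈-pairUp ρ ρ′ (index s)) (∈-pairUp ρ ρ′ (index t))
    agree (rel 1F (s ∷ t ∷ [])) ρ ρ′ le (_ , _ , st)
      rewrite eval-index M ρ s | eval-index M ρ t | eval-index N ρ′ s | eval-index N ρ′ t =
      G.State.~-agree st (∈-pairUp ρ ρ′ (index s)) (∈-pairUp ρ ρ′ (index t))
    agree (rel 2F (s ∷ [])) ρ ρ′ le (_ , _ , st)
      rewrite eval-index M ρ s | eval-index N ρ′ s =
      G.State.star-agree st (∈-pairUp ρ ρ′ (index s))
    agree (¬̇ α) ρ ρ′ le m = ¬-⇔ (agree α ρ ρ′ le m)
    agree {n} (α ∧̇ β) ρ ρ′ le m =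
      let e = agree α ρ ρ′ (≤-trans (+-monoʳ-≤ n (m≤m⊔n _ _)) le) m
          f = agree β ρ ρ′ (≤-trans (+-monoʳ-≤ n (m≤n⊔m (depth α) _)) le) m
      in mk⇔ (λ (a , b) → to e a , to f b) (λ (a , b) → from e a , from f b)
    agree {n} (α ∨̇ β) ρ ρ′ le m =
      let e = agree α ρ ρ′ (≤-trans (+-monoʳ-≤ n (m≤m⊔n _ _)) le) m
          f = agree β ρ ρ′ (≤-trans (+-monoʳ-≤ n (m≤n⊔m (depth α) _)) le) m
      in mk⇔ (λ { (inj₁ a) → inj₁ (to e a) ; (inj₂ b) → inj₂ (to f b) })
             (λ { (inj₁ a) → inj₁ (from e a) ; (inj₂ b) → inj₂ (from f b) })
    agree {n} (α ⇒̇ β) ρ ρ′ le m =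
      let e = agree α ρ ρ′ (≤-trans (+-monoʳ-≤ n (m≤m⊔n _ _)) le) m
          f = agree β ρ ρ′ (≤-trans (+-monoʳ-≤ n (m≤n⊔m (depth α) _)) le) m
      in mk⇔ (λ g a → to f (g (from e a))) (λ g a → from f (g (to e a)))
    agree {n} (∀̇ α) ρ ρ′ le m = mk⇔
      (λ f b → let a , m′ = back n≤ m b in to (agree α _ _ le′ m′) (f a))
      (λ f a → let b , m′ = forth n≤ m a in from (agree α _ _ le′ m′) (f b))
      where
        n≤ = ≤-trans (m≤m+n n _) le
        le′ = subst (_≤ C) (+-suc n (depth α)) le
    agree {n} (∃̇ α) ρ ρ′ le m = mk⇔
      (λ (a , t) → let b , m′ = forth n≤ m a in b , to (agree α _ _ le′ m′) t)
      (λ (b , t) → let a , m′ = back n≤ m b in a , from (agree α _ _ le′ m′) t)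
      where
        n≤ = ≤-trans (m≤m+n n _) le
        le′ = subst (_≤ C) (+-suc n (depth α)) le

    start : Matched [] []
    start = [] , [] , record
      { points = record { order = λ () ; level = λ () }
      ; rows = λ () ; stars = λ () ; sizes→ = λ () ; sizes← = λ () ; pointOf = λ () ; rowOf = λ ()
      ; exactly = λ () ; grx = λ () ; gry = λ () ; grw = λ () }

  elementarilyEquivalent : Classical → ∀ {S M N} → Axioms′ S M → Axioms′ S N → ∀ σ → (M ⊨ σ) ⇔ (N ⊨ σ)
  elementarilyEquivalent cl axM axN σ =
    Equivalent.agree cl axM axN (depth σ) σ [] [] ≤-refl (Equivalent.start cl axM axN (depth σ))

-- The axioms as first-order sentences.

module Definability where

  open Arithmetic
  open Structures
  open Steps
  open Games

  private
    variable
      n k : ℕ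

  Env : Structure L₃ → ℕ → Set
  Env M n = Vec (Structure.Carrier M) n

  record Definable {n : ℕ} (P : (M : Structure L₃) → Env M n → Set) : Set₁ where
    field
      formula : Formula L₃ n
      meaning : ∀ M ρ → (M ⊨ formula [ ρ ]) ⇔ P M ρ

  open Definable

  private
    variable
      P Q : (M : Structure L₃) → Env M n → Set

  iffD : (∀ M ρ → P M ρ ⇔ Q M ρ) → Definable P → Definable Q
  iffD e D = record { formula = formula D ; meaning = λ M ρ → ⇔-trans (meaning D M ρ) (e M ρ) }

  ≡⇒⇔ : {A B : Set} → A ≡ B → A ⇔ B
  ≡⇒⇔ refl = ⇔-refl

  infixr 4 _⇒D_
  infixr 5 _⊎D_
  infixr 6 _×D_

  _×D_ : Definable P → Definable Q → Definable (λ M ρ → P M ρ × Q M ρ)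
  D ×D E = record
    { formula = formula D ∧̇ formula E
    ; meaning = λ M ρ → mk⇔ (λ (a , b) → to (meaning D M ρ) a , to (meaning E M ρ) b)
                            (λ (a , b) → from (meaning D M ρ) a , from (meaning E M ρ) b) }

  _⊎D_ : Definable P → Definable Q → Definable (λ M ρ → P M ρ ⊎ Q M ρ)
  D ⊎D E = record
    { formula = formula D ∨̇ formula E
    ; meaning = λ M ρ → mk⇔ (λ { (inj₁ a) → inj₁ (to (meaning D M ρ) a) ; (inj₂ b) → inj₂ (to (meaning E M ρ) b) })
                            (λ { (inj₁ a) → inj₁ (from (meaning D M ρ) a) ; (inj₂ b) → inj₂ (from (meaning E M ρ) b) }) }

  _⇒D_ : Definable P → Definable Q → Definable (λ M ρ → P M ρ → Q M ρ)
  D ⇒D E = record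
    { formula = formula D ⇒̇ formula E
    ; meaning = λ M ρ → mk⇔ (λ f a → to (meaning E M ρ) (f (from (meaning D M ρ) a)))
                            (λ f a → from (meaning E M ρ) (f (to (meaning D M ρ) a))) }

  ¬D_ : Definable P → Definable (λ M ρ → ¬ P M ρ)
  ¬D D = record { formula = ¬̇ formula D ; meaning = λ M ρ → ¬-⇔ (meaning D M ρ) }

  ∀D_ : {P : (M : Structure L₃) → Env M (suc n) → Set} → Definable P → Definable (λ M ρ → ∀ a → P M (a ∷ ρ))
  ∀D D = record
    { formula = ∀̇ formula D
    ; meaning = λ M ρ → mk⇔ (λ f a → to (meaning D M (a ∷ ρ)) (f a)) (λ f a → from (meaning D M (a ∷ ρ)) (f a)) }

  ∃D_ : {P : (M : Structure L₃) → Env M (suc n) → Set} → Definable P → Definable (λ M ρ → ∃[ a ] P M (a ∷ ρ))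
  ∃D D = record
    { formula = ∃̇ formula D
    ; meaning = λ M ρ → mk⇔ (λ (a , p) → a , to (meaning D M (a ∷ ρ)) p) (λ (a , p) → a , from (meaning D M (a ∷ ρ)) p) }

  ∀ⁿD : ∀ k {n} {P : (M : Structure L₃) → Env M (k + n) → Set} → Definable P →
        Definable (λ M ρ → ∀ (xs : Env M k) → P M (xs ++ ρ))
  ∀ⁿD zero    D = iffD (λ M ρ → mk⇔ (λ { p [] → p }) (λ f → f [])) D
  ∀ⁿD (suc k) D = iffD (λ M ρ → mk⇔ (λ { f (x ∷ xs) → f xs x }) (λ f xs x → f (x ∷ xs))) (∀ⁿD k (∀D D))

  -- Made for `sz-good`: if `c` is not a node, the axiom thereby says that no row but the star row
  -- has a cell of index `c`.
  constD : {A : Set} → Dec A → Definable {suc n} (λ _ _ → A)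
  constD (yes a) = record { formula = var zero ≈̇ var zero ; meaning = λ M ρ → mk⇔ (λ _ → a) (λ _ → refl) }
  constD (no ¬a) = record { formula = ¬̇ (var zero ≈̇ var zero) ; meaning = λ M ρ → mk⇔ (λ f → ⊥-elim (f refl)) (λ a → ⊥-elim (¬a a)) }

  ≲D : (i j : Fin n) → Definable (λ M ρ → Str._≲_ M (lookup ρ i) (lookup ρ j))
  ≲D i j = record { formula = rel 0F (var i ∷ var j ∷ []) ; meaning = λ M ρ → ⇔-refl }

  ~D : (i j : Fin n) → Definable (λ M ρ → Str._~_ M (lookup ρ i) (lookup ρ j))
  ~D i j = record { formula = rel 1F (var i ∷ var j ∷ []) ; meaning = λ M ρ → ⇔-refl }

  starD : (i : Fin n) → Definable (λ M ρ → Str.Star M (lookup ρ i))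
  starD i = record { formula = rel 2F (var i ∷ []) ; meaning = λ M ρ → ⇔-refl }

  ≡D : (i j : Fin n) → Definable (λ M ρ → lookup ρ i ≡ lookup ρ j)
  ≡D i j = record { formula = var i ≈̇ var j ; meaning = λ M ρ → ⇔-refl }

  ∼D : (i j : Fin n) → Definable (λ M ρ → Str._∼_ M (lookup ρ i) (lookup ρ j))
  ∼D i j = ≲D i j ×D ≲D j i

  ≺D : (i j : Fin n) → Definable (λ M ρ → Str._≺_ M (lookup ρ i) (lookup ρ j))
  ≺D i j = ¬D ≲D j i

  cellD : (y x w : Fin n) → Definable (λ M ρ → Str.Cell M (lookup ρ y) (lookup ρ x) (lookup ρ w))
  cellD y x w = ~D w y ×D ∼D w x

  trueD : Fin n → Definable {n} (λ _ _ → ⊤)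
  trueD i = record { formula = var i ≈̇ var i ; meaning = λ M ρ → mk⇔ (λ _ → tt) (λ _ → refl) }

  notInD : (w : Fin n) (es : List (Fin n)) → Definable (λ M ρ → NotIn (lookup ρ w) (List.map (lookup ρ) es))
  notInD w []       = trueD w
  notInD w (e ∷ es) = (¬D ≡D w e) ×D notInD w es

  freshD : (es : List (Fin n)) → Definable {suc n} (λ M ρ → NotIn (hd ρ) (List.map (lookup (Vec.tail ρ)) es))
  freshD es = iffD (λ { M (a ∷ ρ) → ≡⇒⇔ (cong (NotIn a) (sym (List.map-∘ es))) }) (notInD 0F (List.map suc es))

  exactD : ∀ k (y x : Fin n) (es : List (Fin n)) →
           Definable (λ M ρ → Exact (Str.Cell M (lookup ρ y) (lookup ρ x)) k (List.map (lookup ρ) es))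
  exactD zero    y x es = ∀D (cellD (suc y) (suc x) 0F ⇒D ¬D freshD es)
  exactD (suc k) y x es = ∃D (cellD (suc y) (suc x) 0F ×D freshD es ×D iffD shift (exactD k (suc y) (suc x) (0F ∷ List.map suc es)))
    where
      shift : ∀ M (ρ : Env M _) → _ ⇔ Exact (Str.Cell M (lookup ρ (suc y)) (lookup ρ (suc x))) k (hd ρ ∷ List.map (lookup (Vec.tail ρ)) es)
      shift M (a ∷ ρ) = ≡⇒⇔ (cong (λ es → Exact (Str.Cell M (lookup ρ y) (lookup ρ x)) k (a ∷ es)) (sym (List.map-∘ es)))

  szD : ∀ (y x : Fin n) c → Definable (λ M ρ → Str.Sz M (lookup ρ y) (lookup ρ x) c)
  szD y x c = exactD (suc c) y x []

  lvD : ∀ (x : Fin n) m → Definable (λ M ρ → Str.Lv M (lookup ρ x) m)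
  lvD x m = ∃D (starD 0F ×D szD 0F (suc x) m)

  notSimD : ∀ (x : Fin n) (is : Vec (Fin n) k) → Definable (λ M ρ → Str.NotSim M (lookup ρ x) (Vec.map (lookup ρ) is))
  notSimD x []       = trueD x
  notSimD x (i ∷ is) = (¬D ∼D x i) ×D notSimD x is

  notRowD : ∀ (y : Fin n) (is : Vec (Fin n) k) → Definable (λ M ρ → Str.NotRow M (lookup ρ y) (toList (Vec.map (lookup ρ) is)))
  notRowD y []       = trueD y
  notRowD y (i ∷ is) = (¬D ~D y i) ×D notRowD y is

  hd-map : {A B : Set} (f : A → B) (xs : Vec A (suc n)) → f (hd xs) ≡ hd (Vec.map f xs)
  hd-map f (x ∷ xs) = refl

  chainD : ∀ ns (is : Vec (Fin n) (suc (length ns))) → Definable (λ M ρ → Str.Chain M ns (Vec.map (lookup ρ) is))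
  chainD []       is       = trueD (hd is)
  chainD (m ∷ ns) (i ∷ is) = chainD ns is ×D
    iffD (λ M ρ → ≡⇒⇔ (cong (λ x → Str.Lv M x m) (hd-map (lookup ρ) is))) (lvD (hd is) m) ×D notSimD i is

  hasD : ∀ (y : Fin n) ns (is : Vec (Fin n) (suc (length ns))) → Definable (λ M ρ → Str.Has M (lookup ρ y) ns (Vec.map (lookup ρ) is))
  hasD y []       (i ∷ is) = szD y i 0
  hasD y (m ∷ ns) (i ∷ is) = szD y i (labels (m ∷ ns)) ×D hasD y ns is

  -- Numbers are not elements of the structure, so the bounded search for a level in `lv-mono` is
  -- spelt out as a finite disjunction.
  Upto : (M : Structure L₃) → Structure.Carrier M → ℕ → Set
  Upto M a zero    = Str.Lv M a 0
  Upto M a (suc n) = Str.Lv M a (suc n) ⊎ Upto M a n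

  uptoD : ∀ (x : Fin n) m → Definable (λ M ρ → Upto M (lookup ρ x) m)
  uptoD x zero    = lvD x 0
  uptoD x (suc m) = lvD x (suc m) ⊎D uptoD x m

  upto⇔ : ∀ M a n → Upto M a n ⇔ (∃[ m ] m ≤ n × Str.Lv M a m)
  upto⇔ M a zero    = mk⇔ (λ l → 0 , z≤n , l) (λ { (zero , _ , l) → l })
  upto⇔ M a (suc n) = mk⇔
    (λ { (inj₁ l) → suc n , ≤-refl , l ; (inj₂ u) → let m , le , l = to (upto⇔ M a n) u in m , m≤n⇒m≤1+n le , l })
    (λ (m , le , l) → split m le l)
    where
      split : ∀ m → m ≤ suc n → Str.Lv M a m → Upto M a (suc n)
      split m le l with m≤n⇒m<n∨m≡n le
      ... | inj₁ lt   = inj₂ (from (upto⇔ M a n) (m , s≤s⁻¹ lt , l))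
      ... | inj₂ refl = inj₁ l

  RowAxiom : (ns : List ℕ) → ℕ → (M : Structure L₃) → Vec (Structure.Carrier M) (suc (length ns)) → List (Structure.Carrier M) → Set
  RowAxiom ns n M xs ys = Chain ns xs →
    ∃[ y ] ¬ Star y × NotRow y ys × Has y ns xs × (Lv (hd xs) n → ∀ x → ¬ Sz y x (labels ns ▹ n))
    where open Str M

  module _ (ns : List ℕ) (m : ℕ) where
    private
      N : ℕ
      N = suc (length ns)

    rowBodyD : (is : Vec (Fin n) N) (js : Vec (Fin n) k) →
               Definable (λ M ρ → RowAxiom ns m M (Vec.map (lookup ρ) is) (toList (Vec.map (lookup ρ) js)))
    rowBodyD {n} is js = chainD ns is ⇒D ∃D (¬D starD 0F ×D
        iffD notRow (notRowD 0F (Vec.map suc js)) ×D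
        iffD has (hasD 0F ns (Vec.map suc is)) ×D
        (iffD hdLv (lvD (suc (hd is)) m) ⇒D ∀D (¬D szD 1F 0F (labels ns ▹ m))))
      where
        shift : ∀ M (a : Structure.Carrier M) ρ {l} (vs : Vec (Fin n) l) →
                Vec.map (lookup (a ∷ ρ)) (Vec.map suc vs) ≡ Vec.map (lookup ρ) vs
        shift M a ρ vs = sym (Vec.map-∘ (lookup (a ∷ ρ)) suc vs)
        notRow : ∀ M (ρ : Env M (suc n)) → _ ⇔ Str.NotRow M (hd ρ) (toList (Vec.map (lookup (Vec.tail ρ)) js))
        notRow M (a ∷ ρ) = ≡⇒⇔ (cong (λ vs → Str.NotRow M a (toList vs)) (shift M a ρ js))
        has : ∀ M (ρ : Env M (suc n)) → _ ⇔ Str.Has M (hd ρ) ns (Vec.map (lookup (Vec.tail ρ)) is)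
        has M (a ∷ ρ) = ≡⇒⇔ (cong (Str.Has M a ns) (shift M a ρ is))
        hdLv : ∀ M (ρ : Env M (suc n)) → _ ⇔ Str.Lv M (hd (Vec.map (lookup (Vec.tail ρ)) is)) m
        hdLv M (a ∷ ρ) = ≡⇒⇔ (cong (λ x → Str.Lv M x m) (hd-map (lookup ρ) is))

    -- The axiom `row` is a scheme: one sentence for each list of levels, each forbidden
    -- continuation and each number of rows to be avoided.
    rowD : ∀ k → Definable {0} (λ M _ → ∀ (xs : Env M N) (ys : Env M k) → RowAxiom ns m M xs (toList ys))
    rowD k = iffD reshape (∀ⁿD N (∀ⁿD k (rowBodyD (Vec.map (k ↑ʳ_) is₀) (Vec.map (_↑ˡ (N + 0)) (allFin k)))))
      where
        is₀ : Vec (Fin (N + 0)) N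
        is₀ = Vec.map (_↑ˡ 0) (allFin N)
        left : ∀ {A : Set} {a b} (xs : Vec A a) (ys : Vec A b) → Vec.map (lookup (xs ++ ys)) (Vec.map (_↑ˡ b) (allFin a)) ≡ xs
        left xs ys = trans (sym (Vec.map-∘ (lookup (xs ++ ys)) (_↑ˡ _) (allFin _)))
          (trans (Vec.map-cong (Vec.lookup-++ˡ xs ys) (allFin _)) (Vec.map-lookup-allFin xs))
        right : ∀ {A : Set} {a b l} (xs : Vec A a) (ys : Vec A b) (vs : Vec (Fin b) l) →
                Vec.map (lookup (xs ++ ys)) (Vec.map (a ↑ʳ_) vs) ≡ Vec.map (lookup ys) vs
        right xs ys vs = trans (sym (Vec.map-∘ (lookup (xs ++ ys)) _ vs)) (Vec.map-cong (Vec.lookup-++ʳ xs ys) vs)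
        reshape : ∀ M (ρ : Env M 0) → _ ⇔ (∀ (xs : Env M N) (ys : Env M k) → RowAxiom ns m M xs (toList ys))
        reshape M [] = mk⇔ (λ f xs ys → subst id (eq xs ys) (f xs ys)) (λ f xs ys → subst id (sym (eq xs ys)) (f xs ys))
          where
            eq : ∀ xs ys → _ ≡ RowAxiom ns m M xs (toList ys)
            eq xs ys = cong₂ (λ as bs → RowAxiom ns m M as (toList bs))
              (trans (right ys (xs ++ []) is₀) (left xs [])) (left ys (xs ++ []))

  emptyRowD : ∀ k → Definable {0} (λ M _ → ∀ (ys : Env M k) →
              ∃[ y ] ¬ Str.Star M y × Str.NotRow M y (toList ys) × (∀ x → ¬ Str.Sz M y x 0))
  emptyRowD k = iffD reshape (∀ⁿD k (∃D (¬D starD 0F ×D notRowD 0F (Vec.map (λ i → suc (i ↑ˡ 0)) (allFin k)) ×D ∀D (¬D szD 1F 0F 0))))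
    where
      Before : (M : Structure L₃) → Env M (k + 0) → Set
      Before M ρ = ∃[ y ] ¬ Str.Star M y ×
        Str.NotRow M y (toList (Vec.map (lookup (y ∷ ρ)) (Vec.map (λ i → suc (i ↑ˡ 0)) (allFin k)))) × (∀ x → ¬ Str.Sz M y x 0)
      After : (M : Structure L₃) → Env M k → Set
      After M ys = ∃[ y ] ¬ Str.Star M y × Str.NotRow M y (toList ys) × (∀ x → ¬ Str.Sz M y x 0)
      reshape : ∀ M (ρ : Env M 0) → (∀ (ys : Env M k) → Before M (ys ++ ρ)) ⇔
                (∀ (ys : Env M k) → After M ys)
      reshape M [] = mk⇔ (λ f ys → fwd (f ys)) (λ f ys → bwd ys (f ys))
        where
          eq : ∀ (ys : Env M k) y → Vec.map (lookup (y ∷ (ys ++ []))) (Vec.map (λ i → suc (i ↑ˡ 0)) (allFin k)) ≡ ys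
          eq ys y = trans (sym (Vec.map-∘ (lookup (y ∷ (ys ++ []))) _ (allFin k)))
            (trans (Vec.map-cong (Vec.lookup-++ˡ ys []) (allFin k)) (Vec.map-lookup-allFin ys))
          fwd : ∀ {ys} → Before M (ys ++ []) → After M ys
          fwd {ys} (y , a , b , c) = y , a , subst (λ vs → Str.NotRow M y (toList vs)) (eq ys y) b , c
          bwd : ∀ ys → After M ys → Before M (ys ++ [])
          bwd ys (y , a , b , c) = y , a , subst (λ vs → Str.NotRow M y (toList vs)) (sym (eq ys y)) b , c

  module _ {S : ℕ → ℕ} {M N : Structure L₃} {Gr Sm} (axM : Axioms S M Gr Sm)
           (M⇒N : ∀ σ → M ⊨ σ → N ⊨ σ) where
    private
      module M where
        open Structure M public
        open Str M public
        open Axioms axM public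
      module N where
        open Structure N public
        open Str N public

      transfer : ∀ {P : (M : Structure L₃) → Env M 0 → Set} → Definable P → P M [] → P N []
      transfer D p = to (meaning D N []) (M⇒N (formula D) (from (meaning D M []) p))

    -- Apart from the grades, each axiom is a family of first-order sentences with numbers as
    -- parameters, so it passes to every model of the theory of `M`.
    transferAxioms : Axioms′ S N
    transferAxioms = record
      { gr-suc = λ _ → tt
      ; total = N-total
      ; ≲-trans = λ p q → transfer (∀D ∀D ∀D (≲D 2F 1F ⇒D ≲D 1F 0F ⇒D ≲D 2F 0F)) (λ _ _ _ → M.≲-trans) _ _ _ p q
      ; ~-refl = transfer (∀D ~D 0F 0F) (λ _ → M.~-refl) _
      ; ~-sym = λ p → transfer (∀D ∀D (~D 1F 0F ⇒D ~D 0F 1F)) (λ _ _ → M.~-sym) _ _ p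
      ; ~-trans = λ p q → transfer (∀D ∀D ∀D (~D 2F 1F ⇒D ~D 1F 0F ⇒D ~D 2F 0F)) (λ _ _ _ → M.~-trans) _ _ _ p q
      ; star-resp = λ p q → transfer (∀D ∀D (starD 1F ⇒D ~D 1F 0F ⇒D starD 0F)) (λ _ _ → M.star-resp) _ _ p q
      ; star-unique = λ p q → transfer (∀D ∀D (starD 1F ⇒D starD 0F ⇒D ~D 1F 0F)) (λ _ _ → M.star-unique) _ _ p q
      ; star = let p , s = transfer (∃D starD 0F) (proj₁ M.star , proj₁ (proj₂ M.star)) in p , s , λ _ → tt
      ; cell = transfer (∀D ∀D ∃D cellD 2F 1F 0F) M.cell
      -- Without grades the given element itself is the response.
      ; fresh = λ c ∉ → _ , c , ∉ , λ _ _ _ → tt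
      ; dense = λ p → let c , l , h = transfer (∀D ∀D (≺D 1F 0F ⇒D ∃D (≺D 2F 0F ×D ≺D 0F 1F)))
                                        (λ _ _ p → let c , l , h , _ = M.dense p in c , l , h) _ _ p
                      in c , l , h , λ _ _ → tt
      ; above = λ a → let b , l = transfer (∀D ∃D ≺D 1F 0F) (λ a → let b , l , _ = M.above a in b , l) a in b , l , λ _ → tt
      ; lv-mono = λ {_} {_} {n} p l → to (upto⇔ N _ n)
          (transfer (∀D ∀D (≲D 1F 0F ⇒D lvD 0F n ⇒D uptoD 1F n)) (λ _ _ p l → from (upto⇔ M _ n) (M.lv-mono p l)) _ _ p l)
      ; lv-exists = λ n → let a , l = transfer (∃D lvD 0F n) (let a , l , _ = M.lv-exists n in a , l) in a , l , λ _ → tt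
      ; lv-below = λ {_} {n} l → let b , p , l′ = transfer (∀D (lvD 0F n ⇒D ∃D (≺D 0F 1F ×D lvD 0F n)))
                                                    (λ _ l → let b , p , l′ , _ = M.lv-below l in b , p , l′) _ l
                                 in b , p , l′ , λ _ → tt
      ; lv-above = λ {_} {n} l → let b , p , l′ = transfer (∀D (lvD 0F n ⇒D ∃D (≺D 1F 0F ×D lvD 0F n)))
                                                    (λ _ l → let b , p , l′ , _ = M.lv-above l in b , p , l′) _ l
                                 in b , p , l′ , λ _ → tt
      ; sz-unique = λ {_} {_} {_} {c} → transfer (∀D ∀D ∀D (¬D starD 2F ⇒D szD 2F 1F c ⇒D szD 2F 0F c ⇒D ∼D 1F 0F))
                                          (λ _ _ _ → M.sz-unique) _ _ _
      ; sz-parent = λ {_} {_} {c} {n} → transfer (∀D ∀D (¬D starD 1F ⇒D szD 1F 0F (c ▹ n) ⇒D ∃D (szD 2F 0F c ×D lvD 0F n)))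
                                          (λ _ _ → M.sz-parent) _ _
      ; sz-good = λ {_} {_} {c} → transfer (∀D ∀D (¬D starD 1F ⇒D szD 1F 0F c ⇒D constD (S c ≟ 0))) (λ _ _ → M.sz-good) _ _
      ; sz-graded = λ _ _ → _ , (≲-refl , ≲-refl) , λ _ → tt
      ; row = λ ns xs n ys g ch →
          let y , a , b , c , d = subst (RowAxiom ns n N xs) (Vec.toList∘fromList ys)
                (transfer (rowD ns n (length ys))
                  (λ xs ys ch → let y , a , b , c , d , _ = M.row ns xs n (toList ys) g ch in y , a , b , c , d)
                  xs (fromList ys)) ch
          in y , a , b , c , d , λ _ _ _ → tt
      ; emptyRow = λ ys →
          let y , a , b , c = transfer (emptyRowD (length ys))
                (λ ys → let y , a , b , c , _ = M.emptyRow (toList ys) in y , a , b , c) (fromList ys)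
          in y , a , subst (N.NotRow y) (Vec.toList∘fromList ys) b , c , λ _ → tt
      }
      where
        N-total : ∀ a b → a N.≲ b ⊎ b N.≲ a
        N-total = transfer (∀D ∀D (≲D 1F 0F ⊎D ≲D 0F 1F)) M.total
        ≲-refl : ∀ {a} → a N.≲ a
        ≲-refl {a} with N-total a a
        ... | inj₁ p = p
        ... | inj₂ p = p

-- The positive dyadic rationals as a dense order without endpoints.

module Dyadic where

  open Arithmetic

  -- (m , k) stands for (2m + 1) / 2ᵏ.
  Dyadic : Set
  Dyadic = ℕ × ℕ

  numer : ℕ → ℕ
  numer m = suc (2 * m)

  infix 4 _≤ᴰ_
  _≤ᴰ_ : Dyadic → Dyadic → Set
  (m , k) ≤ᴰ (m′ , k′) = numer m * 2 ^ k′ ≤ numer m′ * 2 ^ k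

  ≤ᴰ-total : ∀ a b → a ≤ᴰ b ⊎ b ≤ᴰ a
  ≤ᴰ-total (m , k) (m′ , k′) = ≤-total (numer m * 2 ^ k′) (numer m′ * 2 ^ k)

  private
    swap₃ : ∀ a b c → a * b * c ≡ a * c * b
    swap₃ = +-*-Solver.solve 3 (λ a b c → a :* b :* c := a :* c :* b) refl
      where open +-*-Solver

  ≤ᴰ-trans : ∀ {a b c} → a ≤ᴰ b → b ≤ᴰ c → a ≤ᴰ c
  ≤ᴰ-trans {m , k} {m′ , k′} {m″ , k″} p q = *-cancelʳ-≤ _ _ (2 ^ k′) {{m^n≢0 2 k′}} (begin
    numer m * 2 ^ k″ * 2 ^ k′  ≡⟨ swap₃ (numer m) (2 ^ k″) (2 ^ k′) ⟩
    numer m * 2 ^ k′ * 2 ^ k″  ≤⟨ *-monoˡ-≤ (2 ^ k″) p ⟩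
    numer m′ * 2 ^ k * 2 ^ k″  ≡⟨ swap₃ (numer m′) (2 ^ k) (2 ^ k″) ⟩
    numer m′ * 2 ^ k″ * 2 ^ k  ≤⟨ *-monoˡ-≤ (2 ^ k) q ⟩
    numer m″ * 2 ^ k′ * 2 ^ k  ≡⟨ swap₃ (numer m″) (2 ^ k′) (2 ^ k) ⟩
    numer m″ * 2 ^ k * 2 ^ k′  ∎)
    where open ≤-Reasoning

  odd≢even : ∀ m n → numer m ≢ 2 * n
  odd≢even m n eq = absurd m n (trans (cong suc (double m)) (trans eq (sym (double n))))
    where
      double : ∀ n → n + n ≡ 2 * n
      double n = cong (n +_) (sym (+-identityʳ n))
      absurd : ∀ m n → suc (m + m) ≢ n + n
      absurd m       zero    ()
      absurd zero    (suc n) eq = case (trans eq (cong suc (+-suc n n)))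
        where
          case : ∀ {k} → 1 ≡ suc (suc k) → ⊥
          case ()
      absurd (suc m) (suc n) eq = absurd m n (suc-injective (suc-injective
        (trans (cong (2 +_) (sym (+-suc m m))) (trans eq (cong suc (+-suc n n))))))

  private
    x*2y : ∀ x y → x * (2 * y) ≡ 2 * (x * y)
    x*2y = +-*-Solver.solve 2 (λ x y → x :* (con 2 :* y) := con 2 :* (x :* y)) refl
      where open +-*-Solver

  -- Fractions with odd numerator are in lowest terms: factors 2 are cancelled until one exponent is
  -- 0, and then parity decides. So each dyadic has one code, and points are equal if they are
  -- equivalent in the preorder.
  cross-injective : ∀ {m m′ k k′} → k ≤ k′ → numer m * 2 ^ k′ ≡ numer m′ * 2 ^ k → (m , k) ≡ (m′ , k′)
  cross-injective {m} {m′} {zero} {zero} le eq =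
    cong (_, 0) (*-cancelˡ-≡ m m′ 2 (suc-injective (trans (sym (*-identityʳ _)) (trans eq (*-identityʳ _)))))
  cross-injective {m} {m′} {zero} {suc k′} le eq = ⊥-elim (odd≢even m′ (numer m * 2 ^ k′)
    (trans (sym (*-identityʳ _)) (trans (sym eq) (x*2y (numer m) (2 ^ k′)))))
  cross-injective {m} {m′} {suc k} {suc k′} (s≤s le) eq
    with cross-injective {m} {m′} {k} {k′} le (*-cancelˡ-≡ _ _ 2
           (trans (sym (x*2y (numer m) (2 ^ k′))) (trans eq (x*2y (numer m′) (2 ^ k)))))
  ... | refl = refl

  ≤ᴰ-antisym : ∀ {a b} → a ≤ᴰ b → b ≤ᴰ a → a ≡ b
  ≤ᴰ-antisym {m , k} {m′ , k′} p q with ≤-total k k′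
  ... | inj₁ k≤k′ = cross-injective k≤k′ (≤-antisym p q)
  ... | inj₂ k′≤k = sym (cross-injective k′≤k (≤-antisym q p))

  left right : Dyadic → Dyadic
  left (m , k)  = m , suc k
  right (m , k) = suc m , k

  left≱ : ∀ a → ¬ a ≤ᴰ left a
  left≱ (m , k) p = <⇒≱ (m<m+n X (≤-trans (*-mono-≤ {1} {numer m} {1} (s≤s z≤n) (m^n>0 2 k)) (≤-reflexive (sym (+-identityʳ X)))))
                         (subst (_≤ X) (x*2y (numer m) (2 ^ k)) p)
    where
      X = numer m * 2 ^ k

  right≰ : ∀ a → ¬ right a ≤ᴰ a
  right≰ (m , k) = <⇒≱ (*-monoˡ-< (2 ^ k) {{m^n≢0 2 k}} (s≤s (*-monoʳ-< 2 (n<1+n m))))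

  -- The larger of the two denominators is doubled, which leaves room for an odd
  -- numerator next to the end it belongs to.
  mid : Dyadic → Dyadic → Dyadic
  mid (m , k) (m′ , k′) with k ≤? k′
  ... | yes _ = 2 * m′ , suc k′
  ... | no _  = suc (2 * m) , suc k

  mid-between : ∀ a b → ¬ b ≤ᴰ a → ¬ mid a b ≤ᴰ a × ¬ b ≤ᴰ mid a b
  mid-between (m , k) (m′ , k′) b≰a with k ≤? k′
  ... | yes k≤k′ = <⇒≱ lo , <⇒≱ hi
    where
      open ≤-Reasoning
      e = k′ ∸ k
      split : 2 ^ k′ ≡ 2 ^ e * 2 ^ k
      split = trans (cong (2 ^_) (sym (m∸n+n≡m k≤k′))) (^-distribˡ-+-* 2 e k)
      -- On the grid of the finer denominator the ends are at least one step apart, and `mid` lies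
      -- half a step from the end with that denominator.
      gap : numer m * 2 ^ e < numer m′
      gap = *-cancelʳ-< (2 ^ k) (numer m * 2 ^ e) (numer m′) (subst (_< numer m′ * 2 ^ k)
              (trans (cong (numer m *_) split) (sym (*-assoc (numer m) (2 ^ e) (2 ^ k)))) (≰⇒> b≰a))
      lo : numer m * 2 ^ suc k′ < numer (2 * m′) * 2 ^ k
      lo = begin-strict
        numer m * (2 * 2 ^ k′)             ≡⟨ x*2y (numer m) (2 ^ k′) ⟩
        2 * (numer m * 2 ^ k′)             ≡⟨ cong (λ x → 2 * (numer m * x)) split ⟩
        2 * (numer m * (2 ^ e * 2 ^ k))    ≡⟨ cong (2 *_) (*-assoc (numer m) (2 ^ e) (2 ^ k)) ⟨
        2 * (numer m * 2 ^ e * 2 ^ k)      ≡⟨ *-assoc 2 (numer m * 2 ^ e) (2 ^ k) ⟨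
        2 * (numer m * 2 ^ e) * 2 ^ k      <⟨ *-monoˡ-< (2 ^ k) {{m^n≢0 2 k}} (s≤s (*-monoʳ-≤ 2 (s≤s⁻¹ gap))) ⟩
        numer (2 * m′) * 2 ^ k             ∎
      hi : numer (2 * m′) * 2 ^ k′ < numer m′ * 2 ^ suc k′
      hi = begin-strict
        numer (2 * m′) * 2 ^ k′            <⟨ *-monoˡ-< (2 ^ k′) {{m^n≢0 2 k′}} (≤-reflexive (sym (*-suc 2 (2 * m′)))) ⟩
        2 * numer m′ * 2 ^ k′              ≡⟨ *-assoc 2 (numer m′) (2 ^ k′) ⟩
        2 * (numer m′ * 2 ^ k′)            ≡⟨ x*2y (numer m′) (2 ^ k′) ⟨
        numer m′ * 2 ^ suc k′              ∎
  ... | no k≰k′ = <⇒≱ lo , <⇒≱ hi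
    where
      open ≤-Reasoning
      e = k ∸ k′
      split : 2 ^ k ≡ 2 ^ e * 2 ^ k′
      split = trans (cong (2 ^_) (sym (m∸n+n≡m (≰⇒≥ k≰k′)))) (^-distribˡ-+-* 2 e k′)
      gap : numer m < numer m′ * 2 ^ e
      gap = *-cancelʳ-< (2 ^ k′) (numer m) (numer m′ * 2 ^ e) (subst (numer m * 2 ^ k′ <_)
              (trans (cong (numer m′ *_) split) (sym (*-assoc (numer m′) (2 ^ e) (2 ^ k′)))) (≰⇒> b≰a))
      lo : numer m * 2 ^ suc k < numer (suc (2 * m)) * 2 ^ k
      lo = begin-strict
        numer m * (2 * 2 ^ k)              ≡⟨ x*2y (numer m) (2 ^ k) ⟩
        2 * (numer m * 2 ^ k)              ≡⟨ *-assoc 2 (numer m) (2 ^ k) ⟨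
        2 * numer m * 2 ^ k                <⟨ *-monoˡ-< (2 ^ k) {{m^n≢0 2 k}} (n<1+n (2 * numer m)) ⟩
        numer (suc (2 * m)) * 2 ^ k        ∎
      hi : numer (suc (2 * m)) * 2 ^ k′ < numer m′ * 2 ^ suc k
      hi = begin-strict
        numer (suc (2 * m)) * 2 ^ k′       <⟨ *-monoˡ-< (2 ^ k′) {{m^n≢0 2 k′}} (≤-reflexive (sym (*-suc 2 (numer m)))) ⟩
        2 * suc (numer m) * 2 ^ k′         ≤⟨ *-monoˡ-≤ (2 ^ k′) (*-monoʳ-≤ 2 gap) ⟩
        2 * (numer m′ * 2 ^ e) * 2 ^ k′    ≡⟨ *-assoc 2 (numer m′ * 2 ^ e) (2 ^ k′) ⟩
        2 * (numer m′ * 2 ^ e * 2 ^ k′)    ≡⟨ cong (2 *_) (*-assoc (numer m′) (2 ^ e) (2 ^ k′)) ⟩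
        2 * (numer m′ * (2 ^ e * 2 ^ k′))  ≡⟨ cong (λ x → 2 * (numer m′ * x)) split ⟨
        2 * (numer m′ * 2 ^ k)             ≡⟨ x*2y (numer m′) (2 ^ k) ⟨
        numer m′ * 2 ^ suc k               ∎

-- The concrete models and the proof of the axioms for them.

module StandardModels where

  open Arithmetic
  open Structures
  open Dyadic

  infix 4 _≤ᴾ_

  data Level′ : Set where
    fin : ℕ → Level′
    inf : Level′

  Point : Set
  Point = Level′ × Dyadic

  _≤ᴾ_ : Point → Point → Set
  (fin n , a) ≤ᴾ (fin n′ , b) = n < n′ ⊎ (n ≡ n′ × a ≤ᴰ b)
  (fin n , a) ≤ᴾ (inf    , b) = ⊤
  (inf   , a) ≤ᴾ (fin _  , b) = ⊥
  (inf   , a) ≤ᴾ (inf    , b) = a ≤ᴰ b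

  ≤ᴾ-total : ∀ x y → x ≤ᴾ y ⊎ y ≤ᴾ x
  ≤ᴾ-total (fin n , a) (fin n′ , b) with <-cmp n n′
  ... | tri< lt _ _ = inj₁ (inj₁ lt)
  ... | tri> _ _ gt = inj₂ (inj₁ gt)
  ... | tri≈ _ refl _ with ≤ᴰ-total a b
  ...   | inj₁ p = inj₁ (inj₂ (refl , p))
  ...   | inj₂ p = inj₂ (inj₂ (refl , p))
  ≤ᴾ-total (fin n , a) (inf , b)   = inj₁ tt
  ≤ᴾ-total (inf , a)   (fin n , b) = inj₂ tt
  ≤ᴾ-total (inf , a)   (inf , b)   = ≤ᴰ-total a b

  ≤ᴾ-trans : ∀ {x y z} → x ≤ᴾ y → y ≤ᴾ z → x ≤ᴾ z
  ≤ᴾ-trans {fin _ , _} {fin _ , _} {fin _ , _} (inj₁ p) (inj₁ q) = inj₁ (<-trans p q)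
  ≤ᴾ-trans {fin _ , _} {fin _ , _} {fin _ , _} (inj₁ p) (inj₂ (refl , q)) = inj₁ p
  ≤ᴾ-trans {fin _ , _} {fin _ , _} {fin _ , _} (inj₂ (refl , p)) (inj₁ q) = inj₁ q
  ≤ᴾ-trans {fin _ , a} {fin _ , b} {fin _ , c} (inj₂ (refl , p)) (inj₂ (refl , q)) = inj₂ (refl , ≤ᴰ-trans {a} {b} {c} p q)
  ≤ᴾ-trans {fin _ , _} {fin _ , _} {inf , _} p q = tt
  ≤ᴾ-trans {fin _ , _} {inf , _} {inf , _} p q = tt
  ≤ᴾ-trans {inf , a} {inf , b} {inf , c} p q = ≤ᴰ-trans {a} {b} {c} p q

  ≤ᴾ-antisym : ∀ {x y} → x ≤ᴾ y → y ≤ᴾ x → x ≡ y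
  ≤ᴾ-antisym {fin _ , _} {fin _ , _} (inj₁ p) (inj₁ q) = ⊥-elim (<-asym p q)
  ≤ᴾ-antisym {fin _ , _} {fin _ , _} (inj₁ p) (inj₂ (refl , q)) = ⊥-elim (<-irrefl refl p)
  ≤ᴾ-antisym {fin _ , _} {fin _ , _} (inj₂ (refl , p)) (inj₁ q) = ⊥-elim (<-irrefl refl q)
  ≤ᴾ-antisym {fin _ , a} {fin _ , b} (inj₂ (refl , p)) (inj₂ (_ , q)) = cong (_ ,_) (≤ᴰ-antisym {a} {b} p q)
  ≤ᴾ-antisym {inf , a} {inf , b} p q = cong (_ ,_) (≤ᴰ-antisym {a} {b} p q)

  -- pth is the row whose contents follow a path of the tree.
  data Row : Set where
    star : Row
    pts  : List Point → ℕ → Row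
    pth  : Row

  Raw : Set
  Raw = Row × Point × ℕ

  -- The default for infinite level enters no index: in a valid list such a point can only be the
  -- last one, and an index is made of the levels before.
  level# : Point → ℕ
  level# (fin n , _) = n
  level# (inf   , _) = 0

  levels : List Point → List ℕ
  levels = List.map level#

  pts# : List Point → ℕ
  pts# ps = labels (levels ps)

  prefix : (ℕ → ℕ) → ℕ → List ℕ
  prefix f zero    = []
  prefix f (suc i) = f i ∷ prefix f i

  labels-prefix-< : ∀ f {i j} → i < j → labels (prefix f i) < labels (prefix f j)
  labels-prefix-< f {i} {suc j} (s≤s le) with m≤n⇒m<n∨m≡n le
  ... | inj₁ lt   = <-trans (labels-prefix-< f lt) (s<▹ _ (f j))
  ... | inj₂ refl = s<▹ _ (f j)

  Finite : Point → Set
  Finite x = ∃[ n ] proj₁ x ≡ fin n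

  -- The point of index c among ps.
  At : List Point → ℕ → Point → Set
  At []       c x = ⊥
  At (p ∷ ps) c x = (x ≡ p × c ≡ pts# ps) ⊎ At ps c x

  At-< : ∀ ps {c x} → (∀ {p} → p ∈ ps → Finite p) → At ps c x → c < pts# ps
  At-< (p ∷ ps) f (inj₁ (refl , refl)) = s<▹ (pts# ps) (level# p)
  At-< (p ∷ ps) f (inj₂ a) = <-trans (At-< ps (f ∘ there) a) (s<▹ (pts# ps) (level# p))

  At-∈ : ∀ ps {c x} → At ps c x → x ∈ ps
  At-∈ (p ∷ ps) (inj₁ (refl , _)) = here refl
  At-∈ (p ∷ ps) (inj₂ a) = there (At-∈ ps a)

  -- All models needed are treated at once: `upper` cuts the part of infinite level out of the
  -- dyadics, and `onPath` says whether there is an additional row along `path`.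
  record Kind : Set₁ where
    field
      S      : ℕ → ℕ
      upper  : Dyadic → Set
      upper↑ : ∀ {a b} → upper a → a ≤ᴰ b → upper b
      onPath : Set
      path   : ℕ → ℕ
      good   : onPath → ∀ i → S (labels (prefix path i)) ≡ 0

  module Model (cl : Classical) (κ : Kind) where
    open Classical cl
    open Kind κ

    ValidPoint : Point → Set
    ValidPoint (fin _ , _) = ⊤
    ValidPoint (inf   , a) = upper a

    ValidList : List Point → Set
    ValidList []       = ⊤
    ValidList (p ∷ ps) = ValidList ps × ValidPoint p × (∀ {q} → q ∈ ps → Finite q × p ≢ q) × S (pts# ps) ≡ 0

    ValidRow : Row → Set
    ValidRow star       = ⊤
    ValidRow (pts ps _) = ValidList ps
    ValidRow pth        = onPath

    -- The intended index of a cell: its positions run from 0 to `c` if there is such a `c`, and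
    -- through all numbers if there is none.
    Sig : Row → ℕ → Point → Set
    Sig star       c x = proj₁ x ≡ fin c
    Sig (pts ps _) c x = At ps c x
    -- The dyadic `(i , 0)` keeps the points of the path distinct even where levels repeat.
    Sig pth        c x = ∃[ i ] x ≡ (fin (path i) , i , 0) × c ≡ labels (prefix path i)

    Valid : Raw → Set
    Valid (y , x , k) = ValidRow y × ValidPoint x × (∀ c → Sig y c x → k ≤ c)

    -- Validity enters as a truth value, so that it has only one proof and elements with the same
    -- raw data are equal.
    Element : Set
    Element = Σ[ w ∈ Raw ] T (isYes (em (Valid w)))

    mk : ∀ {w} → Valid w → Element
    mk {w} v = w , fromWitness v

    valid : (w : Element) → Valid (proj₁ w)
    valid (w , t) = toWitness t

    element-≡ : ∀ {v w : Element} → proj₁ v ≡ proj₁ w → v ≡ w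
    element-≡ {v , s} {.v , t} refl = cong (v ,_) (T-irrelevant s t)

    rowOf : Element → Row
    rowOf w = proj₁ (proj₁ w)

    point : Element → Point
    point w = proj₁ (proj₂ (proj₁ w))

    position : Element → ℕ
    position w = proj₂ (proj₂ (proj₁ w))

    structure : Structure L₃
    structure = record
      { Carrier = Element
      ; inhabited = mk {star , (fin 0 , 0 , 0) , 0} (tt , tt , λ _ _ → z≤n)
      ; ⟦_⟧ᶠ = λ ()
      ; ⟦_⟧ʳ = λ where
          0F (v ∷ w ∷ []) → point v ≤ᴾ point w
          1F (v ∷ w ∷ []) → rowOf v ≡ rowOf w
          2F (v ∷ [])     → rowOf v ≡ star }

    open Str structure

    sig-functional : ∀ y {x c c′} → ValidRow y → Sig y c x → Sig y c′ x → c ≡ c′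
    sig-functional star v refl refl = refl
    sig-functional (pts ps t) v = go ps v
      where
        go : ∀ ps {x c c′} → ValidList ps → At ps c x → At ps c′ x → c ≡ c′
        go (p ∷ ps) v (inj₁ (_ , refl)) (inj₁ (_ , refl)) = refl
        go (p ∷ ps) (_ , _ , d , _) (inj₁ (refl , _)) (inj₂ a) = ⊥-elim (proj₂ (d (At-∈ ps a)) refl)
        go (p ∷ ps) (_ , _ , d , _) (inj₂ a) (inj₁ (refl , _)) = ⊥-elim (proj₂ (d (At-∈ ps a)) refl)
        go (p ∷ ps) (v , _) (inj₂ a) (inj₂ b) = go ps v a b
    sig-functional pth v (i , refl , refl) (_ , refl , refl) = refl

    sig-unique : ∀ y {x x′ c} → ValidRow y → y ≢ star → Sig y c x → Sig y c x′ → x ≡ x′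
    sig-unique star v ¬s = ⊥-elim (¬s refl)
    sig-unique (pts ps t) v _ = go ps v
      where
        go : ∀ ps {x x′ c} → ValidList ps → At ps c x → At ps c x′ → x ≡ x′
        go (p ∷ ps) v (inj₁ (refl , _)) (inj₁ (refl , _)) = refl
        go (p ∷ ps) (_ , _ , d , _) (inj₁ (_ , refl)) (inj₂ b) = ⊥-elim (<-irrefl refl (At-< ps (proj₁ ∘ d) b))
        go (p ∷ ps) (_ , _ , d , _) (inj₂ a) (inj₁ (_ , refl)) = ⊥-elim (<-irrefl refl (At-< ps (proj₁ ∘ d) a))
        go (p ∷ ps) (v , _) (inj₂ a) (inj₂ b) = go ps v a b
    sig-unique pth v _ (i , refl , eq) (j , refl , eq′) with <-cmp i j
    ... | tri≈ _ refl _ = refl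
    ... | tri< lt _ _ = ⊥-elim (<⇒≢ (labels-prefix-< path lt) (trans (sym eq) eq′))
    ... | tri> _ _ gt = ⊥-elim (<⇒≢ (labels-prefix-< path gt) (trans (sym eq′) eq))

    sig-parent : ∀ y {x c n} → ValidRow y → y ≢ star → Sig y (c ▹ n) x →
                 ∃[ x′ ] Sig y c x′ × proj₁ x′ ≡ fin n
    sig-parent star v ¬s = ⊥-elim (¬s refl)
    sig-parent (pts ps t) v _ = go ps v
      where
        go : ∀ ps {x c n} → ValidList ps → At ps (c ▹ n) x → ∃[ x′ ] At ps c x′ × proj₁ x′ ≡ fin n
        go (p ∷ q ∷ ps) {c = c} {n} (v , _ , d , _) (inj₁ (_ , eq))
          with proj₁ (d (here refl)) | ▹-injective {c} {n} {pts# ps} {level# q} eq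
        ... | m , refl | refl , refl = q , inj₂ (inj₁ (refl , refl)) , refl
        go (p ∷ ps) (v , _) (inj₂ a) = let x′ , b , eq = go ps v a in x′ , inj₂ b , eq
    sig-parent pth {c = c} {n} v _ (suc i , _ , eq) with ▹-injective {c} {n} {labels (prefix path i)} {path i} eq
    ... | refl , refl = _ , (i , refl , refl) , refl

    sig-good : ∀ y {x c} → ValidRow y → y ≢ star → Sig y c x → S c ≡ 0
    sig-good star v ¬s = ⊥-elim (¬s refl)
    sig-good (pts ps t) v _ = go ps v
      where
        go : ∀ ps {x c} → ValidList ps → At ps c x → S c ≡ 0
        go (p ∷ ps) (_ , _ , _ , s) (inj₁ (_ , refl)) = s
        go (p ∷ ps) (v , _) (inj₂ a) = go ps v a
    sig-good pth v _ (i , _ , refl) = good v i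

    sig-point : ∀ y {x c} → ValidRow y → y ≢ star → Sig y c x → ValidPoint x
    sig-point star v ¬s = ⊥-elim (¬s refl)
    sig-point (pts ps t) v _ = go ps v
      where
        go : ∀ ps {x c} → ValidList ps → At ps c x → ValidPoint x
        go (p ∷ ps) (_ , vp , _) (inj₁ (refl , _)) = vp
        go (p ∷ ps) (v , _) (inj₂ a) = go ps v a
    sig-point pth v _ (i , refl , _) = tt

    atPosition : ∀ y x {k} → ValidRow y → ValidPoint x → (∀ c → Sig y c x → k ≤ c) → Element
    atPosition y x {k} vy vx h = mk {y , x , k} (vy , vx , h)

    module _ (y x : Element) where
      private
        vy = proj₁ (valid y)
        vx = proj₁ (proj₂ (valid x))

      cell-shape : ∀ {w} → Cell y x w → proj₁ w ≡ (rowOf y , point x , position w)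
      cell-shape {w} (e , a , b) = cong₂ (λ r p → r , p , position w) e (≤ᴾ-antisym {point w} {point x} a b)

      in-cell : ∀ {k} (h : ∀ c → Sig (rowOf y) c (point x) → k ≤ c) → Cell y x (atPosition (rowOf y) (point x) vy vx h)
      in-cell h = refl , refl≤ , refl≤
        where
          refl≤ : point x ≤ᴾ point x
          refl≤ with ≤ᴾ-total (point x) (point x)
          ... | inj₁ p = p
          ... | inj₂ p = p

      position≤ : ∀ {w c} → Cell y x w → Sig (rowOf y) c (point x) → position w ≤ c
      position≤ {w} {c} cl s with cell-shape {w} cl | proj₂ (proj₂ (valid w))
      ... | eq | h rewrite eq = h c s

      same-position : ∀ {v w} → Cell y x v → Cell y x w → position v ≡ position w → v ≡ w
      same-position {v} {w} cv cw eq = element-≡ (trans (cell-shape {v} cv)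
        (trans (cong (λ k → rowOf y , point x , k) eq) (sym (cell-shape {w} cw))))

      -- The positions `c`, ..., 0 are counted downwards; what is left after each step are the
      -- positions below a bound.
      sig⇒sz : ∀ {c} → Sig (rowOf y) c (point x) → Sz y x c
      sig⇒sz {c} s = go (suc c) ≤-refl [] (λ w cl → mk⇔ (λ _ → s≤s (position≤ {w} cl s)) (λ _ → tt))
        where
          go : ∀ j → j ≤ suc c → ∀ es → (∀ w → Cell y x w → NotIn w es ⇔ position w < j) → Exact (Cell y x) j es
          go zero    le es h = λ w cl ∉ → n≮0 (to (h w cl) ∉)
          go (suc j) le es h = u , cu , from (h u cu) ≤-refl ,
            go j (<⇒≤ le) (u ∷ es) (λ w cl → mk⇔
              (λ (w≢u , ∉) → ≤∧≢⇒< (s≤s⁻¹ (to (h w cl) ∉)) (λ eq → w≢u (same-position {w} {u} cl cu eq)))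
              (λ lt → (λ { refl → <-irrefl refl lt }) , from (h w cl) (m≤n⇒m≤1+n lt)))
            where
              j≤ : ∀ c′ → Sig (rowOf y) c′ (point x) → j ≤ c′
              j≤ c′ s′ = subst (j ≤_) (sig-functional (rowOf y) vy s s′) (s≤s⁻¹ le)
              u = atPosition (rowOf y) (point x) vy vx j≤
              cu = in-cell j≤

      -- A cell without intended index has elements at all positions, so it is infinite: beyond the
      -- largest position in a finite list there is always another one.
      sz⇒sig : ∀ {c} → Sz y x c → Sig (rowOf y) c (point x)
      sz⇒sig {c} sz with em (∃[ c′ ] Sig (rowOf y) c′ (point x))
      ... | yes (c′ , s) = subst (λ c → Sig (rowOf y) c (point x))
                             (suc-injective (exact-unique (suc c′) (suc c) (sig⇒sz s) sz)) s
      ... | no ¬s = ⊥-elim (infinite (suc c) [] sz)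
        where
          maxPosition : List Element → ℕ
          maxPosition []       = 0
          maxPosition (e ∷ es) = position e ⊔ maxPosition es
          position-max : ∀ {e es} → e ∈ es → position e ≤ maxPosition es
          position-max (here refl) = m≤m⊔n _ _
          position-max {es = e ∷ es} (there i) = ≤-trans (position-max i) (m≤n⊔m (position e) _)
          infinite : ∀ n es → ¬ Exact (Cell y x) n es
          infinite (suc n) es (w , _ , _ , E) = infinite n (w ∷ es) E
          infinite zero    es E = E u (in-cell h) (NotIn-map λ i eq → <⇒≢ (s≤s (position-max i)) (sym (cong position eq)))
            where
              h : ∀ c → Sig (rowOf y) c (point x) → suc (maxPosition es) ≤ c
              h c s = ⊥-elim (¬s (c , s))
              u = atPosition (rowOf y) (point x) vy vx h

    starElement : Element
    starElement = Structure.inhabited structure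

    level-lv : ∀ {w n} → proj₁ (point w) ≡ fin n → Lv w n
    level-lv {w} eq = starElement , refl , sig⇒sz starElement w eq

    lv-level : ∀ {w n} → Lv w n → proj₁ (point w) ≡ fin n
    lv-level {w} {n} (p , s , z) = subst (λ y → Sig y n (point w)) s (sz⇒sig p w z)

    -- A representative of a point, chosen in the star row.
    atPoint : ∀ x → ValidPoint x → Element
    atPoint x vx = atPosition star x {0} tt vx (λ _ _ → z≤n)

    least-number : ∀ (P : ℕ → Set) {k} → P k → ∃[ j ] P j × (∀ i → P i → j ≤ i)
    least-number P {k} p = go k ≤-refl p
      where
        go : ∀ b {k} → k ≤ b → P k → ∃[ j ] P j × (∀ i → P i → j ≤ i)
        go b {k} le p with em (∃[ i ] i < k × P i)
        ... | no none = k , p , λ i pi → ≮⇒≥ (λ lt → none (i , lt , pi))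
        go zero    {zero} le p | yes (i , () , _)
        go (suc b) {k} le p | yes (i , lt , pi) = go b (s≤s⁻¹ (≤-trans lt le)) pi

    -- The bound on `m` is exponential because a midpoint doubles it.
    GrPoint : ℕ → Point → Set
    GrPoint r (fin n , m , k) = n ≤ r × m < 2 ^ r × k ≤ r
    GrPoint r (inf   , m , k) = m < 2 ^ r × k ≤ r

    GrRow : ℕ → Row → Set
    GrRow r star       = ⊤
    GrRow r (pts ps t) = (∀ {p} → p ∈ ps → GrPoint r p) × length ps ≤ r × t ≤ r
    -- The points of a path lie in no single stage. Grades are put to use only in the model without
    -- such a row.
    GrRow r pth        = ⊥

    Gr : ℕ → Element → Set
    Gr r ((y , x , k) , _) = GrRow r y × GrPoint r x × k ≤ r

    Sm : ℕ → ℕ → Set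
    Sm r n = n ≤ r

    2^-mono : ∀ {m r} → m < 2 ^ r → m < 2 ^ suc r
    2^-mono {m} {r} lt = <-≤-trans lt (m≤m+n (2 ^ r) _)

    grPoint-suc : ∀ {r} x → GrPoint r x → GrPoint (suc r) x
    grPoint-suc {r} (fin n , m , k) (a , b , c) = m≤n⇒m≤1+n a , 2^-mono {r = r} b , m≤n⇒m≤1+n c
    grPoint-suc {r} (inf , m , k) (b , c) = 2^-mono {r = r} b , m≤n⇒m≤1+n c

    grRow-suc : ∀ {r} y → GrRow r y → GrRow (suc r) y
    grRow-suc star g = tt
    grRow-suc (pts ps t) (a , b , c) = (λ i → grPoint-suc _ (a i)) , m≤n⇒m≤1+n b , m≤n⇒m≤1+n c

    gr-left : ∀ {r} l d → GrPoint r (l , d) → GrPoint (suc r) (l , left d)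
    gr-left {r} (fin n) d (a , b , c) = m≤n⇒m≤1+n a , 2^-mono {r = r} b , s≤s c
    gr-left {r} inf d (b , c) = 2^-mono {r = r} b , s≤s c

    gr-right : ∀ {r} l d → GrPoint r (l , d) → GrPoint (suc r) (l , right d)
    gr-right {r} (fin n) d (a , b , c) = m≤n⇒m≤1+n a , suc-2^ {r = r} b , m≤n⇒m≤1+n c
      where
        suc-2^ : ∀ {m r} → m < 2 ^ r → suc m < 2 ^ suc r
        suc-2^ {m} {r} lt = ≤-trans (+-mono-≤ (m^n>0 2 r) lt) (≤-reflexive (cong (2 ^ r +_) (sym (+-identityʳ _))))
    gr-right {r} inf d (b , c) = ≤-trans (+-mono-≤ (m^n>0 2 r) b) (≤-reflexive (cong (2 ^ r +_) (sym (+-identityʳ _)))) , m≤n⇒m≤1+n c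

    gr-mid : ∀ {r} l a b → GrPoint r (l , a) → GrPoint r (l , b) → GrPoint (suc r) (l , mid a b)
    gr-mid {r} l (m , k) (m′ , k′) ga gb with k ≤? k′
    gr-mid {r} (fin n) (m , k) (m′ , k′) _ (a , b , c) | yes _ = m≤n⇒m≤1+n a , *-monoʳ-< 2 b , s≤s c
    gr-mid {r} inf     (m , k) (m′ , k′) _ (b , c)     | yes _ = *-monoʳ-< 2 b , s≤s c
    gr-mid {r} (fin n) (m , k) (m′ , k′) (a , b , c) _ | no _ = m≤n⇒m≤1+n a , odd<2^ {m} {r} b , s≤s c
      where
        odd<2^ : ∀ {m r} → m < 2 ^ r → suc (2 * m) < 2 ^ suc r
        odd<2^ {m} {r} lt = ≤-trans (≤-reflexive (sym (*-suc 2 m))) (*-monoʳ-≤ 2 lt)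
    gr-mid {r} inf     (m , k) (m′ , k′) (b , c) _     | no _ =
      ≤-trans (≤-reflexive (sym (*-suc 2 m))) (*-monoʳ-≤ 2 b) , s≤s c

    dense-points : ∀ x z → ValidPoint x → ValidPoint z → ¬ z ≤ᴾ x →
                   ∃[ p ] ValidPoint p × ¬ p ≤ᴾ x × ¬ z ≤ᴾ p × (∀ {r} → GrPoint r x → GrPoint r z → GrPoint (suc r) p)
    dense-points (fin n , a) (fin n′ , b) vx vz z≰x with <-cmp n n′
    ... | tri> _ _ gt = ⊥-elim (z≰x (inj₁ gt))
    ... | tri< lt _ _ = (fin n , right a) , tt ,
            (λ { (inj₁ p) → <-irrefl refl p ; (inj₂ (_ , p)) → right≰ a p }) ,
            (λ { (inj₁ p) → <-asym lt p ; (inj₂ (refl , _)) → <-irrefl refl lt }) ,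
            λ g _ → gr-right (fin n) a g
    ... | tri≈ _ refl _ = let p , q = mid-between a b (λ b≤a → z≰x (inj₂ (refl , b≤a))) in
            (fin n , mid a b) , tt ,
            (λ { (inj₁ p) → <-irrefl refl p ; (inj₂ (_ , p′)) → p p′ }) ,
            (λ { (inj₁ p) → <-irrefl refl p ; (inj₂ (_ , q′)) → q q′ }) ,
            λ g g′ → gr-mid (fin n) a b g g′
    dense-points (fin n , a) (inf , b) vx vz z≰x = (fin n , right a) , tt ,
            (λ { (inj₁ p) → <-irrefl refl p ; (inj₂ (_ , p)) → right≰ a p }) , (λ ()) , λ g _ → gr-right (fin n) a g
    dense-points (inf , a) (fin n , b) vx vz z≰x = ⊥-elim (z≰x tt)
    dense-points (inf , a) (inf , b) vx vz z≰x =
      let p , q = mid-between a b z≰x in (inf , mid a b) , upper↑ vx (≰ᴰ⇒≤ (mid a b) a p) , p , q , λ g g′ → gr-mid inf a b g g′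
      where
        ≰ᴰ⇒≤ : ∀ a b → ¬ a ≤ᴰ b → b ≤ᴰ a
        ≰ᴰ⇒≤ a b n with ≤ᴰ-total a b
        ... | inj₁ p = ⊥-elim (n p)
        ... | inj₂ p = p

    ≤ᴾ-refl : ∀ {x} → x ≤ᴾ x
    ≤ᴾ-refl {x} with ≤ᴾ-total x x
    ... | inj₁ p = p
    ... | inj₂ p = p

    ≡⇒∼ : ∀ v w → point v ≡ point w → v ∼ w
    ≡⇒∼ v w eq = subst (point v ≤ᴾ_) eq ≤ᴾ-refl , subst (_≤ᴾ point v) eq ≤ᴾ-refl

    pointsOf : (ns : List ℕ) → Vec Element (suc (length ns)) → List Point
    pointsOf []       (x ∷ _)  = point x ∷ []
    pointsOf (n ∷ ns) (x ∷ xs) = point x ∷ pointsOf ns xs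

    length-pointsOf : ∀ ns xs → length (pointsOf ns xs) ≡ suc (length ns)
    length-pointsOf []       (x ∷ _)  = refl
    length-pointsOf (n ∷ ns) (x ∷ xs) = cong suc (length-pointsOf ns xs)

    ∈-pointsOf : ∀ ns xs {p} → p ∈ pointsOf ns xs → ∃[ i ] p ≡ point (lookup xs i)
    ∈-pointsOf []       (x ∷ _)  (here refl) = zero , refl
    ∈-pointsOf (n ∷ ns) (x ∷ xs) (here refl) = zero , refl
    ∈-pointsOf (n ∷ ns) (x ∷ xs) (there j) = let i , eq = ∈-pointsOf ns xs j in suc i , eq

    finite-pointsOf : ∀ {n} ns xs → Chain ns xs → Lv (hd xs) n →
                      (∀ {q} → q ∈ pointsOf ns xs → Finite q) × levels (pointsOf ns xs) ≡ n ∷ ns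
    finite-pointsOf {n} [] (x ∷ []) ch l =
      (λ { (here refl) → n , lv-level {x} l }) , cong (_∷ []) (level≡ (lv-level {x} l))
      where
        level≡ : ∀ {p : Point} → proj₁ p ≡ fin n → level# p ≡ n
        level≡ {_ , _} refl = refl
    finite-pointsOf {n} (m ∷ ns) (x ∷ xs) (ch , l′ , _) l =
      let f , eq = finite-pointsOf ns xs ch l′ in
      (λ { (here refl) → n , lv-level {x} l ; (there i) → f i }) ,
      cong₂ _∷_ (level≡ (lv-level {x} l)) eq
      where
        level≡ : ∀ {p : Point} → proj₁ p ≡ fin n → level# p ≡ n
        level≡ {_ , _} refl = refl

    notSim-≢ : ∀ {n} x (xs : Vec Element n) → NotSim x xs → ∀ i → point x ≢ point (lookup xs i)
    notSim-≢ x (x′ ∷ xs) (p , q) zero    eq = p (≡⇒∼ x x′ eq)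
    notSim-≢ x (x′ ∷ xs) (p , q) (suc i) eq = notSim-≢ x xs q i eq

    valid-pointsOf : ∀ ns xs → Good S ns → Chain ns xs → ValidList (pointsOf ns xs)
    valid-pointsOf []       (x ∷ []) g ch = tt , proj₁ (proj₂ (valid x)) , (λ ()) , g
    valid-pointsOf (n ∷ ns) (x ∷ xs) (s , g) (ch , l , ns≁) =
      let f , eq = finite-pointsOf ns xs ch l in
      valid-pointsOf ns xs g ch , proj₁ (proj₂ (valid x)) ,
      (λ j → f j , λ e → let i , eq′ = ∈-pointsOf ns xs j in notSim-≢ x xs ns≁ i (trans e eq′)) ,
      trans (cong (S ∘ labels) eq) s

    has-pointsOf : ∀ y ns xs → (∀ {c x} → At (pointsOf ns xs) c x → Sig (rowOf y) c x) → Chain ns xs → Has y ns xs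
    has-pointsOf y []       (x ∷ [])  f ch = sig⇒sz y x (f (inj₁ (refl , refl)))
    has-pointsOf y (n ∷ ns) (x ∷ xs) f (ch , l , _) =
      sig⇒sz y x (f (inj₁ (refl , cong labels (sym (proj₂ (finite-pointsOf ns xs ch l)))))) ,
      has-pointsOf y ns xs (f ∘ inj₂) ch

    tag : Row → ℕ
    tag star      = 0
    tag (pts _ t) = t
    tag pth       = 0

    maxTag : List Element → ℕ
    maxTag []       = 0
    maxTag (z ∷ zs) = tag (rowOf z) ⊔ maxTag zs

    tag-max : ∀ {z zs} → z ∈ zs → tag (rowOf z) ≤ maxTag zs
    tag-max (here refl) = m≤m⊔n _ _
    tag-max {zs = z ∷ zs} (there i) = ≤-trans (tag-max i) (m≤n⊔m (tag (rowOf z)) _)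

    maxTag≤ : ∀ {r} zs → (∀ {z} → z ∈ zs → Gr r z) → maxTag zs ≤ r
    maxTag≤ []       g = z≤n
    maxTag≤ (z ∷ zs) g = ⊔-lub (tag≤ (rowOf z) (proj₁ (g (here refl)))) (maxTag≤ zs (g ∘ there))
      where
        tag≤ : ∀ {r} y → GrRow r y → tag y ≤ r
        tag≤ star g = z≤n
        tag≤ (pts _ _) (_ , _ , g) = g

    -- The tag, larger than those of all rows to be avoided, makes the row new. An element
    -- represents its row wherever it lies, so it is put at a point and a position of least grade.
    newRow : ∀ ps → ValidList ps → List Element → Element
    newRow ps v zs = atPosition (pts ps (suc (maxTag zs))) (fin 0 , 0 , 0) {0} v tt (λ _ _ → z≤n)

    newRow-fresh : ∀ ps v zs → NotRow (newRow ps v zs) zs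
    newRow-fresh ps v zs = go zs (λ i e → <-irrefl (cong tag (sym e)) (s≤s (tag-max i)))
      where
        go : ∀ zs′ → (∀ {z} → z ∈ zs′ → ¬ newRow ps v zs ~ z) → NotRow (newRow ps v zs) zs′
        go []        f = tt
        go (z ∷ zs′) f = f (here refl) , go zs′ (f ∘ there)

    newRow-graded : ∀ {r} ps v zs → (∀ {p} → p ∈ ps → GrPoint r p) → length ps ≤ suc r →
                    (∀ {z} → z ∈ zs → Gr r z) → Gr (suc r) (newRow ps v zs)
    newRow-graded {r} ps v zs g l h = ((λ i → grPoint-suc _ (g i)) , l , s≤s (maxTag≤ zs h)) ,
      (z≤n , m^n>0 2 (suc r) , z≤n) , z≤n

    axioms : Axioms S structure Gr Sm
    axioms = record
      { gr-suc = λ { {r} {(y , x , k) , _} (a , b , c) → grRow-suc y a , grPoint-suc x b , m≤n⇒m≤1+n c }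
      ; total = λ v w → ≤ᴾ-total (point v) (point w)
      ; ≲-trans = λ {a} {b} {c} → ≤ᴾ-trans {point a} {point b} {point c}
      ; ~-refl = refl
      ; ~-sym = sym
      ; ~-trans = trans
      ; star-resp = λ s e → trans (sym e) s
      ; star-unique = λ s s′ → trans s (sym s′)
      ; star = starElement , refl , λ r → tt , (z≤n , m^n>0 2 r , z≤n) , z≤n
      ; cell = λ y x → atPosition (rowOf y) (point x) (proj₁ (valid y)) (proj₁ (proj₂ (valid x))) (λ _ _ → z≤n) ,
                       in-cell y x {0} (λ _ _ → z≤n)
      ; fresh = λ {y} {x} {w} → fresh {y} {x} {w}
      ; dense = λ {a} {b} a≺b →
          let p , vp , lo , hi , gr = dense-points (point a) (point b) (proj₁ (proj₂ (valid a))) (proj₁ (proj₂ (valid b))) a≺b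
          in atPoint p vp , lo , hi , λ (_ , g , _) (_ , g′ , _) → tt , gr g g′ , z≤n
      ; above = above
      ; lv-mono = λ {a} {b} → lv-mono {a} {b}
      ; lv-exists = λ n → atPoint (fin n , 0 , 0) tt , level-lv {atPoint (fin n , 0 , 0) tt} refl ,
          λ {r} le → tt , (m≤n⇒m≤1+n le , m^n>0 2 (suc r) , z≤n) , z≤n
      ; lv-below = λ {a} → lv-below {a}
      ; lv-above = λ {a} → lv-above {a}
      ; sz-unique = λ {y} {x} {x′} ¬s z z′ → ≡⇒∼ x x′
          (sig-unique (rowOf y) (proj₁ (valid y)) ¬s (sz⇒sig y x z) (sz⇒sig y x′ z′))
      ; sz-parent = λ {y} {x} → sz-parent {y} {x}
      ; sz-good = λ {y} {x} ¬s z → sig-good (rowOf y) (proj₁ (valid y)) ¬s (sz⇒sig y x z)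
      ; sz-graded = λ {y} {x} ¬s z → atPoint (point x) (proj₁ (proj₂ (valid x))) ,
          ≡⇒∼ (atPoint (point x) (proj₁ (proj₂ (valid x)))) x refl ,
          λ (g , _) → tt , sig-graded (rowOf y) ¬s g (sz⇒sig y x z) , z≤n
      ; row = row
      ; emptyRow = λ ys → newRow [] tt ys , (λ ()) , newRow-fresh [] tt ys ,
          (λ x z → sz⇒sig (newRow [] tt ys) x z) , λ g → newRow-graded [] tt ys (λ ()) z≤n g
      }
      where
        fresh : ∀ {y x w us} → Cell y x w → NotIn w us →
                ∃[ u ] Cell y x u × NotIn u us ×
                  (∀ {r} → Gr r y → Gr r x → (∀ {v} → v ∈ us → Gr r v) → Gr (suc r) u)
        fresh {y} {x} {w} {us} cw w∉ = u , in-cell y x hu , u∉ , λ (gy , _) (_ , gx , _) gus →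
            grRow-suc (rowOf y) gy , grPoint-suc (point x) gx , small gus
          where
            vy = proj₁ (valid y)
            vx = proj₁ (proj₂ (valid x))
            put : ∀ {k} → (∀ c → Sig (rowOf y) c (point x) → k ≤ c) → Element
            put = atPosition (rowOf y) (point x) vy vx
            Free : ℕ → Set
            Free k = Σ[ h ∈ (∀ c → Sig (rowOf y) c (point x) → k ≤ c) ] NotIn (put h) us
            hw : ∀ c → Sig (rowOf y) c (point x) → position w ≤ c
            hw c s = position≤ y x {w} cw s
            w≡ : w ≡ put hw
            w≡ = same-position y x {w} {put hw} cw (in-cell y x hw) refl
            free = least-number Free {position w} (hw , subst (λ v → NotIn v us) w≡ w∉)
            k = proj₁ free
            hu = proj₁ (proj₁ (proj₂ free))
            u∉ = proj₂ (proj₁ (proj₂ free))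
            u = put hu
            -- If the least free position were larger, then position `suc r` would be available too,
            -- as the elements of `us` occupy positions up to `r` only.
            small : ∀ {r} → (∀ {v} → v ∈ us → Gr r v) → k ≤ suc r
            small {r} gus with k ≤? suc r
            ... | yes p = p
            ... | no ¬p = ⊥-elim (¬p (proj₂ (proj₂ free) (suc r)
                    ((λ c s → ≤-trans (<⇒≤ (≰⇒> ¬p)) (hu c s)) ,
                     NotIn-map λ i eq → <⇒≱ (n<1+n r) (subst (_≤ r) (sym (cong position eq)) (proj₂ (proj₂ (gus i)))))))
        above : ∀ a → ∃[ b ] a ≺ b × (∀ {r} → Gr r a → Gr (suc r) b)
        above a = go (point a) (proj₁ (proj₂ (valid a)))
          where
            go : ∀ p → ValidPoint p → ∃[ b ] ¬ point b ≤ᴾ p × (∀ {r} → GrRow r (rowOf a) × GrPoint r p × position a ≤ r → Gr (suc r) b)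
            go (fin n , d) v = atPoint (fin n , right d) tt ,
              (λ { (inj₁ p) → <-irrefl refl p ; (inj₂ (_ , p)) → right≰ d p }) , λ (_ , g , _) → tt , gr-right (fin n) d g , z≤n
            go (inf , d) v = atPoint (inf , right d) (upper↑ v d≤) , right≰ d , λ (_ , g , _) → tt , gr-right inf d g , z≤n
              where
                d≤ : d ≤ᴰ right d
                d≤ with ≤ᴰ-total d (right d)
                ... | inj₁ p = p
                ... | inj₂ p = ⊥-elim (right≰ d p)
        lv-mono : ∀ {a b n} → a ≲ b → Lv b n → ∃[ m ] m ≤ n × Lv a m
        lv-mono {a} {b} {n} le l = go (point a) (point b) refl le (lv-level {b} l)
          where
            go : ∀ p q → point a ≡ p → p ≤ᴾ q → proj₁ q ≡ fin n → ∃[ m ] m ≤ n × Lv a m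
            go (fin m , _) (fin _ , _) eq (inj₁ lt) refl = m , <⇒≤ lt , level-lv {a} (cong proj₁ eq)
            go (fin m , _) (fin _ , _) eq (inj₂ (refl , _)) refl = m , ≤-refl , level-lv {a} (cong proj₁ eq)
        lv-below : ∀ {a n} → Lv a n → ∃[ b ] b ≺ a × Lv b n × (∀ {r} → Gr r a → Gr (suc r) b)
        lv-below {a} {n} l = go (point a) (lv-level {a} l)
          where
            go : ∀ p → proj₁ p ≡ fin n → ∃[ b ] ¬ p ≤ᴾ point b × Lv b n × (∀ {r} → GrRow r (rowOf a) × GrPoint r p × position a ≤ r → Gr (suc r) b)
            go (fin n , d) refl = atPoint (fin n , left d) tt ,
              (λ { (inj₁ p) → <-irrefl refl p ; (inj₂ (_ , p)) → left≱ d p }) ,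
              level-lv {atPoint (fin n , left d) tt} refl , λ (_ , g , _) → tt , gr-left (fin n) d g , z≤n
        lv-above : ∀ {a n} → Lv a n → ∃[ b ] a ≺ b × Lv b n × (∀ {r} → Gr r a → Gr (suc r) b)
        lv-above {a} {n} l = go (point a) (lv-level {a} l)
          where
            go : ∀ p → proj₁ p ≡ fin n → ∃[ b ] ¬ point b ≤ᴾ p × Lv b n × (∀ {r} → GrRow r (rowOf a) × GrPoint r p × position a ≤ r → Gr (suc r) b)
            go (fin n , d) refl = atPoint (fin n , right d) tt ,
              (λ { (inj₁ p) → <-irrefl refl p ; (inj₂ (_ , p)) → right≰ d p }) ,
              level-lv {atPoint (fin n , right d) tt} refl , λ (_ , g , _) → tt , gr-right (fin n) d g , z≤n
        sz-parent : ∀ {y x c n} → ¬ Star y → Sz y x (c ▹ n) → ∃[ x′ ] Sz y x′ c × Lv x′ n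
        sz-parent {y} {x} {c} {n} ¬s z =
          let p , s , eq = sig-parent (rowOf y) (proj₁ (valid y)) ¬s (sz⇒sig y x z)
              x′ = atPoint p (sig-point (rowOf y) (proj₁ (valid y)) ¬s s)
          in x′ , sig⇒sz y x′ s , level-lv {x′} eq
        sig-graded : ∀ y {x c r} → y ≢ star → GrRow r y → Sig y c x → GrPoint r x
        sig-graded star ¬s g s = ⊥-elim (¬s refl)
        sig-graded (pts ps t) ¬s (g , _) s = g (At-∈ ps s)
        row : ∀ ns xs n ys → Good S ns → Chain ns xs →
              ∃[ y ] ¬ Star y × NotRow y ys × Has y ns xs ×
                (Lv (hd xs) n → ∀ x → ¬ Sz y x (labels ns ▹ n)) ×
                (∀ {r} → Sm r (labels ns) → (∀ i → Gr r (lookup xs i)) →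
                 (∀ {z} → z ∈ ys → Gr r z) → Gr (suc r) y)
        row ns xs n ys g ch = y , (λ ()) , newRow-fresh ps v ys , has-pointsOf y ns xs id ch ,
            -- The forbidden index is that of a further point on the list, and all indices on the
            -- list are smaller.
            (λ l x z → let f , eq = finite-pointsOf ns xs ch l in
                       <-irrefl (cong labels (sym eq)) (At-< ps f (sz⇒sig y x z))) ,
            λ sm gx gz → newRow-graded ps v ys
              (λ i → let j , eq = ∈-pointsOf ns xs i in subst (GrPoint _) (sym eq) (proj₁ (proj₂ (gx j))))
              (≤-trans (≤-reflexive (length-pointsOf ns xs)) (s≤s (≤-trans (length≤labels ns) sm))) gz
          where
            ps = pointsOf ns xs
            v = valid-pointsOf ns xs g ch
            y = newRow ps v ys

-- Isomorphisms between countable structures.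

module CountableIsomorphism where

  open Arithmetic
  open Structures
  open Steps
  open Responses
  open Games

  -- Every stage of the back-and-forth construction treats the elements with the
  -- same number on both sides.
  module BackAndForth (cl : Classical) {S : ℕ → ℕ} {M N : Structure L₃}
                      (axM : Axioms′ S M) (axN : Axioms′ S N)
                      (countM : Structure.Carrier M ↣ ℕ) (countN : Structure.Carrier N ↣ ℕ) where
    open Classical cl
    private
      Any : ℕ → Set
      Any _ = ⊤

      any-down : ∀ {m n} → m ≤ n → Any n → Any m
      any-down _ _ = tt

      module G = Game cl axM axN Any any-down
      module H = Game cl axN axM Any any-down
      module GS = Step cl axM axN Any any-down
      module HS = Step cl axN axM Any any-down
      Ready : ℕ → Set
      Ready _ = ⊤

    -- All numbers are visible now. The seed `xs₀` allows the least points of infinite level to be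
    -- matched before the construction starts; otherwise a later move could demand a point below a
    -- least one.
    module _ (wf : Acc (Theory._⊏_ cl axM Any any-down) 0)
             {xs₀} (start : ∃[ ys ] G.State 0 xs₀ ys [])
             (tailM : ∀ {xs r} → xs₀ G.⊆ xs → GS.Tail xs r)
             (tailN : ∀ {xs r} → flipped xs₀ H.⊆ xs → HS.Tail xs r) where
      private
        module GM = G.Moves Ready _ (λ _ _ _ → tt) wf 0 (λ _ _ _ → tt)
        module HM = H.Moves Ready _ (λ _ _ _ → tt) wf 0 (λ _ _ _ → tt)

        codeM : Structure.Carrier M → ℕ
        codeM = Injection.to countM

        codeN : Structure.Carrier N → ℕ
        codeN = Injection.to countN

      record Stage : Set where
        field
          {xs ys ws} : GS.Pairs
          state      : G.State 0 xs ys ws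
          initial    : xs₀ G.⊆ xs

      open Stage

      forth : (s : Stage) → ∀ a → Σ[ t ∈ Stage ] ws s G.⊆ ws t × ∃[ b ] (a , b) ∈ ws t
      forth s a =
        let xs′ , ys′ , b , sub , st = GM.addElement {r = 0} (state s) tt (λ sub _ → tailM {r = 0} (λ i → sub (initial s i))) (λ _ _ → tt) a
        in record { state = G.regrade _ st ; initial = λ {p} i → sub (initial s {p} i) } , there , b , here refl

      back : (s : Stage) → ∀ b → Σ[ t ∈ Stage ] ws s G.⊆ ws t × ∃[ a ] (a , b) ∈ ws t
      back s b =
        let flipped₀ = λ {p} (i : p ∈ flipped xs₀) → flipped-∈ (initial s (∈-flipped i))
            xs′ , ys′ , a , sub , st = HM.addElement {r = 0} (flip cl any-down axM axN axN axM (λ _ → tt) (state s)) tt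
                                         (λ sub _ → tailN {r = 0} (λ i → sub (flipped₀ i))) (λ _ _ → tt) b
        in record { state = flip cl any-down axN axM axM axN (λ _ → tt) st
                  ; initial = λ {p} i → flipped-∈ (sub (flipped-∈ (initial s {p} i))) } ,
           (λ i → flipped-∈ (there (flipped-∈ i))) , a , flipped-∈ (here refl)

      pickM : ∀ n (s : Stage) → Dec (∃[ a ] codeM a ≡ n) →
              Σ[ t ∈ Stage ] ws s G.⊆ ws t × (∀ a → codeM a ≡ n → ∃[ b ] (a , b) ∈ ws t)
      pickM n s (no none) = s , id , λ a eq → ⊥-elim (none (a , eq))
      pickM n s (yes (a , refl)) =
        let t , sub , b , i = forth s a in
        t , sub , λ a′ eq → b , subst (λ a → (a , b) ∈ ws t) (Injection.injective countM (sym eq)) i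

      pickN : ∀ n (s : Stage) → Dec (∃[ b ] codeN b ≡ n) →
              Σ[ t ∈ Stage ] ws s G.⊆ ws t × (∀ b → codeN b ≡ n → ∃[ a ] (a , b) ∈ ws t)
      pickN n s (no none) = s , id , λ b eq → ⊥-elim (none (b , eq))
      pickN n s (yes (b , refl)) =
        let t , sub , a , i = back s b in
        t , sub , λ b′ eq → a , subst (λ b → (a , b) ∈ ws t) (Injection.injective countN (sym eq)) i

      stage : ℕ → Stage
      stage zero    = record { state = proj₂ start ; initial = id }
      stage (suc n) = proj₁ (pickN n (proj₁ (pickM n (stage n) (em _))) (em _))

      stage-suc : ∀ n → ws (stage n) G.⊆ ws (stage (suc n))
      stage-suc n i = proj₁ (proj₂ (pickN n (proj₁ (pickM n (stage n) (em _))) (em _)))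
                            (proj₁ (proj₂ (pickM n (stage n) (em _))) i)

      stage+ : ∀ k n → ws (stage n) G.⊆ ws (stage (k + n))
      stage+ zero    n i = i
      stage+ (suc k) n i = stage-suc (k + n) (stage+ k n i)

      Match : Structure.Carrier M → Structure.Carrier N → Set
      Match a b = ∃[ n ] (a , b) ∈ ws (stage n)

      matchM : ∀ a → ∃[ b ] Match a b
      matchM a =
        let n = codeM a
            b , i = proj₂ (proj₂ (pickM n (stage n) (em _))) a refl
        in b , suc n , proj₁ (proj₂ (pickN n (proj₁ (pickM n (stage n) (em _))) (em _))) i

      matchN : ∀ b → ∃[ a ] Match a b
      matchN b =
        let n = codeN b
            a , i = proj₂ (proj₂ (pickN n (proj₁ (pickM n (stage n) (em _))) (em _))) b refl
        in a , suc n , i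

      common : ∀ {a b a′ b′} → Match a b → Match a′ b′ → ∃[ n ] (a , b) ∈ ws (stage n) × (a′ , b′) ∈ ws (stage n)
      common {a′ = a′} {b′} (n , i) (m , j) = m + n , stage+ m n i , subst (λ k → (a′ , b′) ∈ ws (stage k)) (+-comm n m) (stage+ n m j)

      match-≡ : ∀ {a b a′ b′} → Match a b → Match a′ b′ → (a ≡ a′) ⇔ (b ≡ b′)
      match-≡ p q = let n , i , j = common p q in G.State.exactly (state (stage n)) i j

      f : Structure.Carrier M → Structure.Carrier N
      f a = proj₁ (matchM a)

      matched : ∀ a → Match a (f a)
      matched a = proj₂ (matchM a)

      isomorphic : M ≅ N
      isomorphic = record
        { bijection = mk⤖ {to = f}
            ( (λ {a} {a′} eq → from (match-≡ (matched a) (matched a′)) eq)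
            , (λ b → let a , m = matchN b in a , λ { {z} refl → to (match-≡ (matched a) m) refl }) )
        ; preservesᶠ = λ ()
        ; preservesʳ = λ where
            0F (a ∷ b ∷ []) → let n , i , j = common (matched a) (matched b) in G.State.≲-agree (state (stage n)) i j
            1F (a ∷ b ∷ []) → let n , i , j = common (matched a) (matched b) in G.State.~-agree (state (stage n)) i j
            2F (a ∷ [])     → let n , i = matched a in G.State.star-agree (state (stage n)) i
        }

-- Invariants of the models and their classification over a well-founded tree.

module Classification where

  open Arithmetic
  open Structures
  open Steps
  open Responses
  open Games
  open Dyadic
  open StandardModels
  open CountableIsomorphism

  codeLevel : Level′ → ℕ
  codeLevel (fin n) = suc n
  codeLevel inf     = 0

  codePoint : Point → ℕ
  codePoint (l , m , k) = ⟪ codeLevel l , ⟪ m , k ⟫ ⟫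

  codePoints : List Point → ℕ
  codePoints []       = 0
  codePoints (p ∷ ps) = codePoints ps ▹ codePoint p

  codeRow : Row → ℕ
  codeRow star       = 0
  codeRow pth        = 1
  codeRow (pts ps t) = suc (suc ⟪ codePoints ps , t ⟫)

  codeRaw : Raw → ℕ
  codeRaw (y , x , k) = ⟪ codeRow y , ⟪ codePoint x , k ⟫ ⟫

  codeLevel-injective : ∀ {l l′} → codeLevel l ≡ codeLevel l′ → l ≡ l′
  codeLevel-injective {fin n} {fin .n} refl = refl
  codeLevel-injective {inf}   {inf}    eq   = refl

  codePoint-injective : ∀ {x x′} → codePoint x ≡ codePoint x′ → x ≡ x′
  codePoint-injective {l , m , k} {l′ , m′ , k′} eq =
    let p , q = pair-injective {codeLevel l} {⟪ m , k ⟫} {codeLevel l′} {⟪ m′ , k′ ⟫} eq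
        r , s = pair-injective {m} {k} {m′} {k′} q
    in cong₂ _,_ (codeLevel-injective p) (cong₂ _,_ r s)

  codePoints-injective : ∀ {ps ps′} → codePoints ps ≡ codePoints ps′ → ps ≡ ps′
  codePoints-injective {[]}     {[]}       eq = refl
  codePoints-injective {p ∷ ps} {p′ ∷ ps′} eq =
    let a , b = ▹-injective {codePoints ps} {codePoint p} {codePoints ps′} {codePoint p′} eq
    in cong₂ _∷_ (codePoint-injective b) (codePoints-injective a)

  codeRow-injective : ∀ {y y′} → codeRow y ≡ codeRow y′ → y ≡ y′
  codeRow-injective {star}     {star}       eq = refl
  codeRow-injective {pth}      {pth}        eq = refl
  codeRow-injective {pts ps t} {pts ps′ t′} eq =
    let a , b = pair-injective {codePoints ps} {t} {codePoints ps′} {t′} (suc-injective (suc-injective eq))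
    in cong₂ pts (codePoints-injective a) b

  codeRaw-injective : ∀ {w w′} → codeRaw w ≡ codeRaw w′ → w ≡ w′
  codeRaw-injective {y , x , k} {y′ , x′ , k′} eq =
    let p , q = pair-injective {codeRow y} {⟪ codePoint x , k ⟫} {codeRow y′} {⟪ codePoint x′ , k′ ⟫} eq
        r , s = pair-injective {codePoint x} {k} {codePoint x′} {k′} q
    in cong₂ _,_ (codeRow-injective p) (cong₂ _,_ (codePoint-injective r) s)

  countable : ∀ cl κ → Model.Element cl κ ↣ ℕ
  countable cl κ = mk↣ {to = codeRaw ∘ proj₁} (λ eq → Model.element-≡ cl κ (codeRaw-injective eq))

  module _ (M : Structure L₃) where
    open Structure M
    open Str M

    Infinite : Carrier → Set
    Infinite x = ∀ n → ¬ Lv x n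

    -- `HasPath` avoids mentioning the tree: a finite list has bounded indices, so in the concrete
    -- models only the row along a path has finite cells of unbounded size.
    HasInfinite HasLeast HasPath : Set
    HasInfinite = ∃[ x ] Infinite x
    HasLeast    = ∃[ x ] Infinite x × (∀ z → Infinite z → x ≲ z)
    HasPath     = ∃[ y ] ¬ Star y × (∀ b → ∃[ c ] b < c × ∃[ x ] Sz y x c)

  module Invariance {M N : Structure L₃} (iso : M ≅ N) where
    private
      module M where
        open Structure M public
        open Str M public
      module N where
        open Structure N public
        open Str N public
      open module B = Bijection (_≅_.bijection iso) using () renaming (to to h)
      open _≅_ iso

    preimage : ∀ b → ∃[ a ] h a ≡ b
    preimage b = let a , eq = B.surjective b in a , eq refl

    notIn-h : ∀ w es → NotIn w es ⇔ NotIn (h w) (List.map h es)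
    notIn-h w []       = ⇔-refl
    notIn-h w (e ∷ es) = mk⇔ (λ (p , q) → (λ eq → p (B.injective eq)) , to (notIn-h w es) q)
                             (λ (p , q) → (λ eq → p (cong h eq)) , from (notIn-h w es) q)

    exact-h : ∀ {P : M.Carrier → Set} {Q : N.Carrier → Set} → (∀ w → P w ⇔ Q (h w)) →
              ∀ k es → Exact P k es ⇔ Exact Q k (List.map h es)
    exact-h {P} {Q} pq zero es = mk⇔ fwd
        (λ E w p ∉ → E (h w) (to (pq w) p) (to (notIn-h w es) ∉))
      where
        fwd : Exact P zero es → Exact Q zero (List.map h es)
        fwd E b q ∉ with preimage b
        ... | w , refl = E w (from (pq w) q) (from (notIn-h w es) ∉)
    exact-h {P} {Q} pq (suc k) es = mk⇔
        (λ (w , p , ∉ , E) → h w , to (pq w) p , to (notIn-h w es) ∉ , to (exact-h pq k (w ∷ es)) E) bwd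
      where
        bwd : Exact Q (suc k) (List.map h es) → Exact P (suc k) es
        bwd (b , q , ∉ , E) with preimage b
        ... | w , refl = w , from (pq w) q , from (notIn-h w es) ∉ , from (exact-h pq k (w ∷ es)) E

    ≲-h : ∀ a b → (a M.≲ b) ⇔ (h a N.≲ h b)
    ≲-h a b = preservesʳ 0F (a ∷ b ∷ [])

    star-h : ∀ a → M.Star a ⇔ N.Star (h a)
    star-h a = preservesʳ 2F (a ∷ [])

    sz-h : ∀ y x c → M.Sz y x c ⇔ N.Sz (h y) (h x) c
    sz-h y x c = exact-h (λ w → mk⇔
      (λ (a , b , c) → to (preservesʳ 1F (w ∷ y ∷ [])) a , to (≲-h w x) b , to (≲-h x w) c)
      (λ (a , b , c) → from (preservesʳ 1F (w ∷ y ∷ [])) a , from (≲-h w x) b , from (≲-h x w) c)) (suc c) []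

    lv-h : ∀ x n → M.Lv x n ⇔ N.Lv (h x) n
    lv-h x n = mk⇔ (λ (p , s , z) → h p , to (star-h p) s , to (sz-h p x n) z) bwd
      where
        bwd : N.Lv (h x) n → M.Lv x n
        bwd (q , s , z) with preimage q
        ... | p , refl = p , from (star-h p) s , from (sz-h p x n) z

    infinite-h : ∀ x → Infinite M x ⇔ Infinite N (h x)
    infinite-h x = mk⇔ (λ f n l → f n (from (lv-h x n) l)) (λ f n l → f n (to (lv-h x n) l))

    hasInfinite : HasInfinite M ⇔ HasInfinite N
    hasInfinite = mk⇔ (λ (x , i) → h x , to (infinite-h x) i) bwd
      where
        bwd : HasInfinite N → HasInfinite M
        bwd (b , i) with preimage b
        ... | a , refl = a , from (infinite-h a) i

    hasLeast : HasLeast M ⇔ HasLeast N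
    hasLeast = mk⇔ (λ (x , i , l) → h x , to (infinite-h x) i , fwd l) bwd
      where
        fwd : ∀ {x} → (∀ z → Infinite M z → x M.≲ z) → ∀ z → Infinite N z → h x N.≲ z
        fwd l z i with preimage z
        ... | a , refl = to (≲-h _ a) (l a (from (infinite-h a) i))
        bwd : HasLeast N → HasLeast M
        bwd (b , i , l) with preimage b
        ... | a , refl = a , from (infinite-h a) i , λ z j → from (≲-h a z) (l (h z) (to (infinite-h z) j))

    hasPath : HasPath M ⇔ HasPath N
    hasPath = mk⇔ (λ (y , ¬s , p) → h y , (λ s → ¬s (from (star-h y) s)) ,
                     λ b → let c , lt , x , z = p b in c , lt , h x , to (sz-h y x c) z) bwd
      where
        pull : ∀ {y b} → ∃[ c ] b < c × ∃[ x ] N.Sz (h y) x c → ∃[ c ] b < c × ∃[ x ] M.Sz y x c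
        pull (c , lt , x , z) with preimage x
        ... | a , refl = c , lt , a , from (sz-h _ a c) z
        bwd : HasPath N → HasPath M
        bwd (y , ¬s , p) with preimage y
        ... | a , refl = a , (λ s → ¬s (to (star-h a) s)) , λ b → pull (p b)

  -- The part of infinite level is empty, has no least element, or has one.
  data Shape : Set where
    no∞ open∞ closed∞ : Shape

  -- `(0 , 0)` is the fraction 1, so the closed part is a half-line with this least element; the
  -- open one is all of the positive dyadics.
  upperPart : Shape → Dyadic → Set
  upperPart no∞   a = ⊥
  upperPart open∞  a = ⊤
  upperPart closed∞ a = (0 , 0) ≤ᴰ a

  kind : Shape → (ℕ → ℕ) → Kind
  kind s S = record
    { S = S ; upper = upperPart s ; upper↑ = λ {a} {b} → upwards s a b
    ; onPath = ⊥ ; path = λ _ → 0 ; good = λ () }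
    where
      upwards : ∀ s a b → upperPart s a → a ≤ᴰ b → upperPart s b
      upwards open∞  a b p q = tt
      upwards closed∞ a b p q = ≤ᴰ-trans {0 , 0} {a} {b} p q

  kindPath : (S f : ℕ → ℕ) → (∀ i → S (labels (prefix f i)) ≡ 0) → Kind
  kindPath S f good = record
    { S = S ; upper = λ _ → ⊥ ; upper↑ = λ () ; onPath = ⊤ ; path = f ; good = λ _ → good }

  module Profiles (cl : Classical) (S : ℕ → ℕ) where
    open Classical cl

    model : Shape → Structure L₃
    model s = Model.structure cl (kind s S)

    module _ (κ : Kind) where
      open Model cl κ

      infinite-point : ∀ w → Infinite structure w ⇔ (proj₁ (point w) ≡ inf)
      infinite-point w = mk⇔ fwd bwd
        where
          fwd : Infinite structure w → proj₁ (point w) ≡ inf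
          fwd i with proj₁ (point w) in eq
          ... | fin n = ⊥-elim (i n (level-lv {w} eq))
          ... | inf   = refl
          bwd : proj₁ (point w) ≡ inf → Infinite structure w
          bwd eq n l with trans (sym eq) (lv-level {w} l)
          ... | ()

      no-infinite : (∀ a → ¬ Kind.upper κ a) → ¬ HasInfinite structure
      no-infinite empty (w , i) with point w | proj₁ (proj₂ (valid w)) | to (infinite-point w) i
      ... | inf , a | u | refl = empty a u

      -- Every remaining row other than the star row is a finite list, and the indices on it have a
      -- maximum.
      no-path : ¬ Kind.onPath κ → ¬ HasPath structure
      no-path ¬p (y , ¬s , f) = go (rowOf y) refl (proj₁ (valid y))
        where
          bound : ∀ ps → ∃[ b ] (∀ {c x} → At ps c x → c ≤ b)
          bound []       = 0 , λ ()
          bound (p ∷ ps) = let b , h = bound ps in pts# ps ⊔ b ,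
            λ { (inj₁ (_ , refl)) → m≤m⊔n _ b ; (inj₂ a) → ≤-trans (h a) (m≤n⊔m (pts# ps) b) }
          go : ∀ r → rowOf y ≡ r → ValidRow r → ⊥
          go star       eq v = ¬s eq
          go pth        eq v = ¬p v
          go (pts ps t) eq v =
            let b , h = bound ps
                c , lt , x , z = f b
            in <⇒≱ lt (h (subst (λ r → Sig r c (point x)) eq (sz⇒sig y x z)))

    has-path : ∀ f good → HasPath (Model.structure cl (kindPath S f good))
    has-path f good = y , (λ ()) , λ b → labels (prefix f (suc b)) , b<labels b , x (suc b) ,
        sig⇒sz y (x (suc b)) (suc b , refl , refl)
      where
        open Model cl (kindPath S f good)
        y = atPosition pth (fin 0 , 0 , 0) {0} tt tt (λ _ _ → z≤n)
        x : ℕ → Element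
        x i = atPoint (fin (f i) , i , 0) tt
        b<labels : ∀ b → b < labels (prefix f (suc b))
        b<labels zero    = s≤s z≤n
        b<labels (suc b) = ≤-<-trans (b<labels b) (s<▹ (labels (prefix f (suc b))) (f (suc b)))

    module _ (s : Shape) where
      private
        κ = kind s S
      open Model cl κ

      ∞-point : ∀ a → upperPart s a → ∃[ w ] point w ≡ (inf , a) × Infinite structure w
      ∞-point a u = atPoint (inf , a) u , refl , from (infinite-point κ (atPoint (inf , a) u)) refl

    open-infinite : HasInfinite (model open∞)
    open-infinite = let w , _ , i = ∞-point open∞ (0 , 0) tt in w , i

    open-below : ∀ {b} → Infinite (model open∞) b → ∃[ w ] Infinite (model open∞) w × Str._≺_ (model open∞) w b
    open-below {b} i = go (point b) (to (infinite-point (kind open∞ S) b) i)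
      where
        open Model cl (kind open∞ S)
        go : ∀ p → proj₁ p ≡ inf → ∃[ w ] Infinite structure w × ¬ p ≤ᴾ point w
        go (inf , a) refl = let w , eq , i = ∞-point open∞ (left a) tt in w , i ,
          λ le → left≱ a (subst ((inf , a) ≤ᴾ_) eq le)

    open-no-least : ¬ HasLeast (model open∞)
    open-no-least (x , i , l) = let w , j , lt = open-below {x} i in lt (l w j)

    closed-least : HasLeast (model closed∞)
    closed-least = let w , eq , i = ∞-point closed∞ (0 , 0) ≤-refl in w , i , λ z j →
        subst (_≤ᴾ point z) (sym eq) (go (point z) (to (infinite-point (kind closed∞ S) z) j) (proj₁ (proj₂ (valid z))))
      where
        open Model cl (kind closed∞ S)
        go : ∀ p → proj₁ p ≡ inf → ValidPoint p → (inf , 0 , 0) ≤ᴾ p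
        go (inf , a) refl u = u

    private
      Any : ℕ → Set
      Any _ = ⊤

      any-down : ∀ {m n} → m ≤ n → Any n → Any m
      any-down _ _ = tt

    -- A code that is not accessible lies on an infinite path.
    well-founded : S 0 ≡ 0 → ¬ (∃[ f ] (∀ i → S (labels (prefix f i)) ≡ 0)) →
                   ∀ {M Gr Sm} (ax : Axioms S M Gr Sm) → Acc (Theory._⊏_ cl ax Any any-down) 0
    well-founded s₀ pathless ax with em (Acc (Theory._⊏_ cl ax Any any-down) 0)
    ... | yes a = a
    ... | no ¬a = ⊥-elim (pathless (f , ok))
      where
        Bad : Set
        Bad = Σ[ c ∈ ℕ ] ¬ Acc (Theory._⊏_ cl ax Any any-down) c
        next : (b : Bad) → ∃[ n ] S (proj₁ b ▹ n) ≡ 0 × ¬ Acc (Theory._⊏_ cl ax Any any-down) (proj₁ b ▹ n)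
        next (c , ¬acc) = dne λ none → ¬acc (acc λ { (n , refl , _ , s) → dne λ ¬acc′ → none (n , s , ¬acc′) })
        bad : ℕ → Bad
        bad zero    = 0 , ¬a
        bad (suc i) = proj₁ (bad i) ▹ proj₁ (next (bad i)) , proj₂ (proj₂ (next (bad i)))
        f : ℕ → ℕ
        f i = proj₁ (next (bad i))
        code≡ : ∀ i → labels (prefix f i) ≡ proj₁ (bad i)
        code≡ zero    = refl
        code≡ (suc i) = cong (_▹ f i) (code≡ i)
        ok : ∀ i → S (labels (prefix f i)) ≡ 0
        ok zero    = s₀
        ok (suc i) = trans (cong (λ c → S (c ▹ f i)) (code≡ i)) (proj₁ (proj₂ (next (bad i))))

    module _ {M N : Structure L₃} (axM : Axioms′ S M) (axN : Axioms′ S N) where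
      private
        module G = Game cl axM axN Any any-down
        module T = Step cl axM axN Any any-down

      startEmpty : G.State 0 [] [] []
      startEmpty = record
        { points = record { order = λ () ; level = λ () }
        ; rows = λ () ; stars = λ () ; sizes→ = λ () ; sizes← = λ () ; pointOf = λ () ; rowOf = λ ()
        ; exactly = λ () ; grx = λ () ; gry = λ () ; grw = λ () }

      startPair : ∀ {a b} → Infinite M a → Infinite N b → G.State 0 ((a , b) ∷ []) [] []
      startPair i j = record
        { points = record
          { order = λ { (here refl) (here refl) → mk⇔ (λ _ → Theory.≲-refl cl axN) (λ _ → Theory.≲-refl cl axM) }
          ; level = λ { (here refl) n _ → mk⇔ (λ l → ⊥-elim (i n l)) (λ l → ⊥-elim (j n l)) } }
        ; rows = λ () ; stars = λ () ; sizes→ = λ () ; sizes← = λ () ; pointOf = λ () ; rowOf = λ ()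
        ; exactly = λ () ; grx = λ _ → tt ; gry = λ () ; grw = λ () }

      tailNone : ¬ HasInfinite M → ∀ {xs r} → T.Tail xs r
      tailNone bounded big = ⊥-elim (bounded (_ , λ n l → big n tt l))

      tailOpen : HasInfinite N → ¬ HasLeast N → ∀ {xs r} → T.Tail xs r
      tailOpen (b , i) leastless _ = inj₂ ((b , (λ n _ → i n) , tt) , λ {b} big →
        let b′ , j , lt = further b (λ n → big n tt) in b′ , (λ n _ → j n) , lt , λ _ → tt)
        where
          further : ∀ b → Infinite N b → ∃[ b′ ] Infinite N b′ × ¬ Str._≲_ N b b′
          further b i = dne λ none → leastless (b , i , λ z j → dne λ ¬le → none (z , j , ¬le))

      -- The least infinite point has been matched and lies below every other, so a new one is
      -- always placed above a matched one.
      tailPair : ∀ {a b} → Infinite M a → (∀ z → Infinite M z → Str._≲_ M a z) →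
                 ∀ {xs r} → (a , b) ∈ xs → T.Tail xs r
      tailPair i l m big = inj₁ (_ , m , (λ n _ → i n) , l _ (λ n → big n tt))

    -- A missing path makes every list finite, so the only obstacle to back and forth is at the
    -- bottom of the part of infinite level; each of the three shapes comes with its own reason for
    -- `Tail` on both sides.
    classify : S 0 ≡ 0 → ¬ (∃[ f ] (∀ i → S (labels (prefix f i)) ≡ 0)) →
               ∀ {N} → Axioms′ S N → Structure.Carrier N ↣ ℕ → ∃[ s ] N ≅ model s
    classify s₀ pathless {N} axN count with em (HasInfinite N)
    ... | no ¬i = no∞ , BackAndForth.isomorphic cl axN ax count (countable cl κ) (well-founded s₀ pathless axN)
            ([] , startEmpty axN ax) (λ _ → tailNone axN ax ¬i {r = 0}) (λ {xs} _ {a} → tailNone ax axN (no-infinite κ (λ _ ())) {xs} {0} {a})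
      where
        κ = kind no∞ S
        ax = forget (Model.axioms cl κ)
    ... | yes i with em (HasLeast N)
    ...   | no ¬l = open∞ , BackAndForth.isomorphic cl axN ax count (countable cl κ) (well-founded s₀ pathless axN)
            ([] , startEmpty axN ax) (λ _ → tailOpen axN ax open-infinite open-no-least {r = 0}) (λ {xs} _ {a} → tailOpen ax axN i ¬l {xs} {0} {a})
      where
        κ = kind open∞ S
        ax = forget (Model.axioms cl κ)
    ...   | yes (a , ia , la) with closed-least
    ...     | b , ib , lb = closed∞ , BackAndForth.isomorphic cl axN ax count (countable cl κ) (well-founded s₀ pathless axN)
            ([] , startPair axN ax {a} {b} ia ib) (λ sub → tailPair axN ax {a} {b} ia la {r = 0} (sub (here refl)))
            (λ {xs} sub {c} → tailPair ax axN {b} {a} ib lb {xs} {0} (sub (here refl)) {c})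
      where
        κ = kind closed∞ S
        ax = forget (Model.axioms cl κ)

-- A primitive recursive evaluator for formulas.

module Arithmetization where

  open Arithmetic

  private
    variable
      n : ℕ
      f g h : Vec ℕ n → ℕ

  powC : Fun₁ (2 ^_)
  powC = fun₁ (ext (λ { (k ∷ []) → eq k }) (nrecC (lit 1) (ap₂ mulC (lit 2) (arg 1F)) (arg 0F)))
    where
      eq : ∀ k → natrec 1 (λ _ y → 2 * y) k ≡ 2 ^ k
      eq zero    = refl
      eq (suc k) = cong (2 *_) (eq k)

  open Computable

  call₃ : ∀ {m n} {G : Vec ℕ (3 + m) → ℕ} {a b c : Vec ℕ n → ℕ} → Computable G →
          Computable a → Computable b → Computable c → (r : Fin m → Fin n) →
          Computable (λ ρ → G (a ρ ∷ b ρ ∷ c ρ ∷ tabulate (λ i → lookup ρ (r i))))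
  call₃ {G = G} GC A B C r = computable (call (term GC) (term A ∷ term B ∷ term C ∷ tabulate (λ i → var (r i))))
    (λ ρ → trans (correct GC _) (cong G (cong₂ _∷_ (correct A ρ) (cong₂ _∷_ (correct B ρ)
                   (cong₂ _∷_ (correct C ρ) (⟦tabulate⟧ r ρ))))))

  weaken₂ : {f : Vec ℕ n → ℕ} → Computable f → Computable {2 + n} (λ { (a ∷ b ∷ ρ) → f ρ })
  weaken₂ {f = f} F = computable (call (term F) (tabulate (λ i → var (suc (suc i)))))
    (λ { (a ∷ b ∷ ρ) → trans (correct F _) (cong f (trans (⟦tabulate⟧ (λ i → suc (suc i)) (a ∷ b ∷ ρ)) (tabulate∘lookup ρ))) })

  sfoldC : {z : Vec ℕ n → ℕ} {G : Vec ℕ (3 + n) → ℕ} {c : Vec ℕ n → ℕ} →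
           Computable z → Computable G → Computable c →
           Computable (λ ρ → sfold (z ρ) (λ r s a → G (r ∷ s ∷ a ∷ ρ)) (c ρ))
  sfoldC {n} {z} {G} Z GC C = covC {G = step} (ext (λ { (k ∷ h ∷ ρ) → refl }) (nrecC (weaken₂ Z) inner (arg 0F))) C
    where
      step : Vec ℕ (2 + n) → ℕ
      step (k ∷ h ∷ ρ) = sfoldStep (z ρ) (λ r s a → G (r ∷ s ∷ a ∷ ρ)) k h
      inner : Computable {4 + n} (λ { (m ∷ _ ∷ k ∷ h ∷ ρ) → G (at h (m ∸ π₁ m) ∷ π₁ m ∷ π₂ m ∷ ρ) })
      inner = ext (λ { (m ∷ y ∷ k ∷ h ∷ ρ) → cong (λ ρ′ → G (_ ∷ _ ∷ _ ∷ ρ′)) (tabulate∘lookup ρ) })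
        (call₃ GC (ap₂ atC (arg 3F) (ap₂ subC (arg 0F) (ap₁ π₁C (arg 0F)))) (ap₁ π₁C (arg 0F)) (ap₁ π₂C (arg 0F))
               (λ i → suc (suc (suc (suc i)))))

  boolC : {b p q : Vec ℕ n → Bool} → Decidableᵇ b → Decidableᵇ p → Decidableᵇ q →
          Decidableᵇ (λ ρ → if b ρ then p ρ else q ρ)
  boolC {b = b} B P Q = ext (λ ρ → eq (b ρ)) (ifC B P Q)
    where
      eq : ∀ c {p q} → (if c then b2n p else b2n q) ≡ b2n (if c then p else q)
      eq true  = refl
      eq false = refl

  len : ℕ → ℕ
  len = sfold 0 (λ r _ _ → suc r)

  lenC : Fun₁ len
  lenC = fun₁ (sfoldC (lit 0) (sucC (arg 0F)) (arg 0F))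

  -- `fin n` is coded by `n + 1` and the infinite level by 0, so the predecessor agrees with
  -- `level#`, including its default.
  levelN : ℕ → ℕ
  levelN p = pred (π₁ p)

  levelNC : Fun₁ levelN
  levelNC = fun₁ (ap₁ predC (ap₁ π₁C (arg 0F)))

  levelsN : ℕ → ℕ
  levelsN = sfold 0 (λ r _ p → r ▹ levelN p)

  levelsNC : Fun₁ levelsN
  levelsNC = fun₁ (sfoldC (lit 0) (ap₂ ▹C (arg 0F) (ap₁ levelNC (arg 2F))) (arg 0F))

  memberN : ℕ → ℕ → ℕ
  memberN p = sfold 0 (λ r _ q → if p ≡ᵇ q then 1 else r)

  memberNC : Fun₂ memberN
  memberNC = fun₂ (sfoldC (lit 0) (ifC (eqC (arg 3F) (arg 2F)) (lit 1) (arg 0F)) (arg 1F))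

  -- One more than the index of p among the points s, and 0 if there is none.
  indexN : ℕ → ℕ → ℕ
  indexN p = sfold 0 (λ r s q → if p ≡ᵇ q then suc (levelsN s) else r)

  indexNC : Fun₂ indexN
  indexNC = fun₂ (sfoldC (lit 0) (ifC (eqC (arg 3F) (arg 2F)) (sucC (ap₁ levelsNC (arg 1F))) (arg 0F)) (arg 1F))

  numerN : ℕ → ℕ
  numerN p = suc (2 * π₁ (π₂ p))

  numerNC : Fun₁ numerN
  numerNC = fun₁ (sucC (ap₂ mulC (lit 2) (ap₁ π₁C (ap₁ π₂C (arg 0F)))))

  denomN : ℕ → ℕ
  denomN p = 2 ^ π₂ (π₂ p)

  denomNC : Fun₁ denomN
  denomNC = fun₁ (ap₁ powC (ap₁ π₂C (ap₁ π₂C (arg 0F))))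

  pointN : ℕ → ℕ
  pointN w = π₁ (π₂ w)

  pointNC : Fun₁ pointN
  pointNC = fun₁ (ap₁ π₁C (ap₁ π₂C (arg 0F)))

  -- This compares finite levels, the only ones in the model that is evaluated.
  leN : ℕ → ℕ → Bool
  leN p q = (levelN p <ᵇ levelN q) ∨
            ((levelN p ≡ᵇ levelN q) ∧ (numerN p * denomN q <ᵇ suc (numerN q * denomN p)))

  leC : Computable f → Computable g → Decidableᵇ (λ ρ → leN (f ρ) (g ρ))
  leC F G = orC (ltC (ap₁ levelNC F) (ap₁ levelNC G))
    (andC (eqC (ap₁ levelNC F) (ap₁ levelNC G))
          (ltC (ap₂ mulC (ap₁ numerNC F) (ap₁ denomNC G)) (sucC (ap₂ mulC (ap₁ numerNC G) (ap₁ denomNC F)))))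

  truth : Bool → ℕ
  truth b = if b then 2 else 1

  truthC : {p : Vec ℕ n → Bool} → Decidableᵇ p → Computable (λ ρ → truth (p ρ))
  truthC P = ifC P (lit 2) (lit 1)

  isVar : ℕ → ℕ → Bool
  isVar u n = (π₁ u ≡ᵇ 0) ∧ (π₂ u <ᵇ n)

  isVarC : Computable f → Computable g → Decidableᵇ (λ ρ → isVar (f ρ) (g ρ))
  isVarC F G = andC (eqC (ap₁ π₁C F) (lit 0)) (ltC (ap₁ π₂C F) G)

  -- Values of formulas: 0 if ill-formed, 1 if false and 2 if true.

  evalEq : ℕ → ℕ → ℕ
  evalEq e r = if isVar (π₁ r) (len e) ∧ isVar (π₂ r) (len e)
               then truth (at e (π₂ (π₁ r)) ≡ᵇ at e (π₂ (π₂ r))) else 0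

  evalEqC : Fun₂ evalEq
  evalEqC = fun₂ (ifC (andC (isVarC (ap₁ π₁C (arg 1F)) (ap₁ lenC (arg 0F))) (isVarC (ap₁ π₂C (arg 1F)) (ap₁ lenC (arg 0F))))
    (truthC (eqC (ap₂ atC (arg 0F) (ap₁ π₂C (ap₁ π₁C (arg 1F)))) (ap₂ atC (arg 0F) (ap₁ π₂C (ap₁ π₂C (arg 1F))))))
    (lit 0))

  binary : ℕ → ℕ → ℕ → ℕ
  binary k a b = if k ≡ᵇ 0 then truth (leN (pointN a) (pointN b))
                 else if k ≡ᵇ 1 then truth (π₁ a ≡ᵇ π₁ b) else 0

  binaryC : Fun₃ binary
  binaryC = fun₃ (ifC (eqC (arg 0F) (lit 0)) (truthC (leC (ap₁ pointNC (arg 1F)) (ap₁ pointNC (arg 2F))))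
    (ifC (eqC (arg 0F) (lit 1)) (truthC (eqC (ap₁ π₁C (arg 1F)) (ap₁ π₁C (arg 2F)))) (lit 0)))

  evalRel : ℕ → ℕ → ℕ → ℕ
  evalRel e k ts =
    if k ≡ᵇ 2
    then (if isVar (π₁ ts) (len e) ∧ (π₂ ts ≡ᵇ 0) then truth (π₁ (at e (π₂ (π₁ ts))) ≡ᵇ 0) else 0)
    else (if isVar (π₁ ts) (len e) ∧ (isVar (π₁ (π₂ ts)) (len e) ∧ (π₂ (π₂ ts) ≡ᵇ 0))
          then binary k (at e (π₂ (π₁ ts))) (at e (π₂ (π₁ (π₂ ts)))) else 0)

  evalRelC : Fun₃ evalRel
  evalRelC = fun₃ (ifC (eqC (arg 1F) (lit 2))
    (ifC (andC (isVarC u l) (eqC (ap₁ π₂C (arg 2F)) (lit 0))) (truthC (eqC (ap₁ π₁C (ap₂ atC (arg 0F) (ap₁ π₂C u))) (lit 0))) (lit 0))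
    (ifC (andC (isVarC u l) (andC (isVarC w l) (eqC (ap₁ π₂C (ap₁ π₂C (arg 2F))) (lit 0))))
         (ap₃ binaryC (arg 1F) (ap₂ atC (arg 0F) (ap₁ π₂C u)) (ap₂ atC (arg 0F) (ap₁ π₂C w))) (lit 0)))
    where
      u = ap₁ π₁C (arg {3} 2F)
      w = ap₁ π₁C (ap₁ π₂C (arg {3} 2F))
      l = ap₁ lenC (arg {3} 0F)

  negV : ℕ → ℕ
  negV v = if v ≡ᵇ 0 then 0 else truth (not (v ≡ᵇ 2))

  negVC : Fun₁ negV
  negVC = fun₁ (ifC (eqC (arg 0F) (lit 0)) (lit 0) (truthC (notC (eqC (arg 0F) (lit 2)))))

  -- Passes on the ill-formedness of an operand.
  guarded : ℕ → ℕ → ℕ → ℕ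
  guarded a b c = if (a ≡ᵇ 0) ∨ (b ≡ᵇ 0) then 0 else c

  guardedC : Fun₃ guarded
  guardedC = fun₃ (ifC (orC (eqC (arg 0F) (lit 0)) (eqC (arg 1F) (lit 0))) (lit 0) (arg 2F))

  andV orV implV : ℕ → ℕ → ℕ
  andV a b = guarded a b (truth ((a ≡ᵇ 2) ∧ (b ≡ᵇ 2)))
  orV a b = guarded a b (truth ((a ≡ᵇ 2) ∨ (b ≡ᵇ 2)))
  implV a b = guarded a b (truth (not (a ≡ᵇ 2) ∨ (b ≡ᵇ 2)))

  andVC : Fun₂ andV
  andVC = fun₂ (ap₃ guardedC (arg 0F) (arg 1F) (truthC (andC (eqC (arg 0F) (lit 2)) (eqC (arg 1F) (lit 2)))))

  orVC : Fun₂ orV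
  orVC = fun₂ (ap₃ guardedC (arg 0F) (arg 1F) (truthC (orC (eqC (arg 0F) (lit 2)) (eqC (arg 1F) (lit 2)))))

  implVC : Fun₂ implV
  implVC = fun₂ (ap₃ guardedC (arg 0F) (arg 1F) (truthC (orC (notC (eqC (arg 0F) (lit 2))) (eqC (arg 1F) (lit 2)))))

  -- Pairing is monotone, so the largest components of a given grade yield a bound for the code.
  pointBound : ℕ → ℕ
  pointBound r = ⟪ suc r , ⟪ 2 ^ r , r ⟫ ⟫

  pointBoundC : Fun₁ pointBound
  pointBoundC = fun₁ (ap₂ pairC (sucC (arg 0F)) (ap₂ pairC (ap₁ powC (arg 0F)) (arg 0F)))

  pointsBound : ℕ → ℕ → ℕ
  pointsBound r = natrec 0 (λ _ b → b ▹ pointBound r)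

  pointsBoundC : Fun₂ pointsBound
  pointsBoundC = fun₂ (nrecC (lit 0) (ap₂ ▹C (arg 1F) (ap₁ pointBoundC (arg 2F))) (arg 1F))

  opaque
    stageBound : ℕ → ℕ
    stageBound r = suc ⟪ suc (suc ⟪ pointsBound r r , r ⟫) , ⟪ pointBound r , r ⟫ ⟫

    stageBoundC : Fun₁ stageBound
    stageBoundC = fun₁ (sucC (ap₂ pairC (sucC (sucC (ap₂ pairC (ap₂ pointsBoundC (arg 0F) (arg 0F)) (arg 0F))))
                                     (ap₂ pairC (ap₁ pointBoundC (arg 0F)) (arg 0F))))

  -- Elements with codes up to `b` have grade `b`, hence also `C + b`, and by that stage the numbers
  -- up to `C` exist as well. One move played from there ends at this stage.
  stageAfter : ℕ → ℕ → ℕ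
  stageAfter C b = suc (suc (suc C) + suc (C + b))

  stageAfterC : Fun₂ stageAfter
  stageAfterC = fun₂ (ext (λ { (C ∷ b ∷ []) → refl })
    (sucC (ap₂ addC (sucC (sucC (arg {2} 0F))) (sucC (ap₂ addC (arg 0F) (arg 1F))))))

  nextBound : ℕ → ℕ → ℕ
  nextBound C b = stageBound (stageAfter C b)

  nextBoundC : Fun₂ nextBound
  nextBoundC = fun₂ (ext (λ { (C ∷ b ∷ []) → refl }) (ap₁ stageBoundC (ap₂ stageAfterC (arg {2} 0F) (arg 1F))))

  -- The i-th element of a tuple may be chosen below elementBound C i.
  elementBound : ℕ → ℕ → ℕ
  elementBound C = natrec C (λ _ b → nextBound C b)

  elementBoundC : Fun₂ elementBound
  elementBoundC = fun₂ (ext (λ { (C ∷ b ∷ []) → refl }) (nrecC (arg {2} 0F) (ap₂ nextBoundC (arg 2F) (arg 1F)) (arg 1F)))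

  opaque
    nextTuple : ℕ → ℕ → ℕ → ℕ
    nextTuple C i z = suc (z ▹ elementBound C (suc i))

    nextTupleC : Fun₃ nextTuple
    nextTupleC = fun₃ (ext (λ { (C ∷ i ∷ z ∷ []) → refl })
      (sucC (ap₂ ▹C (arg {3} 2F) (ap₂ elementBoundC (arg 0F) (sucC (arg 1F))))))

  tupleBound : ℕ → ℕ → ℕ
  tupleBound C = natrec 1 (λ i z → nextTuple C i z)

  tupleBoundC : Fun₂ tupleBound
  tupleBoundC = fun₂ (ext (λ { (C ∷ b ∷ []) → refl }) (nrecC (lit {2} 1) (ap₃ nextTupleC (arg 2F) (arg 0F) (arg 1F)) (arg 1F)))

  module Evaluator (tree : ℕ → ℕ → ℕ) (treeC : Fun₂ tree) (origin : ℕ) where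

    validPoints : ℕ → ℕ → ℕ
    validPoints x = sfold 1 (λ r s p → b2n ((r ≡ᵇ 1) ∧ ((0 <ᵇ π₁ p) ∧ ((memberN p s ≡ᵇ 0) ∧ (tree x (levelsN s) ≡ᵇ 0)))))

    validPointsC : Fun₂ validPoints
    validPointsC = fun₂ (sfoldC (lit 1)
      (andC (eqC (arg 0F) (lit 1)) (andC (ltC (lit 0) (ap₁ π₁C (arg 2F)))
        (andC (eqC (ap₂ memberNC (arg 2F) (arg 1F)) (lit 0)) (eqC (ap₂ treeC (arg 3F) (ap₁ levelsNC (arg 1F))) (lit 0))))) (arg 1F))

    validPosition : ℕ → ℕ → ℕ → ℕ → Bool
    validPosition x y p k =
      if y ≡ᵇ 0 then k <ᵇ suc (levelN p) else
      -- Code 1 is the row along a path, which the evaluated model does not have.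
      if y ≡ᵇ 1 then false else
      ((validPoints x (π₁ (y ∸ 2)) ≡ᵇ 1) ∧
       ((indexN p (π₁ (y ∸ 2)) ≡ᵇ 0) ∨ (k <ᵇ indexN p (π₁ (y ∸ 2)))))

    validN : ℕ → ℕ → Bool
    validN x w = (0 <ᵇ π₁ (pointN w)) ∧ validPosition x (π₁ w) (pointN w) (π₂ (π₂ w))

    validC : Computable f → Computable g → Decidableᵇ (λ ρ → validN (f ρ) (g ρ))
    validC F G = andC (ltC (lit 0) (ap₁ π₁C p))
        (boolC (eqC y (lit 0)) (ltC k (sucC (ap₁ levelNC p)))
        (boolC (eqC y (lit 1)) (computable zero (λ _ → refl))
        (andC (eqC (ap₂ validPointsC F s) (lit 1)) (orC (eqC (ap₂ indexNC p s) (lit 0)) (ltC k (ap₂ indexNC p s))))))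
      where
        p = ap₁ pointNC G
        y = ap₁ π₁C G
        k = ap₁ π₂C (ap₁ π₂C G)
        s = ap₁ π₁C (ap₂ subC y (lit 2))

    -- h lists, for all smaller codes, the values at all environments below E.
    look : ℕ → ℕ → ℕ → ℕ → ℕ → ℕ
    look E c h c′ e′ = at (at h (c ∸ suc c′)) (E ∸ suc e′)

    forAll forSome : ℕ → ℕ → (ℕ → ℕ) → Bool
    forAll  x b f = allᵇ (λ a → not (validN x a) ∨ (f a ≡ᵇ 2)) b
    forSome x b f = not (allᵇ (λ a → not (validN x a ∧ (f a ≡ᵇ 2))) b)

    lookC : ∀ {E c h c′ e′ : Vec ℕ n → ℕ} → Computable E → Computable c → Computable h → Computable c′ → Computable e′ →
            Computable (λ ρ → look (E ρ) (c ρ) (h ρ) (c′ ρ) (e′ ρ))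
    lookC E C H C′ E′ = ap₂ atC (ap₂ atC H (ap₂ subC C (sucC C′))) (ap₂ subC E (sucC E′))

    opaque
      dispatch : ℕ → ℕ → ℕ → ℕ → ℕ → ℕ → ℕ → ℕ
      dispatch x C e c h t r =
        let val = look (tupleBound C C) c h
            b = elementBound C (suc (len e)) in
        if t ≡ᵇ 0 then evalEq e r else
        if t ≡ᵇ 1 then evalRel e (π₁ r) (π₂ r) else
        if t ≡ᵇ 2 then negV (val r e) else
        if t ≡ᵇ 3 then andV (val (π₁ r) e) (val (π₂ r) e) else
        if t ≡ᵇ 4 then orV (val (π₁ r) e) (val (π₂ r) e) else
        if t ≡ᵇ 5 then implV (val (π₁ r) e) (val (π₂ r) e) else
        -- The bounded search only asks whether values are 2. That the body is well-formed is tested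
        -- at `origin`, which codes an element of the model for every `x`.
        if t ≡ᵇ 6 then guarded (val r (e ▹ origin)) 1 (truth (forAll x b (λ a → val r (e ▹ a)))) else
        if t ≡ᵇ 7 then guarded (val r (e ▹ origin)) 1 (truth (forSome x b (λ a → val r (e ▹ a)))) else 0

      evalStep : ℕ → ℕ → ℕ → ℕ → ℕ → ℕ
      evalStep x C e c h = dispatch x C e c h (π₁ c) (π₂ c)

      evalStepC : Computable {6} (λ { (e ∷ _ ∷ c ∷ h ∷ x ∷ C ∷ []) → evalStep x C e c h })
      evalStepC = ext (λ { (e ∷ _ ∷ c ∷ h ∷ x ∷ C ∷ []) → refl })
        (ifC (tag 0) (ap₂ evalEqC (arg 0F) r)
        (ifC (tag 1) (ap₃ evalRelC (arg 0F) (ap₁ π₁C r) (ap₁ π₂C r))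
        (ifC (tag 2) (ap₁ negVC (val r (arg 0F)))
        (ifC (tag 3) (ap₂ andVC (val (ap₁ π₁C r) (arg 0F)) (val (ap₁ π₂C r) (arg 0F)))
        (ifC (tag 4) (ap₂ orVC (val (ap₁ π₁C r) (arg 0F)) (val (ap₁ π₂C r) (arg 0F)))
        (ifC (tag 5) (ap₂ implVC (val (ap₁ π₁C r) (arg 0F)) (val (ap₁ π₂C r) (arg 0F)))
        (ifC (tag 6) (ap₃ guardedC (val r (ap₂ ▹C (arg 0F) (lit origin))) (lit 1)
           (truthC (allC (orC (notC (validC (arg 5F) (arg 0F))) (eqC val′ (lit 2))) b)))
        (ifC (tag 7) (ap₃ guardedC (val r (ap₂ ▹C (arg 0F) (lit origin))) (lit 1)
           (truthC (notC (allC (notC (andC (validC (arg 5F) (arg 0F)) (eqC val′ (lit 2)))) b))))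
        (lit 0)))))))))
        where
          r : Computable {6} (λ ρ → π₂ (lookup ρ 2F))
          r = ap₁ π₂C (arg 2F)
          tag : ∀ k → Decidableᵇ {6} (λ ρ → π₁ (lookup ρ 2F) ≡ᵇ k)
          tag k = eqC (ap₁ π₁C (arg 2F)) (lit k)
          val : ∀ {c e : Vec ℕ 6 → ℕ} → Computable c → Computable e →
                Computable (λ ρ → look (tupleBound (lookup ρ 5F) (lookup ρ 5F)) (lookup ρ 2F) (lookup ρ 3F) (c ρ) (e ρ))
          val c e = lookC (ap₂ tupleBoundC (arg 5F) (arg 5F)) (arg 2F) (arg 3F) c e
          val′ : Computable {7} (λ ρ → look (tupleBound (lookup ρ 6F) (lookup ρ 6F)) (lookup ρ 3F) (lookup ρ 4F)
                                            (π₂ (lookup ρ 3F)) (lookup ρ 1F ▹ lookup ρ 0F))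
          val′ = lookC (ap₂ tupleBoundC (arg {7} 6F) (arg 6F)) (arg 3F) (arg 4F) (ap₁ π₂C (arg 3F)) (ap₂ ▹C (arg 1F) (arg 0F))
          b : Computable {6} (λ ρ → elementBound (lookup ρ 5F) (suc (len (lookup ρ 0F))))
          b = ap₂ elementBoundC (arg {6} 5F) (sucC (ap₁ lenC (arg 0F)))

    opaque
      values : ℕ → ℕ → ℕ → ℕ → ℕ
      values x C c h = table (λ e _ → evalStep x C e c h) (tupleBound C C)

      valuesC : Fun₄ (λ c h x C → values x C c h)
      valuesC = fun₄ (tableC {n = 4} {G = λ ρ → evalStep (lookup ρ 4F) (lookup ρ 5F) (lookup ρ 0F) (lookup ρ 2F) (lookup ρ 3F)}
                             (ext (λ { (e ∷ a ∷ c ∷ h ∷ x ∷ C ∷ []) → refl }) evalStepC)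
                             (ap₂ tupleBoundC (arg 3F) (arg 3F)))

    -- A quantifier evaluates its body in longer environments, so the course-of-values recursion on
    -- the code `c` tabulates each formula in all environments below one bound; `C` limits the codes
    -- and lengths for which this bound is right.
    evaluate : ℕ → ℕ → ℕ → ℕ → ℕ
    evaluate x C c e = at (cov (values x C) c) (tupleBound C C ∸ suc e)

    evaluateC : Fun₄ evaluate
    evaluateC = fun₄ (ext (λ { (x ∷ C ∷ c ∷ e ∷ []) → refl }) (ap₂ atC
      (covC {n = 4} {G = λ ρ → values (lookup ρ 2F) (lookup ρ 3F) (lookup ρ 0F) (lookup ρ 1F)}
            (ap₄ {f = λ ρ → lookup ρ 0F} {g = λ ρ → lookup ρ 1F} {h = λ ρ → lookup ρ 2F} {k = λ ρ → lookup ρ 3F}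
                 valuesC (arg 0F) (arg 1F) (arg 2F) (arg 3F)) (arg {4} 2F))
      (ap₂ subC (ap₂ tupleBoundC (arg {4} 1F) (arg 1F)) (sucC (arg 3F)))))

-- Witnesses of bounded grade for quantifiers.

module Witnesses where

  open Arithmetic
  open Structures
  open Steps
  open Responses
  open Games
  open StandardModels
  open Arithmetization

  private
    variable
      n : ℕ

  module SmallWitness (cl : Classical) {S : ℕ → ℕ} {M : Structure L₃} {Gr Sm} (ax : Axioms S M Gr Sm)
                      (sm-suc : ∀ {r n} → Sm r n → Sm (suc r) n) (C : ℕ) where
    open Classical cl
    open Structure M
    open Str M
    open Axioms ax
    open Theory cl ax
    open Bounded cl ax ax sm-suc C
    open Step cl ax ax V V-down using (Pairs)
    open Game cl ax ax V V-down

    -- A state with the row `y` must contain the visible points on its list; `sz-graded` replaces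
    -- them by points that come no later than `y`.
    contentsBelow : Carrier → ℕ → List Carrier
    contentsBelow y zero    = []
    contentsBelow y (suc k) with em (∃[ x ] ¬ Star y × Sz y x k)
    ... | yes (x , ¬s , z) = proj₁ (sz-graded ¬s z) ∷ contentsBelow y k
    ... | no _             = contentsBelow y k

    contentsBelow-graded : ∀ {r y z} k → Gr r y → z ∈ contentsBelow y k → Gr r z
    contentsBelow-graded {y = y} (suc k) g i with em (∃[ x ] ¬ Star y × Sz y x k)
    contentsBelow-graded (suc k) g (here refl) | yes (x , ¬s , z) = proj₂ (proj₂ (sz-graded ¬s z)) g
    contentsBelow-graded (suc k) g (there i)   | yes _ = contentsBelow-graded k g i
    contentsBelow-graded (suc k) g i           | no _ = contentsBelow-graded k g i

    contentsBelow-complete : ∀ {y x c} k → c < k → ¬ Star y → Sz y x c → ∃[ z ] z ∈ contentsBelow y k × z ∼ x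
    contentsBelow-complete {y} {x} {c} (suc k) (s≤s le) ¬s z with em (∃[ x ] ¬ Star y × Sz y x k) | m≤n⇒m<n∨m≡n le
    ... | yes (x′ , ¬s′ , z′) | inj₂ refl = _ , here refl , ∼-trans (proj₁ (proj₂ (sz-graded ¬s′ z′))) (sz-unique ¬s z′ z)
    ... | yes _ | inj₁ lt = let u , i , sim = contentsBelow-complete k lt ¬s z in u , there i , sim
    ... | no none | inj₂ refl = ⊥-elim (none (x , ¬s , z))
    ... | no _ | inj₁ lt = contentsBelow-complete k lt ¬s z

    dup : List Carrier → Pairs
    dup = List.map (λ a → a , a)

    ∈-dup : ∀ {as p} → p ∈ dup as → ∃[ a ] a ∈ as × p ≡ (a , a)
    ∈-dup i = ∈-map⁻ (λ a → a , a) i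

    dup-∈ : ∀ {as a} → a ∈ as → (a , a) ∈ dup as
    dup-∈ i = ∈-map⁺ (λ a → a , a) i

    diagonal : ∀ {r} (as : List Carrier) → (∀ {a} → a ∈ as → Gr r a) →
               ∃[ xs ] ∃[ ys ] State r xs ys (dup as)
    diagonal {r} as g = dup bs , dup as , record
        { points = record
          { order = λ i j → agree₂ _≲_ (∈-dup i) (∈-dup j)
          ; level = λ i n _ → agree₁ (λ a → Lv a n) (∈-dup i) }
        ; rows = λ i j → agree₂ _~_ (∈-dup i) (∈-dup j)
        ; stars = λ i → agree₁ Star (∈-dup i)
        ; sizes→ = λ i → sizes→ (∈-dup i)
        ; sizes← = λ i → sizes← (∈-dup i)
        ; pointOf = λ i → pointOf (∈-dup i)
        ; rowOf = λ i → _ , i , ~-refl , ~-refl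
        ; exactly = λ i j → agree₂ _≡_ (∈-dup i) (∈-dup j)
        ; grx = λ i → graded (∈-dup i) grb
        ; gry = λ i → graded (∈-dup i) g
        ; grw = λ i → graded (∈-dup i) g }
      where
        contents′ = List.concat (List.map (λ y → contentsBelow y C) as)
        bs = as List.++ contents′
        agree₁ : ∀ {cs p} (P : Carrier → Set) → ∃[ a ] a ∈ cs × p ≡ (a , a) → P (proj₁ p) ⇔ P (proj₂ p)
        agree₁ P (a , _ , refl) = ⇔-refl
        agree₂ : ∀ {cs ds p q} (R : Carrier → Carrier → Set) → ∃[ a ] a ∈ cs × p ≡ (a , a) → ∃[ a ] a ∈ ds × q ≡ (a , a) →
                 R (proj₁ p) (proj₁ q) ⇔ R (proj₂ p) (proj₂ q)
        agree₂ R (a , _ , refl) (b , _ , refl) = ⇔-refl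
        graded : ∀ {cs p} → ∃[ a ] a ∈ cs × p ≡ (a , a) → (∀ {a} → a ∈ cs → Gr r a) → Gr r (proj₂ p)
        graded (a , i , refl) h = h i
        grb : ∀ {b} → b ∈ bs → Gr r b
        grb {b} i with ∈-++⁻ as i
        ... | inj₁ j = g j
        ... | inj₂ j with ∈-concat⁻′ (List.map (λ y → contentsBelow y C) as) j
        ...   | _ , k , l with ∈-map⁻ (λ y → contentsBelow y C) l
        ...     | y , m , refl = contentsBelow-graded C (g m) k
        entry∈ : ∀ {y z} → y ∈ as → z ∈ contentsBelow y C → z ∈ bs
        entry∈ i j = ∈-++⁺ʳ as (∈-concat⁺′ j (∈-map⁺ (λ y → contentsBelow y C) i))
        sizes→ : ∀ {p} → ∃[ a ] a ∈ as × p ≡ (a , a) → ¬ Star (proj₁ p) → ∀ {c x} → V c → Sz (proj₁ p) x c →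
                 ∃[ q ] q ∈ dup bs × proj₁ q ∼ x × Sz (proj₂ p) (proj₂ q) c
        sizes→ (a , i , refl) ¬s {c} {x} v z =
          let u , j , sim = contentsBelow-complete C v ¬s z in (u , u) , dup-∈ (entry∈ i j) , sim , sz-resp ~-refl (∼-sym sim) z
        sizes← : ∀ {p} → ∃[ a ] a ∈ as × p ≡ (a , a) → ¬ Star (proj₂ p) → ∀ {c x} → V c → Sz (proj₂ p) x c →
                 ∃[ q ] q ∈ dup bs × proj₂ q ∼ x × Sz (proj₁ p) (proj₁ q) c
        sizes← (a , i , refl) ¬s {c} {x} v z =
          let u , j , sim = contentsBelow-complete C v ¬s z in (u , u) , dup-∈ (entry∈ i j) , sim , sz-resp ~-refl (∼-sym sim) z
        pointOf : ∀ {p} → ∃[ a ] a ∈ as × p ≡ (a , a) → ∃[ q ] q ∈ dup bs × proj₁ q ∼ proj₁ p × proj₂ q ∼ proj₂ p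
        pointOf (a , i , refl) = (a , a) , dup-∈ (∈-++⁺ˡ i) , ∼-refl , ∼-refl

    pairUp-dup : (ρ : Vec Carrier n) → pairUp ρ ρ ≡ dup (toList ρ)
    pairUp-dup []      = refl
    pairUp-dup (a ∷ ρ) = cong (_ ∷_) (pairUp-dup ρ)

    -- The structure plays against itself, starting with `ρ` matched to itself. The response to `w`
    -- has a bounded grade, and the resulting state shows that formulas of bounded depth do not tell
    -- it from `w`.
    witness : ∀ {r} (ρ : Vec Carrier n) → (∀ {a} → a ∈ toList ρ → Gr r a) → Ready r → n ≤ C → ∀ w →
              ∃[ w′ ] Gr (suc (suc (suc C) + suc r)) w′ ×
                (∀ (φ : Formula L₃ (suc n)) → suc n + depth φ ≤ C → (M ⊨ φ [ w ∷ ρ ]) ⇔ (M ⊨ φ [ w′ ∷ ρ ]))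
    witness {r = r} ρ g rd le w =
      let xs , ys , st = diagonal {r} (toList ρ) g
          st′ = subst (State r xs ys) (sym (pairUp-dup ρ)) st
          xs′ , ys′ , w′ , st″ = move st′ rd (subst (_≤ C) (sym (length-pairUp ρ ρ)) le) w
      in w′ , State.grw st″ (here refl) ,
         λ φ le′ → Equivalent.agree cl (forget ax) (forget ax) C φ (w ∷ ρ) (w′ ∷ ρ) le′ (xs′ , ys′ , ungrade cl V-down ax ax st″)

-- Codes of elements, the test for validity, and the comparison of codes with grades.

module PlaceCodes where

  open Arithmetic
  open Structures
  open Steps
  open Dyadic
  open StandardModels
  open Classification
  open Arithmetization

  len-▹ : ∀ s a → len (s ▹ a) ≡ suc (len s)
  len-▹ = sfold-▹ 0 (λ r _ _ → suc r)

  levelN-code : ∀ p → levelN (codePoint p) ≡ level# p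
  levelN-code (fin n , m , k) = cong pred (π₁-pair (suc n) ⟪ m , k ⟫)
  levelN-code (inf , m , k)   = cong pred (π₁-pair 0 ⟪ m , k ⟫)

  levelsN-code : ∀ ps → levelsN (codePoints ps) ≡ pts# ps
  levelsN-code []       = refl
  levelsN-code (p ∷ ps) = trans (sfold-▹ 0 (λ r _ p → r ▹ levelN p) (codePoints ps) (codePoint p))
    (cong₂ _▹_ (levelsN-code ps) (levelN-code p))

  memberN-▹ : ∀ p s q → memberN p (s ▹ q) ≡ (if p ≡ᵇ q then 1 else memberN p s)
  memberN-▹ p = sfold-▹ 0 (λ r _ q → if p ≡ᵇ q then 1 else r)

  indexN-▹ : ∀ p s q → indexN p (s ▹ q) ≡ (if p ≡ᵇ q then suc (levelsN s) else indexN p s)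
  indexN-▹ p = sfold-▹ 0 (λ r s q → if p ≡ᵇ q then suc (levelsN s) else r)

  if-true : ∀ {A : Set} {b} {x y : A} → T b → (if b then x else y) ≡ x
  if-true {b = true} _ = refl

  if-false : ∀ {A : Set} {b} {x y : A} → ¬ T b → (if b then x else y) ≡ y
  if-false {b = true}  n = ⊥-elim (n tt)
  if-false {b = false} n = refl

  code-≡ᵇ : ∀ p q → T (codePoint p ≡ᵇ codePoint q) ⇔ (p ≡ q)
  code-≡ᵇ p q = mk⇔ (λ t → codePoint-injective (≡ᵇ⇒≡ (codePoint p) (codePoint q) t))
                    (λ { refl → ≡⇒≡ᵇ (codePoint p) (codePoint p) refl })

  T? : ∀ b → Dec (T b)
  T? true  = yes tt
  T? false = no id

  memberN-code : ∀ p ps → (memberN (codePoint p) (codePoints ps) ≡ 0) ⇔ (∀ {q} → q ∈ ps → p ≢ q)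
  memberN-code p [] = mk⇔ (λ _ ()) (λ _ → refl)
  memberN-code p (q ∷ ps) = cases (T? (codePoint p ≡ᵇ codePoint q))
    where
      unfold = memberN-▹ (codePoint p) (codePoints ps) (codePoint q)
      cases : Dec (T (codePoint p ≡ᵇ codePoint q)) →
              (memberN (codePoint p) (codePoints (q ∷ ps)) ≡ 0) ⇔ (∀ {q′} → q′ ∈ q ∷ ps → p ≢ q′)
      cases (yes t) = mk⇔ (λ e → ⊥-elim (1≢0 (trans (sym (trans unfold (if-true t))) e)))
                          (λ f → ⊥-elim (f (here refl) (to (code-≡ᵇ p q) t)))
        where
          1≢0 : 1 ≢ 0
          1≢0 ()
      cases (no ¬t) = mk⇔
        (λ e → λ { (here refl) eq → ¬t (from (code-≡ᵇ p q) eq)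
                 ; (there i) → to (memberN-code p ps) (trans (sym (trans unfold (if-false ¬t))) e) i })
        (λ f → trans (trans unfold (if-false ¬t)) (from (memberN-code p ps) (λ i → f (there i))))

  indexN-code : ∀ p ps → (indexN (codePoint p) (codePoints ps) ≡ 0 × (∀ c → ¬ At ps c p)) ⊎
                         (∃[ c ] indexN (codePoint p) (codePoints ps) ≡ suc c × At ps c p)
  indexN-code p [] = inj₁ (refl , λ c ())
  indexN-code p (q ∷ ps) = cases (T? (codePoint p ≡ᵇ codePoint q)) (indexN-code p ps)
    where
      unfold = indexN-▹ (codePoint p) (codePoints ps) (codePoint q)
      Result : List Point → Set
      Result ps = (indexN (codePoint p) (codePoints ps) ≡ 0 × (∀ c → ¬ At ps c p)) ⊎
                  (∃[ c ] indexN (codePoint p) (codePoints ps) ≡ suc c × At ps c p)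
      cases : Dec (T (codePoint p ≡ᵇ codePoint q)) → Result ps → Result (q ∷ ps)
      cases (yes t) _ = inj₂ (_ , trans (trans unfold (if-true t)) (cong suc (levelsN-code ps)) , inj₁ (to (code-≡ᵇ p q) t , refl))
      cases (no ¬t) (inj₁ (e , f)) = inj₁ (trans (trans unfold (if-false ¬t)) e ,
        λ { c (inj₁ (eq , _)) → ¬t (from (code-≡ᵇ p q) eq) ; c (inj₂ a) → f c a })
      cases (no ¬t) (inj₂ (c , e , a)) = inj₂ (c , trans (trans unfold (if-false ¬t)) e , inj₂ a)

  -- Every number codes raw data, so a search over numbers has to test validity only.
  decodePoint : ∀ a → ∃[ p ] codePoint p ≡ a
  decodePoint a = go (π₁ a) refl
    where
      tail : ∀ l → codeLevel l ≡ π₁ a → codePoint (l , π₁ (π₂ a) , π₂ (π₂ a)) ≡ a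
      tail l eq = trans (cong₂ ⟪_,_⟫ eq (pair-π (π₂ a))) (pair-π a)
      go : ∀ l → l ≡ π₁ a → ∃[ p ] codePoint p ≡ a
      go zero    eq = (inf , π₁ (π₂ a) , π₂ (π₂ a)) , tail inf eq
      go (suc l) eq = (fin l , π₁ (π₂ a) , π₂ (π₂ a)) , tail (fin l) eq

  decodePoints : ∀ a → ∃[ ps ] codePoints ps ≡ a
  decodePoints a = go a a ≤-refl
    where
      go : ∀ b a → a ≤ b → ∃[ ps ] codePoints ps ≡ a
      go b       zero    le = [] , refl
      go (suc b) (suc a) (s≤s le) =
        let p , e = decodePoint (π₂ a)
            ps , e′ = go b (π₁ a) (≤-trans (π₁≤ a) le)
        in p ∷ ps , trans (cong₂ _▹_ e′ e) (cong suc (pair-π a))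

  decodeRow : ∀ a → ∃[ y ] codeRow y ≡ a
  decodeRow zero          = star , refl
  decodeRow (suc zero)    = pth , refl
  decodeRow (suc (suc a)) =
    let ps , e = decodePoints (π₁ a)
    in pts ps (π₂ a) , cong (λ b → suc (suc b)) (trans (cong (λ b → ⟪ b , π₂ a ⟫) e) (pair-π a))

  decodeRaw : ∀ a → ∃[ w ] codeRaw w ≡ a
  decodeRaw a =
    let y , e = decodeRow (π₁ a)
        x , e′ = decodePoint (π₁ (π₂ a))
    in (y , x , π₂ (π₂ a)) , trans (cong₂ ⟪_,_⟫ e (trans (cong (λ b → ⟪ b , π₂ (π₂ a) ⟫) e′) (pair-π (π₂ a)))) (pair-π a)

  originRaw : Raw
  originRaw = star , (fin 0 , 0 , 0) , 0

  leN-code : ∀ {n n′} a b → T (leN (codePoint (fin n , a)) (codePoint (fin n′ , b))) ⇔ ((fin n , a) ≤ᴾ (fin n′ , b))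
  leN-code {n} {n′} a@(m , k) b@(m′ , k′)
    rewrite levelN-code (fin n , a) | levelN-code (fin n′ , b)
          | π₂-pair (suc n) ⟪ m , k ⟫ | π₂-pair (suc n′) ⟪ m′ , k′ ⟫
          | π₁-pair m k | π₂-pair m k | π₁-pair m′ k′ | π₂-pair m′ k′ =
    mk⇔ (λ t → fwd (to (T-∨ {x = n <ᵇ n′}) t)) (λ p → from T-∨ (bwd p))
    where
      fwd : T (n <ᵇ n′) ⊎ T ((n ≡ᵇ n′) ∧ (numer m * 2 ^ k′ <ᵇ suc (numer m′ * 2 ^ k))) → (fin n , a) ≤ᴾ (fin n′ , b)
      fwd (inj₁ t) = inj₁ (<ᵇ⇒< n n′ t)
      fwd (inj₂ t) = let u , w = to (T-∧ {x = n ≡ᵇ n′}) t in inj₂ (≡ᵇ⇒≡ n n′ u , s≤s⁻¹ (<ᵇ⇒< _ _ w))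
      bwd : (fin n , a) ≤ᴾ (fin n′ , b) → T (n <ᵇ n′) ⊎ T ((n ≡ᵇ n′) ∧ (numer m * 2 ^ k′ <ᵇ suc (numer m′ * 2 ^ k)))
      bwd (inj₁ lt) = inj₁ (<⇒<ᵇ lt)
      bwd (inj₂ (refl , le)) = inj₂ (from T-∧ (≡⇒≡ᵇ n n refl , <⇒<ᵇ (s≤s le)))

  module Codes (cl : Classical) (tree : ℕ → ℕ → ℕ) (treeC : Fun₂ tree) (x : ℕ) where
    open Classical cl
    open Evaluator tree treeC (codeRaw originRaw)
    open Model cl (kind no∞ (tree x))

    validPoint-code : ∀ p → T (0 <ᵇ π₁ (codePoint p)) ⇔ ValidPoint p
    validPoint-code (fin n , m , k) rewrite π₁-pair (suc n) ⟪ m , k ⟫ = ⇔-refl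
    validPoint-code (inf , m , k)   rewrite π₁-pair 0 ⟪ m , k ⟫ = ⇔-refl

    finite : ∀ {p} → ValidPoint p → Finite p
    finite {fin n , _} _ = n , refl

    b2n-⇔ : ∀ b → (b2n b ≡ 1) ⇔ T b
    b2n-⇔ true  = mk⇔ (λ _ → tt) (λ _ → refl)
    b2n-⇔ false = mk⇔ (λ ()) (λ ())

    member-finite : ∀ ps → ValidList ps → ∀ {q} → q ∈ ps → Finite q
    member-finite (p ∷ ps) (_ , vp , _) (here refl) = finite vp
    member-finite (p ∷ ps) (v , _) (there i) = member-finite ps v i

    T-∧⁴ : ∀ a b c d → T (a ∧ (b ∧ (c ∧ d))) ⇔ (T a × T b × T c × T d)
    T-∧⁴ true  true  true  d = mk⇔ (λ t → tt , tt , tt , t) (λ (_ , _ , _ , t) → t)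
    T-∧⁴ false b     c     d = mk⇔ (λ ()) (λ ())
    T-∧⁴ true  false c     d = mk⇔ (λ ()) (λ ())
    T-∧⁴ true  true  false d = mk⇔ (λ ()) (λ ())

    validPoints-code : ∀ ps → (validPoints x (codePoints ps) ≡ 1) ⇔ ValidList ps
    validPoints-code [] = mk⇔ (λ _ → tt) (λ _ → refl)
    validPoints-code (p ∷ ps) = ⇔-trans (mk⇔ (λ e → trans (sym unfold) e) (λ e → trans unfold e))
      (⇔-trans (b2n-⇔ _) (⇔-trans (T-∧⁴ _ _ _ _) (mk⇔ fwd bwd)))
      where
        r = validPoints x (codePoints ps)
        unfold : validPoints x (codePoints (p ∷ ps)) ≡
                 b2n ((r ≡ᵇ 1) ∧ ((0 <ᵇ π₁ (codePoint p)) ∧ ((memberN (codePoint p) (codePoints ps) ≡ᵇ 0) ∧ (tree x (pts# ps) ≡ᵇ 0))))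
        unfold = trans
          (sfold-▹ 1 (λ r s p → b2n ((r ≡ᵇ 1) ∧ ((0 <ᵇ π₁ p) ∧ ((memberN p s ≡ᵇ 0) ∧ (tree x (levelsN s) ≡ᵇ 0)))))
                   (codePoints ps) (codePoint p))
          (cong (λ c → b2n ((r ≡ᵇ 1) ∧ ((0 <ᵇ π₁ (codePoint p)) ∧ ((memberN (codePoint p) (codePoints ps) ≡ᵇ 0) ∧ (tree x c ≡ᵇ 0)))))
                (levelsN-code ps))
        Parts : Set
        Parts = T (r ≡ᵇ 1) × T (0 <ᵇ π₁ (codePoint p)) × T (memberN (codePoint p) (codePoints ps) ≡ᵇ 0) × T (tree x (pts# ps) ≡ᵇ 0)
        fwd : Parts → ValidList (p ∷ ps)
        fwd (a , b , c , d) = v , to (validPoint-code p) b ,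
            (λ {q} i → member-finite ps v i , to (memberN-code p ps) (≡ᵇ⇒≡ _ 0 c) i) , ≡ᵇ⇒≡ _ 0 d
          where
            v : ValidList ps
            v = to (validPoints-code ps) (≡ᵇ⇒≡ r 1 a)
        bwd : ValidList (p ∷ ps) → Parts
        bwd (v , vp , d , s) = ≡⇒≡ᵇ r 1 (from (validPoints-code ps) v) , from (validPoint-code p) vp ,
          ≡⇒≡ᵇ _ 0 (from (memberN-code p ps) (λ i → proj₂ (d i))) , ≡⇒≡ᵇ _ 0 s

    PositionTest : ℕ → ℕ → ℕ → Bool
    PositionTest s p k = (validPoints x s ≡ᵇ 1) ∧ ((indexN p s ≡ᵇ 0) ∨ (k <ᵇ indexN p s))

    positionTest : ∀ ps p k → T (PositionTest (codePoints ps) (codePoint p) k) ⇔ (ValidList ps × (∀ c → At ps c p → k ≤ c))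
    positionTest ps p k = ⇔-trans (T-∧ {x = validPoints x (codePoints ps) ≡ᵇ 1}) (mk⇔ fwd bwd)
      where
        i = indexN (codePoint p) (codePoints ps)
        fwd : T (validPoints x (codePoints ps) ≡ᵇ 1) × T ((i ≡ᵇ 0) ∨ (k <ᵇ i)) → ValidList ps × (∀ c → At ps c p → k ≤ c)
        fwd (a , b) = v , go (indexN-code p ps) (to (T-∨ {x = i ≡ᵇ 0}) b)
          where
            v : ValidList ps
            v = to (validPoints-code ps) (≡ᵇ⇒≡ _ 1 a)
            go : (i ≡ 0 × (∀ c → ¬ At ps c p)) ⊎ (∃[ c ] i ≡ suc c × At ps c p) → T (i ≡ᵇ 0) ⊎ T (k <ᵇ i) →
                 ∀ c → At ps c p → k ≤ c
            go (inj₁ (_ , f)) _ c at = ⊥-elim (f c at)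
            go (inj₂ (c , e , at)) (inj₁ z) c′ at′ = ⊥-elim (0≢1+n (trans (sym (≡ᵇ⇒≡ i 0 z)) e))
            go (inj₂ (c , e , at)) (inj₂ lt) c′ at′ =
              subst (k ≤_) (sig-functional (pts ps 0) v at at′) (s≤s⁻¹ (subst (k <_) e (<ᵇ⇒< k i lt)))
        bwd : ValidList ps × (∀ c → At ps c p → k ≤ c) → T (validPoints x (codePoints ps) ≡ᵇ 1) × T ((i ≡ᵇ 0) ∨ (k <ᵇ i))
        bwd (v , f) = ≡⇒≡ᵇ _ 1 (from (validPoints-code ps) v) , from (T-∨ {x = i ≡ᵇ 0}) (go (indexN-code p ps))
          where
            go : (i ≡ 0 × (∀ c → ¬ At ps c p)) ⊎ (∃[ c ] i ≡ suc c × At ps c p) → T (i ≡ᵇ 0) ⊎ T (k <ᵇ i)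
            go (inj₁ (e , _)) = inj₁ (≡⇒≡ᵇ i 0 e)
            go (inj₂ (c , e , at)) = inj₂ (<⇒<ᵇ (subst (k <_) (sym e) (s≤s (f c at))))

    ≡⇒T⇔ : ∀ {a b} → a ≡ b → T a ⇔ T b
    ≡⇒T⇔ refl = ⇔-refl

    validPosition-code : ∀ y p k → ValidPoint p →
      T (validPosition x (codeRow y) (codePoint p) k) ⇔ (ValidRow y × (∀ c → Sig y c p → k ≤ c))
    validPosition-code star p@(fin n , _) k vp = ⇔-trans (≡⇒T⇔ (cong (λ l → k <ᵇ suc l) (levelN-code p)))
      (mk⇔ (λ t → tt , λ { c refl → s≤s⁻¹ (<ᵇ⇒< k (suc n) t) }) (λ (_ , f) → <⇒<ᵇ (s≤s (f n refl))))
    validPosition-code pth p k vp = mk⇔ (λ ()) (λ ())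
    validPosition-code (pts ps t) p k vp = ⇔-trans
      (≡⇒T⇔ (cong (λ s → PositionTest s (codePoint p) k) (π₁-pair (codePoints ps) t))) (positionTest ps p k)

    valid-code : ∀ w → T (validN x (codeRaw w)) ⇔ Valid w
    valid-code (y , p , k) = ⇔-trans (≡⇒T⇔ unfold) (⇔-trans (T-∧ {x = 0 <ᵇ π₁ (codePoint p)})
      (mk⇔ (λ (a , b) → let vp = to (validPoint-code p) a
                            vy , f = to (validPosition-code y p k vp) b
                        in vy , vp , f)
           (λ (vy , vp , f) → from (validPoint-code p) vp , from (validPosition-code y p k vp) (vy , f))))
      where
        rest = π₂-pair (codeRow y) ⟪ codePoint p , k ⟫
        point≡ : pointN (codeRaw (y , p , k)) ≡ codePoint p
        point≡ = trans (cong π₁ rest) (π₁-pair (codePoint p) k)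
        unfold : validN x (codeRaw (y , p , k)) ≡ (0 <ᵇ π₁ (codePoint p)) ∧ validPosition x (codeRow y) (codePoint p) k
        unfold = cong₂ _∧_ (cong (λ q → 0 <ᵇ π₁ q) point≡)
          (trans (cong (λ r → validPosition x r (pointN (codeRaw (y , p , k))) (π₂ (π₂ (codeRaw (y , p , k))))) (π₁-pair (codeRow y) ⟪ codePoint p , k ⟫))
            (cong₂ (validPosition x (codeRow y)) point≡ (trans (cong π₂ rest) (π₂-pair (codePoint p) k))))

    codeE : Element → ℕ
    codeE w = codeRaw (proj₁ w)

    code-valid : ∀ w → T (validN x (codeE w))
    code-valid w = from (valid-code (proj₁ w)) (valid w)

    element : ∀ a → T (validN x a) → ∃[ w ] codeE w ≡ a
    element a t = let w , e = decodeRaw a in mk {w} (to (valid-code w) (subst (λ b → T (validN x b)) (sym e) t)) , e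

    codePoint≤ : ∀ {r p} → GrPoint r p → codePoint p ≤ pointBound r
    codePoint≤ {r} {fin n , m , k} (a , b , c) = pair-mono (s≤s a) (pair-mono (<⇒≤ b) c)
    codePoint≤ {r} {inf , m , k} (b , c) = pair-mono {0} {⟪ m , k ⟫} {suc r} z≤n (pair-mono (<⇒≤ b) c)

    pointsBound-mono : ∀ r {l l′} → l ≤ l′ → pointsBound r l ≤ pointsBound r l′
    pointsBound-mono r {zero}  {l′}     le = z≤n
    pointsBound-mono r {suc l} {suc l′} (s≤s le) = ▹-mono (pointsBound-mono r le) ≤-refl

    codePoints≤ : ∀ {r} ps → (∀ {p} → p ∈ ps → GrPoint r p) → codePoints ps ≤ pointsBound r (length ps)
    codePoints≤ []       g = z≤n
    codePoints≤ (p ∷ ps) g = ▹-mono (codePoints≤ ps (λ i → g (there i))) (codePoint≤ {p = p} (g (here refl)))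

    opaque
      unfolding stageBound

      code<stageBound : ∀ {r} w → Gr r w → codeE w < stageBound r
      code<stageBound {r} ((y , p , k) , _) (gy , gp , gk) = s≤s (pair-mono (row y gy) (pair-mono (codePoint≤ {p = p} gp) gk))
        where
          row : ∀ y → GrRow r y → codeRow y ≤ suc (suc ⟪ pointsBound r r , r ⟫)
          row star       g = z≤n
          row (pts ps t) (g , l , h) = s≤s (s≤s (pair-mono (≤-trans (codePoints≤ ps g) (pointsBound-mono r l)) h))

      <stageBound : ∀ r → r < stageBound r
      <stageBound r = s≤s (≤-trans (snd≤pair (pointBound r) r) (snd≤pair (suc (suc ⟪ pointsBound r r , r ⟫)) ⟪ pointBound r , r ⟫))

    m<2^m : ∀ m → m < 2 ^ m
    m<2^m zero    = s≤s z≤n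
    m<2^m (suc m) = ≤-trans (+-mono-≤ (m^n>0 2 m) (m<2^m m)) (≤-reflexive (cong (2 ^ m +_) (sym (+-identityʳ _))))

    ≤⇒<2^ : ∀ {m r} → m ≤ r → m < 2 ^ r
    ≤⇒<2^ {m} {r} le = ≤-<-trans le (m<2^m r)

    codePoint-graded : ∀ {r} p → codePoint p ≤ r → GrPoint r p
    codePoint-graded {r} (fin n , m , k) le =
      ≤-trans (≤-trans (n≤1+n n) (fst≤pair (suc n) ⟪ m , k ⟫)) le ,
      ≤⇒<2^ (≤-trans (≤-trans (fst≤pair m k) (snd≤pair (suc n) ⟪ m , k ⟫)) le) ,
      ≤-trans (≤-trans (snd≤pair m k) (snd≤pair (suc n) ⟪ m , k ⟫)) le
    codePoint-graded {r} (inf , m , k) le =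
      ≤⇒<2^ (≤-trans (≤-trans (fst≤pair m k) (snd≤pair 0 ⟪ m , k ⟫)) le) ,
      ≤-trans (≤-trans (snd≤pair m k) (snd≤pair 0 ⟪ m , k ⟫)) le

    codePoints-graded : ∀ {r} ps → codePoints ps ≤ r → (∀ {p} → p ∈ ps → GrPoint r p) × length ps ≤ r
    codePoints-graded []       le = (λ ()) , z≤n
    codePoints-graded {r} (p ∷ ps) le =
      let s≤ = ≤-trans (<⇒≤ (s<▹ (codePoints ps) (codePoint p))) le
          g , _ = codePoints-graded {r} ps s≤
      in (λ { (here refl) → codePoint-graded p (≤-trans (<⇒≤ (a<▹ (codePoints ps) (codePoint p))) le) ; (there i) → g i }) ,
         ≤-trans (s≤s (length≤ ps)) (≤-trans (s<▹ (codePoints ps) (codePoint p)) le)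
      where
        length≤ : ∀ ps → length ps ≤ codePoints ps
        length≤ []       = z≤n
        length≤ (p ∷ ps) = ≤-trans (s≤s (length≤ ps)) (s<▹ (codePoints ps) (codePoint p))

    -- Each component is at most the code, and `m < 2 ^ m`. With `code<stageBound` this passes back
    -- and forth between codes and grades, at the price of fast growing bounds.
    code-graded : ∀ {r} w → codeE w ≤ r → Gr r w
    code-graded {r} w@((y , p , k) , _) le =
      row y (proj₁ (valid w)) (≤-trans (fst≤pair (codeRow y) ⟪ codePoint p , k ⟫) le) ,
      codePoint-graded p (≤-trans (≤-trans (fst≤pair (codePoint p) k) (snd≤pair (codeRow y) ⟪ codePoint p , k ⟫)) le) ,
      ≤-trans (≤-trans (snd≤pair (codePoint p) k) (snd≤pair (codeRow y) ⟪ codePoint p , k ⟫)) le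
      where
        row : ∀ y → ValidRow y → codeRow y ≤ r → GrRow r y
        row star       v le = tt
        row (pts ps t) v le =
          let g , l = codePoints-graded ps (≤-trans (≤-trans (fst≤pair (codePoints ps) t) (≤-trans (n≤1+n _) (n≤1+n _))) le)
          in g , l , ≤-trans (≤-trans (snd≤pair (codePoints ps) t) (≤-trans (n≤1+n _) (n≤1+n _))) le

-- Equations for the evaluator and bounds for its environments.

module Decision where

  open Arithmetic
  open Structures
  open Steps
  open Games
  open StandardModels
  open Classification
  open Arithmetization
  open Witnesses
  open PlaceCodes

  Decides : Set → ℕ → Set
  Decides P v = (v ≡ 2 × P) ⊎ (v ≡ 1 × ¬ P)

  decides-≢0 : ∀ {P v} → Decides P v → v ≢ 0
  decides-≢0 (inj₁ (refl , _)) ()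
  decides-≢0 (inj₂ (refl , _)) ()

  decides-2 : ∀ {P v} → Decides P v → (v ≡ 2) ⇔ P
  decides-2 (inj₁ (refl , p)) = mk⇔ (λ _ → p) (λ _ → refl)
  decides-2 (inj₂ (refl , n)) = mk⇔ (λ ()) (λ p → ⊥-elim (n p))

  decides-truth : ∀ {P} b → T b ⇔ P → Decides P (truth b)
  decides-truth true  e = inj₁ (refl , to e tt)
  decides-truth false e = inj₂ (refl , from e)

  decides-negV : ∀ {P v} → Decides P v → Decides (¬ P) (negV v)
  decides-negV (inj₁ (refl , p)) = inj₂ (refl , λ n → n p)
  decides-negV (inj₂ (refl , n)) = inj₁ (refl , n)

  decides-andV : ∀ {P Q v w} → Decides P v → Decides Q w → Decides (P × Q) (andV v w)
  decides-andV (inj₁ (refl , p)) (inj₁ (refl , q)) = inj₁ (refl , p , q)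
  decides-andV (inj₁ (refl , p)) (inj₂ (refl , q)) = inj₂ (refl , λ (_ , b) → q b)
  decides-andV (inj₂ (refl , p)) (inj₁ (refl , q)) = inj₂ (refl , λ (a , _) → p a)
  decides-andV (inj₂ (refl , p)) (inj₂ (refl , q)) = inj₂ (refl , λ (a , _) → p a)

  decides-orV : ∀ {P Q v w} → Decides P v → Decides Q w → Decides (P ⊎ Q) (orV v w)
  decides-orV (inj₁ (refl , p)) (inj₁ (refl , q)) = inj₁ (refl , inj₁ p)
  decides-orV (inj₁ (refl , p)) (inj₂ (refl , q)) = inj₁ (refl , inj₁ p)
  decides-orV (inj₂ (refl , p)) (inj₁ (refl , q)) = inj₁ (refl , inj₂ q)
  decides-orV (inj₂ (refl , p)) (inj₂ (refl , q)) = inj₂ (refl , λ { (inj₁ a) → p a ; (inj₂ b) → q b })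

  decides-implV : ∀ {P Q v w} → Decides P v → Decides Q w → Decides (P → Q) (implV v w)
  decides-implV (inj₁ (refl , p)) (inj₁ (refl , q)) = inj₁ (refl , λ _ → q)
  decides-implV (inj₁ (refl , p)) (inj₂ (refl , q)) = inj₂ (refl , λ f → q (f p))
  decides-implV (inj₂ (refl , p)) (inj₁ (refl , q)) = inj₁ (refl , λ _ → q)
  decides-implV (inj₂ (refl , p)) (inj₂ (refl , q)) = inj₁ (refl , λ a → ⊥-elim (p a))

  negV-≢0 : ∀ {v} → negV v ≢ 0 → v ≢ 0
  negV-≢0 ne refl = ne refl

  guarded-≢0 : ∀ a b {c} → guarded a b c ≢ 0 → a ≢ 0 × b ≢ 0
  guarded-≢0 zero    b       ne = ⊥-elim (ne refl)
  guarded-≢0 (suc a) zero    ne = ⊥-elim (ne refl)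
  guarded-≢0 (suc a) (suc b) ne = (λ ()) , (λ ())

  guarded-≡ : ∀ {a c} → a ≢ 0 → guarded a 1 c ≡ c
  guarded-≡ {zero}  ne = ⊥-elim (ne refl)
  guarded-≡ {suc a} ne = refl

  if-≢0 : ∀ b {a} → (if b then a else 0) ≢ 0 → T b
  if-≢0 true  ne = tt
  if-≢0 false ne = ⊥-elim (ne refl)

  -- This lets the code of a formula serve as the number of moves to be survived.
  depth≤code : ∀ {n} (φ : Formula L₃ n) → depth φ ≤ ⌜ φ ⌝
  depth≤code (_ ≈̇ _)   = z≤n
  depth≤code (rel _ _) = z≤n
  depth≤code (¬̇ α)     = ≤-trans (depth≤code α) (snd≤pair 2 ⌜ α ⌝)
  depth≤code (α ∧̇ β)   = ≤-trans (⊔-lub (≤-trans (depth≤code α) (fst≤pair ⌜ α ⌝ ⌜ β ⌝)) (≤-trans (depth≤code β) (snd≤pair ⌜ α ⌝ ⌜ β ⌝))) (snd≤pair 3 ⟪ ⌜ α ⌝ , ⌜ β ⌝ ⟫)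
  depth≤code (α ∨̇ β)   = ≤-trans (⊔-lub (≤-trans (depth≤code α) (fst≤pair ⌜ α ⌝ ⌜ β ⌝)) (≤-trans (depth≤code β) (snd≤pair ⌜ α ⌝ ⌜ β ⌝))) (snd≤pair 4 ⟪ ⌜ α ⌝ , ⌜ β ⌝ ⟫)
  depth≤code (α ⇒̇ β)   = ≤-trans (⊔-lub (≤-trans (depth≤code α) (fst≤pair ⌜ α ⌝ ⌜ β ⌝)) (≤-trans (depth≤code β) (snd≤pair ⌜ α ⌝ ⌜ β ⌝))) (snd≤pair 5 ⟪ ⌜ α ⌝ , ⌜ β ⌝ ⟫)
  depth≤code (∀̇ α)     = ≤-trans (s≤s (depth≤code α)) (snd<pair 5 ⌜ α ⌝)
  depth≤code (∃̇ α)     = ≤-trans (s≤s (depth≤code α)) (snd<pair 6 ⌜ α ⌝)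

  isVar-code : ∀ {n} (i : Fin n) → T (isVar ⟪ 0 , toℕ i ⟫ n)
  isVar-code {n} i = from (T-∧ {x = π₁ ⟪ 0 , toℕ i ⟫ ≡ᵇ 0})
    (≡⇒≡ᵇ _ 0 (π₁-pair 0 (toℕ i)) , <⇒<ᵇ (subst (_< n) (sym (π₂-pair 0 (toℕ i))) (toℕ<n i)))

  isVar-decode : ∀ u n → T (isVar u n) → ∃[ i ] ⟪ 0 , toℕ {n} i ⟫ ≡ u
  isVar-decode u n t =
    let a , b = to (T-∧ {x = π₁ u ≡ᵇ 0}) t
        lt = <ᵇ⇒< (π₂ u) n b
    in fromℕ< lt , trans (cong₂ ⟪_,_⟫ (sym (≡ᵇ⇒≡ (π₁ u) 0 a)) (toℕ-fromℕ< lt)) (pair-π u)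

  eqTest : ℕ → ℕ → ℕ → ℕ → ℕ
  eqTest l e u v = if isVar u l ∧ isVar v l then truth (at e (π₂ u) ≡ᵇ at e (π₂ v)) else 0

  unaryTest : ℕ → ℕ → ℕ → ℕ → ℕ
  unaryTest l e u z = if isVar u l ∧ (z ≡ᵇ 0) then truth (π₁ (at e (π₂ u)) ≡ᵇ 0) else 0

  binaryTest : ℕ → ℕ → ℕ → ℕ → ℕ → ℕ → ℕ
  binaryTest l e k u v z = if isVar u l ∧ (isVar v l ∧ (z ≡ᵇ 0)) then binary k (at e (π₂ u)) (at e (π₂ v)) else 0

  module Spec (cl : Classical) (tree : ℕ → ℕ → ℕ) (treeC : Fun₂ tree) (x : ℕ) (C : ℕ) where
    open Classical cl
    open Evaluator tree treeC (codeRaw originRaw)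
    open Codes cl tree treeC x
    open Model cl (kind no∞ (tree x))
    open SmallWitness cl axioms (λ le → m≤n⇒m≤1+n le) C using (witness)

    E : ℕ
    E = tupleBound C C

    eval′ : ℕ → ℕ → ℕ
    eval′ = evaluate x C

    history : ℕ → ℕ
    history = table (values x C)

    opaque
      unfolding values

      evaluate-step : ∀ {c e} → e < E → eval′ c e ≡ evalStep x C e c (history c)
      evaluate-step {c} {e} lt = at-table (λ e _ → evalStep x C e c (history c)) lt

    look-≡ : ∀ {c c′} e → c′ < c → look E c (history c) c′ e ≡ eval′ c′ e
    look-≡ e lt = cong (λ h → at h (E ∸ suc e)) (at-table (values x C) lt)

    opaque
      unfolding dispatch

      evaluate-pair : ∀ t r {e} → e < E → eval′ ⟪ t , r ⟫ e ≡ dispatch x C e ⟪ t , r ⟫ (history ⟪ t , r ⟫) t r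
      evaluate-pair t r {e} lt = trans (evaluate-step lt)
        (cong₂ (dispatch x C e ⟪ t , r ⟫ (history ⟪ t , r ⟫)) (π₁-pair t r) (π₂-pair t r))

      private
        val : ∀ t r c′ e → c′ ≤ r → look E ⟪ suc t , r ⟫ (history ⟪ suc t , r ⟫) c′ e ≡ eval′ c′ e
        val t r c′ e le = look-≡ e (≤-<-trans le (snd<pair t r))

      evaluate-eq : ∀ r {e} → e < E → eval′ ⟪ 0 , r ⟫ e ≡ eqTest (len e) e (π₁ r) (π₂ r)
      evaluate-eq r lt = evaluate-pair 0 r lt

      evaluate-rel : ∀ r {e} → e < E → eval′ ⟪ 1 , r ⟫ e ≡ evalRel e (π₁ r) (π₂ r)
      evaluate-rel r lt = evaluate-pair 1 r lt

      evaluate-not : ∀ r {e} → e < E → eval′ ⟪ 2 , r ⟫ e ≡ negV (eval′ r e)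
      evaluate-not r {e} lt = trans (evaluate-pair 2 r lt) (cong negV (val 1 r r e ≤-refl))

      evaluate-and : ∀ r {e} → e < E → eval′ ⟪ 3 , r ⟫ e ≡ andV (eval′ (π₁ r) e) (eval′ (π₂ r) e)
      evaluate-and r {e} lt = trans (evaluate-pair 3 r lt) (cong₂ andV (val 2 r (π₁ r) e (π₁≤ r)) (val 2 r (π₂ r) e (π₂≤ r)))

      evaluate-or : ∀ r {e} → e < E → eval′ ⟪ 4 , r ⟫ e ≡ orV (eval′ (π₁ r) e) (eval′ (π₂ r) e)
      evaluate-or r {e} lt = trans (evaluate-pair 4 r lt) (cong₂ orV (val 3 r (π₁ r) e (π₁≤ r)) (val 3 r (π₂ r) e (π₂≤ r)))

      evaluate-impl : ∀ r {e} → e < E → eval′ ⟪ 5 , r ⟫ e ≡ implV (eval′ (π₁ r) e) (eval′ (π₂ r) e)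
      evaluate-impl r {e} lt = trans (evaluate-pair 5 r lt) (cong₂ implV (val 4 r (π₁ r) e (π₁≤ r)) (val 4 r (π₂ r) e (π₂≤ r)))

      evaluate-all : ∀ r {e} → e < E → ∃[ f ] (∀ a → f a ≡ eval′ r (e ▹ a)) ×
        eval′ ⟪ 6 , r ⟫ e ≡ guarded (eval′ r (e ▹ codeRaw originRaw)) 1 (truth (forAll x (elementBound C (suc (len e))) f))
      evaluate-all r {e} lt = (λ a → look E ⟪ 6 , r ⟫ (history ⟪ 6 , r ⟫) r (e ▹ a)) , (λ a → val 5 r r (e ▹ a) ≤-refl) ,
        trans (evaluate-pair 6 r lt) (cong (λ v → guarded v 1 (truth (forAll x (elementBound C (suc (len e)))
          (λ a → look E ⟪ 6 , r ⟫ (history ⟪ 6 , r ⟫) r (e ▹ a))))) (val 5 r r (e ▹ codeRaw originRaw) ≤-refl))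

      evaluate-some : ∀ r {e} → e < E → ∃[ f ] (∀ a → f a ≡ eval′ r (e ▹ a)) ×
        eval′ ⟪ 7 , r ⟫ e ≡ guarded (eval′ r (e ▹ codeRaw originRaw)) 1 (truth (forSome x (elementBound C (suc (len e))) f))
      evaluate-some r {e} lt = (λ a → look E ⟪ 7 , r ⟫ (history ⟪ 7 , r ⟫) r (e ▹ a)) , (λ a → val 6 r r (e ▹ a) ≤-refl) ,
        trans (evaluate-pair 7 r lt) (cong (λ v → guarded v 1 (truth (forSome x (elementBound C (suc (len e)))
          (λ a → look E ⟪ 7 , r ⟫ (history ⟪ 7 , r ⟫) r (e ▹ a))))) (val 6 r r (e ▹ codeRaw originRaw) ≤-refl))

      evaluate-other : ∀ t r {e} → e < E → eval′ ⟪ 8 + t , r ⟫ e ≡ 0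
      evaluate-other t r lt = evaluate-pair (8 + t) r lt

    codeEnv : ∀ {n} → Vec Element n → ℕ
    codeEnv []      = 0
    codeEnv (w ∷ ρ) = codeEnv ρ ▹ codeE w

    len-codeEnv : ∀ {n} (ρ : Vec Element n) → len (codeEnv ρ) ≡ n
    len-codeEnv []      = refl
    len-codeEnv (w ∷ ρ) = trans (len-▹ (codeEnv ρ) (codeE w)) (cong suc (len-codeEnv ρ))

    at-codeEnv : ∀ {n} (ρ : Vec Element n) i → at (codeEnv ρ) (toℕ i) ≡ codeE (lookup ρ i)
    at-codeEnv (w ∷ ρ) zero    = at-zero (codeEnv ρ) (codeE w)
    at-codeEnv (w ∷ ρ) (suc i) = trans (at-suc (codeEnv ρ) (codeE w) (toℕ i)) (at-codeEnv ρ i)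

    Within : ∀ {n} → Vec Element n → Set
    Within []            = ⊤
    Within {suc n} (w ∷ ρ) = codeE w < elementBound C (suc n) × Within ρ

    opaque
      unfolding nextTuple

      codeEnv< : ∀ {n} (ρ : Vec Element n) → Within ρ → codeEnv ρ < tupleBound C n
      codeEnv< []      b = s≤s z≤n
      codeEnv< (w ∷ ρ) (b , bs) = s≤s (▹-mono (<⇒≤ (codeEnv< ρ bs)) (<⇒≤ b))

      tupleBound-suc : ∀ n → tupleBound C n ≤ tupleBound C (suc n)
      tupleBound-suc n = ≤-trans (<⇒≤ (s<▹ (tupleBound C n) (elementBound C (suc n)))) (n≤1+n _)

    tupleBound-mono : ∀ {n m} → n ≤ m → tupleBound C n ≤ tupleBound C m
    tupleBound-mono {n} {m} le = subst (λ k → tupleBound C n ≤ tupleBound C k) (m∸n+n≡m le) (go (m ∸ n))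
      where
        go : ∀ k → tupleBound C n ≤ tupleBound C (k + n)
        go zero    = ≤-refl
        go (suc k) = ≤-trans (go k) (tupleBound-suc (k + n))

    env<E : ∀ {n} (ρ : Vec Element n) → Within ρ → n ≤ C → codeEnv ρ < E
    env<E ρ b le = <-≤-trans (codeEnv< ρ b) (tupleBound-mono le)

    elementBound-suc : ∀ n → elementBound C n ≤ elementBound C (suc n)
    elementBound-suc n = <⇒≤ (≤-<-trans
      (≤-trans (m≤n+m b C) (≤-trans (≤-trans (n≤1+n (C + b)) (m≤n+m (suc (C + b)) (suc (suc C)))) (n≤1+n _)))
      (<stageBound (stageAfter C b)))
      where b = elementBound C n

    within≤ : ∀ {n} (ρ : Vec Element n) → Within ρ → ∀ {a} → a ∈ toList ρ → codeE a ≤ elementBound C n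
    within≤ {suc n} (w ∷ ρ) (b , bs) (here refl) = <⇒≤ b
    within≤ {suc n} (w ∷ ρ) (b , bs) (there i)   = ≤-trans (within≤ ρ bs i) (elementBound-suc n)

    small : ∀ {n} (ρ : Vec Element n) → Within ρ → n ≤ C → ∀ w →
            ∃[ w′ ] codeE w′ < elementBound C (suc n) ×
              (∀ (φ : Formula L₃ (suc n)) → suc n + depth φ ≤ C → (structure ⊨ φ [ w ∷ ρ ]) ⇔ (structure ⊨ φ [ w′ ∷ ρ ]))
    small {n} ρ b le w =
      -- By this stage the whole tuple and all numbers up to `C` have appeared.
      let w′ , g , e = witness {r = C + elementBound C n} ρ
            (λ {a} i → code-graded a (≤-trans (within≤ ρ b i) (m≤n+m _ C)))
            (λ k k≤C → ≤-trans k≤C (m≤m+n C _)) le w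
      in w′ , code<stageBound w′ g , e

    -- The representative of the star row has every grade, so it obeys the bound at any place of a
    -- tuple.
    origin-within : ∀ {n} (ρ : Vec Element n) → Within ρ → Within (starElement ∷ ρ)
    origin-within {n} ρ b = code<stageBound starElement (proj₂ (proj₂ (Axioms.star axioms)) (stageAfter C (elementBound C n))) , b

    private
      M₀ = structure

    eqTest-decides : ∀ {n} (ρ : Vec Element n) i j →
      Decides (lookup ρ i ≡ lookup ρ j) (eqTest n (codeEnv ρ) ⟪ 0 , toℕ i ⟫ ⟪ 0 , toℕ j ⟫)
    eqTest-decides {n} ρ i j = subst (Decides _) (sym unfold) (decides-truth _ (mk⇔ fwd bwd))
      where
        u = lookup ρ i
        v = lookup ρ j
        unfold : eqTest n (codeEnv ρ) ⟪ 0 , toℕ i ⟫ ⟪ 0 , toℕ j ⟫ ≡ truth (codeE u ≡ᵇ codeE v)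
        unfold = trans (if-true (from (T-∧ {x = isVar ⟪ 0 , toℕ i ⟫ n}) (isVar-code i , isVar-code j)))
          (cong₂ (λ a b → truth (a ≡ᵇ b)) (trans (cong (at (codeEnv ρ)) (π₂-pair 0 (toℕ i))) (at-codeEnv ρ i))
                                          (trans (cong (at (codeEnv ρ)) (π₂-pair 0 (toℕ j))) (at-codeEnv ρ j)))
        fwd : T (codeE u ≡ᵇ codeE v) → u ≡ v
        fwd t = element-≡ (codeRaw-injective (≡ᵇ⇒≡ (codeE u) (codeE v) t))
        bwd : u ≡ v → T (codeE u ≡ᵇ codeE v)
        bwd eq = ≡⇒≡ᵇ (codeE u) (codeE v) (cong codeE eq)

    rowOf-code : ∀ w → π₁ (codeE w) ≡ codeRow (rowOf w)
    rowOf-code w = π₁-pair (codeRow (rowOf w)) ⟪ codePoint (point w) , position w ⟫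

    point-code : ∀ w → pointN (codeE w) ≡ codePoint (point w)
    point-code w = trans (cong π₁ (π₂-pair (codeRow (rowOf w)) ⟪ codePoint (point w) , position w ⟫))
                         (π₁-pair (codePoint (point w)) (position w))

    le-code : ∀ u w → T (leN (pointN (codeE u)) (pointN (codeE w))) ⇔ (point u ≤ᴾ point w)
    le-code u w = ⇔-trans (≡⇒T⇔ (cong₂ leN (point-code u) (point-code w)))
      (go (point u) (point w) (proj₁ (proj₂ (valid u))) (proj₁ (proj₂ (valid w))))
      where
        go : ∀ p q → ValidPoint p → ValidPoint q → T (leN (codePoint p) (codePoint q)) ⇔ (p ≤ᴾ q)
        go (fin n , a) (fin m , b) _ _ = leN-code a b

    row-code : ∀ u w → T (π₁ (codeE u) ≡ᵇ π₁ (codeE w)) ⇔ (rowOf u ≡ rowOf w)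
    row-code u w = ⇔-trans (≡⇒T⇔ (cong₂ _≡ᵇ_ (rowOf-code u) (rowOf-code w)))
      (mk⇔ (λ t → codeRow-injective (≡ᵇ⇒≡ _ _ t)) (λ eq → ≡⇒≡ᵇ _ _ (cong codeRow eq)))

    star-code : ∀ w → T (π₁ (codeE w) ≡ᵇ 0) ⇔ (rowOf w ≡ star)
    star-code w = ⇔-trans (≡⇒T⇔ (cong (_≡ᵇ 0) (rowOf-code w)))
      (mk⇔ (λ t → codeRow-injective (≡ᵇ⇒≡ _ 0 t)) (λ eq → ≡⇒≡ᵇ _ 0 (cong codeRow eq)))

    unaryTest-≡ : ∀ {n} (ρ : Vec Element n) i → unaryTest n (codeEnv ρ) ⟪ 0 , toℕ i ⟫ 0 ≡ truth (π₁ (codeE (lookup ρ i)) ≡ᵇ 0)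
    unaryTest-≡ {n} ρ i =
      trans (if-true (from (T-∧ {x = isVar ⟪ 0 , toℕ i ⟫ n}) (isVar-code i , tt)))
        (cong (λ a → truth (π₁ a ≡ᵇ 0)) (trans (cong (at (codeEnv ρ)) (π₂-pair 0 (toℕ i))) (at-codeEnv ρ i)))

    binaryTest-≡ : ∀ {n} (ρ : Vec Element n) k i j → binaryTest n (codeEnv ρ) k ⟪ 0 , toℕ i ⟫ ⟪ 0 , toℕ j ⟫ 0 ≡
                   binary k (codeE (lookup ρ i)) (codeE (lookup ρ j))
    binaryTest-≡ {n} ρ k i j =
      trans (if-true (from (T-∧ {x = isVar ⟪ 0 , toℕ i ⟫ n}) (isVar-code i , from (T-∧ {x = isVar ⟪ 0 , toℕ j ⟫ n}) (isVar-code j , tt))))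
        (cong₂ (binary k) (trans (cong (at (codeEnv ρ)) (π₂-pair 0 (toℕ i))) (at-codeEnv ρ i))
                          (trans (cong (at (codeEnv ρ)) (π₂-pair 0 (toℕ j))) (at-codeEnv ρ j)))

-- Correctness of the evaluator on atomic formulas.

module Atoms where

  open Arithmetic
  open Structures
  open Games
  open Definability using (≡⇒⇔)
  open StandardModels
  open Classification
  open Arithmetization
  open PlaceCodes
  open Decision

  decides-resp : ∀ {P Q v w} → P ⇔ Q → v ≡ w → Decides P v → Decides Q w
  decides-resp e refl (inj₁ (eq , p)) = inj₁ (eq , to e p)
  decides-resp e refl (inj₂ (eq , n)) = inj₂ (eq , λ q → n (from e q))

  termCode-index : ∀ {n} (t : Term L₃ n) → termCode t ≡ ⟪ 0 , toℕ (index t) ⟫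
  termCode-index (var i)    = refl
  termCode-index (app () _)

  termCodes-∷ : ∀ {n m} (t : Term L₃ n) (ts : Vec (Term L₃ n) m) → termCodes (t ∷ ts) ≡ ⟪ termCode t , termCodes ts ⟫
  termCodes-∷ t ts = refl

  termCodes-one : ∀ {n} (t : Term L₃ n) → termCodes (t ∷ []) ≡ ⟪ termCode t , 0 ⟫
  termCodes-one t = refl

  code-rel : ∀ {n} k (ts : Vec (Term L₃ n) (Language.arityʳ L₃ k)) → ⌜ rel {L = L₃} k ts ⌝ ≡ ⟪ 1 , ⟪ toℕ k , termCodes ts ⟫ ⟫
  code-rel k ts = refl

  evalRel-binary : ∀ e k z → k ≢ 2 → evalRel e k z ≡ binaryTest (len e) e k (π₁ z) (π₁ (π₂ z)) (π₂ (π₂ z))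
  evalRel-binary e k z k≢2 = if-false (λ t → k≢2 (≡ᵇ⇒≡ k 2 t))

  module Correctness (cl : Classical) (tree : ℕ → ℕ → ℕ) (treeC : Fun₂ tree) (x : ℕ) (C : ℕ) where
    open Classical cl
    open Evaluator tree treeC (codeRaw originRaw)
    open Codes cl tree treeC x
    open Model cl (kind no∞ (tree x))
    open Spec cl tree treeC x C

    private
      M₀ = structure

    module _ {n} (ρ : Vec Element n) (b : Within ρ) (n≤ : n ≤ C) where
      private
        e = codeEnv ρ
        lt = env<E ρ b n≤

      decides-≈ : ∀ s t → Decides (M₀ ⊨ s ≈̇ t [ ρ ]) (eval′ ⌜ s ≈̇ t ⌝ e)
      decides-≈ s t = decides-resp
        (mk⇔ (λ eq → trans (eval-index M₀ ρ s) (trans eq (sym (eval-index M₀ ρ t))))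
             (λ eq → trans (sym (eval-index M₀ ρ s)) (trans eq (eval-index M₀ ρ t))))
        (sym (trans (evaluate-eq ⟪ termCode s , termCode t ⟫ lt)
          (trans (cong₂ (eqTest (len e) e) (π₁-pair (termCode s) (termCode t)) (π₂-pair (termCode s) (termCode t)))
          (trans (cong (λ l → eqTest l e (termCode s) (termCode t)) (len-codeEnv ρ))
                 (cong₂ (eqTest n e) (termCode-index s) (termCode-index t))))))
        (eqTest-decides ρ (index s) (index t))

      binary-≡ : ∀ k {us u vs v} → k ≢ 2 → us ≡ ⟪ u , vs ⟫ → vs ≡ ⟪ v , 0 ⟫ →
                 eval′ ⟪ 1 , ⟪ k , us ⟫ ⟫ e ≡ binaryTest n e k u v 0
      binary-≡ k {us} {u} {vs} {v} k≢2 us≡ vs≡ =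
        trans (evaluate-rel ⟪ k , us ⟫ lt)
        (trans (cong₂ (evalRel e) (π₁-pair k us) (π₂-pair k us))
        (trans (evalRel-binary e k us k≢2)
        (trans (cong₂ (λ a b → binaryTest (len e) e k a (π₁ b) (π₂ b))
                      (trans (cong π₁ us≡) (π₁-pair u vs)) (trans (cong π₂ us≡) (π₂-pair u vs)))
        (trans (cong₂ (binaryTest (len e) e k u)
                      (trans (cong π₁ vs≡) (π₁-pair v 0)) (trans (cong π₂ vs≡) (π₂-pair v 0)))
               (cong (λ l → binaryTest l e k u v 0) (len-codeEnv ρ))))))

      binary-≡′ : ∀ k s t {us} → k ≢ 2 → us ≡ ⟪ termCode s , termCodes (t ∷ []) ⟫ →
                  eval′ ⟪ 1 , ⟪ k , us ⟫ ⟫ e ≡ binary k (codeE (lookup ρ (index s))) (codeE (lookup ρ (index t)))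
      binary-≡′ k s t {us} k≢2 us≡ = trans (binary-≡ k {us} {termCode s} {termCodes (t ∷ [])} {termCode t} k≢2 us≡ (termCodes-one t))
        (trans (cong₂ (λ u v → binaryTest n e k u v 0) (termCode-index s) (termCode-index t)) (binaryTest-≡ ρ k (index s) (index t)))

      unary-≡ : ∀ {us u} → us ≡ ⟪ u , 0 ⟫ → eval′ ⟪ 1 , ⟪ 2 , us ⟫ ⟫ e ≡ unaryTest n e u 0
      unary-≡ {us} {u} us≡ =
        trans (evaluate-rel ⟪ 2 , us ⟫ lt)
        (trans (cong₂ (evalRel e) (π₁-pair 2 us) (π₂-pair 2 us))
        (trans (cong₂ (unaryTest (len e) e) (trans (cong π₁ us≡) (π₁-pair u 0)) (trans (cong π₂ us≡) (π₂-pair u 0)))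
               (cong (λ l → unaryTest l e u 0) (len-codeEnv ρ))))

      decides-rel : ∀ k ts → Decides (M₀ ⊨ rel k ts [ ρ ]) (eval′ ⌜ rel {L = L₃} k ts ⌝ e)
      decides-rel 0F (s ∷ t ∷ []) = decides-resp
        (≡⇒⇔ (cong₂ (λ u v → point u ≤ᴾ point v) (sym (eval-index M₀ ρ s)) (sym (eval-index M₀ ρ t))))
        (sym (trans (cong (λ c → eval′ c e) (code-rel 0F (s ∷ t ∷ []))) (binary-≡′ 0 s t {termCodes (s ∷ t ∷ [])} (λ ()) (termCodes-∷ s (t ∷ [])))))
        (decides-truth _ (le-code (lookup ρ (index s)) (lookup ρ (index t))))
      decides-rel 1F (s ∷ t ∷ []) = decides-resp
        (≡⇒⇔ (cong₂ (λ u v → rowOf u ≡ rowOf v) (sym (eval-index M₀ ρ s)) (sym (eval-index M₀ ρ t))))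
        (sym (trans (cong (λ c → eval′ c e) (code-rel 1F (s ∷ t ∷ []))) (binary-≡′ 1 s t {termCodes (s ∷ t ∷ [])} (λ ()) (termCodes-∷ s (t ∷ [])))))
        (decides-truth _ (row-code (lookup ρ (index s)) (lookup ρ (index t))))
      decides-rel 2F (s ∷ []) = decides-resp
        (≡⇒⇔ (cong (λ u → rowOf u ≡ star) (sym (eval-index M₀ ρ s))))
        (sym (trans (cong (λ c → eval′ c e) (code-rel 2F (s ∷ []))) (trans (unary-≡ {termCodes (s ∷ [])} {termCode s} (termCodes-one s))
             (trans (cong (λ u → unaryTest n e u 0) (termCode-index s)) (unaryTest-≡ ρ (index s))))))
        (decides-truth _ (star-code (lookup ρ (index s))))

-- Correctness of the evaluator on all formulas, and recognition of ill-formed codes.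

module Evaluation where

  open Arithmetic
  open Structures
  open Steps
  open Definability using (≡⇒⇔)
  open StandardModels
  open Classification
  open Arithmetization
  open PlaceCodes
  open Decision
  open Atoms

  -- Bounded search in place of quantification over the model: `reduce` exchanges any instance or
  -- counterexample for one with a code below `B`.
  module Quantifier (cl : Classical) {W : Set} (c : W → ℕ) (ok : ℕ → Bool) (f : ℕ → ℕ) (B : ℕ) (P : W → Set)
                    (c-ok : ∀ w → T (ok (c w))) (surjective : ∀ a → T (ok a) → ∃[ w ] c w ≡ a)
                    (two : ∀ w → c w < B → (f (c w) ≡ 2) ⇔ P w)
                    (reduce : ∀ w → ∃[ w′ ] c w′ < B × (P w ⇔ P w′)) where
    open Classical cl

    not⇔ : ∀ b → T (not b) ⇔ (¬ T b)
    not⇔ true  = mk⇔ (λ ()) (λ n → n tt)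
    not⇔ false = mk⇔ (λ _ ()) (λ _ → tt)

    holds : ∀ a → T (ok a) → a < B → (f a ≡ 2) ⇔ (∃[ w ] c w ≡ a × P w)
    holds a v lt = let w , eq = surjective a v in mk⇔
      (λ e → w , eq , to (two w (subst (_< B) (sym eq) lt)) (trans (cong f eq) e))
      (λ { (w′ , refl , p) → from (two w′ lt) p })

    universal : T (allᵇ (λ a → not (ok a) ∨ (f a ≡ᵇ 2)) B) ⇔ (∀ w → P w)
    universal = mk⇔ fwd bwd
      where
        test : ℕ → Bool
        test a = not (ok a) ∨ (f a ≡ᵇ 2)
        pass : ∀ a → T (ok a) → T (test a) → f a ≡ 2
        pass a v t with ok a
        ... | true = ≡ᵇ⇒≡ (f a) 2 t
        fwd : T (allᵇ test B) → ∀ w → P w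
        fwd t w = let w′ , lt , e = reduce w in
          from e (to (two w′ lt) (pass (c w′) (c-ok w′) (allᵇ⇒ test B t (c w′) lt)))
        bwd : (∀ w → P w) → T (allᵇ test B)
        bwd h = ⇒allᵇ test B λ a lt → cases a lt (T? (ok a))
          where
            cases : ∀ a → a < B → Dec (T (ok a)) → T (test a)
            cases a lt (no ¬v) = from (T-∨ {x = not (ok a)}) (inj₁ (from (not⇔ (ok a)) ¬v))
            cases a lt (yes v) = from (T-∨ {x = not (ok a)}) (inj₂ (≡⇒≡ᵇ (f a) 2
              (from (holds a v lt) (let w , eq = surjective a v in w , eq , h w))))

    existential : T (not (allᵇ (λ a → not (ok a ∧ (f a ≡ᵇ 2))) B)) ⇔ (∃[ w ] P w)
    existential = mk⇔ fwd bwd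
      where
        test : ℕ → Bool
        test a = not (ok a ∧ (f a ≡ᵇ 2))
        fwd : T (not (allᵇ test B)) → ∃[ w ] P w
        fwd t = dne λ none → to (not⇔ (allᵇ test B)) t (⇒allᵇ test B λ a lt →
          from (not⇔ (ok a ∧ (f a ≡ᵇ 2))) λ t′ →
            let v , q = to (T-∧ {x = ok a}) t′
                w , _ , p = to (holds a v lt) (≡ᵇ⇒≡ (f a) 2 q)
            in none (w , p))
        bwd : (∃[ w ] P w) → T (not (allᵇ test B))
        bwd (w , h) = from (not⇔ (allᵇ test B)) λ t →
          let w′ , lt , e = reduce w in
          to (not⇔ (ok (c w′) ∧ (f (c w′) ≡ᵇ 2))) (allᵇ⇒ test B t (c w′) lt)
             (from (T-∧ {x = ok (c w′)}) (c-ok w′ , ≡⇒≡ᵇ (f (c w′)) 2 (from (two w′ lt) (to e h))))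

  module Truth (cl : Classical) (tree : ℕ → ℕ → ℕ) (treeC : Fun₂ tree) (x : ℕ) (C : ℕ) where
    open Classical cl
    open Evaluator tree treeC (codeRaw originRaw)
    open Codes cl tree treeC x
    open Model cl (kind no∞ (tree x))
    open Spec cl tree treeC x C
    open Correctness cl tree treeC x C

    private
      M₀ = structure

    -- The invariant of the evaluation: a quantifier makes the environment longer by one, but the
    -- code shorter by at least one.
    below : ∀ {n a c} → a < c → n + c ≤ C → suc n + a ≤ C
    below {n} {a} lt le = ≤-trans (≤-reflexive (sym (+-suc n a))) (≤-trans (+-monoʳ-≤ n lt) le)

    below′ : ∀ {n a c} → a ≤ c → n + c ≤ C → n + a ≤ C
    below′ {n} p le = ≤-trans (+-monoʳ-≤ n p) le

    bound-≡ : ∀ {n} (ρ : Vec Element n) → elementBound C (suc (len (codeEnv ρ))) ≡ elementBound C (suc n)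
    bound-≡ ρ = cong (λ l → elementBound C (suc l)) (len-codeEnv ρ)

    module _ {n} (α : Formula L₃ (suc n)) (ρ : Vec Element n) (b : Within ρ) (le : suc n + ⌜ α ⌝ ≤ C)
             (ih : ∀ w → codeE w < elementBound C (suc n) → Decides (M₀ ⊨ α [ w ∷ ρ ]) (eval′ ⌜ α ⌝ (codeEnv ρ ▹ codeE w)))
             (f : ℕ → ℕ) (f≡ : ∀ a → f a ≡ eval′ ⌜ α ⌝ (codeEnv ρ ▹ a)) where
      private
        B = elementBound C (suc n)
        n≤ : n ≤ C
        n≤ = ≤-trans (n≤1+n n) (≤-trans (m≤m+n (suc n) ⌜ α ⌝) le)
        reduce : ∀ w → ∃[ w′ ] codeE w′ < B × ((M₀ ⊨ α [ w ∷ ρ ]) ⇔ (M₀ ⊨ α [ w′ ∷ ρ ]))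
        reduce w = let w′ , lt , h = small ρ b n≤ w in w′ , lt , h α (≤-trans (+-monoʳ-≤ (suc n) (depth≤code α)) le)
        two : ∀ w → codeE w < B → (f (codeE w) ≡ 2) ⇔ (M₀ ⊨ α [ w ∷ ρ ])
        two w lt = ⇔-trans (≡⇒⇔ (cong (_≡ 2) (f≡ (codeE w)))) (decides-2 (ih w lt))

      module Q = Quantifier cl codeE (validN x) f B (λ w → M₀ ⊨ α [ w ∷ ρ ]) code-valid element two reduce

      forAll-correct : T (forAll x B f) ⇔ (∀ w → M₀ ⊨ α [ w ∷ ρ ])
      forAll-correct = Q.universal

      forSome-correct : T (forSome x B f) ⇔ (∃[ w ] M₀ ⊨ α [ w ∷ ρ ])
      forSome-correct = Q.existential

    module _ {n} (ρ : Vec Element n) (b : Within ρ) where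
      private
        e = codeEnv ρ

      correct-¬ : ∀ α {c c′} → c′ ≡ ⟪ 2 , c ⟫ → n ≤ C → Decides (M₀ ⊨ α [ ρ ]) (eval′ c e) → Decides (¬ (M₀ ⊨ α [ ρ ])) (eval′ c′ e)
      correct-¬ α {c} refl n≤ d = subst (Decides _) (sym (evaluate-not c (env<E ρ b n≤))) (decides-negV d)

      module _ {P Q : Set} (c d : ℕ) (n≤ : n ≤ C) (p : Decides P (eval′ c e)) (q : Decides Q (eval′ d e)) where
        private
          lt = env<E ρ b n≤
          operands : (op : ℕ → ℕ → ℕ) → op (eval′ (π₁ ⟪ c , d ⟫) e) (eval′ (π₂ ⟪ c , d ⟫) e) ≡ op (eval′ c e) (eval′ d e)
          operands op = cong₂ (λ u v → op (eval′ u e) (eval′ v e)) (π₁-pair c d) (π₂-pair c d)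

        correct-∧ : ∀ {c′} → c′ ≡ ⟪ 3 , ⟪ c , d ⟫ ⟫ → Decides (P × Q) (eval′ c′ e)
        correct-∧ refl = subst (Decides _) (sym (trans (evaluate-and ⟪ c , d ⟫ lt) (operands andV))) (decides-andV p q)

        correct-∨ : ∀ {c′} → c′ ≡ ⟪ 4 , ⟪ c , d ⟫ ⟫ → Decides (P ⊎ Q) (eval′ c′ e)
        correct-∨ refl = subst (Decides _) (sym (trans (evaluate-or ⟪ c , d ⟫ lt) (operands orV))) (decides-orV p q)

        correct-⇒ : ∀ {c′} → c′ ≡ ⟪ 5 , ⟪ c , d ⟫ ⟫ → Decides (P → Q) (eval′ c′ e)
        correct-⇒ refl = subst (Decides _) (sym (trans (evaluate-impl ⟪ c , d ⟫ lt) (operands implV))) (decides-implV p q)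

      module _ (α : Formula L₃ (suc n)) (le : suc n + ⌜ α ⌝ ≤ C)
               (ih : ∀ w → codeE w < elementBound C (suc n) → Decides (M₀ ⊨ α [ w ∷ ρ ]) (eval′ ⌜ α ⌝ (e ▹ codeE w))) where
        private
          n≤ : n ≤ C
          n≤ = ≤-trans (n≤1+n n) (≤-trans (m≤m+n (suc n) ⌜ α ⌝) le)
          lt = env<E ρ b n≤
          nonzero : eval′ ⌜ α ⌝ (e ▹ codeRaw originRaw) ≢ 0
          nonzero = decides-≢0 (ih starElement (proj₁ (origin-within ρ b)))

        correct-∀ : ∀ {c′} → c′ ≡ ⟪ 6 , ⌜ α ⌝ ⟫ → Decides (∀ w → M₀ ⊨ α [ w ∷ ρ ]) (eval′ c′ e)
        correct-∀ refl =
          let f , f≡ , eq = evaluate-all ⌜ α ⌝ lt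
          in subst (Decides _) (sym (trans eq (trans (guarded-≡ nonzero) (cong (λ B → truth (forAll x B f)) (bound-≡ ρ)))))
               (decides-truth _ (forAll-correct α ρ b le ih f f≡))

        correct-∃ : ∀ {c′} → c′ ≡ ⟪ 7 , ⌜ α ⌝ ⟫ → Decides (∃[ w ] M₀ ⊨ α [ w ∷ ρ ]) (eval′ c′ e)
        correct-∃ refl =
          let f , f≡ , eq = evaluate-some ⌜ α ⌝ lt
          in subst (Decides _) (sym (trans eq (trans (guarded-≡ nonzero) (cong (λ B → truth (forSome x B f)) (bound-≡ ρ)))))
               (decides-truth _ (forSome-correct α ρ b le ih f f≡))

    binary≤ : ∀ k c d → c ≤ ⟪ k , ⟪ c , d ⟫ ⟫ × d ≤ ⟪ k , ⟪ c , d ⟫ ⟫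
    binary≤ k c d = ≤-trans (fst≤pair c d) (snd≤pair k ⟪ c , d ⟫) , ≤-trans (snd≤pair c d) (snd≤pair k ⟪ c , d ⟫)

    correct : ∀ {n} (φ : Formula L₃ n) ρ → Within ρ → n + ⌜ φ ⌝ ≤ C → Decides (M₀ ⊨ φ [ ρ ]) (eval′ ⌜ φ ⌝ (codeEnv ρ))
    correct {n} (s ≈̇ t)    ρ b le = decides-≈ ρ b (m+n≤o⇒m≤o n le) s t
    correct {n} (rel k ts) ρ b le = decides-rel ρ b (m+n≤o⇒m≤o n le) k ts
    correct {n} (¬̇ α)      ρ b le = correct-¬ ρ b α refl (m+n≤o⇒m≤o n le) (correct α ρ b (below′ (snd≤pair 2 ⌜ α ⌝) le))
    correct {n} (α ∧̇ β)    ρ b le = correct-∧ ρ b ⌜ α ⌝ ⌜ β ⌝ (m+n≤o⇒m≤o n le)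
      (correct α ρ b (below′ (proj₁ (binary≤ 3 ⌜ α ⌝ ⌜ β ⌝)) le)) (correct β ρ b (below′ (proj₂ (binary≤ 3 ⌜ α ⌝ ⌜ β ⌝)) le)) refl
    correct {n} (α ∨̇ β)    ρ b le = correct-∨ ρ b ⌜ α ⌝ ⌜ β ⌝ (m+n≤o⇒m≤o n le)
      (correct α ρ b (below′ (proj₁ (binary≤ 4 ⌜ α ⌝ ⌜ β ⌝)) le)) (correct β ρ b (below′ (proj₂ (binary≤ 4 ⌜ α ⌝ ⌜ β ⌝)) le)) refl
    correct {n} (α ⇒̇ β)    ρ b le = correct-⇒ ρ b ⌜ α ⌝ ⌜ β ⌝ (m+n≤o⇒m≤o n le)
      (correct α ρ b (below′ (proj₁ (binary≤ 5 ⌜ α ⌝ ⌜ β ⌝)) le)) (correct β ρ b (below′ (proj₂ (binary≤ 5 ⌜ α ⌝ ⌜ β ⌝)) le)) refl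
    correct {n} (∀̇ α)      ρ b le =
      let le′ = below (snd<pair 5 ⌜ α ⌝) le in correct-∀ ρ b α le′ (λ w lt → correct α (w ∷ ρ) (lt , b) le′) refl
    correct {n} (∃̇ α)      ρ b le =
      let le′ = below (snd<pair 6 ⌜ α ⌝) le in correct-∃ ρ b α le′ (λ w lt → correct α (w ∷ ρ) (lt , b) le′) refl

    code-≈ : ∀ {n} (s t : Term L₃ n) → ⌜ s ≈̇ t ⌝ ≡ ⟪ 0 , ⟪ termCode s , termCode t ⟫ ⟫
    code-≈ s t = refl

    termCodes-two : ∀ {n} (s t : Term L₃ n) → termCodes (s ∷ t ∷ []) ≡ ⟪ termCode s , ⟪ termCode t , 0 ⟫ ⟫
    termCodes-two s t = refl

    eqFormula : ∀ n r → T (isVar (π₁ r) n ∧ isVar (π₂ r) n) → ∃[ φ ] ⌜_⌝ {L₃} {n} φ ≡ ⟪ 0 , r ⟫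
    eqFormula n r t =
      let a , b = to (T-∧ {x = isVar (π₁ r) n}) t
          i , ei = isVar-decode (π₁ r) n a
          j , ej = isVar-decode (π₂ r) n b
      in var i ≈̇ var j , trans (code-≈ (var i) (var j)) (cong ⟪ 0 ,_⟫ (trans (cong₂ ⟪_,_⟫ ei ej) (pair-π r)))

    if-branch : ∀ b {a} → (if b then a else 0) ≢ 0 → a ≢ 0
    if-branch true  ne = ne
    if-branch false ne = ⊥-elim (ne refl)

    binaryArgs : ∀ n e k z → binaryTest n e k (π₁ z) (π₁ (π₂ z)) (π₂ (π₂ z)) ≢ 0 →
                 ∃[ s ] ∃[ t ] termCodes {L₃} {n} (s ∷ t ∷ []) ≡ z
    binaryArgs n e k z ne =
      let a , bc = to (T-∧ {x = isVar (π₁ z) n}) (if-≢0 _ ne)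
          b , c = to (T-∧ {x = isVar (π₁ (π₂ z)) n}) bc
          i , ei = isVar-decode (π₁ z) n a
          j , ej = isVar-decode (π₁ (π₂ z)) n b
      in var i , var j , trans (termCodes-two (var i) (var j)) (trans
           (cong₂ ⟪_,_⟫ ei (trans (cong₂ ⟪_,_⟫ ej (sym (≡ᵇ⇒≡ _ 0 c))) (pair-π (π₂ z)))) (pair-π z))

    relFormula : ∀ n e k z → n ≡ len e → evalRel e k z ≢ 0 → ∃[ φ ] ⌜_⌝ {L₃} {n} φ ≡ ⟪ 1 , ⟪ k , z ⟫ ⟫
    relFormula n e zero z refl ne =
      let s , t , eq = binaryArgs n e 0 z ne in
      rel 0F (s ∷ t ∷ []) , trans (code-rel 0F (s ∷ t ∷ [])) (cong (λ y → ⟪ 1 , ⟪ 0 , y ⟫ ⟫) eq)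
    relFormula n e (suc zero) z refl ne =
      let s , t , eq = binaryArgs n e 1 z ne in
      rel 1F (s ∷ t ∷ []) , trans (code-rel 1F (s ∷ t ∷ [])) (cong (λ y → ⟪ 1 , ⟪ 1 , y ⟫ ⟫) eq)
    relFormula n e (suc (suc zero)) z refl ne =
      let a , b = to (T-∧ {x = isVar (π₁ z) n}) (if-≢0 _ ne)
          i , ei = isVar-decode (π₁ z) n a
      in rel 2F (var i ∷ []) , trans (code-rel 2F (var i ∷ [])) (cong (λ y → ⟪ 1 , ⟪ 2 , y ⟫ ⟫)
           (trans (termCodes-one (var i)) (trans (cong₂ ⟪_,_⟫ ei (sym (≡ᵇ⇒≡ _ 0 b))) (pair-π z))))
    relFormula n e (suc (suc (suc k))) z refl ne = ⊥-elim (if-branch (isVar (π₁ z) n ∧ (isVar (π₁ (π₂ z)) n ∧ (π₂ (π₂ z) ≡ᵇ 0))) ne refl)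

    Formed : ℕ → ℕ → Set
    Formed n c = ∃[ φ ] ⌜_⌝ {L₃} {n} φ ≡ c

    formed-¬ : ∀ {n r} → Formed n r → Formed n ⟪ 2 , r ⟫
    formed-¬ (φ , refl) = ¬̇ φ , refl

    formed-∧ : ∀ {n} r → Formed n (π₁ r) → Formed n (π₂ r) → Formed n ⟪ 3 , r ⟫
    formed-∧ r (φ , e) (ψ , e′) = φ ∧̇ ψ , cong ⟪ 3 ,_⟫ (trans (cong₂ ⟪_,_⟫ e e′) (pair-π r))

    formed-∨ : ∀ {n} r → Formed n (π₁ r) → Formed n (π₂ r) → Formed n ⟪ 4 , r ⟫
    formed-∨ r (φ , e) (ψ , e′) = (φ ∨̇ ψ) , cong ⟪ 4 ,_⟫ (trans (cong₂ ⟪_,_⟫ e e′) (pair-π r))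

    formed-⇒ : ∀ {n} r → Formed n (π₁ r) → Formed n (π₂ r) → Formed n ⟪ 5 , r ⟫
    formed-⇒ r (φ , e) (ψ , e′) = (φ ⇒̇ ψ) , cong ⟪ 5 ,_⟫ (trans (cong₂ ⟪_,_⟫ e e′) (pair-π r))

    formed-∀ : ∀ {n r} → Formed (suc n) r → Formed n ⟪ 6 , r ⟫
    formed-∀ (φ , refl) = ∀̇ φ , refl

    formed-∃ : ∀ {n r} → Formed (suc n) r → Formed n ⟪ 7 , r ⟫
    formed-∃ (φ , refl) = ∃̇ φ , refl

    mutual
      -- A number that the decision procedure accepts must really be the code of a sentence. The
      -- formula is rebuilt along the cases of the evaluator, each of which returns 0 unless all its
      -- parts are well-formed; `b` carries the induction.
      formed : ∀ b c → c ≤ b → ∀ {n} (ρ : Vec Element n) → Within ρ → n + c ≤ C → eval′ c (codeEnv ρ) ≢ 0 → Formed n c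
      formed b c c≤ {n} ρ w le ne = subst (Formed n) (pair-π c)
        (formed-pair b (π₁ c) (π₂ c) (subst (_≤ b) (sym (pair-π c)) c≤) ρ w (subst (λ c → n + c ≤ C) (sym (pair-π c)) le)
          (subst (λ c → eval′ c (codeEnv ρ) ≢ 0) (sym (pair-π c)) ne))

      formed-pair : ∀ b t r → ⟪ t , r ⟫ ≤ b → ∀ {n} (ρ : Vec Element n) → Within ρ → n + ⟪ t , r ⟫ ≤ C →
                    eval′ ⟪ t , r ⟫ (codeEnv ρ) ≢ 0 → Formed n ⟪ t , r ⟫
      formed-pair b 0 r _ {n} ρ w le ne = eqFormula n r (if-≢0 (isVar (π₁ r) n ∧ isVar (π₂ r) n)
        (λ z → ne (trans (evaluate-eq r (env<E ρ w (m+n≤o⇒m≤o n le)))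
                  (trans (cong (λ l → eqTest l (codeEnv ρ) (π₁ r) (π₂ r)) (len-codeEnv ρ)) z))))
      formed-pair b 1 r _ {n} ρ w le ne = subst (λ r → Formed n ⟪ 1 , r ⟫) (pair-π r)
        (relFormula n (codeEnv ρ) (π₁ r) (π₂ r) (sym (len-codeEnv ρ))
          (λ z → ne (trans (evaluate-rel r (env<E ρ w (m+n≤o⇒m≤o n le))) z)))
      formed-pair b 2 r c≤ {n} ρ w le ne = formed-¬ (part b 1 r r ≤-refl c≤ ρ w le
        (negV-≢0 (λ z → ne (trans (evaluate-not r (env<E ρ w (m+n≤o⇒m≤o n le))) z))))
      formed-pair b 3 r c≤ {n} ρ w le ne =
        let p , q = guarded-≢0 _ _ (λ z → ne (trans (evaluate-and r (env<E ρ w (m+n≤o⇒m≤o n le))) z))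
        in formed-∧ r (part b 2 r (π₁ r) (π₁≤ r) c≤ ρ w le p) (part b 2 r (π₂ r) (π₂≤ r) c≤ ρ w le q)
      formed-pair b 4 r c≤ {n} ρ w le ne =
        let p , q = guarded-≢0 _ _ (λ z → ne (trans (evaluate-or r (env<E ρ w (m+n≤o⇒m≤o n le))) z))
        in formed-∨ r (part b 3 r (π₁ r) (π₁≤ r) c≤ ρ w le p) (part b 3 r (π₂ r) (π₂≤ r) c≤ ρ w le q)
      formed-pair b 5 r c≤ {n} ρ w le ne =
        let p , q = guarded-≢0 _ _ (λ z → ne (trans (evaluate-impl r (env<E ρ w (m+n≤o⇒m≤o n le))) z))
        in formed-⇒ r (part b 4 r (π₁ r) (π₁≤ r) c≤ ρ w le p) (part b 4 r (π₂ r) (π₂≤ r) c≤ ρ w le q)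
      formed-pair b 6 r c≤ {n} ρ w le ne =
        let f , f≡ , eq = evaluate-all r (env<E ρ w (m+n≤o⇒m≤o n le))
        in formed-∀ (under b 5 r c≤ ρ w le (proj₁ (guarded-≢0 _ 1 (λ z → ne (trans eq z)))))
      formed-pair b 7 r c≤ {n} ρ w le ne =
        let f , f≡ , eq = evaluate-some r (env<E ρ w (m+n≤o⇒m≤o n le))
        in formed-∃ (under b 6 r c≤ ρ w le (proj₁ (guarded-≢0 _ 1 (λ z → ne (trans eq z)))))
      formed-pair b (suc (suc (suc (suc (suc (suc (suc (suc t)))))))) r _ {n} ρ w le ne =
        ⊥-elim (ne (evaluate-other t r (env<E ρ w (m+n≤o⇒m≤o n le))))

      part : ∀ b t r c → c ≤ r → ⟪ suc t , r ⟫ ≤ b → ∀ {n} (ρ : Vec Element n) → Within ρ → n + ⟪ suc t , r ⟫ ≤ C →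
             eval′ c (codeEnv ρ) ≢ 0 → Formed n c
      part zero    t r c c≤ le ρ w h ne = ⊥-elim (n≮0 (≤-trans (snd<pair t r) le))
      part (suc b) t r c c≤ le ρ w h ne =
        formed b c (≤-trans c≤ (s≤s⁻¹ (≤-trans (snd<pair t r) le))) ρ w (below′ (≤-trans c≤ (snd≤pair (suc t) r)) h) ne

      -- The guard of a quantifier evaluates the body with `origin` in front, which is the
      -- environment `starElement ∷ ρ` of the model.
      under : ∀ b t r → ⟪ suc t , r ⟫ ≤ b → ∀ {n} (ρ : Vec Element n) → Within ρ → n + ⟪ suc t , r ⟫ ≤ C →
              eval′ r (codeEnv ρ ▹ codeRaw originRaw) ≢ 0 → Formed (suc n) r
      under zero    t r le ρ w h ne = ⊥-elim (n≮0 (≤-trans (snd<pair t r) le))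
      under (suc b) t r le ρ w h ne =
        formed b r (s≤s⁻¹ (≤-trans (snd<pair t r) le)) (starElement ∷ ρ) (origin-within ρ w) (below (snd<pair t r) h) ne

-- Arithmetical truth as the absence of finite refutations.

module TruthTables where

  open Arithmetic
  open Structures
  open Steps
  open StandardModels using (prefix)
  open Arithmetization
  open Definability using (≡⇒⇔)

  private
    variable
      n : ℕ

  -- Environments as sequences of numbers; every number is one.
  envOf : ∀ n → ℕ → Vec ℕ n
  envOf zero    e = []
  envOf (suc n) e = lst e ∷ envOf n (par e)

  envOf-▹ : ∀ n e w → envOf (suc n) (e ▹ w) ≡ w ∷ envOf n e
  envOf-▹ n e w = cong₂ _∷_ (lst-▹ e w) (cong (envOf n) (par-▹ e w))

  -- Terms do not mention the set variable, so the empty set stands for all sets here.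
  value : Term arithmetic n → ℕ → ℕ
  value {n} s e = eval (standardModel (λ _ → false)) (envOf n e) s

  lookupC : (i : Fin n) → Fun₁ (λ e → lookup (envOf n e) i)
  lookupC zero    = lstC
  lookupC (suc i) = fun₁ (ap₁ (lookupC i) (ap₁ parC (arg 0F)))

  valueC : (s : Term arithmetic n) → Fun₁ (value s)
  valueC (var i)                = lookupC i
  valueC (app 0F [])            = fun₁ (lit 0)
  valueC (app 1F (s ∷ []))      = fun₁ (sucC (ap₁ (valueC s) (arg 0F)))
  valueC (app 2F (s ∷ t ∷ []))  = fun₁ (ap₂ addC (ap₁ (valueC s) (arg 0F)) (ap₁ (valueC t) (arg 0F)))
  valueC (app 3F (s ∷ t ∷ []))  = fun₁ (ap₂ mulC (ap₁ (valueC s) (arg 0F)) (ap₁ (valueC t) (arg 0F)))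

  value-model : ∀ Y {n} (s : Term arithmetic n) e → eval (standardModel Y) (envOf n e) s ≡ value s e
  value-model Y (var i)               e = refl
  value-model Y (app 0F [])           e = refl
  value-model Y (app 1F (s ∷ []))     e = cong suc (value-model Y s e)
  value-model Y (app 2F (s ∷ t ∷ [])) e = cong₂ _+_ (value-model Y s e) (value-model Y t e)
  value-model Y (app 3F (s ∷ t ∷ [])) e = cong₂ _*_ (value-model Y s e) (value-model Y t e)

  differ : Bool → Bool → Bool
  differ a b = if a then not b else b

  differ-⇔ : ∀ a b → (¬ T (differ a b)) ⇔ (T a ⇔ T b)
  differ-⇔ true  true  = mk⇔ (λ _ → ⇔-refl) (λ _ ())
  differ-⇔ true  false = mk⇔ (λ n → ⊥-elim (n tt)) (λ e _ → to e tt)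
  differ-⇔ false true  = mk⇔ (λ n → ⊥-elim (n tt)) (λ e _ → from e tt)
  differ-⇔ false false = mk⇔ (λ _ → ⇔-refl) (λ _ ())

  -- A partial function takes the value 0 where it is unknown and v + 1 where it is v.
  -- An assignment of truth values u = 1 (false) or u ≥ 2 (true) to formulas and of
  -- witnesses to quantified formulas is refuted by three of its values at a time.
  Test : Set
  Test = ℕ → ℕ → ℕ → Bool

  opaque
    check : Test → ℕ → ℕ → ℕ → Bool
    check p u v w = (0 <ᵇ u) ∧ ((0 <ᵇ v) ∧ ((0 <ᵇ w) ∧ p u v w))

    checkC : ∀ {f g h : Vec ℕ n → ℕ} (p : Vec ℕ n → Test) → Computable f → Computable g → Computable h →
             Decidableᵇ (λ ρ → p ρ (f ρ) (g ρ) (h ρ)) → Decidableᵇ (λ ρ → check (p ρ) (f ρ) (g ρ) (h ρ))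
    checkC p F G H P = andC (ltC (lit 0) F) (andC (ltC (lit 0) G) (andC (ltC (lit 0) H) P))

    check-total : ∀ p u v w → check p (suc u) (suc v) (suc w) ≡ p (suc u) (suc v) (suc w)
    check-total p u v w = refl

    check-known : ∀ p u v w → T (check p u v w) → u ≢ 0 × v ≢ 0 × w ≢ 0
    check-known p (suc u) (suc v) (suc w) t = (λ ()) , (λ ()) , (λ ())

  yes? : ℕ → Bool
  yes? u = 1 <ᵇ u

  equalTest : Bool → Test
  equalTest d u _ _ = differ (yes? u) d

  sameTest oppositeTest : Test
  sameTest u v _ = differ (yes? u) (yes? v)
  oppositeTest u v _ = differ (yes? u) (not (yes? v))

  andTest orTest implTest : Test
  andTest u v w = differ (yes? u) (yes? v ∧ yes? w)
  orTest u v w = differ (yes? u) (yes? v ∨ yes? w)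
  implTest u v w = differ (yes? u) (not (yes? v) ∨ yes? w)

  -- `k` is the instance under examination, `w` the stored witness plus 1 and `v` the value of the
  -- body at `k`. An existential claim is checked at its witness and a denial at every instance;
  -- dually for universal formulas, whose witness is a counterexample.
  someTest everyTest : ℕ → Test
  someTest k u w v = if yes? u then (w ≡ᵇ suc k) ∧ not (yes? v) else yes? v
  everyTest k u w v = if yes? u then not (yes? v) else (w ≡ᵇ suc k) ∧ yes? v

  -- The table of a formula: its own truth values below tag 0, its own witnesses
  -- below tag 3, and the tables of its immediate subformulas below tags 1 and 2.
  own sub₁ sub₂ wit : (ℕ → ℕ) → ℕ → ℕ
  own g e = g ⟪ 0 , e ⟫
  sub₁ g k = g ⟪ 1 , k ⟫
  sub₂ g k = g ⟪ 2 , k ⟫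
  wit g e = g ⟪ 3 , e ⟫

  -- `i` codes an environment and, for quantifiers, an instance. With witnesses stored in the table,
  -- all the alternations of quantifiers reduce to one universal quantifier over `i`, which is the
  -- form needed for a tree.
  refuted : Formula arithmetic n → (X g : ℕ → ℕ) → ℕ → Bool
  refuted (s ≈̇ t)             X g i = let e = π₁ i in check (equalTest (value s e ≡ᵇ value t e)) (own g e) (own g e) (own g e)
  refuted (rel 0F (s ∷ []))   X g i = let e = π₁ i in check sameTest (own g e) (X (value s e)) (own g e)
  refuted (¬̇ α)               X g i = let e = π₁ i in check oppositeTest (own g e) (own (sub₁ g) e) (own g e) ∨ refuted α X (sub₁ g) i
  refuted (α ∧̇ β)             X g i = let e = π₁ i in check andTest (own g e) (own (sub₁ g) e) (own (sub₂ g) e) ∨ (refuted α X (sub₁ g) i ∨ refuted β X (sub₂ g) i)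
  refuted (α ∨̇ β)             X g i = let e = π₁ i in check orTest (own g e) (own (sub₁ g) e) (own (sub₂ g) e) ∨ (refuted α X (sub₁ g) i ∨ refuted β X (sub₂ g) i)
  refuted (α ⇒̇ β)             X g i = let e = π₁ i in check implTest (own g e) (own (sub₁ g) e) (own (sub₂ g) e) ∨ (refuted α X (sub₁ g) i ∨ refuted β X (sub₂ g) i)
  refuted (∀̇ α)               X g i = let e = π₁ i in check (everyTest (π₂ i)) (own g e) (wit g e) (own (sub₁ g) (e ▹ π₂ i)) ∨ refuted α X (sub₁ g) i
  refuted (∃̇ α)               X g i = let e = π₁ i in check (someTest (π₂ i)) (own g e) (wit g e) (own (sub₁ g) (e ▹ π₂ i)) ∨ refuted α X (sub₁ g) i

  -- Refutations use finitely many values, all of them known.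

  module _ where
    infix 4 _⊑_
    _⊑_ : (ℕ → ℕ) → (ℕ → ℕ) → Set
    q ⊑ q′ = ∀ k → q k ≢ 0 → q k ≡ q′ k

    check-mono : ∀ p {u v w u′ v′ w′} → (u ≢ 0 → u ≡ u′) → (v ≢ 0 → v ≡ v′) → (w ≢ 0 → w ≡ w′) →
                 T (check p u v w) → T (check p u′ v′ w′)
    check-mono p {u} {v} {w} f g h t with check-known p u v w t
    ... | a , b , c with f a | g b | h c
    ...   | refl | refl | refl = t

    ∨-mono : ∀ a {b c d} → (T a → T c) → (T b → T d) → T (a ∨ b) → T (c ∨ d)
    ∨-mono a {c = c} f g t with to (T-∨ {x = a}) t
    ... | inj₁ p = from (T-∨ {x = c}) (inj₁ (f p))
    ... | inj₂ p = from (T-∨ {x = c}) (inj₂ (g p))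

    refuted-mono : ∀ (φ : Formula arithmetic n) {X X′ g g′} i → X ⊑ X′ → g ⊑ g′ → T (refuted φ X g i) → T (refuted φ X′ g′ i)
    refuted-mono (s ≈̇ t) i x y = check-mono _ (y _) (y _) (y _)
    refuted-mono (rel 0F (s ∷ [])) i x y = check-mono sameTest (y _) (x _) (y _)
    refuted-mono (¬̇ α) i x y = ∨-mono (check _ _ _ _) (check-mono oppositeTest (y _) (y _) (y _)) (refuted-mono α i x (λ k → y _))
    refuted-mono (α ∧̇ β) i x y = ∨-mono (check _ _ _ _) (check-mono andTest (y _) (y _) (y _))
      (∨-mono (refuted α _ _ i) (refuted-mono α i x (λ k → y _)) (refuted-mono β i x (λ k → y _)))
    refuted-mono (α ∨̇ β) i x y = ∨-mono (check _ _ _ _) (check-mono orTest (y _) (y _) (y _))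
      (∨-mono (refuted α _ _ i) (refuted-mono α i x (λ k → y _)) (refuted-mono β i x (λ k → y _)))
    refuted-mono (α ⇒̇ β) i x y = ∨-mono (check _ _ _ _) (check-mono implTest (y _) (y _) (y _))
      (∨-mono (refuted α _ _ i) (refuted-mono α i x (λ k → y _)) (refuted-mono β i x (λ k → y _)))
    refuted-mono (∀̇ α) i x y = ∨-mono (check _ _ _ _) (check-mono (everyTest (π₂ i)) (y _) (y _) (y _)) (refuted-mono α i x (λ k → y _))
    refuted-mono (∃̇ α) i x y = ∨-mono (check _ _ _ _) (check-mono (someTest (π₂ i)) (y _) (y _) (y _)) (refuted-mono α i x (λ k → y _))

    -- The number of values that a refutation looks at.
    Agree : ℕ → (q q′ : ℕ → ℕ) → Set
    Agree b q q′ = ∀ k → k < b → q k ≡ q′ k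

    bound₃ : ∀ a b c → ∃[ d ] a < d × b < d × c < d
    bound₃ a b c = suc (a + (b + c)) , s≤s (m≤m+n a (b + c)) ,
      s≤s (≤-trans (m≤m+n b c) (m≤n+m (b + c) a)) , s≤s (≤-trans (m≤n+m c b) (m≤n+m (b + c) a))

    Local : ((ℕ → ℕ) → Bool) → Set
    Local P = ∃[ b ] (∀ q q′ → Agree b q q′ → P q ≡ P q′)

    local-check : ∀ p a b c → Local (λ q → check p (q a) (q b) (q c))
    local-check p a b c = let d , a< , b< , c< = bound₃ a b c in d , λ q q′ ag →
      trans (cong₂ (λ u v → check p u v (q c)) (ag a a<) (ag b b<)) (cong (check p (q′ a) (q′ b)) (ag c c<))

    local-∨ : ∀ {P Q} → Local P → Local Q → Local (λ q → P q ∨ Q q)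
    local-∨ (b , f) (c , g) = b + c , λ q q′ ag → cong₂ _∨_
      (f q q′ (λ k lt → ag k (≤-trans lt (m≤m+n b c)))) (g q q′ (λ k lt → ag k (≤-trans lt (m≤n+m c b))))

    refuted-local : ∀ (φ : Formula arithmetic n) (KX K : ℕ → ℕ) i → Local (λ q → refuted φ (λ k → q (KX k)) (λ k → q (K k)) i)
    refuted-local (s ≈̇ t) KX K i = local-check _ _ _ _
    refuted-local (rel 0F (s ∷ [])) KX K i = local-check _ _ _ _
    refuted-local (¬̇ α) KX K i = local-∨ (local-check _ _ _ _) (refuted-local α KX (λ k → K ⟪ 1 , k ⟫) i)
    refuted-local (α ∧̇ β) KX K i = local-∨ (local-check _ _ _ _)
      (local-∨ (refuted-local α KX (λ k → K ⟪ 1 , k ⟫) i) (refuted-local β KX (λ k → K ⟪ 2 , k ⟫) i))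
    refuted-local (α ∨̇ β) KX K i = local-∨ (local-check _ _ _ _)
      (local-∨ (refuted-local α KX (λ k → K ⟪ 1 , k ⟫) i) (refuted-local β KX (λ k → K ⟪ 2 , k ⟫) i))
    refuted-local (α ⇒̇ β) KX K i = local-∨ (local-check _ _ _ _)
      (local-∨ (refuted-local α KX (λ k → K ⟪ 1 , k ⟫) i) (refuted-local β KX (λ k → K ⟪ 2 , k ⟫) i))
    refuted-local (∀̇ α) KX K i = local-∨ (local-check _ _ _ _) (refuted-local α KX (λ k → K ⟪ 1 , k ⟫) i)
    refuted-local (∃̇ α) KX K i = local-∨ (local-check _ _ _ _) (refuted-local α KX (λ k → K ⟪ 1 , k ⟫) i)

  Consistent : Formula arithmetic n → (X g : ℕ → ℕ) → Set
  Consistent φ X g = ∀ i → ¬ T (refuted φ (suc ∘ X) (suc ∘ g) i)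

  Describes : Formula arithmetic n → (ℕ → Bool) → (ℕ → ℕ) → Set
  Describes {n} φ Y g = ∀ e → T (0 <ᵇ own g e) ⇔ (standardModel Y ⊨ φ [ envOf n e ])

  T-∧⇔ : ∀ {a b} {A B : Set} → T a ⇔ A → T b ⇔ B → T (a ∧ b) ⇔ (A × B)
  T-∧⇔ {a} e f = ⇔-trans (T-∧ {x = a}) (mk⇔ (λ (p , q) → to e p , to f q) (λ (p , q) → from e p , from f q))

  T-∨⇔ : ∀ {a b} {A B : Set} → T a ⇔ A → T b ⇔ B → T (a ∨ b) ⇔ (A ⊎ B)
  T-∨⇔ {a} e f = ⇔-trans (T-∨ {x = a}) (mk⇔ (λ { (inj₁ p) → inj₁ (to e p) ; (inj₂ q) → inj₂ (to f q) })
                                           (λ { (inj₁ p) → inj₁ (from e p) ; (inj₂ q) → inj₂ (from f q) }))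

  T-not⇔ : ∀ {a} {A : Set} → T a ⇔ A → T (not a) ⇔ (¬ A)
  T-not⇔ {true}  e = mk⇔ (λ ()) (λ n → n (to e tt))
  T-not⇔ {false} e = mk⇔ (λ _ a → from e a) (λ _ → tt)

  T-⇒⇔ : ∀ {a b} {A B : Set} → T a ⇔ A → T b ⇔ B → T (not a ∨ b) ⇔ (A → B)
  T-⇒⇔ {true}  e f = mk⇔ (λ t _ → to f t) (λ g → from f (g (to e tt)))
  T-⇒⇔ {false} e f = mk⇔ (λ _ a → ⊥-elim (from e a)) (λ _ → tt)

  quiet : ∀ a {b} → ¬ T (a ∨ b) → ¬ T a × ¬ T b
  quiet a n = (λ t → n (from (T-∨ {x = a}) (inj₁ t))) , (λ t → n (from (T-∨ {x = a}) (inj₂ t)))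

  passed : ∀ p u v w → ¬ T (check p (suc u) (suc v) (suc w)) → ¬ T (p (suc u) (suc v) (suc w))
  passed p u v w = subst (λ b → ¬ T b) (check-total p u v w)

  failed : ∀ p u v w → ¬ T (p (suc u) (suc v) (suc w)) → ¬ T (check p (suc u) (suc v) (suc w))
  failed p u v w = subst (λ b → ¬ T b) (sym (check-total p u v w))

  module Tables (cl : Classical) where
    open Classical cl

    at-index : ∀ e w (P : ℕ → ℕ → Set) → P (π₁ ⟪ e , w ⟫) (π₂ ⟪ e , w ⟫) → P e w
    at-index e w P p = subst (λ b → P e b) (π₂-pair e w) (subst (λ a → P a (π₂ ⟪ e , w ⟫)) (π₁-pair e w) p)

    module _ {n} (α : Formula arithmetic (suc n)) (Y : ℕ → Bool) (g : ℕ → ℕ) (d : Describes α Y (sub₁ g)) (e : ℕ) where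
      body : ∀ w → T (0 <ᵇ own (sub₁ g) (e ▹ w)) ⇔ (standardModel Y ⊨ α [ w ∷ envOf n e ])
      body w = subst (λ ρ → T (0 <ᵇ own (sub₁ g) (e ▹ w)) ⇔ (standardModel Y ⊨ α [ ρ ])) (envOf-▹ n e w) (d (e ▹ w))

      some-describes : (∀ w → ¬ T (someTest w (suc (own g e)) (suc (wit g e)) (suc (own (sub₁ g) (e ▹ w))))) →
                       T (0 <ᵇ own g e) ⇔ (standardModel Y ⊨ ∃̇ α [ envOf n e ])
      some-describes ok with 0 <ᵇ own g e
      ... | true  = mk⇔ (λ _ → wit g e , to (body (wit g e)) (dne λ ¬t → ok (wit g e)
                          (from (T-∧ {x = wit g e ≡ᵇ wit g e}) (≡⇒≡ᵇ (wit g e) (wit g e) refl , from (T-not⇔ ⇔-refl) ¬t)))) (λ _ → tt)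
      ... | false = mk⇔ (λ ()) (λ (w , h) → ok w (from (body w) h))

      every-describes : (∀ w → ¬ T (everyTest w (suc (own g e)) (suc (wit g e)) (suc (own (sub₁ g) (e ▹ w))))) →
                        T (0 <ᵇ own g e) ⇔ (standardModel Y ⊨ ∀̇ α [ envOf n e ])
      every-describes ok with 0 <ᵇ own g e
      ... | true  = mk⇔ (λ _ w → to (body w) (dne λ ¬t → ok w (from (T-not⇔ ⇔-refl) ¬t))) (λ _ → tt)
      ... | false = mk⇔ (λ ()) (λ h → ok (wit g e)
                      (from (T-∧ {x = wit g e ≡ᵇ wit g e}) (≡⇒≡ᵇ (wit g e) (wit g e) refl , from (body (wit g e)) (h (wit g e)))))

      some-consistent : T (0 <ᵇ own g e) ⇔ (standardModel Y ⊨ ∃̇ α [ envOf n e ]) →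
                        ((∃[ w ] standardModel Y ⊨ α [ w ∷ envOf n e ]) → standardModel Y ⊨ α [ wit g e ∷ envOf n e ]) →
                        ∀ w → ¬ T (someTest w (suc (own g e)) (suc (wit g e)) (suc (own (sub₁ g) (e ▹ w))))
      some-consistent h good w t with 0 <ᵇ own g e
      ... | true  = let a , b = to (T-∧ {x = wit g e ≡ᵇ w}) t in
        to (T-not⇔ ⇔-refl) b (from (body w) (subst (λ w → standardModel Y ⊨ α [ w ∷ envOf n e ]) (≡ᵇ⇒≡ (wit g e) w a) (good (to h tt))))
      ... | false = from h (w , to (body w) t)

      every-consistent : T (0 <ᵇ own g e) ⇔ (standardModel Y ⊨ ∀̇ α [ envOf n e ]) →
                         ((∃[ w ] ¬ (standardModel Y ⊨ α [ w ∷ envOf n e ])) → ¬ (standardModel Y ⊨ α [ wit g e ∷ envOf n e ])) →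
                         ∀ w → ¬ T (everyTest w (suc (own g e)) (suc (wit g e)) (suc (own (sub₁ g) (e ▹ w))))
      every-consistent h good w t with 0 <ᵇ own g e
      ... | true  = to (T-not⇔ ⇔-refl) t (from (body w) (to h tt w))
      ... | false = let a , b = to (T-∧ {x = wit g e ≡ᵇ w}) t in
        dne {⊥} (λ _ → good (dne λ none → from h (λ w → dne λ ¬m → none (w , ¬m)))
          (subst (λ w → standardModel Y ⊨ α [ w ∷ envOf n e ]) (sym (≡ᵇ⇒≡ (wit g e) w a)) (to (body w) b)))

    Represents : (ℕ → Bool) → (ℕ → ℕ) → Set
    Represents Y X = ∀ a → T (0 <ᵇ X a) ⇔ T (Y a)

    -- Passing all tests amounts to Tarski's truth conditions, in which the stored witnesses account
    -- for the unbounded search.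
    describes : ∀ {n} (φ : Formula arithmetic n) Y X g → Represents Y X → Consistent φ X g → Describes φ Y g
    describes {n} (s ≈̇ t) Y X g rep ok e = ⇔-trans
      (to (differ-⇔ (0 <ᵇ own g e) _) (passed (equalTest (value s e ≡ᵇ value t e)) _ _ _
        (subst (λ e → ¬ T (check (equalTest (value s e ≡ᵇ value t e)) (suc (own g e)) (suc (own g e)) (suc (own g e)))) (π₁-pair e 0) (ok ⟪ e , 0 ⟫))))
      (mk⇔ (λ u → trans (value-model Y s e) (trans (≡ᵇ⇒≡ _ _ u) (sym (value-model Y t e))))
           (λ eq → ≡⇒≡ᵇ _ _ (trans (sym (value-model Y s e)) (trans eq (value-model Y t e)))))
    describes (rel 0F (s ∷ [])) Y X g rep ok e = ⇔-trans
      (to (differ-⇔ (0 <ᵇ own g e) _) (passed sameTest _ _ _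
        (subst (λ e → ¬ T (check sameTest (suc (own g e)) (suc (X (value s e))) (suc (own g e)))) (π₁-pair e 0) (ok ⟪ e , 0 ⟫))))
      (⇔-trans (rep (value s e)) (≡⇒⇔ (cong (λ a → T (Y a)) (sym (value-model Y s e)))))
    describes (¬̇ α) Y X g rep ok e = ⇔-trans
      (to (differ-⇔ (0 <ᵇ own g e) _) (passed oppositeTest _ _ _
        (subst (λ e → ¬ T (check oppositeTest (suc (own g e)) (suc (own (sub₁ g) e)) (suc (own g e)))) (π₁-pair e 0) (proj₁ (quiet (check _ _ _ _) (ok ⟪ e , 0 ⟫))))))
      (T-not⇔ (describes α Y X (sub₁ g) rep (λ i → proj₂ (quiet (check _ _ _ _) (ok i))) e))
    describes (α ∧̇ β) Y X g rep ok e = ⇔-trans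
      (to (differ-⇔ (0 <ᵇ own g e) _) (passed andTest _ _ _
        (subst (λ e → ¬ T (check andTest (suc (own g e)) (suc (own (sub₁ g) e)) (suc (own (sub₂ g) e)))) (π₁-pair e 0) (proj₁ (quiet (check _ _ _ _) (ok ⟪ e , 0 ⟫))))))
      (T-∧⇔ (describes α Y X (sub₁ g) rep (λ i → proj₁ (quiet (refuted α _ _ i) (proj₂ (quiet (check _ _ _ _) (ok i))))) e)
            (describes β Y X (sub₂ g) rep (λ i → proj₂ (quiet (refuted α _ _ i) (proj₂ (quiet (check _ _ _ _) (ok i))))) e))
    describes (α ∨̇ β) Y X g rep ok e = ⇔-trans
      (to (differ-⇔ (0 <ᵇ own g e) _) (passed orTest _ _ _
        (subst (λ e → ¬ T (check orTest (suc (own g e)) (suc (own (sub₁ g) e)) (suc (own (sub₂ g) e)))) (π₁-pair e 0) (proj₁ (quiet (check _ _ _ _) (ok ⟪ e , 0 ⟫))))))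
      (T-∨⇔ (describes α Y X (sub₁ g) rep (λ i → proj₁ (quiet (refuted α _ _ i) (proj₂ (quiet (check _ _ _ _) (ok i))))) e)
            (describes β Y X (sub₂ g) rep (λ i → proj₂ (quiet (refuted α _ _ i) (proj₂ (quiet (check _ _ _ _) (ok i))))) e))
    describes (α ⇒̇ β) Y X g rep ok e = ⇔-trans
      (to (differ-⇔ (0 <ᵇ own g e) _) (passed implTest _ _ _
        (subst (λ e → ¬ T (check implTest (suc (own g e)) (suc (own (sub₁ g) e)) (suc (own (sub₂ g) e)))) (π₁-pair e 0) (proj₁ (quiet (check _ _ _ _) (ok ⟪ e , 0 ⟫))))))
      (T-⇒⇔ (describes α Y X (sub₁ g) rep (λ i → proj₁ (quiet (refuted α _ _ i) (proj₂ (quiet (check _ _ _ _) (ok i))))) e)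
            (describes β Y X (sub₂ g) rep (λ i → proj₂ (quiet (refuted α _ _ i) (proj₂ (quiet (check _ _ _ _) (ok i))))) e))
    describes (∀̇ α) Y X g rep ok e = every-describes α Y g (describes α Y X (sub₁ g) rep (λ i → proj₂ (quiet (check _ _ _ _) (ok i)))) e λ w →
      passed (everyTest w) _ _ _ (at-index e w (λ e w → ¬ T (check (everyTest w) (suc (own g e)) (suc (wit g e)) (suc (own (sub₁ g) (e ▹ w)))))
        (proj₁ (quiet (check _ _ _ _) (ok ⟪ e , w ⟫))))
    describes (∃̇ α) Y X g rep ok e = some-describes α Y g (describes α Y X (sub₁ g) rep (λ i → proj₂ (quiet (check _ _ _ _) (ok i)))) e λ w →
      passed (someTest w) _ _ _ (at-index e w (λ e w → ¬ T (check (someTest w) (suc (own g e)) (suc (wit g e)) (suc (own (sub₁ g) (e ▹ w)))))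
        (proj₁ (quiet (check _ _ _ _) (ok ⟪ e , w ⟫))))

    truthOf : Set → ℕ
    truthOf P = b2n (isYes (em P))

    truthOf-⇔ : ∀ P → T (0 <ᵇ truthOf P) ⇔ P
    truthOf-⇔ P with em P
    ... | yes p = mk⇔ (λ _ → p) (λ _ → tt)
    ... | no ¬p = mk⇔ (λ ()) ¬p

    combine : (a b c d : ℕ → ℕ) → ℕ → ℕ
    combine a b c d k = if π₁ k ≡ᵇ 0 then a (π₂ k) else if π₁ k ≡ᵇ 1 then b (π₂ k) else if π₁ k ≡ᵇ 2 then c (π₂ k) else d (π₂ k)

    combine-pair : ∀ a b c d t k → combine a b c d ⟪ t , k ⟫ ≡
                   (if t ≡ᵇ 0 then a k else if t ≡ᵇ 1 then b k else if t ≡ᵇ 2 then c k else d k)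
    combine-pair a b c d t k = cong₂ (λ t k → if t ≡ᵇ 0 then a k else if t ≡ᵇ 1 then b k else if t ≡ᵇ 2 then c k else d k)
                                     (π₁-pair t k) (π₂-pair t k)

    consistent-resp : ∀ {n} (φ : Formula arithmetic n) {X g g′} → (∀ k → g′ k ≡ g k) → Consistent φ X g → Consistent φ X g′
    consistent-resp φ eq ok i t = ok i (refuted-mono φ i (λ _ _ → refl) (λ k _ → cong suc (eq k)) t)

    describes-resp : ∀ {n} (φ : Formula arithmetic n) {Y g g′} → (∀ k → g′ k ≡ g k) → Describes φ Y g → Describes φ Y g′
    describes-resp φ eq d e = ⇔-trans (≡⇒⇔ (cong (λ u → T (0 <ᵇ u)) (eq _))) (d e)

    silent : ∀ a {b} → ¬ T a → ¬ T b → ¬ T (a ∨ b)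
    silent a p q t with to (T-∨ {x = a}) t
    ... | inj₁ u = p u
    ... | inj₂ u = q u

    Table : ∀ {n} → Formula arithmetic n → (ℕ → Bool) → (ℕ → ℕ) → Set
    Table φ Y X = ∃[ g ] Consistent φ X g × Describes φ Y g

    module _ {n} (φ : Formula arithmetic n) (Y : ℕ → Bool) (X b c d : ℕ → ℕ) where
      truths : ℕ → ℕ
      truths e = truthOf (standardModel Y ⊨ φ [ envOf n e ])

      assembled : ℕ → ℕ
      assembled = combine truths b c d

      assembled-describes : Describes φ Y assembled
      assembled-describes e = ⇔-trans (≡⇒⇔ (cong (λ u → T (0 <ᵇ u)) (combine-pair truths b c d 0 e))) (truthOf-⇔ _)

      assembled₁ : ∀ k → sub₁ assembled k ≡ b k
      assembled₁ k = combine-pair truths b c d 1 k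

      assembled₂ : ∀ k → sub₂ assembled k ≡ c k
      assembled₂ k = combine-pair truths b c d 2 k

      assembled₃ : ∀ k → wit assembled k ≡ d k
      assembled₃ k = combine-pair truths b c d 3 k

    module _ {n} (φ α β : Formula arithmetic n) (Y : ℕ → Bool) (X : ℕ → ℕ) (A : Table α Y X) (B : Table β Y X) where
      table₂ : ℕ → ℕ
      table₂ = assembled φ Y X (proj₁ A) (proj₁ B) (proj₁ B)

      left-consistent : Consistent α X (sub₁ table₂)
      left-consistent = consistent-resp α (assembled₁ φ Y X (proj₁ A) (proj₁ B) (proj₁ B)) (proj₁ (proj₂ A))

      right-consistent : Consistent β X (sub₂ table₂)
      right-consistent = consistent-resp β (assembled₂ φ Y X (proj₁ A) (proj₁ B) (proj₁ B)) (proj₁ (proj₂ B))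

      left-describes : Describes α Y (sub₁ table₂)
      left-describes = describes-resp α (assembled₁ φ Y X (proj₁ A) (proj₁ B) (proj₁ B)) (proj₂ (proj₂ A))

      right-describes : Describes β Y (sub₂ table₂)
      right-describes = describes-resp β (assembled₂ φ Y X (proj₁ A) (proj₁ B) (proj₁ B)) (proj₂ (proj₂ B))

      own-describes : Describes φ Y table₂
      own-describes = assembled-describes φ Y X (proj₁ A) (proj₁ B) (proj₁ B)

      agreeing : (p : Test) {b : ℕ → Bool} → (∀ e → T (b e) ⇔ (standardModel Y ⊨ φ [ envOf n e ])) → ∀ e {v w} →
                 (p (suc (own table₂ e)) (suc v) (suc w) ≡ differ (0 <ᵇ own table₂ e) (b e)) →
                 ¬ T (check p (suc (own table₂ e)) (suc v) (suc w))
      agreeing p h e {v} {w} eq = failed p _ v w (subst (λ c → ¬ T c) (sym eq)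
        (from (differ-⇔ (0 <ᵇ own table₂ e) _) (⇔-trans (own-describes e) (⇔-sym (h e)))))

    -- The witnesses of a quantified formula: an instance, or a counterexample.
    witnessOf : ∀ {n} → ((ρ : Vec ℕ n) → ℕ → Set) → ℕ → ℕ
    witnessOf {n} P e with em (∃[ w ] P (envOf n e) w)
    ... | yes (w , _) = w
    ... | no _        = 0

    witnessOf-works : ∀ {n} (P : (ρ : Vec ℕ n) → ℕ → Set) e → (∃[ w ] P (envOf n e) w) → P (envOf n e) (witnessOf P e)
    witnessOf-works {n} P e h with em (∃[ w ] P (envOf n e) w)
    ... | yes (w , p) = p
    ... | no none     = ⊥-elim (none h)

    -- The actual truth values pass all tests once instances and counterexamples have been chosen by
    -- excluded middle wherever they exist.
    tables : ∀ {n} (φ : Formula arithmetic n) Y X → Represents Y X → Table φ Y X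
    tables {n} φ@(s ≈̇ t) Y X rep = g , (λ i → failed (equalTest _) _ _ _
        (from (differ-⇔ (0 <ᵇ own g (π₁ i)) _) (⇔-trans (assembled-describes φ Y X X X X (π₁ i)) (⇔-sym (h (π₁ i)))))) ,
        assembled-describes φ Y X X X X
      where
        g = assembled φ Y X X X X
        h : ∀ e → T (value s e ≡ᵇ value t e) ⇔ (standardModel Y ⊨ s ≈̇ t [ envOf n e ])
        h e = mk⇔ (λ u → trans (value-model Y s e) (trans (≡ᵇ⇒≡ _ _ u) (sym (value-model Y t e))))
                  (λ eq → ≡⇒≡ᵇ _ _ (trans (sym (value-model Y s e)) (trans eq (value-model Y t e))))
    tables {n} φ@(rel 0F (s ∷ [])) Y X rep = g , (λ i → failed sameTest _ _ _
        (from (differ-⇔ (0 <ᵇ own g (π₁ i)) _) (⇔-trans (assembled-describes φ Y X X X X (π₁ i)) (⇔-sym (h (π₁ i)))))) ,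
        assembled-describes φ Y X X X X
      where
        g = assembled φ Y X X X X
        h : ∀ e → T (0 <ᵇ X (value s e)) ⇔ (standardModel Y ⊨ rel 0F (s ∷ []) [ envOf n e ])
        h e = ⇔-trans (rep (value s e)) (≡⇒⇔ (cong (λ a → T (Y a)) (sym (value-model Y s e))))
    tables (¬̇ α) Y X rep = table₂ (¬̇ α) α α Y X A A , (λ i → silent (check _ _ _ _)
        (agreeing (¬̇ α) α α Y X A A oppositeTest (λ e → T-not⇔ (left-describes (¬̇ α) α α Y X A A e)) (π₁ i) refl)
        (left-consistent (¬̇ α) α α Y X A A i)) , own-describes (¬̇ α) α α Y X A A
      where A = tables α Y X rep
    tables (α ∧̇ β) Y X rep = table₂ (α ∧̇ β) α β Y X A B , (λ i → silent (check _ _ _ _)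
        (agreeing (α ∧̇ β) α β Y X A B andTest (λ e → T-∧⇔ (left-describes (α ∧̇ β) α β Y X A B e) (right-describes (α ∧̇ β) α β Y X A B e)) (π₁ i) refl)
        (silent (refuted α _ _ i) (left-consistent (α ∧̇ β) α β Y X A B i) (right-consistent (α ∧̇ β) α β Y X A B i))) ,
        own-describes (α ∧̇ β) α β Y X A B
      where A = tables α Y X rep ; B = tables β Y X rep
    tables (α ∨̇ β) Y X rep = table₂ (α ∨̇ β) α β Y X A B , (λ i → silent (check _ _ _ _)
        (agreeing (α ∨̇ β) α β Y X A B orTest (λ e → T-∨⇔ (left-describes (α ∨̇ β) α β Y X A B e) (right-describes (α ∨̇ β) α β Y X A B e)) (π₁ i) refl)
        (silent (refuted α _ _ i) (left-consistent (α ∨̇ β) α β Y X A B i) (right-consistent (α ∨̇ β) α β Y X A B i))) ,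
        own-describes (α ∨̇ β) α β Y X A B
      where A = tables α Y X rep ; B = tables β Y X rep
    tables (α ⇒̇ β) Y X rep = table₂ (α ⇒̇ β) α β Y X A B , (λ i → silent (check _ _ _ _)
        (agreeing (α ⇒̇ β) α β Y X A B implTest (λ e → T-⇒⇔ (left-describes (α ⇒̇ β) α β Y X A B e) (right-describes (α ⇒̇ β) α β Y X A B e)) (π₁ i) refl)
        (silent (refuted α _ _ i) (left-consistent (α ⇒̇ β) α β Y X A B i) (right-consistent (α ⇒̇ β) α β Y X A B i))) ,
        own-describes (α ⇒̇ β) α β Y X A B
      where A = tables α Y X rep ; B = tables β Y X rep
    tables {n} (∀̇ α) Y X rep = g , (λ i → silent (check _ _ _ _)
        (failed (everyTest (π₂ i)) _ _ _ (every-consistent α Y g d (π₁ i) (D (π₁ i)) (good (π₁ i)) (π₂ i)))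
        (consistent-resp α (assembled₁ (∀̇ α) Y X (proj₁ A) X W) (proj₁ (proj₂ A)) i)) , D
      where
        A = tables α Y X rep
        P : Vec ℕ n → ℕ → Set
        P ρ w = ¬ (standardModel Y ⊨ α [ w ∷ ρ ])
        W = witnessOf P
        g = assembled (∀̇ α) Y X (proj₁ A) X W
        D = assembled-describes (∀̇ α) Y X (proj₁ A) X W
        d = describes-resp α (assembled₁ (∀̇ α) Y X (proj₁ A) X W) (proj₂ (proj₂ A))
        good : ∀ e → (∃[ w ] P (envOf n e) w) → P (envOf n e) (wit g e)
        good e h = subst (P (envOf n e)) (sym (assembled₃ (∀̇ α) Y X (proj₁ A) X W e)) (witnessOf-works P e h)
    tables {n} (∃̇ α) Y X rep = g , (λ i → silent (check _ _ _ _)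
        (failed (someTest (π₂ i)) _ _ _ (some-consistent α Y g d (π₁ i) (D (π₁ i)) (good (π₁ i)) (π₂ i)))
        (consistent-resp α (assembled₁ (∃̇ α) Y X (proj₁ A) X W) (proj₁ (proj₂ A)) i)) , D
      where
        A = tables α Y X rep
        P : Vec ℕ n → ℕ → Set
        P ρ w = standardModel Y ⊨ α [ w ∷ ρ ]
        W = witnessOf P
        g = assembled (∃̇ α) Y X (proj₁ A) X W
        D = assembled-describes (∃̇ α) Y X (proj₁ A) X W
        d = describes-resp α (assembled₁ (∃̇ α) Y X (proj₁ A) X W) (proj₂ (proj₂ A))
        good : ∀ e → (∃[ w ] P (envOf n e) w) → P (envOf n e) (wit g e)
        good e h = subst (P (envOf n e)) (sym (assembled₃ (∃̇ α) Y X (proj₁ A) X W e)) (witnessOf-works P e h)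

-- The tree of attempts at a counterexample.

module KleeneTree where

  open Arithmetic
  open Structures
  open Steps
  open StandardModels using (prefix)
  open TruthTables
  open Arithmetization
  open PlaceCodes using (len-▹; if-true; if-false)
  open Definability using (≡⇒⇔)

  private
    variable
      n : ℕ

  differC : {p q : Vec ℕ n → Bool} → Decidableᵇ p → Decidableᵇ q → Decidableᵇ (λ ρ → differ (p ρ) (q ρ))
  differC P Q = boolC P (notC Q) Q

  yesC : {f : Vec ℕ n → ℕ} → Computable f → Decidableᵇ (λ ρ → yes? (f ρ))
  yesC F = ltC (lit 1) F

  -- The partial function given by a finite sequence.
  opaque
    get : ℕ → ℕ → ℕ
    get s j = if j <ᵇ len s then suc (at s (len s ∸ suc j)) else 0

    getC : Fun₂ get
    getC = fun₂ (ifC (ltC (arg 1F) (ap₁ lenC (arg 0F)))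
      (sucC (ap₂ atC (arg 0F) (ap₂ subC (ap₁ lenC (arg 0F)) (sucC (arg 1F))))) (lit 0))

    len-prefix : ∀ f m → len (labels (prefix f m)) ≡ m
    len-prefix f zero    = refl
    len-prefix f (suc m) = trans (len-▹ (labels (prefix f m)) (f m)) (cong suc (len-prefix f m))

    at-prefix : ∀ f j i → at (labels (prefix f (i + suc j))) i ≡ f j
    at-prefix f j zero    = at-zero (labels (prefix f j)) (f j)
    at-prefix f j (suc i) = trans (at-suc (labels (prefix f (i + suc j))) (f (i + suc j)) i) (at-prefix f j i)

    get-prefix : ∀ f {m j} → j < m → get (labels (prefix f m)) j ≡ suc (f j)
    get-prefix f {m} {j} lt = trans (if-true (subst (λ l → T (j <ᵇ l)) (sym (len-prefix f m)) (<⇒<ᵇ lt)))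
      (cong suc (trans (cong (λ l → at (labels (prefix f m)) (l ∸ suc j)) (len-prefix f m))
        (subst (λ k → at (labels (prefix f k)) (m ∸ suc j) ≡ f j) (m∸n+n≡m lt) (at-prefix f j (m ∸ suc j)))))

    get-known : ∀ f {m} j → get (labels (prefix f m)) j ≢ 0 → get (labels (prefix f m)) j ≡ suc (f j)
    get-known f {m} j ne with j <? m
    ... | yes lt = get-prefix f lt
    ... | no ¬lt = ⊥-elim (ne (if-false (λ t → ¬lt (subst (j <_) (len-prefix f m) (<ᵇ⇒< j _ t)))))

  -- `KX` and `K` tell where the sequence stores the set and the table; they are arbitrary so that
  -- the induction can pass to the tables of subformulas.
  refutedC : (φ : Formula arithmetic n) {KX K : ℕ → ℕ} → Fun₁ KX → Fun₁ K →
             Decidableᵇ {2} (λ ρ → refuted φ (λ k → get (lookup ρ 0F) (KX k)) (λ k → get (lookup ρ 0F) (K k)) (lookup ρ 1F))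
  refutedC {n} φ {KX} {K} KXC KC = go φ
    where
      e : Computable {2} (λ ρ → π₁ (lookup ρ 1F))
      e = ap₁ π₁C (arg 1F)
      w : Computable {2} (λ ρ → π₂ (lookup ρ 1F))
      w = ap₁ π₂C (arg 1F)
      entry′ : ∀ {F f} → Fun₁ F → Computable {2} f → Computable {2} (λ ρ → get (lookup ρ 0F) (F (f ρ)))
      entry′ FC c = ap₂ getC (arg 0F) (ap₁ FC c)
      tagged : ∀ {f : Vec ℕ 2 → ℕ} t → Computable f → Computable (λ ρ → ⟪ t , f ρ ⟫)
      tagged t c = ap₂ pairC (lit t) c
      u : Computable {2} (λ ρ → own (λ k → get (lookup ρ 0F) (K k)) (π₁ (lookup ρ 1F)))
      u = entry′ KC (tagged 0 e)
      u₁ : Computable {2} (λ ρ → own (sub₁ (λ k → get (lookup ρ 0F) (K k))) (π₁ (lookup ρ 1F)))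
      u₁ = entry′ KC (tagged 1 (tagged 0 e))
      u₂ : Computable {2} (λ ρ → own (sub₂ (λ k → get (lookup ρ 0F) (K k))) (π₁ (lookup ρ 1F)))
      u₂ = entry′ KC (tagged 2 (tagged 0 e))
      ub : Computable {2} (λ ρ → own (sub₁ (λ k → get (lookup ρ 0F) (K k))) (π₁ (lookup ρ 1F) ▹ π₂ (lookup ρ 1F)))
      ub = entry′ KC (tagged 1 (tagged 0 (ap₂ ▹C e w)))
      uw : Computable {2} (λ ρ → wit (λ k → get (lookup ρ 0F) (K k)) (π₁ (lookup ρ 1F)))
      uw = entry′ KC (tagged 3 e)
      K₁ : Fun₁ (λ k → K ⟪ 1 , k ⟫)
      K₁ = fun₁ (ap₁ KC (ap₂ pairC (lit 1) (arg 0F)))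
      K₂ : Fun₁ (λ k → K ⟪ 2 , k ⟫)
      K₂ = fun₁ (ap₁ KC (ap₂ pairC (lit 2) (arg 0F)))
      go : (φ : Formula arithmetic n) → Decidableᵇ {2} (λ ρ → refuted φ (λ k → get (lookup ρ 0F) (KX k)) (λ k → get (lookup ρ 0F) (K k)) (lookup ρ 1F))
      go (s ≈̇ t) = checkC (λ ρ → equalTest (value s (π₁ (lookup ρ 1F)) ≡ᵇ value t (π₁ (lookup ρ 1F)))) u u u
        (differC (yesC u) (eqC (ap₁ (valueC s) e) (ap₁ (valueC t) e)))
      go (rel 0F (s ∷ [])) = checkC (λ _ → sameTest) u (entry′ KXC (ap₁ (valueC s) e)) u
        (differC (yesC u) (yesC (entry′ KXC (ap₁ (valueC s) e))))
      go (¬̇ α) = orC (checkC (λ _ → oppositeTest) u u₁ u (differC (yesC u) (notC (yesC u₁)))) (refutedC α KXC K₁)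
      go (α ∧̇ β) = orC (checkC (λ _ → andTest) u u₁ u₂ (differC (yesC u) (andC (yesC u₁) (yesC u₂)))) (orC (refutedC α KXC K₁) (refutedC β KXC K₂))
      go (α ∨̇ β) = orC (checkC (λ _ → orTest) u u₁ u₂ (differC (yesC u) (orC (yesC u₁) (yesC u₂)))) (orC (refutedC α KXC K₁) (refutedC β KXC K₂))
      go (α ⇒̇ β) = orC (checkC (λ _ → implTest) u u₁ u₂ (differC (yesC u) (orC (notC (yesC u₁)) (yesC u₂)))) (orC (refutedC α KXC K₁) (refutedC β KXC K₂))
      go (∀̇ α) = orC (checkC (λ ρ → everyTest (π₂ (lookup ρ 1F))) u uw ub
        (boolC (yesC u) (notC (yesC ub)) (andC (eqC uw (sucC w)) (yesC ub)))) (refutedC α KXC K₁)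
      go (∃̇ α) = orC (checkC (λ ρ → someTest (π₂ (lookup ρ 1F))) u uw ub
        (boolC (yesC u) (andC (eqC uw (sucC w)) (notC (yesC ub))) (yesC ub))) (refutedC α KXC K₁)

  -- The finite attempts at a set X and a table that show the failure of α at x.
  module Tree (α : Formula arithmetic 1) where

    -- A sequence stores the set under tag 0 and the table under tag 1; this is the place of the
    -- truth value of `α` itself in the environment `x`.
    root : ℕ → ℕ
    root x = ⟪ 1 , ⟪ 0 , 0 ▹ x ⟫ ⟫

    rootC : Fun₁ root
    rootC = fun₁ (ap₂ pairC (lit 1) (ap₂ pairC (lit 0) (ap₂ ▹C (lit 0) (arg 0F))))

    -- An attempt fails by a refutation of its table, or because its table declares `α` true at `x`.
    fails : ℕ → (ℕ → ℕ) → ℕ → Bool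
    fails x q i = refuted α (λ k → q ⟪ 0 , k ⟫) (λ k → q ⟪ 1 , k ⟫) i ∨ (1 <ᵇ q (root x))

    opaque
      -- Only the failures with `i` below the length are looked for, so the test is bounded; along a
      -- path every `i` has its turn.
      tree : ℕ → ℕ → ℕ
      tree x s = b2n (not (allᵇ (λ i → not (fails x (get s) i)) (len s)))

      treeC : Fun₂ tree
      treeC = fun₂ (notC (allC {p = λ ρ → not (fails (lookup ρ 1F) (get (lookup ρ 2F)) (lookup ρ 0F))}
                               (notC failsC) (ap₁ lenC (arg 1F))))
        where
          setC : Fun₁ (λ k → ⟪ 0 , k ⟫)
          setC = fun₁ (ap₂ pairC (lit 0) (arg 0F))
          entryC : Fun₁ (λ k → ⟪ 1 , k ⟫)
          entryC = fun₁ (ap₂ pairC (lit 1) (arg 0F))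
          localC : Fun₂ (λ s i → b2n (refuted α (λ k → get s ⟪ 0 , k ⟫) (λ k → get s ⟪ 1 , k ⟫) i))
          localC = fun₂ (refutedC α setC entryC)
          failsC : Decidableᵇ {3} (λ ρ → fails (lookup ρ 1F) (get (lookup ρ 2F)) (lookup ρ 0F))
          failsC = orC {p = λ ρ → refuted α (λ k → get (lookup ρ 2F) ⟪ 0 , k ⟫) (λ k → get (lookup ρ 2F) ⟪ 1 , k ⟫) (lookup ρ 0F)}
                       (ap₂ localC (arg 2F) (arg 0F)) (yesC (ap₂ getC (arg 2F) (ap₁ rootC (arg 1F))))

      tree-zero : ∀ x → tree x 0 ≡ 0
      tree-zero x = refl

      tree-prefix : ∀ x f m → tree x (labels (prefix f m)) ≡ 0 ⇔ (∀ i → i < m → ¬ T (fails x (get (labels (prefix f m))) i))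
      tree-prefix x f m = mk⇔
        (λ e i lt → to (T-not⇔ ⇔-refl) (allᵇ⇒ test (len s) (all? e) i (subst (i <_) (sym (len-prefix f m)) lt)))
        (λ h → none (⇒allᵇ test (len s) (λ i lt → from (T-not⇔ ⇔-refl) (h i (subst (i <_) (len-prefix f m) lt)))))
        where
          s : ℕ
          s = labels (prefix f m)
          test : ℕ → Bool
          test i = not (fails x (get s) i)
          all? : b2n (not (allᵇ test (len s))) ≡ 0 → T (allᵇ test (len s))
          all? e with allᵇ test (len s)
          ... | true = tt
          none : T (allᵇ test (len s)) → b2n (not (allᵇ test (len s))) ≡ 0
          none t with allᵇ test (len s)
          ... | true = refl

    module _ (cl : Classical) (x : ℕ) where
      open Classical cl
      open Tables cl

      Path : (ℕ → ℕ) → Set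
      Path f = ∀ m → tree x (labels (prefix f m)) ≡ 0

      fails-local : ∀ i → Local (λ q → fails x q i)
      fails-local i = local-∨ (refuted-local α (λ k → ⟪ 0 , k ⟫) (λ k → ⟪ 1 , k ⟫) i)
        (suc (root x) , λ q q′ ag → cong (1 <ᵇ_) (ag (root x) ≤-refl))

      path⇒never : ∀ f → Path f → ∀ i → ¬ T (fails x (suc ∘ f) i)
      path⇒never f p i t =
        let b , h = fails-local i
            -- Long enough to contain all values on which the failure depends, and to have `i`
            -- tested.
            m = b + suc i
            s = labels (prefix f m)
        in to (tree-prefix x f m) (p m) i (m≤n+m (suc i) b)
             (subst T (sym (h (get s) (suc ∘ f) (λ k lt → get-prefix f (<-≤-trans lt (m≤m+n b (suc i)))))) t)

      never⇒path : ∀ f → (∀ i → ¬ T (fails x (suc ∘ f) i)) → Path f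
      never⇒path f h m = from (tree-prefix x f m) λ i lt t → h i
        (∨-mono (refuted α _ _ i)
          (refuted-mono α i (λ k → get-known f _) (λ k → get-known f _))
          (λ u → subst (λ v → T (1 <ᵇ v)) (get-known f (root x) (λ z → n≮0 (subst (1 <_) z (<ᵇ⇒< 1 _ u)))) u) t)

      env≡ : envOf 1 (0 ▹ x) ≡ x ∷ []
      env≡ = envOf-▹ 0 0 x

      path⇒counterexample : ∃[ f ] Path f → ∃[ Y ] ¬ (standardModel Y ⊨ α [ x ∷ [] ])
      path⇒counterexample (f , p) = Y , λ h → proj₂ (quiet (refuted α _ _ 0) (ok 0))
          (from (d (0 ▹ x)) (subst (λ ρ → standardModel Y ⊨ α [ ρ ]) (sym env≡) h))
        where
          ok = path⇒never f p
          X g : ℕ → ℕ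
          X k = f ⟪ 0 , k ⟫
          g k = f ⟪ 1 , k ⟫
          Y : ℕ → Bool
          Y k = 0 <ᵇ X k
          d : Describes α Y g
          d = describes α Y X g (λ _ → ⇔-refl) (λ i → proj₁ (quiet (refuted α _ _ i) (ok i)))

      counterexample⇒path : ∃[ Y ] ¬ (standardModel Y ⊨ α [ x ∷ [] ]) → ∃[ f ] Path f
      counterexample⇒path (Y , no-model) = f , never⇒path f λ i → silent (refuted α _ _ i)
          (λ t → proj₁ (proj₂ tbl) i (refuted-mono α i (λ k _ → cong suc (set≡ k)) (λ k _ → cong suc (table≡ k)) t))
          (λ t → no-model (subst (λ ρ → standardModel Y ⊨ α [ ρ ]) env≡
                   (to (proj₂ (proj₂ tbl) (0 ▹ x)) (subst (λ v → T (0 <ᵇ v)) (table≡ ⟪ 0 , 0 ▹ x ⟫) t))))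
        where
          X : ℕ → ℕ
          X k = b2n (Y k)
          rep : Represents Y X
          rep k with Y k
          ... | true  = ⇔-refl
          ... | false = ⇔-refl
          tbl : Table α Y X
          tbl = tables α Y X rep
          f : ℕ → ℕ
          f = combine X (proj₁ tbl) X X
          set≡ : ∀ k → f ⟪ 0 , k ⟫ ≡ X k
          set≡ k = combine-pair X (proj₁ tbl) X X 0 k
          table≡ : ∀ k → f ⟪ 1 , k ⟫ ≡ proj₁ tbl k
          table≡ k = combine-pair X (proj₁ tbl) X X 1 k

open Arithmetic
open Structures
open Steps
open Responses
open Games
open Dyadic
open StandardModels
open Classification
open Arithmetization
open Witnesses
open PlaceCodes
open Decision
open Atoms
open Evaluation
open Definability
open CountableIsomorphism
open TruthTables
open KleeneTree

-- Determinism of programs and injectivity of their codes.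

χ-functional : ∀ {ℓ} {A : Pred ℕ ℓ} {x y z} → χ A x y → χ A x z → y ≡ z
χ-functional (inside a)   (inside b)   = refl
χ-functional (outside ¬a) (outside ¬b) = refl
χ-functional (inside a)   (outside ¬b) = ⊥-elim (¬b a)
χ-functional (outside ¬a) (inside b)   = ⊥-elim (¬a b)

module _ {ℓ} {A : Pred ℕ ℓ} where
  mutual
    -- Evaluation is a relation, so that an index determines its theory has to be proved; this is
    -- one half of the reason, and injectivity of `code` is the other.
    eval-functional : ∀ {n} {p : Program n} {xs y z} → Eval A p xs y → Eval A p xs z → y ≡ z
    eval-functional zer zer = refl
    eval-functional succ succ = refl
    eval-functional proj proj = refl
    eval-functional (comp gs f) (comp gs′ f′) with evals-functional gs gs′
    ... | refl = eval-functional f f′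
    eval-functional (rec-z f) (rec-z f′) = eval-functional f f′
    eval-functional (rec-s r g) (rec-s r′ g′) with eval-functional r r′
    ... | refl = eval-functional g g′
    eval-functional {y = y} {z} (μ before f) (μ before′ f′) with <-cmp y z
    ... | tri≈ _ eq _ = eq
    ... | tri< lt _ _ = ⊥-elim (0≢1+n (eval-functional f (proj₂ (before′ y lt))))
    ... | tri> _ _ gt = ⊥-elim (0≢1+n (eval-functional f′ (proj₂ (before z gt))))
    eval-functional (oracle c) (oracle c′) = χ-functional c c′

    evals-functional : ∀ {n m} {gs : Vec (Program n) m} {xs ys zs} → Evals A gs xs ys → Evals A gs xs zs → ys ≡ zs
    evals-functional [] [] = refl
    evals-functional (e ∷ es) (f ∷ fs) = cong₂ _∷_ (eval-functional e f) (evals-functional es fs)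

tagOf rest : ∀ {n} → Program n → ℕ
tagOf zer        = 0
tagOf succ       = 1
tagOf (proj _)   = 2
tagOf (comp _ _) = 3
tagOf (rec _ _)  = 4
tagOf (μ _)      = 5
tagOf oracle     = 6
rest zer                  = 0
rest succ                 = 0
rest (proj i)             = toℕ i
rest (comp {m = m} f gs)  = ⟪ m , ⟪ code f , codes gs ⟫ ⟫
rest (rec f g)            = ⟪ code f , code g ⟫
rest (μ f)                = code f
rest oracle               = 0

code-parts : ∀ {n} (p : Program n) → code p ≡ ⟪ tagOf p , rest p ⟫
code-parts zer        = refl
code-parts succ       = refl
code-parts (proj _)   = refl
code-parts (comp _ _) = refl
code-parts (rec _ _)  = refl
code-parts (μ _)      = refl
code-parts oracle     = refl

codes-∷ : ∀ {n m} (g : Program n) (gs : Vec (Program n) m) → codes (g ∷ gs) ≡ ⟪ code g , codes gs ⟫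
codes-∷ g gs = refl

mutual
  -- Otherwise one number could be an index through several programs and so belong to several
  -- theories.
  code-injective : ∀ {n} (p q : Program n) → code p ≡ code q → p ≡ q
  code-injective p q eq =
    let a , b = pair-injective {tagOf p} {rest p} {tagOf q} {rest q} (trans (sym (code-parts p)) (trans eq (code-parts q)))
    in parts-injective p q a b

  parts-injective : ∀ {n} (p q : Program n) → tagOf p ≡ tagOf q → rest p ≡ rest q → p ≡ q
  parts-injective zer zer _ _ = refl
  parts-injective succ succ _ _ = refl
  parts-injective (proj i) (proj j) _ eq = cong proj (toℕ-injective eq)
  parts-injective (comp {m = m} f gs) (comp {m = m′} f′ gs′) _ eq
    with pair-injective {m} {⟪ code f , codes gs ⟫} {m′} {⟪ code f′ , codes gs′ ⟫} eq
  ... | refl , eq′ =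
    let a , b = pair-injective {code f} {codes gs} {code f′} {codes gs′} eq′
    in cong₂ comp (code-injective f f′ a) (codes-injective gs gs′ b)
  parts-injective (rec f g) (rec f′ g′) _ eq =
    let a , b = pair-injective {code f} {code g} {code f′} {code g′} eq
    in cong₂ rec (code-injective f f′ a) (code-injective g g′ b)
  parts-injective (μ f) (μ f′) _ eq = cong μ (code-injective f f′ eq)
  parts-injective oracle oracle _ _ = refl

  codes-injective : ∀ {n m} (gs hs : Vec (Program n) m) → codes gs ≡ codes hs → gs ≡ hs
  codes-injective [] [] _ = refl
  codes-injective (g ∷ gs) (h ∷ hs) eq =
    let a , b = pair-injective {code g} {codes gs} {code h} {codes hs} eq
    in cong₂ _∷_ (code-injective g h a) (codes-injective gs hs b)

-- Numerals and the s-m-n theorem.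

numeral : ℕ → Program 1
numeral zero    = zer
numeral (suc k) = comp succ (numeral k ∷ [])

eval-numeral : ∀ {ℓ} {A : Pred ℕ ℓ} k {xs} → Eval A (numeral k) xs k
eval-numeral zero    = zer
eval-numeral (suc k) = comp (eval-numeral k ∷ []) succ

compCode : ℕ → ℕ → ℕ → ℕ
compCode m f gs = ⟪ 3 , ⟪ m , ⟪ f , gs ⟫ ⟫ ⟫

compCodeC : Fun₃ compCode
compCodeC = fun₃ (ext (λ { (a ∷ b ∷ c ∷ []) → refl }) (ap₂ pairC (lit {3} 3) (ap₂ pairC (arg 0F) (ap₂ pairC (arg 1F) (arg 2F)))))

numeralC : Fun₁ (λ k → code (numeral k))
numeralC = fun₁ (ext (λ { (k ∷ []) → eq k })
  (nrecC (ap₂ pairC (lit {1} 0) (lit 0)) (ap₃ compCodeC (lit 1) (ap₂ pairC (lit 1) (lit 0)) (ap₂ pairC (arg 1F) (lit 0))) (arg 0F)))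
  where
    eq : ∀ k → natrec ⟪ 0 , 0 ⟫ (λ _ y → compCode 1 ⟪ 1 , 0 ⟫ ⟪ y , 0 ⟫) k ≡ code (numeral k)
    eq zero    = refl
    eq (suc k) = trans (cong (λ y → compCode 1 ⟪ 1 , 0 ⟫ ⟪ y , 0 ⟫) (eq k))
      (trans (cong (compCode 1 ⟪ 1 , 0 ⟫) (sym (codes-∷ (numeral k) []))) (sym (code-parts (comp succ (numeral k ∷ [])))))

specialize : Program 2 → ℕ → Program 1
specialize p x = comp p (numeral x ∷ proj 0F ∷ [])

specializeC : ∀ p → Fun₁ (λ x → code (specialize p x))
specializeC p = fun₁ (ext (λ { (x ∷ []) → eq x })
  (ap₃ compCodeC (lit {1} 2) (lit (code p)) (ap₂ pairC (ap₁ numeralC (arg 0F)) (lit (codes (proj {1} 0F ∷ []))))))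
  where
    eq : ∀ x → compCode 2 (code p) ⟪ code (numeral x) , codes (proj {1} 0F ∷ []) ⟫ ≡ code (specialize p x)
    eq x = trans (cong (compCode 2 (code p)) (sym (codes-∷ (numeral x) (proj 0F ∷ [])))) (sym (code-parts (specialize p x)))

opaque
  program₁ : ∀ {f} → Fun₁ f → Program 1
  program₁ F = compile (Computable.term (Fun₁.body F))

  program₁-sound : ∀ {ℓ} {A : Pred ℕ ℓ} {f} (F : Fun₁ f) x → Eval A (program₁ F) (x ∷ []) (f x)
  program₁-sound {A = A} F x = subst (Eval A (program₁ F) (x ∷ [])) (Computable.correct (Fun₁.body F) (x ∷ []))
    (compile-sound (Computable.term (Fun₁.body F)) (x ∷ []))

  program₂ : ∀ {f} → Fun₂ f → Program 2
  program₂ F = compile (Computable.term (Fun₂.body F))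

  program₂-sound : ∀ {ℓ} {A : Pred ℕ ℓ} {f} (F : Fun₂ f) x y → Eval A (program₂ F) (x ∷ y ∷ []) (f x y)
  program₂-sound {A = A} F x y = subst (Eval A (program₂ F) (x ∷ y ∷ [])) (Computable.correct (Fun₂.body F) (x ∷ y ∷ []))
    (compile-sound (Computable.term (Fun₂.body F)) (x ∷ y ∷ []))

-- The theory of each number, its index, and the reduction.

module Reduction (em₁ : ExcludedMiddle (lsuc 0ℓ)) (α : Formula arithmetic 1) where

  cl : Classical
  cl = record { em = λ P → lowered (em₁ {P = Lift (lsuc 0ℓ) P}) }
    where
      lowered : ∀ {P : Set} → Dec (Lift (lsuc 0ℓ) P) → Dec P
      lowered (yes p) = yes (Lift.lower p)
      lowered (no ¬p) = no (λ p → ¬p (lift p))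

  open Classical cl
  open Tree α

  module At (x : ℕ) where
    S : ℕ → ℕ
    S = tree x

    open Profiles cl S
    open Evaluator tree treeC (codeRaw originRaw)

    M₀ : Structure L₃
    M₀ = model no∞

    -- As the theory of one model it is complete at once; the other models join by elementary
    -- equivalence.
    Th : Pred (Sentence L₃) 0ℓ
    Th σ = M₀ ⊨ σ

    complete : IsCompleteTheory Th
    complete = record
      { closed     = λ σ consequence → consequence M₀ (λ _ h → h)
      ; consistent = λ σ (p , q) → q p
      ; complete   = λ σ → decideSentence σ (em (M₀ ⊨ σ)) }
      where
        decideSentence : ∀ σ → Dec (M₀ ⊨ σ) → Th σ ⊎ Th (¬̇ σ)
        decideSentence σ (yes p) = inj₁ p
        decideSentence σ (no ¬p) = inj₂ ¬p

    -- The number itself bounds the evaluation: a sentence has no free variables, so the invariant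
    -- on environment and code starts out as an equality.
    answer : ℕ → ℕ
    answer n = b2n (evaluate x n n 0 ≡ᵇ 2)

    decided : ∀ n σ → ⌜ σ ⌝ ≡ n → Decides (M₀ ⊨ σ) (evaluate x n n 0)
    decided n σ eq = subst (λ c → Decides (M₀ ⊨ σ) (evaluate x n c 0)) eq
                       (Truth.correct cl tree treeC x n σ [] tt (≤-reflexive eq))

    -- The evaluator sees only the code, so sentences with equal codes are true together.
    coded⇒true : ∀ σ → GödelNumbers Th ⌜ σ ⌝ → Th σ
    coded⇒true σ (τ , t , eq) = to (decides-2 (decided ⌜ σ ⌝ σ refl)) (from (decides-2 (decided ⌜ σ ⌝ τ eq)) t)

    answer-correct : ∀ n → χ (GödelNumbers Th) n (sgn (answer n))
    answer-correct n = cases (T? (evaluate x n n 0 ≡ᵇ 2))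
      where
        module E = Truth cl tree treeC x n
        cases : Dec (T (evaluate x n n 0 ≡ᵇ 2)) → χ (GödelNumbers Th) n (sgn (answer n))
        cases (yes t) =
          let v = ≡ᵇ⇒≡ (evaluate x n n 0) 2 t
              σ , eq = E.formed n n ≤-refl [] tt ≤-refl (λ z → 0≢1+n (trans (sym z) v))
          in subst (χ (GödelNumbers Th) n) (cong sgn (sym (if⇒ t))) (inside (σ , to (decides-2 (decided n σ eq)) v , eq))
          where
            if⇒ : ∀ {b} → T b → b2n b ≡ 1
            if⇒ {true} _ = refl
        cases (no ¬t) = subst (χ (GödelNumbers Th) n) (cong sgn (sym (if⇒ ¬t)))
          (outside λ (σ , h , eq) → ¬t (≡⇒≡ᵇ _ 2 (from (decides-2 (decided n σ eq)) h)))
          where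
            if⇒ : ∀ {b} → ¬ T b → b2n b ≡ 0
            if⇒ {true}  n = ⊥-elim (n tt)
            if⇒ {false} _ = refl

    ax : ∀ κ → Axioms (Kind.S κ) (Model.structure cl κ) (Model.Gr cl κ) (Model.Sm cl κ)
    ax κ = Model.axioms cl κ

    countableModel : (κ : Kind) → Kind.S κ ≡ S → CountableModel Th
    countableModel κ refl = record
      { structure = Model.structure cl κ
      ; countable = countable cl κ
      ; models = λ σ → to (elementarilyEquivalent cl (forget (ax (kind no∞ S))) (forget (ax κ)) σ) }

    shape : Fin 3 → Shape
    shape 0F = no∞
    shape 1F = open∞
    shape 2F = closed∞

    place : Shape → Fin 3
    place no∞     = 0F
    place open∞   = 1F
    place closed∞ = 2F

    models₃ : Fin 3 → CountableModel Th
    models₃ i = countableModel (kind (shape i) S) refl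

    least⇒infinite : ∀ {M} → HasLeast M → HasInfinite M
    least⇒infinite (a , i , _) = a , i

    distinct₃ : ∀ i j → model (shape i) ≅ model (shape j) → i ≡ j
    distinct₃ 0F 0F iso = refl
    distinct₃ 1F 1F iso = refl
    distinct₃ 2F 2F iso = refl
    distinct₃ 0F 1F iso = ⊥-elim (no-infinite (kind no∞ S) (λ _ ()) (from (Invariance.hasInfinite iso) open-infinite))
    distinct₃ 0F 2F iso = ⊥-elim (no-infinite (kind no∞ S) (λ _ ())
                            (from (Invariance.hasInfinite iso) (least⇒infinite {model closed∞} closed-least)))
    distinct₃ 1F 0F iso = ⊥-elim (no-infinite (kind no∞ S) (λ _ ()) (to (Invariance.hasInfinite iso) open-infinite))
    distinct₃ 1F 2F iso = ⊥-elim (open-no-least (from (Invariance.hasLeast iso) closed-least))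
    distinct₃ 2F 0F iso = ⊥-elim (no-infinite (kind no∞ S) (λ _ ())
                            (to (Invariance.hasInfinite iso) (least⇒infinite {model closed∞} closed-least)))
    distinct₃ 2F 1F iso = ⊥-elim (open-no-least (to (Invariance.hasLeast iso) closed-least))

    three : ¬ (∃[ f ] Path cl x f) → HasExactlyCountableModels 3 Th
    three pathless = models₃ , distinct₃ , λ N →
        let s , iso = classify (tree-zero x) pathless (axiomsOf N) (CountableModel.countable N)
        in place s , subst (λ t → CountableModel.structure N ≅ model t) (sym (shape-place s)) iso
      where
        shape-place : ∀ s → shape (place s) ≡ s
        shape-place no∞     = refl
        shape-place open∞   = refl
        shape-place closed∞ = refl
        axiomsOf : (N : CountableModel Th) → Axioms′ S (CountableModel.structure N)
        axiomsOf N = transferAxioms (ax (kind no∞ S)) (CountableModel.models N)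

    module _ (f : ℕ → ℕ) (good : Path cl x f) where

      models₄ : Fin 4 → CountableModel Th
      models₄ 0F = countableModel (kind no∞ S) refl
      models₄ 1F = countableModel (kind open∞ S) refl
      models₄ 2F = countableModel (kind closed∞ S) refl
      models₄ 3F = countableModel (kindPath S f good) refl

      -- Isomorphism invariants that exclude one another, one for each model.
      Profile : Fin 4 → Structure L₃ → Set
      Profile 0F K = ¬ HasInfinite K × ¬ HasPath K
      Profile 1F K = HasInfinite K × ¬ HasLeast K
      Profile 2F K = HasLeast K
      Profile 3F K = ¬ HasInfinite K × HasPath K

      profile : ∀ i → Profile i (CountableModel.structure (models₄ i))
      profile 0F = no-infinite (kind no∞ S) (λ _ ()) , no-path (kind no∞ S) (λ ())
      profile 1F = open-infinite , open-no-least
      profile 2F = closed-least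
      profile 3F = no-infinite (kindPath S f good) (λ _ ()) , has-path f good

      profile-iso : ∀ i {M N} → M ≅ N → Profile i M → Profile i N
      profile-iso 0F iso (a , b) = (λ h → a (from (Invariance.hasInfinite iso) h)) , (λ h → b (from (Invariance.hasPath iso) h))
      profile-iso 1F iso (a , b) = to (Invariance.hasInfinite iso) a , (λ h → b (from (Invariance.hasLeast iso) h))
      profile-iso 2F iso a = to (Invariance.hasLeast iso) a
      profile-iso 3F iso (a , b) = (λ h → a (from (Invariance.hasInfinite iso) h)) , to (Invariance.hasPath iso) b

      profile-unique : ∀ i j → i Fin.< j → ∀ {K} → Profile i K → ¬ Profile j K
      profile-unique 0F 1F _ (a , _) (b , _) = a b
      profile-unique 0F 2F _ {K} (a , _) b = a (least⇒infinite {K} b)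
      profile-unique 0F 3F _ (_ , a) (_ , b) = a b
      profile-unique 1F 2F _ (_ , a) b = a b
      profile-unique 1F 3F _ (a , _) (b , _) = b a
      profile-unique 2F 3F _ {K} a (b , _) = b (least⇒infinite {K} a)
      profile-unique 1F 1F (s≤s ()) _ _
      profile-unique 2F 1F (s≤s ()) _ _
      profile-unique 2F 2F (s≤s (s≤s ())) _ _
      profile-unique 3F 1F (s≤s ()) _ _
      profile-unique 3F 2F (s≤s (s≤s ())) _ _
      profile-unique 3F 3F (s≤s (s≤s (s≤s ()))) _ _

      -- By the pigeonhole principle two of the four models are isomorphic to the same listed one,
      -- which would have both profiles.
      not-three : ¬ HasExactlyCountableModels 3 Th
      not-three (K , _ , covers) =
        let place₄ = λ i → proj₁ (covers (models₄ i))
            i , j , i<j , same = pigeonhole ≤-refl place₄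
            shared = λ k → profile-iso k (proj₂ (covers (models₄ k))) (profile k)
        in profile-unique i j i<j (shared i)
             (subst (λ k → Profile j (CountableModel.structure (K k))) (sym same) (shared j))

  open At using (Th)

  answerC : Fun₂ (λ x n → At.answer x n)
  answerC = fun₂ (eqC (ap₄ evaluateC (arg 0F) (arg 1F) (arg 1F) (lit 0)) (lit 2))
    where open Evaluator tree treeC (codeRaw originRaw)

  decider : Program 2
  decider = program₂ answerC

  index-of : ℕ → ℕ
  index-of x = code (specialize decider x)

  eval-specialize : ∀ {ℓ} {A : Pred ℕ ℓ} x n → Eval A (specialize decider x) (n ∷ []) (At.answer x n)
  eval-specialize x n = comp (eval-numeral x ∷ proj ∷ []) (program₂-sound answerC x n)

  isIndex : ∀ x → IsIndexOf (index-of x) (Th x)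
  isIndex x n = At.answer x n , (specialize decider x , refl , eval-specialize x n) , At.answer-correct x n

  -- The index computes `answer` and nothing else, so each sentence of `Th′` is accepted and hence
  -- true. The other inclusion follows by completeness: the negation of a true sentence cannot be in
  -- `Th′`.
  same-theory : ∀ x Th′ → IsCompleteTheory Th′ → IsIndexOf (index-of x) Th′ → ∀ σ → Th′ σ ⇔ Th x σ
  same-theory x Th′ complete′ index′ σ = mk⇔ (forwards σ) (backwards (IsCompleteTheory.complete complete′ σ))
    where
      clash : ∀ σ {v} → Th′ σ → χ (GödelNumbers Th′) ⌜ σ ⌝ v → χ (GödelNumbers (Th x)) ⌜ σ ⌝ v → Th x σ
      clash σ h (outside n) _        = ⊥-elim (n (σ , h , refl))
      clash σ h (inside _)  (inside g) = At.coded⇒true x σ g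
      output : ∀ n {y} → φ (index-of x) n y → y ≡ At.answer x n
      output n {y} (p , eq , ev) = eval-functional
        (subst (λ p → Eval ∅ p (n ∷ []) y) (code-injective p (specialize decider x) eq) ev) (eval-specialize x n)
      accepted : ∀ σ → Th′ σ → (∃[ y ] φ (index-of x) ⌜ σ ⌝ y × χ (GödelNumbers Th′) ⌜ σ ⌝ (sgn y)) → Th x σ
      accepted σ h (y , computes , c) = clash σ h
        (subst (χ (GödelNumbers Th′) ⌜ σ ⌝) (cong sgn (output ⌜ σ ⌝ computes)) c) (At.answer-correct x ⌜ σ ⌝)
      forwards : ∀ σ → Th′ σ → Th x σ
      forwards σ h = accepted σ h (index′ ⌜ σ ⌝)
      backwards : Th′ σ ⊎ Th′ (¬̇ σ) → Th x σ → Th′ σ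
      backwards (inj₁ p) h = p
      backwards (inj₂ q) h = ⊥-elim (forwards (¬̇ σ) q h)

  transport-models : ∀ {Th₁ Th₂ : Pred (Sentence L₃) 0ℓ} → (∀ σ → Th₁ σ ⇔ Th₂ σ) →
                     HasExactlyCountableModels 3 Th₁ → HasExactlyCountableModels 3 Th₂
  transport-models {Th₁} {Th₂} same (K , distinct , covers) = (λ i → over (K i)) , distinct , λ N → covers (under N)
    where
      over : CountableModel Th₁ → CountableModel Th₂
      over N = record { structure = structure ; countable = countable′ ; models = λ σ h → models σ (from (same σ) h) }
        where open CountableModel N renaming (countable to countable′)
      under : CountableModel Th₂ → CountableModel Th₁
      under N = record { structure = structure ; countable = countable′ ; models = λ σ h → models σ (to (same σ) h) }
        where open CountableModel N renaming (countable to countable′)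

  pathless⇔3Mod : ∀ x → (¬ (∃[ f ] Path cl x f)) ⇔ 3Mod L₃ (index-of x)
  pathless⇔3Mod x = mk⇔ (λ p → Th x , At.complete x , isIndex x , At.three x p)
    (λ (Th′ , complete′ , index′ , models) (f , good) →
       At.not-three x f good (transport-models (same-theory x Th′ complete′ index′) models))

  module _ (B : Pred ℕ 0ℓ) (defines : ∀ x → B x ⇔ (∀ X → standardModel X ⊨ α [ x ∷ [] ])) where

    member⇔3Mod : ∀ x → B x ⇔ 3Mod L₃ (index-of x)
    member⇔3Mod x = mk⇔
      (λ b → to (pathless⇔3Mod x) λ p → let Y , n = path⇒counterexample cl x p in n (to (defines x) b Y))
      (λ m → from (defines x) λ X → dne λ n → from (pathless⇔3Mod x) m (counterexample⇒path cl x (X , n)))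

    -- In fact many-one: the oracle is asked once, and its answer is the output.
    reduction : B ≤T 3Mod L₃
    reduction = code program , λ x → answerAt x (em (B x))
      where
        indexC : Fun₁ index-of
        indexC = specializeC decider
        program : Program 1
        program = comp oracle (program₁ indexC ∷ [])
        runs : ∀ x {y} → χ (3Mod L₃) (index-of x) y → Φ (3Mod L₃) (code program) x y
        runs x c = program , refl , comp (program₁-sound indexC x ∷ []) (oracle c)
        answerAt : ∀ x → Dec (B x) → ∃[ y ] Φ (3Mod L₃) (code program) x y × χ B x y
        answerAt x (yes b) = 1 , runs x (inside (to (member⇔3Mod x) b)) , inside b
        answerAt x (no ¬b) = 0 , runs x (outside (λ m → ¬b (from (member⇔3Mod x) m))) , outside ¬b

theorem9 : ExcludedMiddle (lsuc 0ℓ) → ∃[ L ] ((B : Pred ℕ 0ℓ) → Π¹₁ B → B ≤T 3Mod L)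
theorem9 em₁ = L₃ , λ B (α , defines) → Reduction.reduction em₁ α B defines
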